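{- For $|q|<1$, $$\mathrm{C}\Phi_5(q)=\frac{1}{(q;q)_\infty^5}\left(1+25\sum_{j=1}^\infty\Big(\frac{j}{5}\Big)\frac{q^j}{(1-q^j)^2}-5\sum_{j=1}^\infty\Big(\frac j5\Big)\frac{jq^j}{1-q^j}\right)=\frac{1}{(q^5;q^5)_\infty}+25q\frac{(q^5;q^5)_\infty^5}{(q;q)_\infty^6}=\frac{1}{(q^5;q^5)_\infty}+5\sum_{j=1}^\infty p(5j-1)q^j.$$
   Context: A $k$-colored generalized Frobenius symbol is a two-row array with $d\ge 0$ columns whose entries are colored nonnegative integers $\ell_c$ ($\ell\ge 0$, color $c\in\{1,\dots,k\}$), each row strictly decreasing with respect to the total order $0_1\prec 0_2\prec\cdots\prec 0_k\prec 1_1\prec\cdots\prec 1_k\prec 2_1\prec\cdots$. It is a $k$-colored generalized Frobenius partition of $n=d+\sum(\text{integer values of all entries})$. $c\phi_k(n)$ is the number of such partitions of $n$ (with $c\phi_k(0)=1$), and $\mathrm{C}\Phi_k(q)=\sum_{n\ge0}c\phi_k(n)q^n$. $(a;q)_\infty=\prod_{j\ge1}(1-aq^{j-1})$, $p(n)$ is the number of ordinary partitions of $n$, and $\left(\frac{j}{5}\right)$ is the Legendre symbol. -}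

module Defs where

open import Data.Nat as ℕ using (ℕ; zero; suc; _∸_; _%_; _<_; _≤_)
open import Data.Integer as ℤ using (ℤ; +_; -_)
open import Data.Fin using (Fin; toℕ)
open import Data.Fin.Properties using () 
open import Data.List using (List; []; _∷_; map; concatMap; upTo; allFin; cartesianProduct; filter; length; foldr; zipWith)
open import Data.Nat.ListAction using (sum)
open import Data.List.Relation.Unary.Linked using (Linked; linked?)
open import Data.Product using (_×_; _,_; proj₁; proj₂)
open import Data.Sum using (_⊎_)
open import Relation.Binary.PropositionalEquality using (_≡_)
open import Relation.Nullary using (Dec; yes; no)
open import Relation.Nullary.Decidable using (_×-dec_; _⊎-dec_)

-- A colored nonnegative integer ℓ_c : value ℓ, color c ∈ {1..k} (as Fin k).
Entry : ℕ → Set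
Entry k = ℕ × Fin k

_≺_ : ∀ {k} → Entry k → Entry k → Set
(ℓ , c) ≺ (ℓ' , c') = ℓ < ℓ' ⊎ (ℓ ≡ ℓ' × toℕ c < toℕ c')

_≺?_ : ∀ {k} (x y : Entry k) → Dec (x ≺ y)
(ℓ , c) ≺? (ℓ' , c') = (ℓ ℕ.<? ℓ') ⊎-dec ((ℓ ℕ.≟ ℓ') ×-dec (toℕ c ℕ.<? toℕ c'))

_≻_ : ∀ {k} → Entry k → Entry k → Set
x ≻ y = y ≺ x

StrictlyDecreasing : ∀ {k} → List (Entry k) → Set
StrictlyDecreasing = Linked _≻_

strictlyDecreasing? : ∀ {k} (r : List (Entry k)) → Dec (StrictlyDecreasing r)
strictlyDecreasing? = linked? (λ x y → y ≺? x)

Symbol : ℕ → Set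
Symbol k = List (Entry k) × List (Entry k)

IsFrobenius : ∀ {k} → Symbol k → Set
IsFrobenius (t , b) = StrictlyDecreasing t × StrictlyDecreasing b × length t ≡ length b

isFrobenius? : ∀ {k} (s : Symbol k) → Dec (IsFrobenius s)
isFrobenius? (t , b) = strictlyDecreasing? t ×-dec (strictlyDecreasing? b ×-dec (length t ℕ.≟ length b))

weight : ∀ {k} → Symbol k → ℕ
weight (t , b) = length t ℕ.+ sum (map proj₁ t) ℕ.+ sum (map proj₁ b)

listsOfLength : ∀ {A : Set} → ℕ → List A → List (List A)
listsOfLength zero xs = [] ∷ []
listsOfLength (suc d) xs = concatMap (λ x → map (x ∷_) (listsOfLength d xs)) xs

entriesUpTo : (k N : ℕ) → List (Entry k)
entriesUpTo k N = concatMap (λ ℓ → map (ℓ ,_) (allFin k)) (upTo (suc N))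

-- all candidate arrays with d ≤ n columns and entry values ≤ n
-- (every symbol of weight n is among them, each exactly once)
candidates : (k n : ℕ) → List (Symbol k)
candidates k n = concatMap (λ d → cartesianProduct (listsOfLength d (entriesUpTo k n))
                                                   (listsOfLength d (entriesUpTo k n)))
                           (upTo (suc n))

cφ : ℕ → ℕ → ℕ
cφ k n = length (filter (λ s → isFrobenius? s ×-dec (weight s ℕ.≟ n)) (candidates k n))

partitionCandidates : ℕ → List (List ℕ)
partitionCandidates n = concatMap (λ d → listsOfLength d (map suc (upTo n))) (upTo (suc n))

p : ℕ → ℕ
p n = length (filter (λ xs → linked? (λ x y → y ℕ.≤? x) xs ×-dec (sum xs ℕ.≟ n))
                     (partitionCandidates n))

leg5 : ℕ → ℤ
leg5 j with j % 5
... | 1 = + 1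
... | 2 = - (+ 1)
... | 3 = - (+ 1)
... | 4 = + 1
... | _ = + 0

PS : Set
PS = ℕ → ℤ

sumZ : List ℤ → ℤ
sumZ = foldr ℤ._+_ (+ 0)

oneP : PS
oneP zero = + 1
oneP (suc _) = + 0

mono : ℕ → PS
mono j n with n ℕ.≟ j
... | yes _ = + 1
... | no _ = + 0

_⊕_ : PS → PS → PS
(f ⊕ g) n = f n ℤ.+ g n

_⊖_ : PS → PS → PS
(f ⊖ g) n = f n ℤ.- g n

_·_ : ℤ → PS → PS
(a · f) n = a ℤ.* f n

infixl 6 _⊕_ _⊖_
infixl 7 _⊛_ _·_

_⊛_ : PS → PS → PS
(f ⊛ g) n = sumZ (map (λ i → f i ℤ.* g (n ∸ i)) (upTo (suc n)))

_^P_ : PS → ℕ → PS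
f ^P zero = oneP
f ^P suc m = f ⊛ (f ^P m)

-- Multiplicative inverse of a series with constant term 1:
-- invL f n = [c_n, c_{n-1}, ..., c_0] with c_0 = 1,
-- c_{n+1} = - Σ_{i=1}^{n+1} f_i c_{n+1-i}.
invL : PS → ℕ → List ℤ
invL f zero = + 1 ∷ []
invL f (suc n) = (- sumZ (zipWith ℤ._*_ (map (λ i → f (suc i)) (upTo (suc n))) (invL f n))) ∷ invL f n

headZ : List ℤ → ℤ
headZ [] = + 0
headZ (x ∷ _) = x

inv : PS → PS
inv f n = headZ (invL f n)

-- (q^m; q^m)_∞ as a formal power series (m ≥ 1): its n-th coefficient
-- equals that of the finite product ∏_{j=1}^{n} (1 - q^{mj}).
finProd : ℕ → ℕ → PS
finProd m zero = oneP
finProd m (suc N) = finProd m N ⊛ (oneP ⊖ mono (m ℕ.* suc N))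

qPoch : ℕ → PS
qPoch m n = finProd m n n

-- Σ_{j≥1} g_j for series with g_j = O(q^j): n-th coefficient is Σ_{j=1}^{n} (g_j)_n
sumInf : (ℕ → PS) → PS
sumInf g n = sumZ (map (λ j → g (suc j) n) (upTo n))

CΦ : ℕ → PS
CΦ k n = + cφ k n

rhs1 : PS
rhs1 = inv (qPoch 1 ^P 5) ⊛
       (oneP ⊕ (+ 25) · sumInf (λ j → leg5 j · (mono j ⊛ inv ((oneP ⊖ mono j) ^P 2)))
             ⊖ (+ 5) · sumInf (λ j → (leg5 j ℤ.* + j) · (mono j ⊛ inv (oneP ⊖ mono j))))

rhs2 : PS
rhs2 = inv (qPoch 5) ⊕ (+ 25) · (mono 1 ⊛ ((qPoch 5 ^P 5) ⊛ inv (qPoch 1 ^P 6)))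

pSeries : PS
pSeries zero = + 0
pSeries (suc j) = + p (5 ℕ.* suc j ∸ 1)

rhs3 : PS
rhs3 = inv (qPoch 5) ⊕ (+ 5) · pSeries

{-# OPTIONS --safe #-}
module Submission where

-- Jacobi's triple product turns the generating function, the diagonal of
-- ∏ⱼ (1 + x^(j+1) y^j)⁵ (1 + x^j y^(j+1))⁵, into θ/(q;q)⁵ with θ the theta series of the lattice A₄,
-- where q = xy.  Let ζ be a primitive fifth root of unity.  Replacing (x , y) by (ζ⁻ⁱ x , ζⁱ y) in the
-- i-th factor gives the sum of ζ^(c₁ w) over A₄, c₁ w = Σ i wᵢ, and by Jacobi again the product
-- (q;q)⁵/(q⁵;q⁵).  The classes of w modulo (1 − ζ)³ with c₁ w ≢ 0 are permuted transitively by the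
-- affine group of ℤ/5, so their partial sums coincide; one of them is a translate of √5 A₄, and its
-- sum is the 5-core series q (q⁵;q⁵)⁵/(q;q).  Hence θ = (q;q)⁵/(q⁵;q⁵) + 25 q (q⁵;q⁵)⁵/(q;q).
--
-- Both Lambert series come from Weierstrass' three-term relation for theta functions with one
-- argument deformed to u = 1 + ε, ε³ = 0: a factor pair (1 − t u)(1 − t u⁻¹) equals
-- (1 − t)² − δ t with δ = u + u⁻¹ − 2, so the coefficient of δ of the relation produces
-- Σ t/(1 − t)².  In base q⁵ at q, q² this evaluates the first Lambert series as q (q⁵;q⁵)⁵/(q;q), in
-- base q at ζ, ζ² the second one as (1 − (q;q)⁵/(q⁵;q⁵))/5.  Ramanujan's series results from the
-- first by extracting every fifth coefficient.

-- The 25 is 20 + 5: the affine group of ℤ/5 has order 20, so twenty classes contribute 20 equal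
-- sums to θ, while in the twisted sum the same classes count -5 times. At u = 1 Weierstrass'
-- relation is a tautology, because θ vanishes at 1; its content lies in the next order. The
-- deformed factors are symmetric in u and u⁻¹, so only δ enters, and δ² = 0 replaces
-- differentiation. The relation itself needs no function theory: b θ(ab) θ(a/b) is a 2 × 2
-- determinant formed from the even and odd parts of theta series in a and in b, so three such
-- products obey the Plücker relation. Two obstacles shape the proof. The series are integral, but
-- ζ, u and δ are not; all computations run over an abstract ring U containing them, and an additive
-- coordinate κ, which reads off the coefficient of δ, brings identities back to ℤ. And there is no
-- division: Gaussian binomials are given by recursion, infinite products are cancelled by explicit
-- inverses, and a constant of ℤ[ζ] that is not a unit is first multiplied up to 5, which is then
-- cancelled in ℤ.

open import Defs
open import Algebra.Bundles using (CommutativeRing; RawRing)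
open import Data.Empty using (⊥-elim)
open import Data.Integer as ℤ using (ℤ; +_; -[1+_])
open import Data.Integer.DivMod using (_%ℕ_; _/ℕ_; a≡a%ℕn+[a/ℕn]*n; n%ℕd<d)
open import Data.List using (List; []; _∷_; _++_; map; upTo; cartesianProduct)
open import Data.List.Membership.Propositional using (_∈_)
open import Data.List.Relation.Unary.All as All using (All; []; _∷_)
open import Data.List.Relation.Unary.AllPairs as AllPairs using ([]; _∷_)
open import Data.List.Relation.Unary.Any using (here; there)
open import Data.List.Relation.Unary.Unique.Propositional using (Unique)
open import Data.Nat as ℕ using (ℕ; zero; suc)
open import Data.Product using (_×_; _,_; proj₁; proj₂; ∃)
open import Data.Sum using (_⊎_; inj₁; inj₂; [_,_]′)
open import Function using (_∘_)
open import Level using (0ℓ)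
open import Relation.Binary.Definitions using (DecidableEquality)
open import Relation.Binary.PropositionalEquality as ≡ using (_≡_; _≢_)
open import Relation.Nullary using (yes; no; ¬_; contradiction; Dec; _×-dec_)
import Algebra.Properties.CommutativeSemiring.Exp as CExp
import Algebra.Properties.Ring as RingProps
import Algebra.Properties.Semiring.Exp as Exp
import Algebra.Properties.Semiring.Mult.TCOptimised as Mult
import Algebra.Solver.Ring as RingSolver
import Data.Integer.Properties as ℤP
import Data.Integer.Tactic.RingSolver as ℤS
import Data.List.Membership.DecPropositional as DecMem
import Data.List.Membership.Propositional.Properties as ∈P
import Data.List.Relation.Unary.All.Properties as AllP
import Data.List.Relation.Unary.AllPairs.Properties as APP
import Data.List.Relation.Unary.Linked.Properties as LinkedP
import Data.List.Relation.Unary.Unique.DecPropositional.Properties as UDP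
import Data.List.Relation.Unary.Unique.Propositional.Properties as UP
import Data.Maybe
import Data.Nat.DivMod as ℕD
import Data.Nat.Properties as ℕP
import Data.Nat.Solver
import Data.Nat.Tactic.RingSolver as ℕS
import Data.Product.Properties as ×P
import Data.Sum.Properties as ⊎P
import Relation.Binary.Reasoning.Setoid as SetoidReasoning

-- Commutative rings: a solver with integer coefficients, finite sums and products.

module RingX (R : CommutativeRing 0ℓ 0ℓ) where
  open import Data.List using (applyUpTo)
  open import Relation.Nullary.Decidable using (dec⇒maybe)
  open import Algebra.Solver.Ring.AlmostCommutativeRing
    using (AlmostCommutativeRing; fromCommutativeRing; _-Raw-AlmostCommutative⟶_)

  open CommutativeRing R hiding (zero)
  open Mult semiring using (×-homo-+; ×1-homo-*; 1+×) renaming (_×_ to _⋆_)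
  open RingProps ring using (-‿+-comm; -‿distribˡ-*; -‿distribʳ-*; -‿involutive; -0#≈0#)
  open SetoidReasoning setoid

  -- With the optimised multiples `1 ⋆ 1#` reduces to `1#`, so that the solver's constant
  -- `con (+ 1)` denotes the unit itself.
  intR : ℤ → Carrier
  intR (+ n) = n ⋆ 1#
  intR -[1+ n ] = - (suc n ⋆ 1#)

  private
    cancel-1 : ∀ a b → a - b ≈ (1# + a) - (1# + b)
    cancel-1 a b = begin
      a - b                          ≈⟨ sym (+-identityˡ _) ⟩
      0# + (a - b)                   ≈⟨ +-congʳ (sym (-‿inverseʳ 1#)) ⟩
      (1# - 1#) + (a - b)            ≈⟨ +-assoc _ _ _ ⟩
      1# + (- 1# + (a - b))          ≈⟨ +-congˡ (sym (+-assoc _ _ _)) ⟩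
      1# + ((- 1# + a) - b)          ≈⟨ +-congˡ (+-congʳ (+-comm _ _)) ⟩
      1# + ((a - 1#) - b)            ≈⟨ +-congˡ (+-assoc _ _ _) ⟩
      1# + (a + (- 1# - b))          ≈⟨ sym (+-assoc _ _ _) ⟩
      (1# + a) + (- 1# - b)          ≈⟨ +-congˡ (-‿+-comm 1# b) ⟩
      (1# + a) - (1# + b)            ∎

  intR-⊖ : ∀ m n → intR (m ℤ.⊖ n) ≈ (m ⋆ 1#) - (n ⋆ 1#)
  intR-⊖ m zero = sym (trans (+-congˡ -0#≈0#) (+-identityʳ _))
  intR-⊖ zero (suc n) = sym (+-identityˡ _)
  intR-⊖ (suc m) (suc n) = begin
    intR (suc m ℤ.⊖ suc n)            ≡⟨ ≡.cong intR (ℤP.[1+m]⊖[1+n]≡m⊖n m n) ⟩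
    intR (m ℤ.⊖ n)                    ≈⟨ intR-⊖ m n ⟩
    m ⋆ 1# - n ⋆ 1#                   ≈⟨ cancel-1 _ _ ⟩
    (1# + m ⋆ 1#) - (1# + n ⋆ 1#)     ≈⟨ +-cong (sym (1+× m 1#)) (-‿cong (sym (1+× n 1#))) ⟩
    suc m ⋆ 1# - suc n ⋆ 1#           ∎

  intR-+ : ∀ i j → intR (i ℤ.+ j) ≈ intR i + intR j
  intR-+ (+ m) (+ n) = ×-homo-+ 1# m n
  intR-+ (+ m) -[1+ n ] = intR-⊖ m (suc n)
  intR-+ -[1+ m ] (+ n) = trans (intR-⊖ n (suc m)) (+-comm _ _)
  intR-+ -[1+ m ] -[1+ n ] = begin
    - (suc (suc (m ℕ.+ n)) ⋆ 1#)      ≡⟨ ≡.cong (λ k → - (suc k ⋆ 1#)) (≡.sym (ℕP.+-suc m n)) ⟩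
    - ((suc m ℕ.+ suc n) ⋆ 1#)        ≈⟨ -‿cong (×-homo-+ 1# (suc m) (suc n)) ⟩
    - (suc m ⋆ 1# + suc n ⋆ 1#)       ≈⟨ sym (-‿+-comm _ _) ⟩
    - (suc m ⋆ 1#) + - (suc n ⋆ 1#)   ∎

  intR-neg : ∀ i → intR (ℤ.- i) ≈ - intR i
  intR-neg (+ zero) = sym -0#≈0#
  intR-neg (+ suc n) = refl
  intR-neg -[1+ n ] = sym (-‿involutive _)

  private
    intR-*⁺ : ∀ m j → intR (+ m ℤ.* j) ≈ (m ⋆ 1#) * intR j
    intR-*⁺ m (+ n) = trans (reflexive (≡.cong intR (≡.sym (ℤP.pos-* m n)))) (×1-homo-* m n)
    intR-*⁺ m -[1+ n ] = begin
      intR (+ m ℤ.* ℤ.- (+ suc n))     ≡⟨ ≡.cong intR (≡.sym (ℤP.neg-distribʳ-* (+ m) (+ suc n))) ⟩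
      intR (ℤ.- (+ m ℤ.* (+ suc n)))   ≈⟨ intR-neg (+ m ℤ.* (+ suc n)) ⟩
      - intR (+ m ℤ.* (+ suc n))       ≈⟨ -‿cong (intR-*⁺ m (+ suc n)) ⟩
      - ((m ⋆ 1#) * (suc n ⋆ 1#))      ≈⟨ -‿distribʳ-* _ _ ⟩
      (m ⋆ 1#) * - (suc n ⋆ 1#)        ∎

  intR-* : ∀ i j → intR (i ℤ.* j) ≈ intR i * intR j
  intR-* (+ m) j = intR-*⁺ m j
  intR-* -[1+ m ] j = begin
    intR (ℤ.- (+ suc m) ℤ.* j)   ≡⟨ ≡.cong intR (≡.sym (ℤP.neg-distribˡ-* (+ suc m) j)) ⟩
    intR (ℤ.- (+ suc m ℤ.* j))   ≈⟨ intR-neg (+ suc m ℤ.* j) ⟩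
    - intR (+ suc m ℤ.* j)       ≈⟨ -‿cong (intR-*⁺ (suc m) j) ⟩
    - ((suc m ⋆ 1#) * intR j)    ≈⟨ -‿distribˡ-* _ _ ⟩
    - (suc m ⋆ 1#) * intR j      ∎

  private
    ℤraw : RawRing 0ℓ 0ℓ
    ℤraw = record { Carrier = ℤ ; _≈_ = _≡_ ; _+_ = ℤ._+_ ; _*_ = ℤ._*_ ; -_ = ℤ.-_ ; 0# = + 0 ; 1# = + 1 }

    acr : AlmostCommutativeRing 0ℓ 0ℓ
    acr = fromCommutativeRing R

    morphism : ℤraw -Raw-AlmostCommutative⟶ acr
    morphism = record
      { ⟦_⟧ = intR ; +-homo = intR-+ ; *-homo = intR-* ; -‿homo = intR-neg ; 0-homo = refl ; 1-homo = refl }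

  open RingSolver ℤraw acr morphism
    (λ i j → Data.Maybe.map (λ e → reflexive (≡.cong intR e)) (dec⇒maybe (i ℤ.≟ j)))
    using (Polynomial; solve; _:=_; _:+_; _:*_; :-_; _:-_; _:^_; con) public

  sumL : {X : Set} → (X → Carrier) → List X → Carrier
  sumL f [] = 0#
  sumL f (x ∷ xs) = f x + sumL f xs

  Σ< : ℕ → (ℕ → Carrier) → Carrier
  Σ< zero f = 0#
  Σ< (suc n) f = Σ< n f + f n

  Π< : ℕ → (ℕ → Carrier) → Carrier
  Π< zero f = 1#
  Π< (suc n) f = Π< n f * f n

  open Exp semiring using (_^_; ^-congˡ; ^-homo-*; ^-assocʳ) public
  open CExp commutativeSemiring using (^-distrib-*) public

  sumL-cong∈ : ∀ {X : Set} {f g : X → Carrier} (xs : List X) → (∀ {x} → x ∈ xs → f x ≈ g x) → sumL f xs ≈ sumL g xs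
  sumL-cong∈ [] h = refl
  sumL-cong∈ (x ∷ xs) h = +-cong (h (here ≡.refl)) (sumL-cong∈ xs (h ∘ there))

  sumL-cong : ∀ {X : Set} {f g : X → Carrier} → (∀ x → f x ≈ g x) → ∀ xs → sumL f xs ≈ sumL g xs
  sumL-cong h xs = sumL-cong∈ xs (λ {x} _ → h x)

  sumL-zero : ∀ {X : Set} {f : X → Carrier} (xs : List X) → (∀ {x} → x ∈ xs → f x ≈ 0#) → sumL f xs ≈ 0#
  sumL-zero [] h = refl
  sumL-zero (x ∷ xs) h = trans (+-cong (h (here ≡.refl)) (sumL-zero xs (h ∘ there))) (+-identityˡ 0#)

  sumL-++ : ∀ {X : Set} (f : X → Carrier) xs ys → sumL f (xs ++ ys) ≈ sumL f xs + sumL f ys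
  sumL-++ f [] ys = sym (+-identityˡ _)
  sumL-++ f (x ∷ xs) ys = trans (+-congˡ (sumL-++ f xs ys)) (sym (+-assoc _ _ _))

  sumL-map : ∀ {X Y : Set} (f : Y → Carrier) (g : X → Y) xs → sumL f (map g xs) ≈ sumL (f ∘ g) xs
  sumL-map f g [] = refl
  sumL-map f g (x ∷ xs) = +-congˡ (sumL-map f g xs)

  private
    interchange : ∀ a b c d → (a + b) + (c + d) ≈ (a + c) + (b + d)
    interchange = solve 4 (λ a b c d → (a :+ b) :+ (c :+ d) := (a :+ c) :+ (b :+ d)) refl

  sumL-+ : ∀ {X : Set} (f g : X → Carrier) xs → sumL (λ x → f x + g x) xs ≈ sumL f xs + sumL g xs
  sumL-+ f g [] = sym (+-identityˡ _)
  sumL-+ f g (x ∷ xs) = trans (+-congˡ (sumL-+ f g xs)) (interchange _ _ _ _)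

  sumL-*ˡ : ∀ {X : Set} c (f : X → Carrier) xs → sumL (λ x → c * f x) xs ≈ c * sumL f xs
  sumL-*ˡ c f [] = sym (zeroʳ c)
  sumL-*ˡ c f (x ∷ xs) = trans (+-congˡ (sumL-*ˡ c f xs)) (sym (distribˡ _ _ _))

  sumL-*ʳ : ∀ {X : Set} c (f : X → Carrier) xs → sumL (λ x → f x * c) xs ≈ sumL f xs * c
  sumL-*ʳ c f xs = trans (sumL-cong (λ x → *-comm _ _) xs) (trans (sumL-*ˡ c f xs) (*-comm _ _))

  sumL-swap : ∀ {X Y : Set} (f : X → Y → Carrier) xs ys →
    sumL (λ x → sumL (f x) ys) xs ≈ sumL (λ y → sumL (λ x → f x y) xs) ys
  sumL-swap f [] ys = sym (sumL-zero ys (λ _ → refl))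
  sumL-swap f (x ∷ xs) ys = trans (+-congˡ (sumL-swap f xs ys)) (sym (sumL-+ _ _ ys))

  sumL-product : ∀ {X Y : Set} (f : X × Y → Carrier) xs ys →
    sumL f (cartesianProduct xs ys) ≈ sumL (λ x → sumL (λ y → f (x , y)) ys) xs
  sumL-product f [] ys = refl
  sumL-product f (x ∷ xs) ys = trans (sumL-++ f (map (x ,_) ys) _) (+-cong (sumL-map f (x ,_) ys) (sumL-product f xs ys))

  Σ<-cong : ∀ n {f g : ℕ → Carrier} → (∀ i → i ℕ.< n → f i ≈ g i) → Σ< n f ≈ Σ< n g
  Σ<-cong zero h = refl
  Σ<-cong (suc n) h = +-cong (Σ<-cong n (λ i i<n → h i (ℕP.m<n⇒m<1+n i<n))) (h n (ℕP.n<1+n n))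

  Σ<-zero : ∀ n {f : ℕ → Carrier} → (∀ i → i ℕ.< n → f i ≈ 0#) → Σ< n f ≈ 0#
  Σ<-zero zero h = refl
  Σ<-zero (suc n) h = trans (+-cong (Σ<-zero n (λ i i<n → h i (ℕP.m<n⇒m<1+n i<n))) (h n (ℕP.n<1+n n))) (+-identityˡ 0#)

  Σ<-point : ∀ n k {f : ℕ → Carrier} → k ℕ.< n → (∀ i → i ≡.≢ k → f i ≈ 0#) → Σ< n f ≈ f k
  Σ<-point (suc n) k (ℕ.s≤s k≤n) h with ℕP.m≤n⇒m<n∨m≡n k≤n
  ... | inj₁ k<n = trans (+-cong (Σ<-point n k k<n h) (h n (λ n≡k → ℕP.<⇒≢ k<n (≡.sym n≡k)))) (+-identityʳ _)
  ... | inj₂ ≡.refl = trans (+-congʳ (Σ<-zero n (λ i i<n → h i (ℕP.<⇒≢ i<n)))) (+-identityˡ _)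

  Σ<-front : ∀ n (f : ℕ → Carrier) → Σ< (suc n) f ≈ f 0 + Σ< n (f ∘ suc)
  Σ<-front zero f = +-comm _ _
  Σ<-front (suc n) f = trans (+-congʳ (Σ<-front n f)) (+-assoc _ _ _)

  Σ<-+ : ∀ n (f g : ℕ → Carrier) → Σ< n (λ i → f i + g i) ≈ Σ< n f + Σ< n g
  Σ<-+ zero f g = sym (+-identityˡ _)
  Σ<-+ (suc n) f g = trans (+-congʳ (Σ<-+ n f g)) (interchange _ _ _ _)

  Σ<-*ˡ : ∀ n c (f : ℕ → Carrier) → Σ< n (λ i → c * f i) ≈ c * Σ< n f
  Σ<-*ˡ zero c f = sym (zeroʳ c)
  Σ<-*ˡ (suc n) c f = trans (+-congʳ (Σ<-*ˡ n c f)) (sym (distribˡ _ _ _))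

  Σ<-swap : ∀ m n (f : ℕ → ℕ → Carrier) → Σ< m (λ i → Σ< n (f i)) ≈ Σ< n (λ j → Σ< m (λ i → f i j))
  Σ<-swap zero n f = sym (Σ<-zero n (λ _ _ → refl))
  Σ<-swap (suc m) n f = trans (+-congʳ (Σ<-swap m n f)) (sym (Σ<-+ n _ _))

  sumL-applyUpTo : ∀ {X : Set} (f : X → Carrier) (g : ℕ → X) n → sumL f (applyUpTo g n) ≈ Σ< n (f ∘ g)
  sumL-applyUpTo f g zero = refl
  sumL-applyUpTo f g (suc n) = trans (+-congˡ (sumL-applyUpTo f (g ∘ suc) n)) (sym (Σ<-front n (f ∘ g)))

  sumL-upTo : ∀ (f : ℕ → Carrier) n → sumL f (upTo n) ≈ Σ< n f
  sumL-upTo f n = sumL-applyUpTo f (λ i → i) n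

  Σ<-5 : ∀ n (f : ℕ → Carrier) → Σ< (n ℕ.* 5) f ≈
    Σ< n (λ i → f (i ℕ.* 5) + f (1 ℕ.+ i ℕ.* 5) + f (2 ℕ.+ i ℕ.* 5) + f (3 ℕ.+ i ℕ.* 5) + f (4 ℕ.+ i ℕ.* 5))
  Σ<-5 zero f = refl
  Σ<-5 (suc n) f =
    trans (+-congʳ (+-congʳ (+-congʳ (+-congʳ (+-congʳ (Σ<-5 n f))))))
      (solve 6 (λ p a b c d e → p :+ a :+ b :+ c :+ d :+ e := p :+ (a :+ b :+ c :+ d :+ e)) refl _ _ _ _ _ _)

  Π<-cong : ∀ n {f g : ℕ → Carrier} → (∀ i → f i ≈ g i) → Π< n f ≈ Π< n g
  Π<-cong zero h = refl
  Π<-cong (suc n) h = *-cong (Π<-cong n h) (h n)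

  private
    *-interchange : ∀ a b c d → (a * b) * (c * d) ≈ (a * c) * (b * d)
    *-interchange = solve 4 (λ a b c d → (a :* b) :* (c :* d) := (a :* c) :* (b :* d)) refl

  Π<-* : ∀ n (f g : ℕ → Carrier) → Π< n (λ i → f i * g i) ≈ Π< n f * Π< n g
  Π<-* zero f g = sym (*-identityˡ _)
  Π<-* (suc n) f g = trans (*-congʳ (Π<-* n f g)) (*-interchange _ _ _ _)

  Π<-front : ∀ n (f : ℕ → Carrier) → Π< (suc n) f ≈ f 0 * Π< n (f ∘ suc)
  Π<-front zero f = *-comm _ _
  Π<-front (suc n) f = trans (*-congʳ (Π<-front n f)) (*-assoc _ _ _)

  Π<-5 : ∀ n (f : ℕ → Carrier) → Π< (n ℕ.* 5) f ≈
    Π< n (λ i → f (i ℕ.* 5) * f (1 ℕ.+ i ℕ.* 5) * f (2 ℕ.+ i ℕ.* 5) * f (3 ℕ.+ i ℕ.* 5) * f (4 ℕ.+ i ℕ.* 5))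
  Π<-5 zero f = refl
  Π<-5 (suc n) f =
    trans (*-congʳ (*-congʳ (*-congʳ (*-congʳ (*-congʳ (Π<-5 n f))))))
      (solve 6 (λ p a b c d e → p :* a :* b :* c :* d :* e := p :* (a :* b :* c :* d :* e)) refl _ _ _ _ _ _)

-- Formal power series, congruence modulo powers of the variable, and limits.

module PS (K : CommutativeRing 0ℓ 0ℓ) where
  private
    module K = CommutativeRing K
    module KX = RingX K
    module KRing = RingProps K.ring

  module _ where
    open CommutativeRing K hiding (zero)
    open KX using (solve; _:=_; _:+_)
    open SetoidReasoning setoid

    Series : Set
    Series = ℕ → Carrier

    infix 4 _≋_
    _≋_ : Series → Series → Set
    f ≋ g = ∀ n → f n ≈ g n

    tail : Series → Series
    tail f n = f (suc n)

    conv : Series → Series → Series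
    conv f g zero = f 0 * g 0
    conv f g (suc n) = f 0 * g (suc n) + conv (tail f) g n

    C : Carrier → Series
    C c zero = c
    C c (suc _) = 0#

    -- Coefficient n of a product sees only coefficients up to n of the factors; this makes
    -- truncation compatible with multiplication.
    conv-cong≤ : ∀ {f f′ g g′} n → (∀ i → i ℕ.≤ n → f i ≈ f′ i) → (∀ i → i ℕ.≤ n → g i ≈ g′ i) →
      conv f g n ≈ conv f′ g′ n
    conv-cong≤ zero p q = *-cong (p 0 ℕ.z≤n) (q 0 ℕ.z≤n)
    conv-cong≤ (suc n) p q = +-cong (*-cong (p 0 ℕ.z≤n) (q (suc n) ℕP.≤-refl))
      (conv-cong≤ n (λ i i≤n → p (suc i) (ℕ.s≤s i≤n)) (λ i i≤n → q i (ℕP.m≤n⇒m≤1+n i≤n)))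

    conv-back : ∀ f g n → conv f g (suc n) ≈ conv f (tail g) n + f (suc n) * g 0
    conv-back f g zero = refl
    conv-back f g (suc n) = trans (+-congˡ (conv-back (tail f) g n)) (sym (+-assoc _ _ _))

    conv-comm : ∀ f g → conv f g ≋ conv g f
    conv-comm f g zero = *-comm _ _
    conv-comm f g (suc n) = trans (conv-back f g n) (trans (+-comm _ _) (+-cong (*-comm _ _) (conv-comm f (tail g) n)))

    conv-distribʳ : ∀ h f g → conv (λ n → f n + g n) h ≋ (λ n → conv f h n + conv g h n)
    conv-distribʳ h f g zero = distribʳ _ _ _
    conv-distribʳ h f g (suc n) = trans (+-cong (distribʳ _ _ _) (conv-distribʳ h (tail f) (tail g) n))
      (solve 4 (λ a b c d → (a :+ b) :+ (c :+ d) := (a :+ c) :+ (b :+ d)) refl _ _ _ _)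

    conv-scaleˡ : ∀ c f g → conv (λ n → c * f n) g ≋ (λ n → c * conv f g n)
    conv-scaleˡ c f g zero = *-assoc _ _ _
    conv-scaleˡ c f g (suc n) = trans (+-cong (*-assoc _ _ _) (conv-scaleˡ c (tail f) g n)) (sym (distribˡ _ _ _))

    conv-zeroˡ : ∀ {f} g n → (∀ i → i ℕ.≤ n → f i ≈ 0#) → conv f g n ≈ 0#
    conv-zeroˡ g zero h = trans (*-congʳ (h 0 ℕ.z≤n)) (zeroˡ _)
    conv-zeroˡ g (suc n) h = trans (+-cong (trans (*-congʳ (h 0 ℕ.z≤n)) (zeroˡ _))
      (conv-zeroˡ g n (λ i i≤n → h (suc i) (ℕ.s≤s i≤n)))) (+-identityˡ 0#)

    C-conv : ∀ c g → conv (C c) g ≋ (λ n → c * g n)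
    C-conv c g zero = refl
    C-conv c g (suc n) = trans (+-congˡ (conv-zeroˡ g n (λ _ _ → refl))) (+-identityʳ _)

    conv-assoc : ∀ f g h → conv (conv f g) h ≋ conv f (conv g h)
    conv-assoc f g h zero = *-assoc _ _ _
    conv-assoc f g h (suc n) = begin
      f 0 * g 0 * h (suc n) + conv (λ m → f 0 * g (suc m) + conv (tail f) g m) h n
        ≈⟨ +-cong (*-assoc _ _ _) (trans (conv-distribʳ h (λ m → f 0 * g (suc m)) (conv (tail f) g) n)
             (+-cong (conv-scaleˡ (f 0) (tail g) h n) (conv-assoc (tail f) g h n))) ⟩
      f 0 * (g 0 * h (suc n)) + (f 0 * conv (tail g) h n + conv (tail f) (conv g h) n)
        ≈⟨ sym (+-assoc _ _ _) ⟩
      (f 0 * (g 0 * h (suc n)) + f 0 * conv (tail g) h n) + conv (tail f) (conv g h) n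
        ≈⟨ +-congʳ (sym (distribˡ _ _ _)) ⟩
      f 0 * (g 0 * h (suc n) + conv (tail g) h n) + conv (tail f) (conv g h) n ∎

    psRing : CommutativeRing 0ℓ 0ℓ
    psRing = record
      { Carrier = Series
      ; _≈_ = _≋_
      ; _+_ = λ f g n → f n + g n
      ; _*_ = conv
      ; -_ = λ f n → - f n
      ; 0# = λ _ → 0#
      ; 1# = C 1#
      ; isCommutativeRing = record
        { isRing = record
          { +-isAbelianGroup = record
            { isGroup = record
              { isMonoid = record
                { isSemigroup = record
                  { isMagma = record
                    { isEquivalence = record
                      { refl = λ _ → refl ; sym = λ p n → sym (p n) ; trans = λ p q n → trans (p n) (q n) }
                    ; ∙-cong = λ p q n → +-cong (p n) (q n) }
                  ; assoc = λ _ _ _ _ → +-assoc _ _ _ }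
                ; identity = (λ _ _ → +-identityˡ _) , (λ _ _ → +-identityʳ _) }
              ; inverse = (λ _ _ → -‿inverseˡ _) , (λ _ _ → -‿inverseʳ _)
              ; ⁻¹-cong = λ p n → -‿cong (p n) }
            ; comm = λ _ _ _ → +-comm _ _ }
          ; *-cong = λ p q n → conv-cong≤ n (λ i _ → p i) (λ i _ → q i)
          ; *-assoc = conv-assoc
          ; *-identity = (λ f n → trans (C-conv 1# f n) (*-identityˡ _))
                       , (λ f n → trans (conv-comm f (C 1#) n) (trans (C-conv 1# f n) (*-identityˡ _)))
          ; distrib = (λ f g h n → trans (conv-comm f (λ m → g m + h m) n)
                         (trans (conv-distribʳ f g h n) (+-cong (conv-comm g f n) (conv-comm h f n))))
                    , conv-distribʳ }
        ; *-comm = conv-comm } }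

  private
    module P = CommutativeRing psRing
    module PX = RingX psRing
  open CommutativeRing psRing hiding (zero)
  open PX using (solve; _:=_; _:+_; :-_; _:-_; sumL; Σ<; Π<; _^_)

  mon : K.Carrier → ℕ → Series
  mon c zero = C c
  mon c (suc k) zero = K.0#
  mon c (suc k) (suc n) = mon c k n

  C-cong : ∀ {c d} → c K.≈ d → C c ≈ C d
  C-cong p zero = p
  C-cong p (suc n) = K.refl

  mon-cong : ∀ {c d} k → c K.≈ d → mon c k ≈ mon d k
  mon-cong zero p = C-cong p
  mon-cong (suc k) p zero = K.refl
  mon-cong (suc k) p (suc n) = mon-cong k p n

  mon-≡ : ∀ c {k l} → k ≡ l → mon c k ≈ mon c l
  mon-≡ c ≡.refl = refl

  C-scale : ∀ c d l → (λ n → c K.* mon d l n) ≈ mon (c K.* d) l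
  C-scale c d zero zero = K.refl
  C-scale c d zero (suc n) = K.zeroʳ c
  C-scale c d (suc l) zero = K.zeroʳ c
  C-scale c d (suc l) (suc n) = C-scale c d l n

  mon-* : ∀ c k d l → mon c k * mon d l ≈ mon (c K.* d) (k ℕ.+ l)
  mon-* c zero d l = trans (C-conv c (mon d l)) (C-scale c d l)
  mon-* c (suc k) d l zero = K.zeroˡ _
  mon-* c (suc k) d l (suc n) = K.trans (K.+-cong (K.zeroˡ _) (mon-* c k d l n)) (K.+-identityˡ _)

  mon-^ : ∀ c k n → mon c k ^ n ≈ mon (c KX.^ n) (n ℕ.* k)
  mon-^ c k zero = refl
  mon-^ c k (suc n) = trans (*-congˡ (mon-^ c k n)) (mon-* c k (c KX.^ n) (n ℕ.* k))

  mon-zero : ∀ k → mon K.0# k ≈ 0#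
  mon-zero zero zero = K.refl
  mon-zero zero (suc n) = K.refl
  mon-zero (suc k) zero = K.refl
  mon-zero (suc k) (suc n) = mon-zero k n

  mon-+ : ∀ c d k → mon c k + mon d k ≈ mon (c K.+ d) k
  mon-+ c d zero zero = K.refl
  mon-+ c d zero (suc n) = K.+-identityˡ _
  mon-+ c d (suc k) zero = K.+-identityˡ _
  mon-+ c d (suc k) (suc n) = mon-+ c d k n

  mon-neg : ∀ c k → - mon c k ≈ mon (K.- c) k
  mon-neg c zero zero = K.refl
  mon-neg c zero (suc n) = KRing.-0#≈0#
  mon-neg c (suc k) zero = KRing.-0#≈0#
  mon-neg c (suc k) (suc n) = mon-neg c k n

  mon-shift : ∀ c k f n → (mon c k * f) (k ℕ.+ n) K.≈ c K.* f n
  mon-shift c zero f n = C-conv c f n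
  mon-shift c (suc k) f n = K.trans (K.+-cong (K.zeroˡ _) (mon-shift c k f n)) (K.+-identityˡ _)

  mon-below : ∀ c k f n → n ℕ.< k → (mon c k * f) n K.≈ K.0#
  mon-below c (suc k) f zero _ = K.zeroˡ _
  mon-below c (suc k) f (suc n) (ℕ.s≤s n<k) = K.trans (K.+-cong (K.zeroˡ _) (mon-below c k f n n<k)) (K.+-identityˡ _)

  mon-same : ∀ c k → mon c k k K.≈ c
  mon-same c zero = K.refl
  mon-same c (suc k) = mon-same c k

  mon-diff : ∀ c k n → n ≡.≢ k → mon c k n K.≈ K.0#
  mon-diff c zero zero p = ⊥-elim (p ≡.refl)
  mon-diff c zero (suc n) p = K.refl
  mon-diff c (suc k) zero p = K.refl
  mon-diff c (suc k) (suc n) p = mon-diff c k n (p ∘ ≡.cong suc)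

  -- Congruence modulo Xᴺ; `O N` is the ideal generated by Xᴺ.
  infix 4 _≈[_]_
  _≈[_]_ : Series → ℕ → Series → Set
  f ≈[ N ] g = ∀ i → i ℕ.< N → f i K.≈ g i

  O : ℕ → Series → Set
  O N f = f ≈[ N ] 0#

  ≈⇒ : ∀ {N f g} → f ≈ g → f ≈[ N ] g
  ≈⇒ p i _ = p i

  ⇒≈ : ∀ {f g} → (∀ N → f ≈[ N ] g) → f ≈ g
  ⇒≈ p n = p (suc n) n (ℕP.n<1+n n)

  tr : ∀ {N f g h} → f ≈[ N ] g → g ≈[ N ] h → f ≈[ N ] h
  tr p q i i<N = K.trans (p i i<N) (q i i<N)

  sy : ∀ {N f g} → f ≈[ N ] g → g ≈[ N ] f
  sy p i i<N = K.sym (p i i<N)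

  weaken : ∀ {M N f g} → M ℕ.≤ N → f ≈[ N ] g → f ≈[ M ] g
  weaken M≤N p i i<M = p i (ℕP.≤-trans i<M M≤N)

  +-≈⟨⟩ : ∀ {N f f′ g g′} → f ≈[ N ] f′ → g ≈[ N ] g′ → f + g ≈[ N ] f′ + g′
  +-≈⟨⟩ p q i i<N = K.+-cong (p i i<N) (q i i<N)

  *-≈⟨⟩ : ∀ {N f f′ g g′} → f ≈[ N ] f′ → g ≈[ N ] g′ → f * g ≈[ N ] f′ * g′
  *-≈⟨⟩ p q i i<N = conv-cong≤ i (λ j j≤i → p j (ℕP.≤-<-trans j≤i i<N)) (λ j j≤i → q j (ℕP.≤-<-trans j≤i i<N))

  sumL-≈⟨⟩ : ∀ {N} {X : Set} {f g : X → Series} → (∀ x → f x ≈[ N ] g x) → ∀ xs → sumL f xs ≈[ N ] sumL g xs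
  sumL-≈⟨⟩ h [] = ≈⇒ refl
  sumL-≈⟨⟩ h (x ∷ xs) = +-≈⟨⟩ (h x) (sumL-≈⟨⟩ h xs)

  Σ<-≈⟨⟩ : ∀ {N} n {f g : ℕ → Series} → (∀ i → i ℕ.< n → f i ≈[ N ] g i) → Σ< n f ≈[ N ] Σ< n g
  Σ<-≈⟨⟩ zero h = ≈⇒ refl
  Σ<-≈⟨⟩ (suc n) h = +-≈⟨⟩ (Σ<-≈⟨⟩ n (λ i i<n → h i (ℕP.m<n⇒m<1+n i<n))) (h n (ℕP.n<1+n n))

  O-weaken : ∀ {M N f} → M ℕ.≤ N → O N f → O M f
  O-weaken {f = f} = weaken {f = f} {0#}

  O-≈ : ∀ {N f g} → f ≈ g → O N f → O N g
  O-≈ p q i i<N = K.trans (K.sym (p i)) (q i i<N)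

  O-mon : ∀ c k → O k (mon c k)
  O-mon c k i i<k = mon-diff c k i (ℕP.<⇒≢ i<k)

  O-* : ∀ {a b f g} → O a f → O b g → O (a ℕ.+ b) (f * g)
  O-* {zero} {b} {f} {g} p q i i<b = K.trans (conv-comm f g i) (conv-zeroˡ f i (λ j j≤i → q j (ℕP.≤-<-trans j≤i i<b)))
  O-* {suc a} {b} {f} {g} p q zero i< = K.trans (K.*-congʳ (p 0 (ℕ.s≤s ℕ.z≤n))) (K.zeroˡ _)
  O-* {suc a} {b} {f} {g} p q (suc i) (ℕ.s≤s i<) = K.trans
    (K.+-cong (K.trans (K.*-congʳ (p 0 (ℕ.s≤s ℕ.z≤n))) (K.zeroˡ _))
              (O-* {a} {b} {tail f} {g} (λ j j<a → p (suc j) (ℕ.s≤s j<a)) q i i<))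
    (K.+-identityˡ _)

  O-*ˡ : ∀ {b} f {g} → O b g → O b (f * g)
  O-*ˡ f {g} q = O-* {0} {f = f} {g} (λ _ ()) q

  O-^ : ∀ {a f} n → O a f → O (n ℕ.* a) (f ^ n)
  O-^ zero p i ()
  O-^ {a} {f} (suc n) p = O-* {a} {n ℕ.* a} {f} {f ^ n} p (O-^ n p)

  O-+ : ∀ {N f g} → O N f → O N g → O N (f + g)
  O-+ p q i i<N = K.trans (K.+-cong (p i i<N) (q i i<N)) (K.+-identityˡ _)

  ≈⟨⟩⇒O : ∀ {N f g} → f ≈[ N ] g → O N (f - g)
  ≈⟨⟩⇒O p i i<N = K.trans (K.+-congʳ (p i i<N)) (K.-‿inverseʳ _)

  O⇒≈⟨⟩ : ∀ {N f g} → O N (f - g) → f ≈[ N ] g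
  O⇒≈⟨⟩ {N} {f} {g} p i i<N = K.trans (solve₂ (f i) (g i)) (K.trans (K.+-congʳ (p i i<N)) (K.+-identityˡ _))
    where
    solve₂ : ∀ a b → a K.≈ (a K.- b) K.+ b
    solve₂ = KX.solve 2 (λ a b → a KX.:= (a KX.:- b) KX.:+ b) K.refl

  Lim : (ℕ → Series) → Series → Set
  Lim s l = ∀ N → ∃ λ M₀ → ∀ M → M₀ ℕ.≤ M → s M ≈[ N ] l

  Lim-unique : ∀ {s l l′} → Lim s l → Lim s l′ → l ≈ l′
  Lim-unique {s} p q = ⇒≈ λ N → let (M₁ , h₁) = p N ; (M₂ , h₂) = q N in
    tr (sy (h₁ (M₁ ℕ.⊔ M₂) (ℕP.m≤m⊔n M₁ M₂))) (h₂ (M₁ ℕ.⊔ M₂) (ℕP.m≤n⊔m M₁ M₂))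

  Lim-cong : ∀ {s t l} → (∀ M → s M ≈ t M) → Lim s l → Lim t l
  Lim-cong e p N = let (M₀ , h) = p N in M₀ , λ M le → tr (≈⇒ (sym (e M))) (h M le)

  Lim-≈ : ∀ {s l l′} → l ≈ l′ → Lim s l → Lim s l′
  Lim-≈ e p N = let (M₀ , h) = p N in M₀ , λ M le → tr (h M le) (≈⇒ e)

  Lim-* : ∀ {s t l m} → Lim s l → Lim t m → Lim (λ M → s M * t M) (l * m)
  Lim-* p q N = let (M₁ , h₁) = p N ; (M₂ , h₂) = q N in
    M₁ ℕ.⊔ M₂ , λ M le → *-≈⟨⟩ (h₁ M (ℕP.m⊔n≤o⇒m≤o M₁ M₂ le)) (h₂ M (ℕP.m⊔n≤o⇒n≤o M₁ M₂ le))

  Lim-+ : ∀ {s t l m} → Lim s l → Lim t m → Lim (λ M → s M + t M) (l + m)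
  Lim-+ p q N = let (M₁ , h₁) = p N ; (M₂ , h₂) = q N in
    M₁ ℕ.⊔ M₂ , λ M le → +-≈⟨⟩ (h₁ M (ℕP.m⊔n≤o⇒m≤o M₁ M₂ le)) (h₂ M (ℕP.m⊔n≤o⇒n≤o M₁ M₂ le))

  Lim-const : ∀ f → Lim (λ _ → f) f
  Lim-const f N = 0 , λ _ _ → ≈⇒ refl

  Lim-sub : ∀ {s l} (φ : ℕ → ℕ) → (∀ M → M ℕ.≤ φ M) → Lim s l → Lim (s ∘ φ) l
  Lim-sub φ grow p N = let (M₀ , h) = p N in M₀ , λ M le → h (φ M) (ℕP.≤-trans le (grow M))

  lim-stable : ∀ {s : ℕ → Series} → (∀ M → s (suc M) ≈[ M ] s M) → ∀ {N} d → s (d ℕ.+ N) ≈[ N ] s N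
  lim-stable h zero = ≈⇒ refl
  lim-stable h {N} (suc d) = tr (weaken (ℕP.m≤n+m N d) (h (d ℕ.+ N))) (lim-stable h d)

  -- When members M and M + 1 agree modulo X^M, coefficient n is settled from index n + 1 on.
  limit : (ℕ → Series) → Series
  limit s n = s (suc n) n

  Lim-limit : ∀ {s} → (∀ M → s (suc M) ≈[ M ] s M) → Lim s (limit s)
  Lim-limit {s} h N = N , λ M N≤M i i<N →
    K.trans (K.reflexive (≡.cong (λ k → s k i) (≡.sym (ℕP.m∸n+n≡m (ℕP.≤-trans i<N N≤M)))))
      (lim-stable h {suc i} (M ℕ.∸ suc i) i (ℕP.n<1+n i))

  Lim-Π : ∀ {t : ℕ → Series} → (∀ M → O M (t M)) → Lim (λ M → Π< M (λ j → 1# + t j)) (limit (λ M → Π< M (λ j → 1# + t j)))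
  Lim-Π {t} h = Lim-limit λ M → tr (*-≈⟨⟩ {M} {f = Π< M (λ j → 1# + t j)} (≈⇒ refl) (+-≈⟨⟩ (≈⇒ refl) (h M)))
    (≈⇒ (trans (*-congˡ (+-identityʳ 1#)) (*-identityʳ _)))

  -- Serves two kinds of regrouping: an infinite product split by the residue of its index modulo 5,
  -- and five conjugate products merged into one.
  Lim-Π5 : ∀ {f₀ f₁ f₂ f₃ f₄ F : ℕ → Series} {l₀ l₁ l₂ l₃ l₄ L} →
    Lim (λ N → Π< N f₀) l₀ → Lim (λ N → Π< N f₁) l₁ → Lim (λ N → Π< N f₂) l₂ → Lim (λ N → Π< N f₃) l₃ → Lim (λ N → Π< N f₄) l₄ →
    (∀ j → f₀ j * (f₁ j * (f₂ j * (f₃ j * f₄ j))) ≈ F j) → Lim (λ N → Π< N F) L → l₀ * (l₁ * (l₂ * (l₃ * l₄))) ≈ L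
  Lim-Π5 {f₀} {f₁} {f₂} {f₃} {f₄} p₀ p₁ p₂ p₃ p₄ e p = Lim-unique
    (Lim-* p₀ (Lim-* p₁ (Lim-* p₂ (Lim-* p₃ p₄))))
    (Lim-cong (λ N → sym (trans (*-congˡ (trans (*-congˡ (trans (*-congˡ (sym (PX.Π<-* N f₃ f₄))) (sym (PX.Π<-* N f₂ _)))) (sym (PX.Π<-* N f₁ _))))
      (trans (sym (PX.Π<-* N f₀ _)) (PX.Π<-cong N e)))) p)

-- Unordered infinite sums of series.

module Sum (K : CommutativeRing 0ℓ 0ℓ) where
  open import Data.List using (filter; deduplicate)
  open import Data.List.Membership.Propositional using (_∉_)
  open import Algebra.Properties.AbelianGroup ℤP.+-0-abelianGroup using (∙-cancelʳ)

  open PS K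
  private module PX = RingX psRing
  open CommutativeRing psRing hiding (zero)
  open PX using (sumL)

  -- Each precision has its own finite list, outside of which all terms are negligible. Sums over ℤ⁵
  -- then need no enumeration and no order, and products, disjoint unions and reindexing become
  -- operations on lists.
  HasSum : {X : Set} → (X → Series) → Series → Set
  HasSum {X} f s = ∀ N → ∃ λ (L : List X) → Unique L × (∀ x → x ∉ L → O N (f x)) × sumL f L ≈[ N ] s

  sumL-point-∉ : ∀ {X : Set} (g : X → Series) y → (∀ x → x ≢ y → g x ≈ 0#) → ∀ L → y ∉ L → sumL g L ≈ 0#
  sumL-point-∉ g y h L y∉ = PX.sumL-zero L (λ {x} x∈ → h x (λ { ≡.refl → y∉ x∈ }))

  sumL-point : ∀ {X : Set} (g : X → Series) y → (∀ x → x ≢ y → g x ≈ 0#) → ∀ {L} → Unique L → y ∈ L → sumL g L ≈ g y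
  sumL-point g y h (x∉ ∷ u) (here ≡.refl) =
    trans (+-congˡ (sumL-point-∉ g y h _ (λ y∈ → All.lookup x∉ y∈ ≡.refl))) (+-identityʳ _)
  sumL-point g y h (x∉ ∷ u) (there y∈) =
    trans (+-cong (h _ (All.lookup x∉ y∈)) (sumL-point g y h u y∈)) (+-identityˡ _)

  module _ {X : Set} (_≟_ : DecidableEquality X) where
    open DecMem _≟_ using (_∈?_)

    private
      sel : (X → Series) → X → X → Series
      sel f x y with x ≟ y
      ... | yes _ = f x
      ... | no _ = 0#

      sel-same : ∀ f x → sel f x x ≈ f x
      sel-same f x with x ≟ x
      ... | yes _ = refl
      ... | no x≢x = contradiction ≡.refl x≢x

      sel-diff : ∀ f x y → x ≢ y → sel f x y ≈ 0#
      sel-diff f x y x≢y with x ≟ y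
      ... | yes x≡y = contradiction x≡y x≢y
      ... | no _ = refl

      cover-row : ∀ N f {L} → Unique L → (∀ x → x ∉ L → O N (f x)) → ∀ x → f x ≈[ N ] sumL (sel f x) L
      cover-row N f {L} u out x with x ∈? L
      ... | yes x∈ = ≈⇒ (sym (trans (sumL-point (sel f x) x (λ y y≢x → sel-diff f x y (y≢x ∘ ≡.sym)) u x∈) (sel-same f x)))
      ... | no x∉ = tr (out x x∉) (≈⇒ (sym (sumL-point-∉ (sel f x) x (λ y y≢x → sel-diff f x y (y≢x ∘ ≡.sym)) L x∉)))

      cover-col : ∀ N f {L} → Unique L → (∀ x → x ∉ L → O N (f x)) → ∀ y → sumL (λ x → sel f x y) L ≈[ N ] f y
      cover-col N f {L} u out y with y ∈? L
      ... | yes y∈ = ≈⇒ (trans (sumL-point (λ x → sel f x y) y (λ x → sel-diff f x y) u y∈) (sel-same f y))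
      ... | no y∉ = tr (≈⇒ (sumL-point-∉ (λ x → sel f x y) y (λ x → sel-diff f x y) L y∉)) (sy (out y y∉))

    -- Both sums are compared with the double sum of f over the diagonal pairs of L and L′: summed
    -- by rows it gives the first, by columns the second, up to order N.
    sumL-cover : ∀ N f {L L′} → Unique L → Unique L′ → (∀ x → x ∉ L → O N (f x)) → (∀ x → x ∉ L′ → O N (f x)) →
      sumL f L ≈[ N ] sumL f L′
    sumL-cover N f {L} {L′} u u′ out out′ =
      tr (sumL-≈⟨⟩ (cover-row N f u′ out′) L)
        (tr (≈⇒ (PX.sumL-swap (sel f) L L′)) (sumL-≈⟨⟩ (cover-col N f u out) L′))

    HasSum-unique : ∀ {f s t} → HasSum {X} f s → HasSum f t → s ≈ t
    HasSum-unique {f} p q = ⇒≈ λ N →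
      let (L , u , out , e) = p N ; (L′ , u′ , out′ , e′) = q N in
      tr (sy e) (tr (sumL-cover N f u u′ out out′) e′)

    HasSum-+ : ∀ {f g s t} → HasSum {X} f s → HasSum g t → HasSum (λ x → f x + g x) (s + t)
    HasSum-+ {f} {g} p q N =
      let (L₁ , u₁ , out₁ , e₁) = p N ; (L₂ , u₂ , out₂ , e₂) = q N
          L = deduplicate _≟_ (L₁ ++ L₂)
          u = UDP.deduplicate-! _≟_ (L₁ ++ L₂)
          out₁′ : ∀ x → x ∉ L → O N (f x)
          out₁′ x x∉ = out₁ x (λ x∈ → x∉ (∈P.∈-deduplicate⁺ _≟_ (∈P.∈-++⁺ˡ x∈)))
          out₂′ : ∀ x → x ∉ L → O N (g x)
          out₂′ x x∉ = out₂ x (λ x∈ → x∉ (∈P.∈-deduplicate⁺ _≟_ (∈P.∈-++⁺ʳ L₁ x∈)))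
      in L , u , (λ x x∉ → O-+ {f = f x} {g x} (out₁′ x x∉) (out₂′ x x∉)) ,
         tr (≈⇒ (PX.sumL-+ f g L))
           (+-≈⟨⟩ (tr (sumL-cover N f u u₁ out₁′ out₁) e₁) (tr (sumL-cover N g u u₂ out₂′ out₂) e₂))

    private
      product-out : ∀ {Y : Set} N {f : X → Series} {g : Y → Series} {L₁ L₂} →
        (∀ x → x ∉ L₁ → O N (f x)) → (∀ y → y ∉ L₂ → O N (g y)) →
        ∀ z → z ∉ cartesianProduct L₁ L₂ → O N (f (proj₁ z) * g (proj₂ z))
      product-out N {f} {g} {L₁} out₁ out₂ (x , y) z∉ with x ∈? L₁
      ... | yes x∈ = O-*ˡ (f x) {g y} (out₂ y (λ y∈ → z∉ (∈P.∈-cartesianProduct⁺ x∈ y∈)))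
      ... | no x∉ = O-≈ (*-comm (g y) (f x)) (O-*ˡ (g y) {f x} (out₁ x x∉))

    HasSum-* : ∀ {Y : Set} {f : X → Series} {g : Y → Series} {s t} → HasSum f s → HasSum g t →
      HasSum (λ (z : X × Y) → f (proj₁ z) * g (proj₂ z)) (s * t)
    HasSum-* {Y} {f} {g} p q N =
      let (L₁ , u₁ , out₁ , e₁) = p N ; (L₂ , u₂ , out₂ , e₂) = q N
      in cartesianProduct L₁ L₂ , UP.cartesianProduct⁺ u₁ u₂ , product-out N {f} {g} {L₁} {L₂} out₁ out₂ ,
         tr (≈⇒ (trans (PX.sumL-product (λ z → f (proj₁ z) * g (proj₂ z)) L₁ L₂)
                  (trans (PX.sumL-cong (λ x → PX.sumL-*ˡ (f x) g L₂) L₁) (PX.sumL-*ʳ (sumL g L₂) f L₁))))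
            (*-≈⟨⟩ e₁ e₂)

    module _ {Y : Set} {f : X → Series} {g : Y → Series} (φ : X → Y) (ψ : Y → X)
      (fwd : ∀ x → f x ≈ 0# ⊎ (ψ (φ x) ≡ x × g (φ x) ≈ f x))
      (bwd : ∀ y → g y ≈ 0# ⊎ (φ (ψ y) ≡ y × g y ≈ f (ψ y))) where
      private
        good? : ∀ x → Dec (ψ (φ x) ≡ x)
        good? x = ψ (φ x) ≟ x

        agree : ∀ x → ψ (φ x) ≡ x → g (φ x) ≈ f x
        agree x r with fwd x | bwd (φ x)
        ... | inj₂ (_ , e) | _ = e
        ... | inj₁ z | inj₁ z′ = trans z′ (sym z)
        ... | inj₁ z | inj₂ (_ , e) = trans e (reflexive (≡.cong f r))

        sum-push : ∀ L → sumL g (map φ (filter good? L)) ≈ sumL f L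
        sum-push [] = refl
        sum-push (x ∷ L) with good? x
        ... | yes r = +-cong (agree x r) (sum-push L)
        ... | no ¬r with fwd x
        ...   | inj₁ z = trans (sum-push L) (sym (trans (+-congʳ z) (+-identityˡ _)))
        ...   | inj₂ (r , _) = contradiction r ¬r

        unique-push : ∀ {L} → Unique L → All (λ x → ψ (φ x) ≡ x) L → Unique (map φ L)
        unique-push [] [] = []
        unique-push (x∉ ∷ u) (r ∷ rs) =
          AllP.map⁺ (All.zipWith (λ { (x≢y , ry) e → x≢y (≡.trans (≡.sym r) (≡.trans (≡.cong ψ e) ry)) }) (x∉ , rs))
            ∷ unique-push u rs

      -- The two maps have to be mutually inverse only where the terms do not vanish. Hence a
      -- sublattice or one of its translates can be treated as a function on all of ℤ⁵ that is zero
      -- elsewhere.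
      HasSum-transport : ∀ {s} → HasSum f s → HasSum g s
      HasSum-transport p N =
        let (L , u , out , e) = p N
            out′ : ∀ y → y ∉ map φ (filter good? L) → O N (g y)
            out′ y y∉ = [ (λ z → ≈⇒ z) , (λ { (r , e′) → O-≈ (sym e′) (out (ψ y) (λ ψy∈ →
              y∉ (≡.subst (_∈ map φ (filter good? L)) r
                (∈P.∈-map⁺ φ (∈P.∈-filter⁺ good? ψy∈ (≡.cong ψ r)))))) }) ]′ (bwd y)
        in map φ (filter good? L) , unique-push (UP.filter⁺ good? u) (AllP.all-filter good? L) , out′ ,
           tr (≈⇒ (sum-push L)) e

  HasSum-cong : ∀ {X : Set} {f g : X → Series} {s t} → (∀ x → f x ≈ g x) → s ≈ t → HasSum f s → HasSum g t
  HasSum-cong h s≈t p N = let (L , u , out , e) = p N in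
    L , u , (λ x x∉ → O-≈ (h x) (out x x∉)) , tr (≈⇒ (sym (PX.sumL-cong h L))) (tr e (≈⇒ s≈t))

  HasSum-scale : ∀ {X : Set} {f : X → Series} {s} c → HasSum f s → HasSum (λ x → c * f x) (c * s)
  HasSum-scale {f = f} c p N = let (L , u , out , e) = p N in
    L , u , (λ x x∉ → O-*ˡ c {f x} (out x x∉)) , tr (≈⇒ (PX.sumL-*ˡ c f L)) (*-≈⟨⟩ {f = c} (≈⇒ refl) e)

  private
    inj₁≢ : ∀ {X Y : Set} {x : X} (L : List Y) → All (inj₁ x ≢_) (map inj₂ L)
    inj₁≢ L = AllP.map⁺ (All.universal (λ _ ()) L)

    unique-⊎ : ∀ {X Y : Set} {L₁ : List X} {L₂ : List Y} → Unique L₁ → Unique L₂ → Unique (map inj₁ L₁ ++ map inj₂ L₂)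
    unique-⊎ [] u₂ = UP.map⁺ (λ { ≡.refl → ≡.refl }) u₂
    unique-⊎ {L₂ = L₂} (x∉ ∷ u₁) u₂ =
      AllP.++⁺ (AllP.map⁺ (All.map (λ { x≢y ≡.refl → x≢y ≡.refl }) x∉)) (inj₁≢ L₂) ∷ unique-⊎ u₁ u₂

  HasSum-⊎ : ∀ {X Y : Set} {f : X → Series} {g : Y → Series} {s t} → HasSum f s → HasSum g t →
    HasSum [ f , g ]′ (s + t)
  HasSum-⊎ {f = f} {g} p q N =
    let (L₁ , u₁ , out₁ , e₁) = p N ; (L₂ , u₂ , out₂ , e₂) = q N
        out : ∀ z → z ∉ map inj₁ L₁ ++ map inj₂ L₂ → O N ([ f , g ]′ z)
        out = λ { (inj₁ x) z∉ → out₁ x (λ x∈ → z∉ (∈P.∈-++⁺ˡ (∈P.∈-map⁺ inj₁ x∈)))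
                ; (inj₂ y) z∉ → out₂ y (λ y∈ → z∉ (∈P.∈-++⁺ʳ (map inj₁ L₁) (∈P.∈-map⁺ inj₂ y∈))) }
    in map inj₁ L₁ ++ map inj₂ L₂ , unique-⊎ u₁ u₂ , out ,
       tr (≈⇒ (trans (PX.sumL-++ [ f , g ]′ (map inj₁ L₁) _) (+-cong (PX.sumL-map [ f , g ]′ inj₁ L₁) (PX.sumL-map [ f , g ]′ inj₂ L₂))))
          (+-≈⟨⟩ e₁ e₂)

  HasSum-zero : ∀ {X : Set} → HasSum {X} (λ _ → 0#) 0#
  HasSum-zero N = [] , [] , (λ _ _ → ≈⇒ refl) , ≈⇒ refl

  HasSum-sumL : ∀ {X A : Set} → DecidableEquality X → {f : A → X → Series} {s : A → Series} (L : List A) →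
    All (λ κ → HasSum (f κ) (s κ)) L → HasSum (λ x → sumL (λ κ → f κ x) L) (sumL s L)
  HasSum-sumL _≟_ [] [] = HasSum-zero
  HasSum-sumL _≟_ (κ ∷ L) (h ∷ hs) = HasSum-+ _≟_ h (HasSum-sumL _≟_ L hs)

  HasSum-point : ∀ {X : Set} {f : X → Series} x → (∀ y → y ≢ x → f y ≈ 0#) → HasSum f (f x)
  HasSum-point {f = f} x h N = x ∷ [] , [] ∷ [] , (λ y y∉ → ≈⇒ (h y (λ y≡x → y∉ (here y≡x)))) , ≈⇒ (+-identityʳ (f x))

  interval : ℕ → List ℤ
  interval N = map (λ k → + k ℤ.- + N) (upTo (suc (N ℕ.+ N)))

  interval-! : ∀ N → Unique (interval N)
  interval-! N = UP.map⁺ (λ {i} {j} e → ℤP.+-injective (∙-cancelʳ (ℤ.- + N) (+ i) (+ j) e)) (UP.upTo⁺ (suc (N ℕ.+ N)))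

  ∉interval : ∀ N i → i ∉ interval N → N ℕ.< ℤ.∣ i ∣
  ∉interval N i i∉ with N ℕP.<? ℤ.∣ i ∣
  ... | yes p = p
  ... | no ¬p = contradiction (inside i (ℕP.≮⇒≥ ¬p)) i∉
    where
    eq : ∀ i k → i ℤ.+ + N ≡ + k → + k ℤ.- + N ≡ i
    eq i k e = ≡.trans (≡.cong (ℤ._- + N) (≡.sym e)) (≡.trans (ℤP.+-assoc i (+ N) (ℤ.- + N))
      (≡.trans (≡.cong (λ z → i ℤ.+ z) (ℤP.+-inverseʳ (+ N))) (ℤP.+-identityʳ i)))
    member : ∀ i k → k ℕ.≤ N ℕ.+ N → i ℤ.+ + N ≡ + k → i ∈ interval N
    member i k k≤ e = ≡.subst (_∈ interval N) (eq i k e) (∈P.∈-map⁺ (λ k → + k ℤ.- + N) (∈P.∈-upTo⁺ (ℕ.s≤s k≤)))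
    inside : ∀ i → ℤ.∣ i ∣ ℕ.≤ N → i ∈ interval N
    inside (+ n) n≤ = member (+ n) (n ℕ.+ N) (ℕP.+-monoˡ-≤ N n≤) ≡.refl
    inside -[1+ n ] n< = member -[1+ n ] (N ℕ.∸ suc n) (ℕP.≤-trans (ℕP.m∸n≤m N (suc n)) (ℕP.m≤m+n N N))
      (ℤP.⊖-≥ n<)

  module _ (f : ℤ → Series) (ord : ∀ i → O (ℤ.∣ i ∣ ℕ.∸ 1) (f i)) where
    private
      out : ∀ N x → x ∉ interval N → O N (f x)
      out N x x∉ = O-weaken {f = f x} (ℕP.∸-monoˡ-≤ 1 (∉interval N x x∉)) (ord x)

    -- The order |i| ∸ 1 is what triangular exponents provide, since m (m + 1) / 2 vanishes at both
    -- 0 and -1. Outside the interval of radius n + 1 it exceeds n.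
    sumℤ : Series
    sumℤ n = sumL f (interval (suc n)) n

    HasSum-sumℤ : HasSum f sumℤ
    HasSum-sumℤ N = interval N , interval-! N , out N , λ i i<N →
      sumL-cover ℤ._≟_ (suc i) f (interval-! N) (interval-! (suc i))
        (λ x x∉ → O-weaken {f = f x} i<N (out N x x∉)) (out (suc i)) i (ℕP.n<1+n i)

-- The finite form of Jacobi's triple product.

module Jacobi where
  module ℕSolver = Data.Nat.Solver.+-*-Solver

  tri : ℕ → ℕ
  tri zero = 0
  tri (suc n) = suc n ℕ.+ tri n

  -- τ a b = m (m + 1) / 2 for the integer m = a − b.
  τ : ℕ → ℕ → ℕ
  τ a zero = tri a
  τ zero (suc b) = tri b
  τ (suc a) (suc b) = τ a b

  -- T(m) = m (m + 1) / 2, which takes the same value at -1 - n as at n.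
  triℤ : ℤ → ℕ
  triℤ (+ n) = tri n
  triℤ -[1+ n ] = tri n

  triℤ-⊖ : ∀ a b → triℤ (a ℤ.⊖ b) ≡ τ a b
  triℤ-⊖ a zero = ≡.refl
  triℤ-⊖ zero (suc b) = ≡.refl
  triℤ-⊖ (suc a) (suc b) = ≡.trans (≡.cong triℤ (ℤP.[1+m]⊖[1+n]≡m⊖n a b)) (triℤ-⊖ a b)

  -- This and the next are T(m + 1) = T(m) + m + 1 and T(m - 1) = T(m) - m for m = a - b, freed of
  -- subtraction.
  τ-sucˡ : ∀ a b → τ (suc a) b ℕ.+ b ≡ τ a b ℕ.+ suc a
  τ-sucˡ a zero = ≡.trans (ℕP.+-identityʳ _) (ℕP.+-comm (suc a) (tri a))
  τ-sucˡ zero (suc zero) = ≡.refl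
  τ-sucˡ zero (suc (suc b)) = ≡.trans (ℕP.+-comm (tri b) _) (ℕP.+-comm 1 _)
  τ-sucˡ (suc a) (suc b) = ≡.trans (ℕP.+-suc _ b) (≡.trans (≡.cong suc (τ-sucˡ a b)) (≡.sym (ℕP.+-suc _ (suc a))))

  τ-sucʳ : ∀ a b → τ a (suc b) ℕ.+ a ≡ τ a b ℕ.+ b
  τ-sucʳ zero zero = ≡.refl
  τ-sucʳ zero (suc b) = ≡.trans (ℕP.+-identityʳ _) (ℕP.+-comm (suc b) (tri b))
  τ-sucʳ (suc a) zero = ≡.trans (ℕP.+-comm (tri a) (suc a)) (≡.sym (ℕP.+-identityʳ _))
  τ-sucʳ (suc a) (suc b) = ≡.trans (ℕP.+-suc _ a) (≡.trans (≡.cong suc (τ-sucʳ a b)) (≡.sym (ℕP.+-suc _ b)))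

  module FiniteJacobi (R : CommutativeRing 0ℓ 0ℓ) where
    open CommutativeRing R hiding (zero)
    open RingX R
    open SetoidReasoning setoid

    module Gauss (q : Carrier) where
      -- Gaussian binomials, defined by a Pascal rule because the usual quotient of products would
      -- need division.
      gauss : ℕ → ℕ → Carrier
      gauss _ zero = 1#
      gauss zero (suc k) = 0#
      gauss (suc n) (suc k) = gauss n k + q ^ suc k * gauss n (suc k)

      gauss-above : ∀ n d → gauss n (suc (d ℕ.+ n)) ≈ 0#
      gauss-above zero d = refl
      gauss-above (suc n) d = begin
        gauss n (d ℕ.+ suc n) + q ^ suc (d ℕ.+ suc n) * gauss n (suc (d ℕ.+ suc n))
          ≡⟨ ≡.cong (λ k → gauss n k + q ^ suc (d ℕ.+ suc n) * gauss n (suc k)) (ℕP.+-suc d n) ⟩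
        gauss n (suc (d ℕ.+ n)) + q ^ suc (d ℕ.+ suc n) * gauss n (suc (suc d ℕ.+ n))
          ≈⟨ +-cong (gauss-above n d) (*-congˡ (gauss-above n (suc d))) ⟩
        0# + q ^ suc (d ℕ.+ suc n) * 0#  ≈⟨ trans (+-identityˡ _) (zeroʳ _) ⟩
        0# ∎

      gauss-diag : ∀ n → gauss n n ≈ 1#
      gauss-diag zero = refl
      gauss-diag (suc n) = trans (+-cong (gauss-diag n) (trans (*-congˡ (gauss-above n 0)) (zeroʳ _))) (+-identityʳ _)

      -- The Pascal rule with the power of q on the other summand. The defining rule absorbs a
      -- factor in y into the finite triple product, this one a factor in x. The upper index is k +
      -- d so that the difference is available as d.
      pascal′ : ∀ k d → gauss (suc (k ℕ.+ d)) (suc k) ≈ q ^ d * gauss (k ℕ.+ d) k + gauss (k ℕ.+ d) (suc k)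
      pascal′ k zero = begin
        gauss (suc (k ℕ.+ 0)) (suc k)     ≡⟨ ≡.cong (λ n → gauss (suc n) (suc k)) (ℕP.+-identityʳ k) ⟩
        gauss (suc k) (suc k)             ≈⟨ gauss-diag (suc k) ⟩
        1#                                ≈⟨ sym (trans (+-identityʳ _) (*-identityʳ 1#)) ⟩
        1# * 1# + 0#                      ≈⟨ sym (+-cong (*-congˡ (gauss-diag k)) (gauss-above k 0)) ⟩
        1# * gauss k k + gauss k (suc k)  ≡⟨ ≡.cong (λ n → 1# * gauss n k + gauss n (suc k)) (≡.sym (ℕP.+-identityʳ k)) ⟩
        1# * gauss (k ℕ.+ 0) k + gauss (k ℕ.+ 0) (suc k) ∎
      pascal′ zero (suc d) = begin
        1# + q * 1# * gauss (suc d) 1                       ≈⟨ +-congˡ (*-congˡ (pascal′ zero d)) ⟩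
        1# + q * 1# * (q ^ d * 1# + gauss d 1)              ≈⟨ solve 3 (λ q a b → con (+ 1) :+ q :* con (+ 1) :* (a :* con (+ 1) :+ b)
                                                                := q :* a :* con (+ 1) :+ (con (+ 1) :+ q :* con (+ 1) :* b)) refl q (q ^ d) (gauss d 1) ⟩
        q * q ^ d * 1# + (1# + q * 1# * gauss d 1)          ∎
      pascal′ (suc k) (suc d) = begin
        gauss (suc (k ℕ.+ suc d)) (suc k) + Q * gauss (suc (k ℕ.+ suc d)) (suc (suc k))
          ≈⟨ +-cong (pascal′ k (suc d)) (*-congˡ ih) ⟩
        (q * q ^ d * gauss (k ℕ.+ suc d) k + gauss (k ℕ.+ suc d) (suc k))
          + Q * (q ^ d * gauss (k ℕ.+ suc d) (suc k) + gauss (k ℕ.+ suc d) (suc (suc k)))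
          ≈⟨ solve 6 (λ q a b c e p → (q :* a :* b :+ c) :+ q :* p :* (a :* c :+ e)
               := q :* a :* (b :+ p :* c) :+ (c :+ q :* p :* e)) refl q (q ^ d) _ _ _ (q ^ suc k) ⟩
        q * q ^ d * (gauss (k ℕ.+ suc d) k + q ^ suc k * gauss (k ℕ.+ suc d) (suc k))
          + (gauss (k ℕ.+ suc d) (suc k) + Q * gauss (k ℕ.+ suc d) (suc (suc k))) ∎
        where
        Q = q ^ suc (suc k)
        ih : gauss (suc (k ℕ.+ suc d)) (suc (suc k)) ≈ q ^ d * gauss (k ℕ.+ suc d) (suc k) + gauss (k ℕ.+ suc d) (suc (suc k))
        ih rewrite ℕP.+-suc k d = pascal′ (suc k) d

      -- The two Pascal rules expand the same binomial in the same two neighbours; combining them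
      -- eliminates one neighbour.
      gauss-ratio : ∀ k d → (1# - q ^ suc k) * gauss (suc (k ℕ.+ d)) (suc k) ≈ (1# - q ^ suc (k ℕ.+ d)) * gauss (k ℕ.+ d) k
      gauss-ratio k d = begin
        (1# - Q) * X                 ≈⟨ solve 2 (λ Q X → (con (+ 1) :- Q) :* X := X :- Q :* X) refl Q X ⟩
        X - Q * X                    ≈⟨ +-congˡ (-‿cong (*-congˡ (pascal′ k d))) ⟩
        (Y + Q * Z) - Q * (q ^ d * Y + Z)
          ≈⟨ solve 4 (λ Q D Y Z → (Y :+ Q :* Z) :- Q :* (D :* Y :+ Z) := (con (+ 1) :- Q :* D) :* Y) refl Q (q ^ d) Y Z ⟩
        (1# - Q * q ^ d) * Y         ≈⟨ *-congʳ (+-congˡ (-‿cong (sym (^-homo-* q (suc k) d)))) ⟩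
        (1# - q ^ suc (k ℕ.+ d)) * Y ∎
        where
        Q = q ^ suc k
        X = gauss (suc (k ℕ.+ d)) (suc k)
        Y = gauss (k ℕ.+ d) k
        Z = gauss (k ℕ.+ d) (suc k)

      gauss-product : ∀ k d → gauss (k ℕ.+ d) k * Π< k (λ i → 1# - q ^ suc i) ≈ Π< k (λ i → 1# - q ^ suc (i ℕ.+ d))
      gauss-product zero d = *-identityʳ 1#
      gauss-product (suc k) d = begin
        X * (P * (1# - q ^ suc k))                       ≈⟨ solve 3 (λ X P Q → X :* (P :* Q) := Q :* X :* P) refl X P (1# - q ^ suc k) ⟩
        (1# - q ^ suc k) * X * P                         ≈⟨ *-congʳ (gauss-ratio k d) ⟩
        (1# - q ^ suc (k ℕ.+ d)) * gauss (k ℕ.+ d) k * P ≈⟨ solve 3 (λ X P Q → Q :* X :* P := X :* P :* Q) refl _ P _ ⟩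
        gauss (k ℕ.+ d) k * P * (1# - q ^ suc (k ℕ.+ d)) ≈⟨ *-congʳ (gauss-product k d) ⟩
        Π< k (λ i → 1# - q ^ suc (i ℕ.+ d)) * (1# - q ^ suc (k ℕ.+ d)) ∎
        where
        X = gauss (suc (k ℕ.+ d)) (suc k)
        P = Π< k (λ i → 1# - q ^ suc i)

    module _ (x y : Carrier) where
      private
        q = x * y
        open Gauss q

        -- x^T(m) y^T(-m) for m = k - N.
        term : ℕ → ℕ → Carrier
        term k N = x ^ τ k N * y ^ τ N k

        mono-step : ∀ {a b c d a′ b′} k → a ℕ.+ c ≡ k ℕ.+ a′ → b ℕ.+ d ≡ k ℕ.+ b′ →
          (x ^ a * y ^ b) * (x ^ c * y ^ d) ≈ q ^ k * (x ^ a′ * y ^ b′)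
        mono-step {a} {b} {c} {d} {a′} {b′} k p p′ = begin
          (x ^ a * y ^ b) * (x ^ c * y ^ d)     ≈⟨ swap _ _ _ _ ⟩
          (x ^ a * x ^ c) * (y ^ b * y ^ d)     ≈⟨ sym (*-cong (^-homo-* x a c) (^-homo-* y b d)) ⟩
          x ^ (a ℕ.+ c) * y ^ (b ℕ.+ d)         ≡⟨ ≡.cong₂ (λ m n → x ^ m * y ^ n) p p′ ⟩
          x ^ (k ℕ.+ a′) * y ^ (k ℕ.+ b′)       ≈⟨ *-cong (^-homo-* x k a′) (^-homo-* y k b′) ⟩
          (x ^ k * x ^ a′) * (y ^ k * y ^ b′)   ≈⟨ swap _ _ _ _ ⟩
          (x ^ k * y ^ k) * (x ^ a′ * y ^ b′)   ≈⟨ *-congʳ (sym (^-distrib-* x y k)) ⟩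
          q ^ k * (x ^ a′ * y ^ b′) ∎
          where
          swap : ∀ a b c d → (a * b) * (c * d) ≈ (a * c) * (b * d)
          swap = solve 4 (λ a b c d → (a :* b) :* (c :* d) := (a :* c) :* (b :* d)) refl

        term-x : ∀ k d → term k 0 * (x ^ suc (k ℕ.+ d) * y ^ (k ℕ.+ d)) ≈ q ^ d * term (suc k) 0
        term-x k d = mono-step {tri k} {τ 0 k} {suc (k ℕ.+ d)} {k ℕ.+ d} d
          (ℕSolver.solve 3 (λ t k d → t ℕSolver.:+ (ℕSolver.con 1 ℕSolver.:+ (k ℕSolver.:+ d)) ℕSolver.:= d ℕSolver.:+ (ℕSolver.con 1 ℕSolver.:+ k ℕSolver.:+ t)) ≡.refl (tri k) k d)
          (≡.trans (≡.cong (ℕ._+ (k ℕ.+ d)) (τ-0 k)) (≡.trans (≡.sym (ℕP.+-assoc _ k d)) (≡.trans (ℕP.+-comm _ d) (≡.cong (d ℕ.+_) (≡.trans (ℕP.+-comm _ k) (tri-pred k))))))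
          where
          τ-0 : ∀ k → τ 0 k ≡ tri (ℕ.pred k)
          τ-0 zero = ≡.refl
          τ-0 (suc k) = ≡.refl
          tri-pred : ∀ k → k ℕ.+ tri (ℕ.pred k) ≡ tri k
          tri-pred zero = ≡.refl
          tri-pred (suc k) = ≡.refl

        term-y : ∀ k N → term k N * (x ^ N * y ^ suc N) ≈ q ^ k * term k (suc N)
        term-y k N = mono-step {τ k N} {τ N k} {N} {suc N} k
          (≡.trans (≡.sym (τ-sucʳ k N)) (ℕP.+-comm _ k))
          (≡.trans (≡.sym (τ-sucˡ N k)) (ℕP.+-comm _ k))

        shift : ∀ n (d : ℕ → Carrier) → d (suc n) ≈ 0# → Σ< (suc n) d ≈ d 0 + Σ< (suc n) (d ∘ suc)
        shift n d z = begin
          Σ< (suc n) d              ≈⟨ sym (trans (+-congˡ z) (+-identityʳ _)) ⟩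
          Σ< (suc (suc n)) d        ≈⟨ Σ<-front (suc n) d ⟩
          d 0 + Σ< (suc n) (d ∘ suc) ∎

        xFactor yFactor : ℕ → Carrier
        xFactor j = 1# + x ^ suc j * y ^ j
        yFactor j = 1# + x ^ j * y ^ suc j

        -- The q-binomial theorem, the case without factors in y.
        jacobi₀ : ∀ M → Π< M xFactor ≈ Σ< (suc M) (λ k → gauss M k * term k 0)
        jacobi₀ zero = sym (trans (+-identityˡ _) (trans (*-identityˡ _) (*-identityˡ _)))
        jacobi₀ (suc M) = begin
          Π< M xFactor * (1# + w)   ≈⟨ *-congʳ (jacobi₀ M) ⟩
          S * (1# + w)              ≈⟨ solve 2 (λ S w → S :* (con (+ 1) :+ w) := S :+ w :* S) refl S w ⟩
          S + w * S                 ≈⟨ +-cong (shift M _ (trans (*-congʳ (gauss-above M 0)) (zeroˡ _)))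
                                         (trans (sym (Σ<-*ˡ (suc M) w _)) (Σ<-cong (suc M) λ { k (ℕ.s≤s k≤M) → lead k k≤M })) ⟩
          (c 0 + Σ< (suc M) (c ∘ suc)) + Σ< (suc M) e   ≈⟨ trans (+-assoc _ _ _) (+-congˡ (sym (Σ<-+ (suc M) _ _))) ⟩
          c 0 + Σ< (suc M) (λ k → c (suc k) + e k)      ≈⟨ +-congˡ (Σ<-cong (suc M) λ { k (ℕ.s≤s k≤M) → combine k k≤M }) ⟩
          c 0 + Σ< (suc M) (λ k → gauss (suc M) (suc k) * term (suc k) 0) ≈⟨ sym (Σ<-front (suc M) _) ⟩
          Σ< (suc (suc M)) (λ k → gauss (suc M) k * term k 0) ∎
          where
          w = x ^ suc M * y ^ M
          S = Σ< (suc M) (λ k → gauss M k * term k 0)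
          c e : ℕ → Carrier
          c k = gauss M k * term k 0
          e k = q ^ (M ℕ.∸ k) * gauss M k * term (suc k) 0
          lead : ∀ k → k ℕ.≤ M → w * (gauss M k * term k 0) ≈ e k
          lead k k≤M = begin
            w * (gauss M k * term k 0)     ≈⟨ solve 3 (λ w g t → w :* (g :* t) := g :* (t :* w)) refl w _ _ ⟩
            gauss M k * (term k 0 * w)     ≈⟨ *-congˡ w-step ⟩
            gauss M k * (q ^ (M ℕ.∸ k) * term (suc k) 0) ≈⟨ solve 3 (λ g p t → g :* (p :* t) := p :* g :* t) refl _ _ _ ⟩
            e k ∎
            where
            w-step : term k 0 * w ≈ q ^ (M ℕ.∸ k) * term (suc k) 0
            w-step = trans (reflexive (≡.cong (λ m → term k 0 * (x ^ suc m * y ^ m)) (≡.sym (ℕP.m+[n∸m]≡n k≤M)))) (term-x k (M ℕ.∸ k))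
          combine : ∀ k → k ℕ.≤ M → c (suc k) + e k ≈ gauss (suc M) (suc k) * term (suc k) 0
          combine k k≤M = trans (+-comm _ _) (trans (sym (distribʳ _ _ _)) (*-congʳ (sym pascal-M)))
            where
            pascal-M : gauss (suc M) (suc k) ≈ q ^ (M ℕ.∸ k) * gauss M k + gauss M (suc k)
            pascal-M = ≡.subst (λ m → gauss (suc m) (suc k) ≈ q ^ (M ℕ.∸ k) * gauss m k + gauss m (suc k)) (ℕP.m+[n∸m]≡n k≤M) (pascal′ k (M ℕ.∸ k))

      -- Induction on N. Raising N recentres the sum: the old term at k is the new one at k + 1, and
      -- the factor x^N y^(N + 1) turns it into q^k times the new one at k. The contributions to one
      -- new term add up by the defining rule of `gauss`. As `gauss` depends on xy only, x and y
      -- stay independent.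
      jacobi-finite : ∀ M N → Π< M (λ j → 1# + x ^ suc j * y ^ j) * Π< N (λ j → 1# + x ^ j * y ^ suc j)
        ≈ Σ< (suc (N ℕ.+ M)) (λ k → Gauss.gauss (x * y) (N ℕ.+ M) k * (x ^ τ k N * y ^ τ N k))
      jacobi-finite M zero = trans (*-identityʳ _) (jacobi₀ M)
      jacobi-finite M (suc N) = begin
        Π< M xFactor * (Π< N yFactor * (1# + w))   ≈⟨ sym (*-assoc _ _ _) ⟩
        Π< M xFactor * Π< N yFactor * (1# + w)     ≈⟨ *-congʳ (jacobi-finite M N) ⟩
        S * (1# + w)                               ≈⟨ solve 2 (λ S w → S :* (con (+ 1) :+ w) := S :+ w :* S) refl S w ⟩
        S + w * S                                  ≈⟨ +-congˡ (trans (sym (Σ<-*ˡ (suc n) w _)) (Σ<-cong (suc n) λ k _ → lead k)) ⟩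
        S + Σ< (suc n) e                           ≈⟨ +-congˡ (shift n e (trans (*-congʳ (trans (*-congˡ (gauss-above n 0)) (zeroʳ _))) (zeroˡ _))) ⟩
        S + (e 0 + Σ< (suc n) (e ∘ suc))           ≈⟨ solve 3 (λ a b c → a :+ (b :+ c) := b :+ (a :+ c)) refl _ _ _ ⟩
        e 0 + (S + Σ< (suc n) (e ∘ suc))           ≈⟨ +-cong (*-congʳ (*-identityˡ 1#)) (sym (Σ<-+ (suc n) _ _)) ⟩
        1# * term 0 (suc N) + Σ< (suc n) (λ k → gauss n k * term (suc k) (suc N) + e (suc k))
          ≈⟨ +-congˡ (Σ<-cong (suc n) λ k _ → sym (distribʳ _ _ _)) ⟩
        1# * term 0 (suc N) + Σ< (suc n) (λ k → gauss (suc n) (suc k) * term (suc k) (suc N)) ≈⟨ sym (Σ<-front (suc n) _) ⟩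
        Σ< (suc (suc n)) (λ k → gauss (suc n) k * term k (suc N)) ∎
        where
        n = N ℕ.+ M
        w = x ^ N * y ^ suc N
        S = Σ< (suc n) (λ k → gauss n k * term k N)
        e : ℕ → Carrier
        e k = q ^ k * gauss n k * term k (suc N)
        lead : ∀ k → w * (gauss n k * term k N) ≈ e k
        lead k = begin
          w * (gauss n k * term k N)         ≈⟨ solve 3 (λ w g t → w :* (g :* t) := g :* (t :* w)) refl w _ _ ⟩
          gauss n k * (term k N * w)         ≈⟨ *-congˡ (term-y k N) ⟩
          gauss n k * (q ^ k * term k (suc N)) ≈⟨ solve 3 (λ g p t → g :* (p :* t) := p :* g :* t) refl _ _ _ ⟩
          e k ∎

-- Jacobi's triple product as a sum over ℤ.

module JTP (K : CommutativeRing 0ℓ 0ℓ) where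
  open Jacobi

  open PS K
  open Sum K
  private
    module PX = RingX psRing
    module FJ = FiniteJacobi psRing
  open CommutativeRing psRing hiding (zero)
  open PX using (solve; _:=_; _:*_; :-_; _:-_; con; Π<; _^_)

  Π<-stable : ∀ {t : ℕ → Series} {k N} → (∀ j → k ℕ.≤ j → O N (t j)) → ∀ d →
    Π< (d ℕ.+ k) (λ j → 1# + t j) ≈[ N ] Π< k (λ j → 1# + t j)
  Π<-stable h zero = ≈⇒ refl
  Π<-stable {t} {k} h (suc d) = tr
    (*-≈⟨⟩ (Π<-stable h d) (+-≈⟨⟩ {f = 1#} (≈⇒ refl) (h (d ℕ.+ k) (ℕP.m≤n+m k d))))
    (≈⇒ (trans (*-congˡ (+-identityʳ 1#)) (*-identityʳ _)))

  tri-≥ : ∀ n → n ℕ.≤ tri n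
  tri-≥ zero = ℕ.z≤n
  tri-≥ (suc n) = ℕP.m≤m+n (suc n) (tri n)

  triℤ-≥ : ∀ m → ℤ.∣ m ∣ ℕ.∸ 1 ℕ.≤ triℤ m
  triℤ-≥ (+ n) = ℕP.≤-trans (ℕP.m∸n≤m n 1) (tri-≥ n)
  triℤ-≥ -[1+ n ] = tri-≥ n

  triℤ-neg-≥ : ∀ m → ℤ.∣ m ∣ ℕ.∸ 1 ℕ.≤ triℤ (ℤ.- m)
  triℤ-neg-≥ m = ≡.subst (λ k → k ℕ.∸ 1 ℕ.≤ triℤ (ℤ.- m)) (ℤP.∣-i∣≡∣i∣ m) (triℤ-≥ (ℤ.- m))

  weighted-≥ : ∀ a b k {s t} → 1 ℕ.≤ a ℕ.+ b → k ℕ.≤ s → k ℕ.≤ t → k ℕ.≤ s ℕ.* a ℕ.+ t ℕ.* b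
  weighted-≥ (suc a) b k {s} {t} _ k≤s _ = ℕP.≤-trans k≤s (ℕP.≤-trans (ℕP.m≤m*n s (suc a)) (ℕP.m≤m+n _ _))
  weighted-≥ zero (suc b) k {s} {t} _ _ k≤t = ℕP.≤-trans k≤t (ℕP.≤-trans (ℕP.m≤m*n t (suc b)) (ℕP.m≤n+m _ _))

  private
    other-≥ : ∀ {k d N} → k ℕ.+ d ≡ N ℕ.+ N → k ℕ.≤ N → N ℕ.≤ d
    other-≥ {k} {d} {N} e k≤N = ℕP.+-cancelˡ-≤ k N d (ℕP.≤-trans (ℕP.+-monoˡ-≤ N k≤N) (ℕP.≤-reflexive (≡.sym e)))

    other-≤ : ∀ {k d N} → k ℕ.+ d ≡ N ℕ.+ N → N ℕ.≤ k → d ℕ.≤ N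
    other-≤ {k} {d} {N} e N≤k = ℕP.+-cancelˡ-≤ N d N (ℕP.≤-trans (ℕP.+-monoˡ-≤ d N≤k) (ℕP.≤-reflexive e))

  -- Here the minimum of k and d is N - |k - N|. The order of a theta term and the accuracy of its
  -- Gaussian binomial thus add up to at least N: far from the centre the term is small, near the
  -- centre the binomial is close to its limit.
  gap : ∀ k d N → k ℕ.+ d ≡ N ℕ.+ N → N ℕ.≤ (ℤ.∣ k ℤ.⊖ N ∣ ℕ.∸ 1) ℕ.+ suc (k ℕ.⊓ d)
  gap k d N e with ℕP.≤-total k N
  ... | inj₁ k≤N rewrite ℤP.∣⊖∣-≤ k≤N | ℕP.m≤n⇒m⊓n≡m (ℕP.≤-trans k≤N (other-≥ e k≤N)) = bound (N ℕ.∸ k) (ℕP.m∸n+n≡m k≤N)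
    where
    bound : ∀ r → r ℕ.+ k ≡ N → N ℕ.≤ (r ℕ.∸ 1) ℕ.+ suc k
    bound zero ≡.refl = ℕP.n≤1+n k
    bound (suc r) ≡.refl = ℕP.≤-reflexive (≡.sym (ℕP.+-suc r k))
  ... | inj₂ N≤k rewrite ℤP.⊖-≥ N≤k | ℕP.m≥n⇒m⊓n≡n (ℕP.≤-trans (other-≤ e N≤k) N≤k) = bound (k ℕ.∸ N) (ℕP.m∸n+n≡m N≤k)
    where
    bound : ∀ r → r ℕ.+ N ≡ k → N ℕ.≤ (r ℕ.∸ 1) ℕ.+ suc d
    bound r ≡.refl = ℕP.≤-trans (ℕP.≤-reflexive (ℕP.+-cancelˡ-≡ N N (r ℕ.+ d)
        (≡.trans (≡.sym e) (≡.trans (≡.cong (ℕ._+ d) (ℕP.+-comm r N)) (ℕP.+-assoc N r d))))) (go r)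
      where
      go : ∀ r → r ℕ.+ d ℕ.≤ (r ℕ.∸ 1) ℕ.+ suc d
      go zero = ℕP.n≤1+n d
      go (suc r) = ℕP.≤-reflexive (≡.sym (ℕP.+-suc r d))

  -- The condition concerns the sum of the two orders, because later one of x and y often has order
  -- zero: in series in x with coefficients in y, the variable y is a constant.
  module _ {x y : Series} {a b : ℕ} (ox : O a x) (oy : O b y) (pos : 1 ℕ.≤ a ℕ.+ b) where
    private q = x * y

    O-pow : ∀ m n k → k ℕ.≤ m → k ℕ.≤ n → O k (x ^ m * y ^ n)
    O-pow m n k k≤m k≤n = O-weaken {f = x ^ m * y ^ n} (weighted-≥ a b k pos k≤m k≤n)
      (O-* {f = x ^ m} {y ^ n} (O-^ m ox) (O-^ n oy))

    O-q^ : ∀ n → O n (q ^ n)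
    O-q^ n = O-≈ (sym (PX.^-distrib-* x y n)) (O-pow n n n ℕP.≤-refl ℕP.≤-refl)

    O-neg : ∀ {N f} → O N f → O N (- f)
    O-neg {N} {f} p i i<N = CommutativeRing.trans K (CommutativeRing.-‿cong K (p i i<N)) (-0#≈0#)
      where
      open RingProps (CommutativeRing.ring K) using (-0#≈0#)

    Jterm : ℤ → Series
    Jterm m = x ^ triℤ m * y ^ triℤ (ℤ.- m)

    O-Jterm : ∀ m → O (ℤ.∣ m ∣ ℕ.∸ 1) (Jterm m)
    O-Jterm m = O-pow (triℤ m) (triℤ (ℤ.- m)) _ (triℤ-≥ m) (triℤ-neg-≥ m)

    xProduct yProduct qProduct : ℕ → Series
    xProduct M = Π< M (λ j → 1# + x ^ suc j * y ^ j)
    yProduct M = Π< M (λ j → 1# + x ^ j * y ^ suc j)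
    qProduct M = Π< M (λ j → 1# - q ^ suc j)

    Lim-xProduct : Lim xProduct (limit xProduct)
    Lim-xProduct = Lim-Π (λ M → O-pow (suc M) M M (ℕP.n≤1+n M) ℕP.≤-refl)

    Lim-yProduct : Lim yProduct (limit yProduct)
    Lim-yProduct = Lim-Π (λ M → O-pow M (suc M) M ℕP.≤-refl (ℕP.n≤1+n M))

    module _ {q∞ : Series} (lim-q : Lim qProduct q∞) where
      private
        open FJ.Gauss q

        q∞-approx : ∀ k → q∞ ≈[ suc k ] qProduct k
        q∞-approx k = let (M₀ , h) = lim-q (suc k) in
          tr (sy (h (M₀ ℕ.+ k) (ℕP.m≤m+n M₀ k)))
            (Π<-stable {λ j → - (q ^ suc j)} {k} (λ j k≤j → O-neg {f = q ^ suc j} (O-weaken {f = q ^ suc j} (ℕ.s≤s k≤j) (O-q^ (suc j)))) M₀)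

        -- `gauss-product` relates the binomial to two products. The one on the left agrees with
        -- `q∞` modulo X^(k + 1), the one on the right with 1 modulo X^(d + 1).
        gauss-approx : ∀ k d → q∞ * gauss (k ℕ.+ d) k ≈[ suc (k ℕ.⊓ d) ] 1#
        gauss-approx k d =
          tr (*-≈⟨⟩ {g = gauss (k ℕ.+ d) k} (weaken (ℕ.s≤s (ℕP.m⊓n≤m k d)) (q∞-approx k)) (≈⇒ refl))
            (tr (≈⇒ (trans (*-comm _ _) (FJ.Gauss.gauss-product q k d)))
              (weaken (ℕ.s≤s (ℕP.m⊓n≤n k d)) (near-one k)))
          where
          near-one : ∀ k → Π< k (λ i → 1# - q ^ suc (i ℕ.+ d)) ≈[ suc d ] 1#
          near-one k = ≡.subst (λ m → Π< m (λ i → 1# - q ^ suc (i ℕ.+ d)) ≈[ suc d ] 1#) (ℕP.+-identityʳ k)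
            (Π<-stable {λ i → - (q ^ suc (i ℕ.+ d))} {0}
              (λ j _ → O-neg {f = q ^ suc (j ℕ.+ d)} (O-weaken {f = q ^ suc (j ℕ.+ d)} (ℕ.s≤s (ℕP.m≤n+m d j)) (O-q^ (suc (j ℕ.+ d))))) k)

        Jterm-⊖ : ∀ k N → Jterm (+ k ℤ.- + N) ≈ x ^ τ k N * y ^ τ N k
        Jterm-⊖ k N = reflexive (≡.cong₂ (λ m n → x ^ m * y ^ n)
          (≡.trans (≡.cong triℤ (ℤP.m-n≡m⊖n k N)) (triℤ-⊖ k N))
          (≡.trans (≡.cong triℤ (≡.trans (≡.cong ℤ.-_ (ℤP.m-n≡m⊖n k N)) (≡.sym (ℤP.⊖-swap N k)))) (triℤ-⊖ N k)))

        term-approx : ∀ N k → k ℕ.≤ N ℕ.+ N → Jterm (+ k ℤ.- + N) ≈[ N ] q∞ * (gauss (N ℕ.+ N) k * (x ^ τ k N * y ^ τ N k))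
        term-approx N k k≤ = sy (O⇒≈⟨⟩ {g = t} (O-≈ split (O-weaken {f = t * (q∞ * g - 1#)}
            (≡.subst (λ i → N ℕ.≤ (ℤ.∣ i ∣ ℕ.∸ 1) ℕ.+ suc (k ℕ.⊓ d)) (≡.sym (ℤP.m-n≡m⊖n k N)) (gap k d N e))
            (O-* {f = t} {q∞ * g - 1#} (O-Jterm (+ k ℤ.- + N)) (≈⟨⟩⇒O (≡.subst (λ n → q∞ * gauss n k ≈[ suc (k ℕ.⊓ d) ] 1#) e (gauss-approx k d)))))))
          where
          d = (N ℕ.+ N) ℕ.∸ k
          e = ℕP.m+[n∸m]≡n k≤
          g = gauss (N ℕ.+ N) k
          t = Jterm (+ k ℤ.- + N)
          split : t * (q∞ * g - 1#) ≈ q∞ * (g * (x ^ τ k N * y ^ τ N k)) - t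
          split = trans (solve 3 (λ t q g → t :* (q :* g :- con (+ 1)) := q :* (g :* t) :- t) refl t q∞ g)
            (+-congʳ (*-congˡ (*-congˡ (Jterm-⊖ k N))))

      -- With equally many factors in x and in y, the index k - N of the finite identity runs over a
      -- symmetric interval. Multiplication by `q∞` replaces every Gaussian binomial by 1, up to the
      -- error bounded in `term-approx`.
      jacobi : HasSum Jterm (q∞ * (limit xProduct * limit yProduct))
      jacobi N₀ = let (M₁ , h₁) = Lim-xProduct N₀ ; (M₂ , h₂) = Lim-yProduct N₀
                      N = N₀ ℕ.⊔ (M₁ ℕ.⊔ M₂)
                      N₀≤N = ℕP.m≤m⊔n N₀ (M₁ ℕ.⊔ M₂)
                      M≤N = ℕP.m≤n⊔m N₀ (M₁ ℕ.⊔ M₂) in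
        interval N , interval-! N ,
        (λ m m∉ → O-weaken {f = Jterm m} (ℕP.≤-trans N₀≤N (ℕP.∸-monoˡ-≤ 1 (∉interval N m m∉))) (O-Jterm m)) ,
        tr (≈⇒ (trans (PX.sumL-map Jterm (λ k → + k ℤ.- + N) (upTo (suc (N ℕ.+ N)))) (PX.sumL-upTo _ (suc (N ℕ.+ N)))))
        (tr (weaken N₀≤N (Σ<-≈⟨⟩ (suc (N ℕ.+ N)) (λ { k (ℕ.s≤s k≤) → term-approx N k k≤ })))
        (tr (≈⇒ (trans (PX.Σ<-*ˡ (suc (N ℕ.+ N)) q∞ _) (*-congˡ (sym (FJ.jacobi-finite x y N N)))))
          (*-≈⟨⟩ {f = q∞} (≈⇒ refl) (*-≈⟨⟩ (h₁ N (ℕP.≤-trans (ℕP.m≤m⊔n M₁ M₂) M≤N)) (h₂ N (ℕP.≤-trans (ℕP.m≤n⊔m M₁ M₂) M≤N))))))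

-- Ring homomorphisms, coefficientwise maps and substitution.

module Ev where
  record RingHom (K L : CommutativeRing 0ℓ 0ℓ) : Set where
    private
      module K = CommutativeRing K
      module L = CommutativeRing L
    field
      ⟦_⟧ : K.Carrier → L.Carrier
      cong : ∀ {a b} → a K.≈ b → ⟦ a ⟧ L.≈ ⟦ b ⟧
      hom-0 : ⟦ K.0# ⟧ L.≈ L.0#
      hom-1 : ⟦ K.1# ⟧ L.≈ L.1#
      hom-+ : ∀ a b → ⟦ a K.+ b ⟧ L.≈ ⟦ a ⟧ L.+ ⟦ b ⟧
      hom-* : ∀ a b → ⟦ a K.* b ⟧ L.≈ ⟦ a ⟧ L.* ⟦ b ⟧

  module HomX {K L : CommutativeRing 0ℓ 0ℓ} (h : RingHom K L) where
    open RingHom h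
    private
      module K = CommutativeRing K
      module KX = RingX K
      module LX = RingX L
    open CommutativeRing L hiding (zero)

    hom-neg : ∀ a → ⟦ K.- a ⟧ ≈ - ⟦ a ⟧
    hom-neg a = +-cancelˡ ⟦ a ⟧ _ _ (trans (sym (hom-+ a (K.- a)))
      (trans (cong (K.-‿inverseʳ a)) (trans hom-0 (sym (-‿inverseʳ ⟦ a ⟧)))))
      where
      open RingProps ring using (+-cancelˡ)

    hom-sub : ∀ a b → ⟦ a K.- b ⟧ ≈ ⟦ a ⟧ - ⟦ b ⟧
    hom-sub a b = trans (hom-+ a (K.- b)) (+-congˡ (hom-neg b))

    hom-^ : ∀ a n → ⟦ a KX.^ n ⟧ ≈ ⟦ a ⟧ LX.^ n
    hom-^ a zero = hom-1
    hom-^ a (suc n) = trans (hom-* a (a KX.^ n)) (*-congˡ (hom-^ a n))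

    hom-Π : ∀ n (f : ℕ → K.Carrier) → ⟦ KX.Π< n f ⟧ ≈ LX.Π< n (⟦_⟧ ∘ f)
    hom-Π zero f = hom-1
    hom-Π (suc n) f = trans (hom-* _ _) (*-congʳ (hom-Π n f))

    hom-Σ : ∀ n (f : ℕ → K.Carrier) → ⟦ KX.Σ< n f ⟧ ≈ LX.Σ< n (⟦_⟧ ∘ f)
    hom-Σ zero f = hom-0
    hom-Σ (suc n) f = trans (hom-+ _ _) (+-congʳ (hom-Σ n f))

    hom-intR : ∀ i → ⟦ KX.intR i ⟧ ≈ LX.intR i
    hom-intR (+ n) = nat n
      where
      nat : ∀ n → ⟦ KX.intR (+ n) ⟧ ≈ LX.intR (+ n)
      nat zero = hom-0
      nat (suc n) = trans (cong (KX.intR-+ (+ 1) (+ n))) (trans (hom-+ _ _) (trans (+-cong hom-1 (nat n)) (sym (LX.intR-+ (+ 1) (+ n)))))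
    hom-intR -[1+ n ] = trans (cong (KX.intR-neg (+ suc n))) (trans (hom-neg _) (trans (-‿cong (hom-intR (+ suc n))) (sym (LX.intR-neg (+ suc n)))))

  intHom : (R : CommutativeRing 0ℓ 0ℓ) → RingHom ℤP.+-*-commutativeRing R
  intHom R = record { ⟦_⟧ = intR ; cong = λ e → reflexive (≡.cong intR e) ; hom-0 = refl ; hom-1 = refl ; hom-+ = intR-+ ; hom-* = intR-* }
    where
    open RingX R
    open CommutativeRing R

  module Coefficientwise {K L : CommutativeRing 0ℓ 0ℓ} (h : RingHom K L) where
    open RingHom h
    private
      module PK = PS K
      module PL = PS L
      module CL = CommutativeRing PL.psRing
    open CommutativeRing L hiding (zero)

    mapPS : PK.Series → PL.Series
    mapPS f n = ⟦ f n ⟧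

    mapPS-mon : ∀ c k → mapPS (PK.mon c k) PL.≋ PL.mon ⟦ c ⟧ k
    mapPS-mon c zero zero = refl
    mapPS-mon c zero (suc n) = hom-0
    mapPS-mon c (suc k) zero = hom-0
    mapPS-mon c (suc k) (suc n) = mapPS-mon c k n

    mapPS-conv : ∀ f g → mapPS (PK.conv f g) PL.≋ PL.conv (mapPS f) (mapPS g)
    mapPS-conv f g zero = hom-* _ _
    mapPS-conv f g (suc n) = trans (hom-+ _ _) (+-cong (hom-* _ _) (mapPS-conv (PK.tail f) g n))

    mapHom : RingHom PK.psRing PL.psRing
    mapHom = record
      { ⟦_⟧ = mapPS
      ; cong = λ e n → cong (e n)
      ; hom-0 = λ _ → hom-0
      ; hom-1 = CL.trans (mapPS-mon _ 0) (PL.C-cong hom-1)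
      ; hom-+ = λ f g n → hom-+ (f n) (g n)
      ; hom-* = mapPS-conv }

    mapPS-Lim : ∀ {s l} → PK.Lim s l → PL.Lim (mapPS ∘ s) (mapPS l)
    mapPS-Lim p N = let (M₀ , q) = p N in M₀ , λ M le i i<N → cong (q M le i i<N)

  -- Substitution of a series t without constant term for the variable.
  module Substitution (K L : CommutativeRing 0ℓ 0ℓ) (h : RingHom K (PS.psRing L))
                      (t : PS.Series L) (Ot : PS.O L 1 t) where
    private
      module K = CommutativeRing K
      module PK = PS K
      module PKR = CommutativeRing PK.psRing
    open RingHom h
    open PS L
    open CommutativeRing psRing hiding (zero)
    open RingX psRing using (solve; _:=_; _:+_; _:*_; _:-_; _^_)
    open SetoidReasoning setoid

    -- Horner's scheme for the first N coefficients.
    evₙ : ℕ → PK.Series → Series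
    evₙ zero g = 0#
    evₙ (suc N) g = ⟦ g 0 ⟧ + t * evₙ N (PK.tail g)

    t*-≈⟨⟩ : ∀ {N f g} → f ≈[ N ] g → t * f ≈[ suc N ] t * g
    t*-≈⟨⟩ {N} {f} {g} p = O⇒≈⟨⟩ {f = t * f} {t * g} (O-≈ (solve 3 (λ t f g → t :* (f :- g) := t :* f :- t :* g) refl t f g)
      (O-* {f = t} {f - g} Ot (≈⟨⟩⇒O p)))

    evₙ-stable : ∀ N g → evₙ (suc N) g ≈[ N ] evₙ N g
    evₙ-stable zero g i ()
    evₙ-stable (suc N) g = +-≈⟨⟩ {f = ⟦ g 0 ⟧} (≈⇒ refl) (t*-≈⟨⟩ (evₙ-stable N (PK.tail g)))

    ev : PK.Series → Series
    ev g = limit (λ N → evₙ N g)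

    ev-evₙ : ∀ N g → ev g ≈[ N ] evₙ N g
    ev-evₙ N g i i<N = CommutativeRing.sym L (let (M₀ , h′) = Lim-limit (λ M → evₙ-stable M g) N in
      CommutativeRing.trans L (CommutativeRing.sym L
        (lim-stable (λ M → evₙ-stable M g) {N} M₀ i i<N)) (h′ (M₀ ℕ.+ N) (ℕP.m≤m+n M₀ N) i i<N))

    ev-unfold : ∀ g → ev g ≈ ⟦ g 0 ⟧ + t * ev (PK.tail g)
    ev-unfold g = ⇒≈ λ N → tr (weaken (ℕP.n≤1+n N) (ev-evₙ (suc N) g))
      (+-≈⟨⟩ {f = ⟦ g 0 ⟧} (≈⇒ refl) (*-≈⟨⟩ {f = t} (≈⇒ refl) (sy (ev-evₙ N (PK.tail g)))))

    evₙ-cong : ∀ N {f g} → f PK.≈[ N ] g → evₙ N f ≈ evₙ N g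
    evₙ-cong zero p = refl
    evₙ-cong (suc N) p = +-cong (cong (p 0 (ℕ.s≤s ℕ.z≤n))) (*-congˡ (evₙ-cong N (λ i i<N → p (suc i) (ℕ.s≤s i<N))))

    ev-≈⟨⟩ : ∀ {N f g} → f PK.≈[ N ] g → ev f ≈[ N ] ev g
    ev-≈⟨⟩ {N} {f} {g} p = tr (ev-evₙ N f) (tr (≈⇒ (evₙ-cong N p)) (sy (ev-evₙ N g)))

    ev-cong : ∀ {f g} → f PK.≋ g → ev f ≈ ev g
    ev-cong p = ⇒≈ λ N → ev-≈⟨⟩ (λ i _ → p i)

    evₙ-0 : ∀ N {g} → g PK.≋ PKR.0# → evₙ N g ≈ 0#
    evₙ-0 zero p = refl
    evₙ-0 (suc N) p = trans (+-cong (trans (cong (p 0)) hom-0) (trans (*-congˡ (evₙ-0 N (p ∘ suc))) (zeroʳ t))) (+-identityˡ 0#)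

    ev-0 : ev PKR.0# ≈ 0#
    ev-0 = ⇒≈ λ N → tr (ev-evₙ N PKR.0#) (≈⇒ (evₙ-0 N PKR.refl))

    ev-C : ∀ c → ev (PK.C c) ≈ ⟦ c ⟧
    ev-C c = trans (ev-unfold (PK.C c)) (trans (+-congˡ (trans (*-congˡ ev-0) (zeroʳ t))) (+-identityʳ _))

    evₙ-+ : ∀ N f g → evₙ N (f PKR.+ g) ≈ evₙ N f + evₙ N g
    evₙ-+ zero f g = sym (+-identityˡ 0#)
    evₙ-+ (suc N) f g = trans (+-cong (hom-+ _ _) (*-congˡ (evₙ-+ N (PK.tail f) (PK.tail g))))
      (solve 5 (λ a b t c d → (a :+ b) :+ t :* (c :+ d) := (a :+ t :* c) :+ (b :+ t :* d)) refl _ _ t _ _)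

    ev-+ : ∀ f g → ev (f PKR.+ g) ≈ ev f + ev g
    ev-+ f g = ⇒≈ λ N → tr (ev-evₙ N _) (tr (≈⇒ (evₙ-+ N f g)) (+-≈⟨⟩ (sy (ev-evₙ N f)) (sy (ev-evₙ N g))))

    evₙ-scale : ∀ N c f → evₙ N (λ n → c K.* f n) ≈ ⟦ c ⟧ * evₙ N f
    evₙ-scale zero c f = sym (zeroʳ _)
    evₙ-scale (suc N) c f = trans (+-cong (hom-* _ _) (*-congˡ (evₙ-scale N c (PK.tail f))))
      (solve 4 (λ c a t b → c :* a :+ t :* (c :* b) := c :* (a :+ t :* b)) refl _ _ t _)

    ev-scale : ∀ c f → ev (λ n → c K.* f n) ≈ ⟦ c ⟧ * ev f
    ev-scale c f = ⇒≈ λ N → tr (ev-evₙ N _) (tr (≈⇒ (evₙ-scale N c f)) (*-≈⟨⟩ {f = ⟦ c ⟧} (≈⇒ refl) (sy (ev-evₙ N f))))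

    -- Induction on the precision: the factor t in front of the tail gains one order.
    ev-*⟨⟩ : ∀ N f g → ev (f PKR.* g) ≈[ N ] ev f * ev g
    ev-*⟨⟩ zero f g i ()
    ev-*⟨⟩ (suc N) f g = tr (≈⇒ lhs) (tr (+-≈⟨⟩ {f = ⟦ f 0 ⟧ * ev g} (≈⇒ refl) (t*-≈⟨⟩ (ev-*⟨⟩ N (PK.tail f) g))) (≈⇒ rhs))
      where
      lhs : ev (f PKR.* g) ≈ ⟦ f 0 ⟧ * ev g + t * ev (PK.tail f PKR.* g)
      lhs = begin
        ev (f PKR.* g)  ≈⟨ ev-unfold (f PKR.* g) ⟩
        ⟦ f 0 K.* g 0 ⟧ + t * ev (λ n → f 0 K.* g (suc n) K.+ PK.conv (PK.tail f) g n)
          ≈⟨ +-cong (hom-* _ _) (*-congˡ (trans (ev-+ (λ n → f 0 K.* g (suc n)) (PK.tail f PKR.* g)) (+-congʳ (ev-scale (f 0) (PK.tail g))))) ⟩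
        ⟦ f 0 ⟧ * ⟦ g 0 ⟧ + t * (⟦ f 0 ⟧ * ev (PK.tail g) + ev (PK.tail f PKR.* g))
          ≈⟨ solve 5 (λ a b t c d → a :* b :+ t :* (a :* c :+ d) := a :* (b :+ t :* c) :+ t :* d) refl _ _ t _ _ ⟩
        ⟦ f 0 ⟧ * (⟦ g 0 ⟧ + t * ev (PK.tail g)) + t * ev (PK.tail f PKR.* g)
          ≈⟨ +-congʳ (*-congˡ (sym (ev-unfold g))) ⟩
        ⟦ f 0 ⟧ * ev g + t * ev (PK.tail f PKR.* g) ∎
      rhs : ⟦ f 0 ⟧ * ev g + t * (ev (PK.tail f) * ev g) ≈ ev f * ev g
      rhs = trans (solve 4 (λ a g t b → a :* g :+ t :* (b :* g) := (a :+ t :* b) :* g) refl _ (ev g) t _) (*-congʳ (sym (ev-unfold f)))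

    evHom : RingHom PK.psRing psRing
    evHom = record { ⟦_⟧ = ev ; cong = ev-cong ; hom-0 = ev-0 ; hom-1 = trans (ev-C K.1#) hom-1
                   ; hom-+ = ev-+ ; hom-* = λ f g → ⇒≈ λ N → ev-*⟨⟩ N f g }

    ev-mon : ∀ c k → ev (PK.mon c k) ≈ ⟦ c ⟧ * t ^ k
    ev-mon c zero = trans (ev-C c) (sym (*-identityʳ _))
    ev-mon c (suc k) = trans (ev-unfold (PK.mon c (suc k))) (trans (+-cong hom-0 (*-congˡ (ev-mon c k)))
      (trans (+-identityˡ _) (solve 3 (λ t c p → t :* (c :* p) := c :* (t :* p)) refl t _ _)))

    ev-Lim : ∀ {s l} → PK.Lim s l → Lim (ev ∘ s) (ev l)
    ev-Lim p N = let (M₀ , h′) = p N in M₀ , λ M le → ev-≈⟨⟩ (h′ M le)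

    -- Extraction operators (diagonal, every fifth coefficient) that undo the substitution.
    module Extraction (Δ : Series → PK.Series)
      (Δ-cong : ∀ {f g} → f ≈ g → Δ f PK.≋ Δ g)
      (Δ-+ : ∀ f g → Δ (f + g) PK.≋ Δ f PKR.+ Δ g)
      (Δ-scale : ∀ c f n → Δ (⟦ c ⟧ * f) n K.≈ c K.* Δ f n)
      (Δ-zero : ∀ f → Δ (t * f) 0 K.≈ K.0#)
      (Δ-suc : ∀ f n → Δ (t * f) (suc n) K.≈ Δ f n) where
      -- A projection formula: the extraction is linear over the image of the substitution. It moves
      -- series in xy into or out of a diagonal, and series in q⁵ out of an extraction of every
      -- fifth coefficient.
      Δ-* : ∀ f g → Δ (f * ev g) PK.≋ Δ f PKR.* g
      Δ-* f g n = K.trans (Δ-cong (trans (*-congˡ (ev-unfold g))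
          (solve 4 (λ f a t b → f :* (a :+ t :* b) := a :* f :+ t :* (f :* b)) refl f _ t _)) n)
        (K.trans (Δ-+ _ _ n) (K.trans (K.+-congʳ (Δ-scale (g 0) f n)) (finish n)))
        where
        finish : ∀ n → g 0 K.* Δ f n K.+ Δ (t * (f * ev (PK.tail g))) n K.≈ (Δ f PKR.* g) n
        finish zero = K.trans (K.+-cong (K.*-comm _ _) (Δ-zero _)) (K.+-identityʳ _)
        finish (suc n) = K.trans (K.+-cong (K.*-comm _ _) (K.trans (Δ-suc _ n) (Δ-* f (PK.tail g) n)))
          (K.trans (K.+-comm _ _) (K.sym (PK.conv-back (Δ f) g n)))

-- Arithmetic of A₄: exponents, residues modulo 5, multiplication by √5 and affine symmetries.

module LatticeZ where
  open import Data.Integer using (_+_; _*_; _-_; -_)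
  open import Data.Integer.Tactic.RingSolver using (solve-∀)
  open ≡ using (cong; cong₂; sym; trans)
  open Jacobi

  tri2 : ∀ m → + triℤ m * + 2 ≡ m * m + m
  tri2 (+ n) = go n
    where
    step : ∀ n t → t * + 2 ≡ n * n + n → (+ 1 + n + t) * + 2 ≡ (+ 1 + n) * (+ 1 + n) + (+ 1 + n)
    step n t e = trans (lhs n t) (trans (cong (λ z → + 2 + n * + 2 + z) e) (rhs n))
      where
      lhs : ∀ n t → (+ 1 + n + t) * + 2 ≡ + 2 + n * + 2 + t * + 2
      lhs = solve-∀
      rhs : ∀ n → + 2 + n * + 2 + (n * n + n) ≡ (+ 1 + n) * (+ 1 + n) + (+ 1 + n)
      rhs = solve-∀
    go : ∀ n → + tri n * + 2 ≡ + n * + n + + n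
    go zero = ≡.refl
    go (suc n) = step (+ n) (+ tri n) (go n)
  tri2 -[1+ n ] = trans (tri2 (+ n)) (reflect (+ n))
    where
    reflect : ∀ n → n * n + n ≡ - (+ 1 + n) * - (+ 1 + n) + - (+ 1 + n)
    reflect = solve-∀

  tri2-neg : ∀ m → + triℤ (- m) * + 2 ≡ m * m - m
  tri2-neg m = trans (tri2 (- m)) (lemma m)
    where
    lemma : ∀ m → - m * - m + - m ≡ m * m - m
    lemma = solve-∀

  halve : ∀ i j → i * + 2 ≡ j * + 2 → i ≡ j
  halve i j = ℤP.*-cancelʳ-≡ i j (+ 2)

  tri-diff : ∀ m → + triℤ m ≡ + triℤ (- m) + m
  tri-diff m = halve _ _ (trans (tri2 m) (trans (lemma m) (trans (cong (_+ m * + 2) (sym (tri2-neg m))) (sym (ℤP.*-distribʳ-+ (+ 2) (+ triℤ (- m)) m)))))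
    where
    lemma : ∀ m → m * m + m ≡ (m * m - m) + m * + 2
    lemma = solve-∀

  private
   divmod5-unique : ∀ {z} r k → z ≡ + r + k * + 5 → r ℕ.< 5 → z %ℕ 5 ≡ r × z /ℕ 5 ≡ k
   divmod5-unique {z} r k e r<5 = rem-eq , ℤP.*-cancelʳ-≡ (z /ℕ 5) k (+ 5) (quot (cong +_ rem-eq))
     where
     s = z %ℕ 5
     l = z /ℕ 5
     e′ : + s + l * + 5 ≡ + r + k * + 5
     e′ = trans (sym (a≡a%ℕn+[a/ℕn]*n z 5)) e
     diff : ∀ (r s k l : ℤ) → s + l * + 5 ≡ r + k * + 5 → r - s ≡ (l - k) * + 5
     diff r s k l e = trans (shape r s k l) (trans (cong (λ t → (l - k) * + 5 + (t - (s + l * + 5))) (sym e)) (cancel ((l - k) * + 5) (s + l * + 5)))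
       where
       shape : ∀ r s k l → r - s ≡ (l - k) * + 5 + ((r + k * + 5) - (s + l * + 5))
       shape = solve-∀
       cancel : ∀ a b → a + (b - b) ≡ a
       cancel = solve-∀
     small : ∀ r s → r ℕ.< 5 → s ℕ.< 5 → ∀ d → + r - + s ≡ d * + 5 → s ≡ r
     small r s r< s< (+ zero) e = sym (ℤP.+-injective (ℤP.i-j≡0⇒i≡j (+ r) (+ s) e))
     small r s r< s< (+ suc d) e = contradiction (bound e) (ℕP.<⇒≱ r<)
       where
       bound : + r - + s ≡ + suc d * + 5 → 5 ℕ.≤ r
       bound e = ℤP.drop‿+≤+ (ℤP.≤-trans {+ 5} {+ suc d * + 5} {+ r} (ℤ.+≤+ (ℕP.m≤m+n 5 (d ℕ.* 5)))
         (ℤP.≤-trans (ℤP.≤-reflexive (sym e)) (ℤP.i≤j⇒i-k≤j (+ s) (ℤP.≤-refl {+ r}))))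
     small r s r< s< -[1+ d ] e = contradiction (bound (neg e)) (ℕP.<⇒≱ s<)
       where
       swap : ∀ a b → b - a ≡ - (a - b)
       swap = solve-∀
       neg : + r - + s ≡ -[1+ d ] * + 5 → + s - + r ≡ + suc d * + 5
       neg e = trans (swap (+ r) (+ s)) (cong -_ e)
       bound : + s - + r ≡ + suc d * + 5 → 5 ℕ.≤ s
       bound e = ℤP.drop‿+≤+ (ℤP.≤-trans {+ 5} {+ suc d * + 5} {+ s} (ℤ.+≤+ (ℕP.m≤m+n 5 (d ℕ.* 5)))
         (ℤP.≤-trans (ℤP.≤-reflexive (sym e)) (ℤP.i≤j⇒i-k≤j (+ r) (ℤP.≤-refl {+ s}))))
     rem-eq : s ≡ r
     rem-eq = small r s r<5 (n%ℕd<d z 5) (l - k) (diff (+ r) (+ s) k l e′)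
     quot : + s ≡ + r → l * + 5 ≡ k * + 5
     quot es = trans (shape (+ s) (l * + 5)) (trans (cong₂ _-_ (trans e′ (cong (_+ k * + 5) (sym es))) ≡.refl) (sym (shape (+ s) (k * + 5))))
       where
       shape : ∀ a b → b ≡ (a + b) - a
       shape = solve-∀

  -- Only the division identity, the bound and uniqueness are used below; hiding the definitions
  -- keeps quotients of variable integers from unfolding.
  abstract
    res5 : ℤ → ℕ
    res5 z = z %ℕ 5

    quot5 : ℤ → ℤ
    quot5 z = z /ℕ 5

    split5 : ∀ z → z ≡ + res5 z + quot5 z * + 5
    split5 z = a≡a%ℕn+[a/ℕn]*n z 5

    res5<5 : ∀ z → res5 z ℕ.< 5
    res5<5 z = n%ℕd<d z 5

    res5-unique : ∀ z r k → z ≡ + r + k * + 5 → r ℕ.< 5 → res5 z ≡ r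
    res5-unique z r k e r<5 = proj₁ (divmod5-unique r k e r<5)

    quot5-unique : ∀ z r k → z ≡ + r + k * + 5 → r ℕ.< 5 → quot5 z ≡ k
    quot5-unique z r k e r<5 = proj₂ (divmod5-unique r k e r<5)

  res5-% : ∀ z n k → z ≡ + n + k * + 5 → res5 z ≡ n ℕ.% 5
  res5-% z n k e = res5-unique z (n ℕ.% 5) (+ (n ℕ./ 5) + k)
    (trans e (trans (cong (_+ k * + 5) n-split) (regroup (+ (n ℕ.% 5)) (+ (n ℕ./ 5)) k))) (ℕD.m%n<n n 5)
    where
    n-split : + n ≡ + (n ℕ.% 5) + + (n ℕ./ 5) * + 5
    n-split = trans (cong +_ (ℕD.m≡m%n+[m/n]*n n 5)) (cong (λ z → + (n ℕ.% 5) + z) (ℤP.pos-* (n ℕ./ 5) 5))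
    regroup : ∀ a b k → (a + b * + 5) + k * + 5 ≡ a + (b + k) * + 5
    regroup = solve-∀

  ℤ⁵ : Set
  ℤ⁵ = ℤ × ℤ × ℤ × ℤ × ℤ

  -- Vectors of sum 0 form the lattice A₄; c₁ and c₂ are the functionals Σ i wᵢ and Σ (i choose 2) wᵢ,
  -- the latter with its coefficients 0, 0, 1, 3, 6 reduced modulo 5.
  S c₁ c₂ : ℤ⁵ → ℤ
  S (a , b , c , d , e) = a + b + c + d + e
  c₁ (a , b , c , d , e) = b + (c + c) + (d + d + d) + (e + e + e + e)
  c₂ (a , b , c , d , e) = c + (d + d + d) + e

  -- Exponents of x and of y in a product of five theta series: `C` for five copies of (x , y), `G`
  -- for the five pairs x (xy)ᵇ, y (xy)⁴⁻ᵇ. In both cases the exponent of x exceeds that of y by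
  -- `S w`, so equality of exponents singles out A₄.
  kC lC kG lG : ℤ⁵ → ℕ
  kC (a , b , c , d , e) = triℤ a ℕ.+ (triℤ b ℕ.+ (triℤ c ℕ.+ (triℤ d ℕ.+ triℤ e)))
  lC (a , b , c , d , e) = triℤ (- a) ℕ.+ (triℤ (- b) ℕ.+ (triℤ (- c) ℕ.+ (triℤ (- d) ℕ.+ triℤ (- e))))

  -- The degree of X^T(a) Y^T(-a) in a variable that occurs to the power m in X and n in Y.
  wt : ℕ → ℕ → ℤ → ℕ
  wt m n a = triℤ a ℕ.* m ℕ.+ triℤ (- a) ℕ.* n

  kG (a , b , c , d , e) = wt 5 0 a ℕ.+ (wt 4 1 b ℕ.+ (wt 3 2 c ℕ.+ (wt 2 3 d ℕ.+ wt 1 4 e)))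
  lG (a , b , c , d , e) = wt 4 1 a ℕ.+ (wt 3 2 b ℕ.+ (wt 2 3 c ℕ.+ (wt 1 4 d ℕ.+ wt 0 5 e)))

  wt-ℤ : ∀ m n a → + wt m n a ≡ + triℤ a * + m + + triℤ (- a) * + n
  wt-ℤ m n a = cong₂ _+_ (ℤP.pos-* (triℤ a) m) (ℤP.pos-* (triℤ (- a)) n)

  wt2 : ∀ m n a → + wt m n a * + 2 ≡ (a * a + a) * + m + (a * a - a) * + n
  wt2 m n a = trans (cong (_* + 2) (wt-ℤ m n a)) (trans (shape (+ triℤ a) (+ triℤ (- a)) (+ m) (+ n))
    (cong₂ (λ p q → p * + m + q * + n) (tri2 a) (tri2-neg a)))
    where
    shape : ∀ p q m n → (p * m + q * n) * + 2 ≡ (p * + 2) * m + (q * + 2) * n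
    shape = solve-∀

  wt-diff : ∀ m n a → + wt (suc m) n a ≡ + wt m (suc n) a + a
  wt-diff m n a = trans (wt-ℤ (suc m) n a) (trans (shape (+ triℤ a) (+ triℤ (- a)) (+ m) (+ n))
    (trans (cong (λ t → + triℤ a * + m + + triℤ (- a) * + n + t) (tri-diff a))
      (trans (shape′ (+ triℤ a) (+ triℤ (- a)) (+ m) (+ n) a) (cong (_+ a) (sym (wt-ℤ m (suc n) a))))))
    where
    shape : ∀ p q m n → p * (+ 1 + m) + q * n ≡ p * m + q * n + p
    shape = solve-∀
    shape′ : ∀ p q m n a → p * m + q * n + (q + a) ≡ (p * m + q * (+ 1 + n)) + a
    shape′ = solve-∀

  private
    add5 : ∀ a b c d e a′ b′ c′ d′ e′ u v w x y → + a ≡ + a′ + u → + b ≡ + b′ + v → + c ≡ + c′ + w → + d ≡ + d′ + x → + e ≡ + e′ + y →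
      + (a ℕ.+ (b ℕ.+ (c ℕ.+ (d ℕ.+ e)))) ≡ + (a′ ℕ.+ (b′ ℕ.+ (c′ ℕ.+ (d′ ℕ.+ e′)))) + (u + v + w + x + y)
    add5 a b c d e a′ b′ c′ d′ e′ u v w x y p q r s t =
      trans (cong₂ _+_ p (cong₂ _+_ q (cong₂ _+_ r (cong₂ _+_ s t)))) (shape (+ a′) (+ b′) (+ c′) (+ d′) (+ e′) u v w x y)
      where
      shape : ∀ a b c d e u v w x y → (a + u) + ((b + v) + ((c + w) + ((d + x) + (e + y))))
        ≡ (a + (b + (c + (d + e)))) + (u + v + w + x + y)
      shape = solve-∀

    double5 : ∀ a b c d e {a′ b′ c′ d′ e′} → + a * + 2 ≡ a′ → + b * + 2 ≡ b′ → + c * + 2 ≡ c′ → + d * + 2 ≡ d′ → + e * + 2 ≡ e′ →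
      + (a ℕ.+ (b ℕ.+ (c ℕ.+ (d ℕ.+ e)))) * + 2 ≡ a′ + (b′ + (c′ + (d′ + e′)))
    double5 a b c d e p q r s t = trans (shape (+ a) (+ b) (+ c) (+ d) (+ e)) (cong₂ _+_ p (cong₂ _+_ q (cong₂ _+_ r (cong₂ _+_ s t))))
      where
      shape : ∀ a b c d e → (a + (b + (c + (d + e)))) * + 2 ≡ a * + 2 + (b * + 2 + (c * + 2 + (d * + 2 + e * + 2)))
      shape = solve-∀

  kC-lC : ∀ w → + kC w ≡ + lC w + S w
  kC-lC (a , b , c , d , e) = add5 (triℤ a) (triℤ b) (triℤ c) (triℤ d) (triℤ e) (triℤ (- a)) (triℤ (- b)) (triℤ (- c)) (triℤ (- d)) (triℤ (- e)) a b c d e (tri-diff a) (tri-diff b) (tri-diff c) (tri-diff d) (tri-diff e)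

  kG-lG : ∀ w → + kG w ≡ + lG w + S w
  kG-lG (a , b , c , d , e) = add5 (wt 5 0 a) (wt 4 1 b) (wt 3 2 c) (wt 2 3 d) (wt 1 4 e) (wt 4 1 a) (wt 3 2 b) (wt 2 3 c) (wt 1 4 d) (wt 0 5 e) a b c d e (wt-diff 4 0 a) (wt-diff 3 1 b) (wt-diff 2 2 c) (wt-diff 1 3 d) (wt-diff 0 4 e)

  balanced⇒S≡0 : ∀ {k l s} → + k ≡ + l + s → k ≡ l → s ≡ + 0
  balanced⇒S≡0 {k} {s = s} e ≡.refl = trans (shape (+ k) s) (trans (cong (_- + k) (sym e)) (ℤP.+-inverseʳ (+ k)))
    where
    shape : ∀ k s → s ≡ (k + s) - k
    shape = solve-∀

  S≡0⇒balanced : ∀ {k l s} → + k ≡ + l + s → s ≡ + 0 → k ≡ l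
  S≡0⇒balanced {l = l} e ≡.refl = ℤP.+-injective (trans e (ℤP.+-identityʳ (+ l)))

  -- Multiplication by √5 = ζ + ζ⁴ − ζ² − ζ³ on A₄ ⊂ ℤ[ζ]/(1 + ζ + ⋯ + ζ⁴), followed by a translation.
  φ : ℤ⁵ → ℤ⁵
  φ (a , b , c , d , e) = (e + b - d - c) , (a + c - e - d + + 1) , (b + d - a - e) , (c + e - b - a - + 1) , (d + a - c - b)

  -- The inverse of `φ`, with k and l standing for (c₁ - 3) / 5 and (c₂ - 2) / 5. In terms of these
  -- quotients the division by √5 has integral coefficients.
  ψ′ : ℤ → ℤ → ℤ⁵ → ℤ⁵
  ψ′ k l (_ , _ , c , d , e) =
    (k + (l + l) - c - (d + d) - e + + 1) , (- k + (l + l) - d) , ((k + k) + (l + l) - c - (d + d) - (e + e) + + 2) ,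
    ((l + l) - d + + 1) , ((- k - k) + (l + l) + e)

  ψ : ℤ⁵ → ℤ⁵
  ψ w = ψ′ (quot5 (c₁ w)) (quot5 (c₂ w)) w

  private
    first : ∀ a b c d e → a + b + c + d + e ≡ + 0 → a ≡ - (b + c + d + e)
    first a b c d e p = trans (shape a b c d e) (trans (cong (_- (b + c + d + e)) p) (ℤP.+-identityˡ _))
      where
      shape : ∀ a b c d e → a ≡ (a + b + c + d + e) - (b + c + d + e)
      shape = solve-∀

  S-φ : ∀ n → S (φ n) ≡ + 0
  S-φ (a , b , c , d , e) = shape a b c d e
    where
    shape : ∀ a b c d e → (e + b - d - c) + (a + c - e - d + + 1) + (b + d - a - e) + (c + e - b - a - + 1) + (d + a - c - b) ≡ + 0
    shape = solve-∀

  -- Multiples of √5 in A₄ have both functionals divisible by 5. The residues 3 and 2 are those of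
  -- the translation vector (0, 1, 0, -1, 0), where c₁ = -2 and c₂ = -3.
  c₁-φ : ∀ n → c₁ (φ n) ≡ + 3 + (proj₁ (proj₂ (proj₂ (proj₂ n))) - proj₁ (proj₂ n) - + 1) * + 5
  c₁-φ (a , b , c , d , e) = shape a b c d e
    where
    shape : ∀ a b c d e → (a + c - e - d + + 1) + ((b + d - a - e) + (b + d - a - e)) + ((c + e - b - a - + 1) + (c + e - b - a - + 1) + (c + e - b - a - + 1)) + ((d + a - c - b) + (d + a - c - b) + (d + a - c - b) + (d + a - c - b)) ≡ + 3 + (d - b - + 1) * + 5
    shape = solve-∀

  c₂-φ : ∀ n → S n ≡ + 0 → c₂ (φ n) ≡ + 2 + (proj₁ (proj₂ (proj₂ n)) + proj₁ (proj₂ (proj₂ (proj₂ n))) + proj₂ (proj₂ (proj₂ (proj₂ n))) - + 1) * + 5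
  c₂-φ (a , b , c , d , e) s = subst-first a b c d e (first a b c d e s)
    where
    shape : ∀ b c d e → (b + d - (- (b + c + d + e)) - e) + ((c + e - b - (- (b + c + d + e)) - + 1) + (c + e - b - (- (b + c + d + e)) - + 1) + (c + e - b - (- (b + c + d + e)) - + 1)) + (d + (- (b + c + d + e)) - c - b) ≡ + 2 + (c + d + e - + 1) * + 5
    shape = solve-∀
    subst-first : ∀ a b c d e → a ≡ - (b + c + d + e) → c₂ (φ (a , b , c , d , e)) ≡ + 2 + (c + d + e - + 1) * + 5
    subst-first a b c d e ≡.refl = shape b c d e

  ψ-φ : ∀ n → S n ≡ + 0 → ψ (φ n) ≡ n
  ψ-φ n@(a , b , c , d , e) s = trans (cong₂ (λ k l → ψ′ k l (φ n))
      (quot5-unique (c₁ (φ n)) 3 (d - b - + 1) (c₁-φ n) (ℕ.s≤s (ℕ.s≤s (ℕ.s≤s (ℕ.s≤s ℕ.z≤n)))))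
      (quot5-unique (c₂ (φ n)) 2 (c + d + e - + 1) (c₂-φ n s) (ℕ.s≤s (ℕ.s≤s (ℕ.s≤s ℕ.z≤n))))) (back a b c d e (first a b c d e s))
    where
    e₀ : ∀ b c d e → (d - b - + 1) + ((c + d + e - + 1) + (c + d + e - + 1)) - (b + d - (- (b + c + d + e)) - e) - ((c + e - b - (- (b + c + d + e)) - + 1) + (c + e - b - (- (b + c + d + e)) - + 1)) - (d + (- (b + c + d + e)) - c - b) + + 1 ≡ - (b + c + d + e)
    e₀ = solve-∀
    e₁ : ∀ b c d e → - (d - b - + 1) + ((c + d + e - + 1) + (c + d + e - + 1)) - (c + e - b - (- (b + c + d + e)) - + 1) ≡ b
    e₁ = solve-∀
    e₂ : ∀ b c d e → ((d - b - + 1) + (d - b - + 1)) + ((c + d + e - + 1) + (c + d + e - + 1)) - (b + d - (- (b + c + d + e)) - e) - ((c + e - b - (- (b + c + d + e)) - + 1) + (c + e - b - (- (b + c + d + e)) - + 1)) - ((d + (- (b + c + d + e)) - c - b) + (d + (- (b + c + d + e)) - c - b)) + + 2 ≡ c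
    e₂ = solve-∀
    e₃ : ∀ b c d e → ((c + d + e - + 1) + (c + d + e - + 1)) - (c + e - b - (- (b + c + d + e)) - + 1) + + 1 ≡ d
    e₃ = solve-∀
    e₄ : ∀ b c d e → (- (d - b - + 1) - (d - b - + 1)) + ((c + d + e - + 1) + (c + d + e - + 1)) + (d + (- (b + c + d + e)) - c - b) ≡ e
    e₄ = solve-∀
    back : ∀ a b c d e → a ≡ - (b + c + d + e) → ψ′ (d - b - + 1) (c + d + e - + 1) (φ (a , b , c , d , e)) ≡ (a , b , c , d , e)
    back a b c d e ≡.refl = cong₂ _,_ (e₀ b c d e) (cong₂ _,_ (e₁ b c d e) (cong₂ _,_ (e₂ b c d e) (cong₂ _,_ (e₃ b c d e) (e₄ b c d e))))

  private
    second : ∀ b c d e r → b + (c + c) + (d + d + d) + (e + e + e + e) ≡ r → b ≡ r - (c + c) - (d + d + d) - (e + e + e + e)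
    second b c d e r ≡.refl = shape b c d e
      where
      shape : ∀ b c d e → b ≡ (b + (c + c) + (d + d + d) + (e + e + e + e)) - (c + c) - (d + d + d) - (e + e + e + e)
      shape = solve-∀

    third : ∀ c d e r → c + (d + d + d) + e ≡ r → c ≡ r - (d + d + d) - e
    third c d e r ≡.refl = shape c d e
      where
      shape : ∀ c d e → c ≡ (c + (d + d + d) + e) - (d + d + d) - e
      shape = solve-∀

  S-ψ′ : ∀ w k l → c₂ w ≡ + 2 + l * + 5 → S (ψ′ k l w) ≡ + 0
  S-ψ′ (a , b , c , d , e) k l p₂ = subst-third c (third c d e _ p₂)
    where
    shape : ∀ k l d e → (k + (l + l) - (+ 2 + l * + 5 - (d + d + d) - e) - (d + d) - e + + 1) + (- k + (l + l) - d) + ((k + k) + (l + l) - (+ 2 + l * + 5 - (d + d + d) - e) - (d + d) - (e + e) + + 2) +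
      ((l + l) - d + + 1) + ((- k - k) + (l + l) + e) ≡ + 0
    shape = solve-∀
    subst-third : ∀ c → c ≡ + 2 + l * + 5 - (d + d + d) - e → S (ψ′ k l (a , b , c , d , e)) ≡ + 0
    subst-third c ≡.refl = shape k l d e

  φ-ψ′ : ∀ w k l → S w ≡ + 0 → c₁ w ≡ + 3 + k * + 5 → c₂ w ≡ + 2 + l * + 5 → φ (ψ′ k l w) ≡ w
  φ-ψ′ (a , b , c , d , e) k l s p₁ p₂ =
    recover a b c (third c d e _ p₂) (second b c d e _ p₁) (first a b c d e s)
    where
    e₀ : ∀ k l d e → ((- k - k) + (l + l) + e) + (- k + (l + l) - d) - ((l + l) - d + + 1) - ((k + k) + (l + l) - (+ 2 + l * + 5 - (d + d + d) - e) - (d + d) - (e + e) + + 2)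
      ≡ - ((+ 3 + k * + 5 - ((+ 2 + l * + 5 - (d + d + d) - e) + (+ 2 + l * + 5 - (d + d + d) - e)) - (d + d + d) - (e + e + e + e)) + (+ 2 + l * + 5 - (d + d + d) - e) + d + e)
    e₀ = solve-∀
    e₁ : ∀ k l d e → (k + (l + l) - (+ 2 + l * + 5 - (d + d + d) - e) - (d + d) - e + + 1) + ((k + k) + (l + l) - (+ 2 + l * + 5 - (d + d + d) - e) - (d + d) - (e + e) + + 2) - ((- k - k) + (l + l) + e) - ((l + l) - d + + 1) + + 1
      ≡ + 3 + k * + 5 - ((+ 2 + l * + 5 - (d + d + d) - e) + (+ 2 + l * + 5 - (d + d + d) - e)) - (d + d + d) - (e + e + e + e)
    e₁ = solve-∀
    e₂ : ∀ k l d e → (- k + (l + l) - d) + ((l + l) - d + + 1) - (k + (l + l) - (+ 2 + l * + 5 - (d + d + d) - e) - (d + d) - e + + 1) - ((- k - k) + (l + l) + e)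
      ≡ + 2 + l * + 5 - (d + d + d) - e
    e₂ = solve-∀
    e₃ : ∀ k l d e → ((k + k) + (l + l) - (+ 2 + l * + 5 - (d + d + d) - e) - (d + d) - (e + e) + + 2) + ((- k - k) + (l + l) + e) - (- k + (l + l) - d) - (k + (l + l) - (+ 2 + l * + 5 - (d + d + d) - e) - (d + d) - e + + 1) - + 1
      ≡ d
    e₃ = solve-∀
    e₄ : ∀ k l d e → ((l + l) - d + + 1) + (k + (l + l) - (+ 2 + l * + 5 - (d + d + d) - e) - (d + d) - e + + 1) - ((k + k) + (l + l) - (+ 2 + l * + 5 - (d + d + d) - e) - (d + d) - (e + e) + + 2) - (- k + (l + l) - d)
      ≡ e
    e₄ = solve-∀

    recover : ∀ a b c → c ≡ + 2 + l * + 5 - (d + d + d) - e → b ≡ + 3 + k * + 5 - (c + c) - (d + d + d) - (e + e + e + e) → a ≡ - (b + c + d + e) →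
      φ (ψ′ k l (a , b , c , d , e)) ≡ (a , b , c , d , e)
    recover a b c ≡.refl ≡.refl ≡.refl = cong₂ _,_ (e₀ k l d e) (cong₂ _,_ (e₁ k l d e) (cong₂ _,_ (e₂ k l d e) (cong₂ _,_ (e₃ k l d e) (e₄ k l d e))))

  -- On vectors of sum zero `kC` is half the squared norm. Multiplication by √5 scales the squared
  -- norm by 5, the translation vector has squared norm 2, whence the additional 1, and the cross
  -- term is the linear part of `kG` up to a multiple of the sum.
  kC-φ : ∀ n → S n ≡ + 0 → kC (φ n) ≡ suc (kG n)
  kC-φ (a , b , c , d , e) s = subst-first a (first a b c d e s)
    where
    shape : ∀ b c d e → let a = - (b + c + d + e) in let w₀ = e + b - d - c in let w₁ = a + c - e - d + + 1 in
      let w₂ = b + d - a - e in let w₃ = c + e - b - a - + 1 in let w₄ = d + a - c - b in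
      (w₀ * w₀ + w₀) + ((w₁ * w₁ + w₁) + ((w₂ * w₂ + w₂) + ((w₃ * w₃ + w₃) + (w₄ * w₄ + w₄)))) ≡
      + 2 + (((a * a + a) * + 5 + (a * a - a) * + 0) + (((b * b + b) * + 4 + (b * b - b) * + 1) + (((c * c + c) * + 3 + (c * c - c) * + 2)
        + (((d * d + d) * + 2 + (d * d - d) * + 3) + ((e * e + e) * + 1 + (e * e - e) * + 4)))))
    shape = solve-∀
    subst-first : ∀ a → a ≡ - (b + c + d + e) → kC (φ (a , b , c , d , e)) ≡ suc (kG (a , b , c , d , e))
    subst-first a ≡.refl = ℤP.+-injective (halve (+ kC (φ n)) (+ suc (kG n))
      (trans (double5 (triℤ w₀) (triℤ w₁) (triℤ w₂) (triℤ w₃) (triℤ w₄) (tri2 w₀) (tri2 w₁) (tri2 w₂) (tri2 w₃) (tri2 w₄))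
      (trans (shape b c d e) (sym (trans (ℤP.*-distribʳ-+ (+ 2) (+ 1) (+ kG n))
        (cong (λ z → + 2 + z) (double5 (wt 5 0 a) (wt 4 1 b) (wt 3 2 c) (wt 2 3 d) (wt 1 4 e)
          (wt2 5 0 a) (wt2 4 1 b) (wt2 3 2 c) (wt2 2 3 d) (wt2 1 4 e))))))))
      where
      n = (a , b , c , d , e)
      w₀ = proj₁ (φ n)
      w₁ = proj₁ (proj₂ (φ n))
      w₂ = proj₁ (proj₂ (proj₂ (φ n)))
      w₃ = proj₁ (proj₂ (proj₂ (proj₂ (φ n))))
      w₄ = proj₂ (proj₂ (proj₂ (proj₂ (φ n))))

  -- The 20 affine maps i ↦ c i + d of ℤ/5 permute the coordinates; they act simply transitively on the
  -- values of (c₁, c₂) modulo 5 with c₁ ≢ 0.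
  key : ℤ⁵ → ℕ × ℕ
  key w = res5 (c₁ w) , res5 (c₂ w)

  -- The separate summand s takes up the multiples of `S w` by which permuted functionals differ
  -- from linear combinations of c₁ and c₂; it vanishes on A₄.
  res5-linear : ∀ α β z x y j s → z ≡ + α * x + + β * y + j * + 5 + s → s ≡ + 0 →
    res5 z ≡ (α ℕ.* res5 x ℕ.+ β ℕ.* res5 y) ℕ.% 5
  res5-linear α β z x y j s e s≡0 = res5-% z (α ℕ.* res5 x ℕ.+ β ℕ.* res5 y) (+ α * quot5 x + + β * quot5 y + j)
    (trans e (trans (cong₂ (λ p q → + α * p + + β * q + j * + 5 + s) (split5 x) (split5 y))
      (trans (cong (λ t → + α * (+ res5 x + quot5 x * + 5) + + β * (+ res5 y + quot5 y * + 5) + j * + 5 + t) s≡0)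
        (trans (shape (+ α) (+ β) (+ res5 x) (quot5 x) (+ res5 y) (quot5 y) j)
          (cong (_+ (+ α * quot5 x + + β * quot5 y + j) * + 5) (sym (cong₂ _+_ (ℤP.pos-* α (res5 x)) (ℤP.pos-* β (res5 y)))))))))
    where
    shape : ∀ α β r k s l j → α * (r + k * + 5) + β * (s + l * + 5) + j * + 5 + + 0 ≡ (α * r + β * s) + (α * k + β * l + j) * + 5
    shape = solve-∀

  record Symmetry : Set where
    field
      act act⁻¹ : ℤ⁵ → ℤ⁵
      act⁻¹-act : ∀ w → act⁻¹ (act w) ≡ w
      act-act⁻¹ : ∀ w → act (act⁻¹ w) ≡ w
      S-act : ∀ w → S (act w) ≡ S w
      kC-act : ∀ w → kC (act w) ≡ kC w
      step step⁻¹ : ℕ × ℕ → ℕ × ℕ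
      key-act : ∀ w → S w ≡ + 0 → key (act w) ≡ step (key w)
      key-act⁻¹ : ∀ w → S w ≡ + 0 → key (act⁻¹ w) ≡ step⁻¹ (key w)

    S-act⁻¹ : ∀ w → S (act⁻¹ w) ≡ S w
    S-act⁻¹ w = trans (sym (S-act (act⁻¹ w))) (cong S (act-act⁻¹ w))

  -- The map i ↦ i + 1. The entries of `step` come from (i + 1 choose 2) = (i choose 2) + i, those
  -- of `step⁻¹` from (i - 1 choose 2) = (i choose 2) - i + 1.
  rotation : Symmetry
  rotation = record
    { act = λ (a , b , c , d , e) → e , a , b , c , d
    ; act⁻¹ = λ (a , b , c , d , e) → b , c , d , e , a
    ; act⁻¹-act = λ _ → ≡.refl
    ; act-act⁻¹ = λ _ → ≡.refl
    ; S-act = λ (a , b , c , d , e) → S-eq a b c d e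
    ; kC-act = λ (a , b , c , d , e) → k-eq (triℤ a) (triℤ b) (triℤ c) (triℤ d) (triℤ e)
    ; step = λ (r , s) → (1 ℕ.* r ℕ.+ 0 ℕ.* s) ℕ.% 5 , (1 ℕ.* r ℕ.+ 1 ℕ.* s) ℕ.% 5
    ; step⁻¹ = λ (r , s) → (1 ℕ.* r ℕ.+ 0 ℕ.* s) ℕ.% 5 , (4 ℕ.* r ℕ.+ 1 ℕ.* s) ℕ.% 5
    ; key-act = λ w@(a , b , c , d , e) s → cong₂ _,_
        (res5-linear 1 0 _ (c₁ w) (c₂ w) (- e) (S w) (e₁ a b c d e) s)
        (res5-linear 1 1 _ (c₁ w) (c₂ w) (- d - e) (+ 0) (e₂ a b c d e) ≡.refl)
    ; key-act⁻¹ = λ w@(a , b , c , d , e) s → cong₂ _,_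
        (res5-linear 1 0 _ (c₁ w) (c₂ w) a (- S w) (e₃ a b c d e) (cong -_ s))
        (res5-linear 4 1 _ (c₁ w) (c₂ w) (e - c₁ w) (S w) (e₄ a b c d e) s)
    }
    where
    S-eq : ∀ a b c d e → e + a + b + c + d ≡ a + b + c + d + e
    S-eq = solve-∀
    k-eq : ∀ a b c d e → e ℕ.+ (a ℕ.+ (b ℕ.+ (c ℕ.+ d))) ≡ a ℕ.+ (b ℕ.+ (c ℕ.+ (d ℕ.+ e)))
    k-eq = ℕS.solve-∀
    e₁ : ∀ a b c d e → a + (b + b) + (c + c + c) + (d + d + d + d) ≡
      + 1 * (b + (c + c) + (d + d + d) + (e + e + e + e)) + + 0 * (c + (d + d + d) + e) + - e * + 5 + (a + b + c + d + e)
    e₁ = solve-∀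
    e₂ : ∀ a b c d e → b + (c + c + c) + d ≡
      + 1 * (b + (c + c) + (d + d + d) + (e + e + e + e)) + + 1 * (c + (d + d + d) + e) + (- d - e) * + 5 + + 0
    e₂ = solve-∀
    e₃ : ∀ a b c d e → c + (d + d) + (e + e + e) + (a + a + a + a) ≡
      + 1 * (b + (c + c) + (d + d + d) + (e + e + e + e)) + + 0 * (c + (d + d + d) + e) + a * + 5 + - (a + b + c + d + e)
    e₃ = solve-∀
    e₄ : ∀ a b c d e → d + (e + e + e) + a ≡
      + 4 * (b + (c + c) + (d + d + d) + (e + e + e + e)) + + 1 * (c + (d + d + d) + e)
        + (e - (b + (c + c) + (d + d + d) + (e + e + e + e))) * + 5 + (a + b + c + d + e)
    e₄ = solve-∀

  -- The map i ↦ 2 i, with inverse i ↦ 3 i. Modulo 5 one has (2 i choose 2) = 4 (i choose 2) + i and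
  -- (3 i choose 2) = 4 (i choose 2) + 3 i.
  doubling : Symmetry
  doubling = record
    { act = λ (a , b , c , d , e) → a , d , b , e , c
    ; act⁻¹ = λ (a , b , c , d , e) → a , c , e , b , d
    ; act⁻¹-act = λ _ → ≡.refl
    ; act-act⁻¹ = λ _ → ≡.refl
    ; S-act = λ (a , b , c , d , e) → S-eq a b c d e
    ; kC-act = λ (a , b , c , d , e) → k-eq (triℤ a) (triℤ b) (triℤ c) (triℤ d) (triℤ e)
    ; step = λ (r , s) → (2 ℕ.* r ℕ.+ 0 ℕ.* s) ℕ.% 5 , (1 ℕ.* r ℕ.+ 4 ℕ.* s) ℕ.% 5
    ; step⁻¹ = λ (r , s) → (3 ℕ.* r ℕ.+ 0 ℕ.* s) ℕ.% 5 , (3 ℕ.* r ℕ.+ 4 ℕ.* s) ℕ.% 5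
    ; key-act = λ w@(a , b , c , d , e) s → cong₂ _,_
        (res5-linear 2 0 _ (c₁ w) (c₂ w) (- d - e) (+ 0) (e₁ a b c d e) ≡.refl)
        (res5-linear 1 4 _ (c₁ w) (c₂ w) (- c - d - d - d - e) (+ 0) (e₂ a b c d e) ≡.refl)
    ; key-act⁻¹ = λ w@(a , b , c , d , e) s → cong₂ _,_
        (res5-linear 3 0 _ (c₁ w) (c₂ w) (- c - d - e - e) (+ 0) (e₃ a b c d e) ≡.refl)
        (res5-linear 3 4 _ (c₁ w) (c₂ w) (- c - c - d - d - d - d - e - e - e) (+ 0) (e₄ a b c d e) ≡.refl)
    }
    where
    S-eq : ∀ a b c d e → a + d + b + e + c ≡ a + b + c + d + e
    S-eq = solve-∀
    k-eq : ∀ a b c d e → a ℕ.+ (d ℕ.+ (b ℕ.+ (e ℕ.+ c))) ≡ a ℕ.+ (b ℕ.+ (c ℕ.+ (d ℕ.+ e)))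
    k-eq = ℕS.solve-∀
    e₁ : ∀ a b c d e → d + (b + b) + (e + e + e) + (c + c + c + c) ≡
      + 2 * (b + (c + c) + (d + d + d) + (e + e + e + e)) + + 0 * (c + (d + d + d) + e) + (- d - e) * + 5 + + 0
    e₁ = solve-∀
    e₂ : ∀ a b c d e → b + (e + e + e) + c ≡
      + 1 * (b + (c + c) + (d + d + d) + (e + e + e + e)) + + 4 * (c + (d + d + d) + e) + (- c - d - d - d - e) * + 5 + + 0
    e₂ = solve-∀
    e₃ : ∀ a b c d e → c + (e + e) + (b + b + b) + (d + d + d + d) ≡
      + 3 * (b + (c + c) + (d + d + d) + (e + e + e + e)) + + 0 * (c + (d + d + d) + e) + (- c - d - e - e) * + 5 + + 0
    e₃ = solve-∀
    e₄ : ∀ a b c d e → e + (b + b + b) + d ≡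
      + 3 * (b + (c + c) + (d + d + d) + (e + e + e + e)) + + 4 * (c + (d + d + d) + e) + (- c - c - d - d - d - d - e - e - e) * + 5 + + 0
    e₄ = solve-∀

  -- Exponents of ζ in the product of the theta series of (ζ⁻ⁱ x, ζⁱ y), with ζ⁻¹ = ζ⁴.
  eζ : ℤ⁵ → ℕ
  eζ (a , b , c , d , e) = wt 0 0 a ℕ.+ (wt 1 4 b ℕ.+ (wt 2 8 c ℕ.+ (wt 3 12 d ℕ.+ wt 4 16 e)))

  eζ-res : ∀ w → eζ w ℕ.% 5 ≡ res5 (c₁ w)
  eζ-res (a , b , c , d , e) = sym (res5-% _ (eζ (a , b , c , d , e)) (- j) (move _ _ j total))
    where
    j = + triℤ (- b) + + triℤ (- c) * + 2 + + triℤ (- d) * + 3 + + triℤ (- e) * + 4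
    move : ∀ z n j → n ≡ z + j * + 5 → z ≡ n + - j * + 5
    move z n j ≡.refl = shape z j
      where
      shape : ∀ z j → z ≡ (z + j * + 5) + - j * + 5
      shape = solve-∀
    term : ∀ m n a → + wt m n a ≡ (+ triℤ (- a) + a) * + m + + triℤ (- a) * + n
    term m n a = trans (wt-ℤ m n a) (cong (λ t → t * + m + + triℤ (- a) * + n) (tri-diff a))
    shape : ∀ a b c d e p q r s t →
      ((p + a) * + 0 + p * + 0) + (((q + b) * + 1 + q * + 4) + (((r + c) * + 2 + r * + 8) + (((s + d) * + 3 + s * + 12) + ((t + e) * + 4 + t * + 16))))
      ≡ (b + (c + c) + (d + d + d) + (e + e + e + e)) + (q + r * + 2 + s * + 3 + t * + 4) * + 5
    shape = solve-∀
    total : + eζ (a , b , c , d , e) ≡ c₁ (a , b , c , d , e) + j * + 5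
    total = trans (cong₂ _+_ (term 0 0 a) (cong₂ _+_ (term 1 4 b) (cong₂ _+_ (term 2 8 c) (cong₂ _+_ (term 3 12 d) (term 4 16 e)))))
      (shape a b c d e (+ triℤ (- a)) (+ triℤ (- b)) (+ triℤ (- c)) (+ triℤ (- d)) (+ triℤ (- e)))

-- Series in x and y, their diagonal, and theta series of monomials.

module Base (U : CommutativeRing 0ℓ 0ℓ) where
  open Jacobi
  open Ev
  open LatticeZ using (wt)

  module UR = CommutativeRing U
  module UX = RingX U
  module P1 = PS U
  R1 : CommutativeRing 0ℓ 0ℓ
  R1 = P1.psRing
  module C1 = CommutativeRing R1
  module X1 = RingX R1
  module S1 = Sum U
  module P2 = PS R1
  R2 : CommutativeRing 0ℓ 0ℓ
  R2 = P2.psRing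
  module C2 = CommutativeRing R2
  module X2 = RingX R2
  module S2 = Sum R1
  module J2 = JTP R1

  qFactor : ℕ → ℕ → P1.Series
  qFactor m j = C1.1# C1.- P1.mon UR.1# (m ℕ.* suc j)

  Q : ℕ → P1.Series
  Q m = P1.limit (λ N → X1.Π< N (qFactor m))

  O-neg1 : ∀ {N} f → P1.O N f → P1.O N (C1.- f)
  O-neg1 f p i i<N = UR.trans (UR.-‿cong (p i i<N)) -0#≈0#
    where
    open RingProps UR.ring using (-0#≈0#)

  Lim-Q : ∀ m → P1.Lim (λ N → X1.Π< N (qFactor (suc m))) (Q (suc m))
  Lim-Q m = P1.Lim-Π {λ j → C1.- P1.mon UR.1# (suc m ℕ.* suc j)} (λ j → O-neg1 (P1.mon UR.1# (suc m ℕ.* suc j))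
    (P1.O-weaken {f = P1.mon UR.1# (suc m ℕ.* suc j)} (ℕP.≤-trans (ℕP.n≤1+n j) (ℕP.m≤n*m (suc j) (suc m))) (P1.O-mon UR.1# (suc m ℕ.* suc j))))

  -- M c k l is c xᵏ yˡ.
  M : UR.Carrier → ℕ → ℕ → P2.Series
  M c k l = P2.mon (P1.mon c l) k

  M-* : ∀ c k l d k′ l′ → M c k l C2.* M d k′ l′ C2.≈ M (c UR.* d) (k ℕ.+ k′) (l ℕ.+ l′)
  M-* c k l d k′ l′ = C2.trans (P2.mon-* _ k _ k′) (P2.mon-cong (k ℕ.+ k′) (P1.mon-* c l d l′))

  M-^ : ∀ c k l n → M c k l X2.^ n C2.≈ M (c UX.^ n) (n ℕ.* k) (n ℕ.* l)
  M-^ c k l n = C2.trans (P2.mon-^ _ k n) (P2.mon-cong (n ℕ.* k) (P1.mon-^ c l n))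

  M-cong : ∀ {c d} k l → c UR.≈ d → M c k l C2.≈ M d k l
  M-cong k l p = P2.mon-cong k (P1.mon-cong l p)

  M-≡ : ∀ c {k k′ l l′} → k ≡ k′ → l ≡ l′ → M c k l C2.≈ M c k′ l′
  M-≡ c ≡.refl ≡.refl = C2.refl

  -- Keeps the monomials that are powers of xy. Applied to a sum over ℤ⁵ it discards the vectors of
  -- nonzero sum, so A₄ never has to be a type of its own.
  diag : P2.Series → P1.Series
  diag f n = f n n

  diag-cong : ∀ {f g} → f C2.≈ g → diag f C1.≈ diag g
  diag-cong p n = p n n

  diag-M-≡ : ∀ c k → diag (M c k k) C1.≈ P1.mon c k
  diag-M-≡ c k n with n ℕ.≟ k
  ... | yes ≡.refl = P2.mon-same (P1.mon c k) k k
  ... | no n≢k = UR.trans (P2.mon-diff _ k n n≢k n) (UR.sym (P1.mon-diff c k n n≢k))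

  diag-M-balanced : ∀ c k l → k ≡ l → diag (M c k l) C1.≈ P1.mon c k
  diag-M-balanced c k .k ≡.refl = diag-M-≡ c k

  diag-M-≢ : ∀ c k l → k ≢ l → diag (M c k l) C1.≈ C1.0#
  diag-M-≢ c k l k≢l n with n ℕ.≟ k
  ... | yes ≡.refl = UR.trans (P2.mon-same (P1.mon c l) n n) (P1.mon-diff c l n k≢l)
  ... | no n≢k = P2.mon-diff _ k n n≢k n

  diag-sumL : ∀ {A : Set} (f : A → P2.Series) L → diag (X2.sumL f L) C1.≈ X1.sumL (diag ∘ f) L
  diag-sumL f L = go L
    where
    go : ∀ L → diag (X2.sumL f L) C1.≈ X1.sumL (diag ∘ f) L
    go [] n = UR.refl
    go (x ∷ L) n = UR.+-congˡ (go L n)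

  -- The coefficient of (xy)ⁿ sits in the coefficient of xⁿ, so precision N in x alone is precision
  -- N on the diagonal.
  diag-HasSum : ∀ {A : Set} {f : A → P2.Series} {s} → S2.HasSum f s → S1.HasSum (diag ∘ f) (diag s)
  diag-HasSum {f = f} p N = let (L , u , out , e) = p N in
    L , u , (λ x x∉ i i<N → out x x∉ i i<N i) , λ i i<N → UR.trans (UR.sym (diag-sumL f L i)) (e i i<N i)

  const₂ : RingHom U R2
  const₂ = record
    { ⟦_⟧ = λ c → M c 0 0
    ; cong = M-cong 0 0
    ; hom-0 = C2.trans (P2.mon-cong 0 (P1.mon-zero 0)) (P2.mon-zero 0)
    ; hom-1 = C2.refl
    ; hom-+ = λ a b → C2.sym (C2.trans (P2.mon-+ _ _ 0) (P2.mon-cong 0 (P1.mon-+ a b 0)))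
    ; hom-* = λ a b → C2.sym (M-* a 0 0 b 0 0) }

  xy : P2.Series
  xy = M UR.1# 1 1

  -- The embedding q ↦ xy, over whose image `diag` is linear.
  module ι = Substitution U R1 const₂ xy (P2.O-mon _ 1)

  ι-mon : ∀ c k → ι.ev (P1.mon c k) C2.≈ M c k k
  ι-mon c k = C2.trans (ι.ev-mon c k) (C2.trans (C2.*-congˡ (M-^ UR.1# 1 1 k))
    (C2.trans (M-* c 0 0 (UR.1# UX.^ k) (k ℕ.* 1) (k ℕ.* 1)) (C2.trans (M-cong (k ℕ.* 1) (k ℕ.* 1) (UR.trans (UR.*-congˡ (one^ k)) (UR.*-identityʳ c)))
      (M-≡ c (ℕP.*-identityʳ k) (ℕP.*-identityʳ k)))))
    where
    one^ : ∀ k → UR.1# UX.^ k UR.≈ UR.1#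
    one^ zero = UR.refl
    one^ (suc k) = UR.trans (UR.*-identityˡ _) (one^ k)

  module ιX = HomX ι.evHom

  module Δdiag = ι.Extraction diag diag-cong (λ _ _ _ → UR.refl)
    (λ c f n → UR.trans (P2.C-conv (P1.C c) f n n) (P1.C-conv c (f n) n))
    (λ f → P2.mon-below (P1.mon UR.1# 1) 1 f 0 (ℕ.s≤s ℕ.z≤n) 0)
    (λ f n → UR.trans (P2.mon-shift (P1.mon UR.1# 1) 1 f n (suc n)) (UR.trans (P1.mon-shift UR.1# 1 (f n) n) (UR.*-identityˡ _)))

  Lim-ιQ : ∀ m {q} → q C2.≈ M UR.1# (suc m) (suc m) → P2.Lim (λ N → X2.Π< N (λ j → C2.1# C2.- q X2.^ suc j)) (ι.ev (Q (suc m)))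
  Lim-ιQ m {q} e = P2.Lim-cong (λ N → C2.trans (ιX.hom-Π N (qFactor (suc m))) (X2.Π<-cong N factor)) (ι.ev-Lim (Lim-Q m))
    where
    one^ : ∀ k → UR.1# UX.^ k UR.≈ UR.1#
    one^ zero = UR.refl
    one^ (suc k) = UR.trans (UR.*-identityˡ _) (one^ k)
    factor : ∀ j → ι.ev (qFactor (suc m) j) C2.≈ C2.1# C2.- q X2.^ suc j
    factor j = C2.trans (ιX.hom-sub C1.1# (P1.mon UR.1# (suc m ℕ.* suc j))) (C2.+-cong (RingHom.hom-1 ι.evHom) (C2.-‿cong
      (C2.trans (ι-mon UR.1# (suc m ℕ.* suc j)) (C2.trans (M-≡ UR.1# (ℕP.*-comm (suc m) (suc j)) (ℕP.*-comm (suc m) (suc j)))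
        (C2.sym (C2.trans (X2.^-congˡ (suc j) e) (C2.trans (M-^ UR.1# (suc m) (suc m) (suc j)) (M-cong (suc j ℕ.* suc m) (suc j ℕ.* suc m) (one^ (suc j))))))))))

  module ThetaSeries (g : UR.Carrier) where
    -- x = gᵖ xᵃ yᵇ and y = gʳ xᶜ yᵈ in Jacobi's triple product, with gᵖ gʳ = 1 and xy of the form (xy)^(1 + m).
    module _ (p r a b c d m : ℕ) (unit : g UX.^ p UR.* g UX.^ r UR.≈ UR.1#) (ac : a ℕ.+ c ≡ suc m) (bd : b ℕ.+ d ≡ suc m) where
      private
        x y : P2.Series
        x = M (g UX.^ p) a b
        y = M (g UX.^ r) c d

        pos : 1 ℕ.≤ a ℕ.+ c
        pos = ≡.subst (1 ℕ.≤_) (≡.sym ac) (ℕ.s≤s ℕ.z≤n)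

        power : ∀ m n → x X2.^ m C2.* y X2.^ n C2.≈ M (g UX.^ (m ℕ.* p ℕ.+ n ℕ.* r)) (m ℕ.* a ℕ.+ n ℕ.* c) (m ℕ.* b ℕ.+ n ℕ.* d)
        power m n = C2.trans (C2.*-cong (M-^ _ a b m) (M-^ _ c d n)) (C2.trans (M-* ((g UX.^ p) UX.^ m) (m ℕ.* a) (m ℕ.* b) ((g UX.^ r) UX.^ n) (n ℕ.* c) (n ℕ.* d))
          (M-cong (m ℕ.* a ℕ.+ n ℕ.* c) (m ℕ.* b ℕ.+ n ℕ.* d) (UR.trans (UR.*-cong (exp p m) (exp r n)) (UR.sym (UX.^-homo-* g (m ℕ.* p) (n ℕ.* r))))))
          where
          exp : ∀ p m → (g UX.^ p) UX.^ m UR.≈ g UX.^ (m ℕ.* p)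
          exp p m = UR.trans (UX.^-assocʳ g p m) (UR.reflexive (≡.cong (g UX.^_) (ℕP.*-comm p m)))

        xy-eq : x C2.* y C2.≈ M UR.1# (suc m) (suc m)
        xy-eq = C2.trans (M-* (g UX.^ p) a b (g UX.^ r) c d) (C2.trans (M-cong (a ℕ.+ c) (b ℕ.+ d) unit) (M-≡ UR.1# ac bd))

      thetaX thetaY : ℕ → P2.Series
      thetaX j = M (g UX.^ (suc j ℕ.* p ℕ.+ j ℕ.* r)) (suc j ℕ.* a ℕ.+ j ℕ.* c) (suc j ℕ.* b ℕ.+ j ℕ.* d)
      thetaY j = M (g UX.^ (j ℕ.* p ℕ.+ suc j ℕ.* r)) (j ℕ.* a ℕ.+ suc j ℕ.* c) (j ℕ.* b ℕ.+ suc j ℕ.* d)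

      productX productY : P2.Series
      productX = P2.limit (λ N → X2.Π< N (λ j → C2.1# C2.+ thetaX j))
      productY = P2.limit (λ N → X2.Π< N (λ j → C2.1# C2.+ thetaY j))

      Lim-productX : P2.Lim (λ N → X2.Π< N (λ j → C2.1# C2.+ thetaX j)) productX
      Lim-productX = P2.Lim-Π {thetaX} (λ j → P2.O-weaken {f = thetaX j}
        (J2.weighted-≥ a c j pos (ℕP.n≤1+n j) ℕP.≤-refl) (P2.O-mon _ (suc j ℕ.* a ℕ.+ j ℕ.* c)))

      Lim-productY : P2.Lim (λ N → X2.Π< N (λ j → C2.1# C2.+ thetaY j)) productY
      Lim-productY = P2.Lim-Π {thetaY} (λ j → P2.O-weaken {f = thetaY j}
        (J2.weighted-≥ a c j pos ℕP.≤-refl (ℕP.n≤1+n j)) (P2.O-mon _ (j ℕ.* a ℕ.+ suc j ℕ.* c)))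

      theta-sum : S2.HasSum (λ z → M (g UX.^ wt p r z) (wt a c z) (wt b d z)) (ι.ev (Q (suc m)) C2.* (productX C2.* productY))
      theta-sum = S2.HasSum-cong (λ z → power (triℤ z) (triℤ (ℤ.- z)))
        (C2.*-congˡ (C2.*-cong
          (P2.Lim-unique (J2.Lim-xProduct ox oy pos) (P2.Lim-cong (λ N → X2.Π<-cong N (λ j → C2.+-congˡ (C2.sym (power (suc j) j)))) Lim-productX))
          (P2.Lim-unique (J2.Lim-yProduct ox oy pos) (P2.Lim-cong (λ N → X2.Π<-cong N (λ j → C2.+-congˡ (C2.sym (power j (suc j))))) Lim-productY))))
        (J2.jacobi ox oy pos (Lim-ιQ m xy-eq))
        where
        ox : P2.O a x
        ox = P2.O-mon _ a
        oy : P2.O c y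
        oy = P2.O-mon _ c

-- The adjoined elements: a fifth root of unity and a unit close to 1.

module Cyclo where
  -- The axiom is Φ₅(ζ) = 0 rather than ζ⁵ = 1: it is the sum of the five powers that must vanish,
  -- and ζ - 1 could not be cancelled to obtain this.
  record FifthRoot (U : CommutativeRing 0ℓ 0ℓ) : Set where
    open CommutativeRing U using (Carrier; 1#; 0#; _+_; _≈_)
    open RingX U using (_^_)
    field
      ζ : Carrier
      Φ₅ : 1# + ζ + ζ ^ 2 + ζ ^ 3 + ζ ^ 4 ≈ 0#

  module Quintic (R : CommutativeRing 0ℓ 0ℓ) where
    open CommutativeRing R
    open RingX R

    -- The two sides differ by Φ₅(z) times an explicit polynomial, which the solver confirms.
    quintic : ∀ z t → 1# + z + z ^ 2 + z ^ 3 + z ^ 4 ≈ 0# →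
      (1# + t) * ((1# + z * t) * ((1# + z ^ 2 * t) * ((1# + z ^ 3 * t) * (1# + z ^ 4 * t)))) ≈ 1# + t ^ 5
    quintic z t e = trans (solve 2 (λ z t →
        (con (+ 1) :+ t) :* ((con (+ 1) :+ z :* t) :* ((con (+ 1) :+ z :^ 2 :* t) :* ((con (+ 1) :+ z :^ 3 :* t) :* (con (+ 1) :+ z :^ 4 :* t)))) :=
        con (+ 1) :+ t :^ 5 :+ (con (+ 1) :+ z :+ z :^ 2 :+ z :^ 3 :+ z :^ 4) :*
          (t :+ t :^ 2 :* (z :^ 3 :+ z) :+ t :^ 3 :* (z :^ 5 :+ z :^ 3) :+ t :^ 4 :* z :^ 6 :+ t :^ 5 :* (z :^ 6 :- z :^ 5 :+ z :- con (+ 1)))) refl z t)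
      (trans (+-congˡ (trans (*-congʳ e) (zeroˡ _))) (+-identityʳ _))

  -- A unit u with u + u⁻¹ = 2 + δ, δ² = 0, that is u = 1 + ε with ε³ = 0.
  record DualUnit (V : CommutativeRing 0ℓ 0ℓ) : Set where
    open CommutativeRing V
    field
      u v δ : Carrier
      uv : u * v ≈ 1#
      u+v : u + v ≈ 1# + 1# + δ
      δδ : δ * δ ≈ 0#

-- Theta series twisted by powers of ζ, and their product.

module Theta (U : CommutativeRing 0ℓ 0ℓ) (root : Cyclo.FifthRoot U) where
  open Cyclo.FifthRoot root using (ζ; Φ₅)
  open Jacobi
  open LatticeZ
  open Ev
  open Base U public

  -- ζ⁵ − 1 = (ζ − 1) Φ₅(ζ)
  ζ⁵ : ζ UX.^ 5 UR.≈ UR.1#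
  ζ⁵ = UR.trans (UX.solve 1 (λ z → z UX.:^ 5 UX.:= UX.con (+ 1) UX.:+ (z UX.:- UX.con (+ 1)) UX.:* (UX.con (+ 1) UX.:+ z UX.:+ z UX.:^ 2 UX.:+ z UX.:^ 3 UX.:+ z UX.:^ 4)) UR.refl ζ)
    (UR.trans (UR.+-congˡ (UR.trans (UR.*-congˡ Φ₅) (UR.zeroʳ _))) (UR.+-identityʳ _))

  ζ^5* : ∀ n → ζ UX.^ (5 ℕ.* n) UR.≈ UR.1#
  ζ^5* n = UR.trans (UR.sym (UX.^-assocʳ ζ 5 n)) (UR.trans (UX.^-congˡ n ζ⁵) (one^ n))
    where
    one^ : ∀ k → UR.1# UX.^ k UR.≈ UR.1#
    one^ zero = UR.refl
    one^ (suc k) = UR.trans (UR.*-identityˡ _) (one^ k)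

  ζ^+5* : ∀ m n → ζ UX.^ (m ℕ.+ 5 ℕ.* n) UR.≈ ζ UX.^ m
  ζ^+5* m n = UR.trans (UX.^-homo-* ζ m (5 ℕ.* n)) (UR.trans (UR.*-congˡ (ζ^5* n)) (UR.*-identityʳ _))

  ζ^% : ∀ n → ζ UX.^ n UR.≈ ζ UX.^ (n ℕ.% 5)
  ζ^% n = UR.trans (UR.reflexive (≡.cong (ζ UX.^_) (≡.trans (ℕD.m≡m%n+[m/n]*n n 5) (≡.cong (n ℕ.% 5 ℕ.+_) (ℕP.*-comm (n ℕ./ 5) 5))))) (ζ^+5* (n ℕ.% 5) (n ℕ./ 5))

  open ThetaSeries ζ
  private module Q2 = Cyclo.Quintic R2

  module _ where
    open X2 using (solve; _:=_; _:*_; _:^_)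
    open C2

    regroup5 : ∀ q x₀ x₁ x₂ x₃ x₄ y₀ y₁ y₂ y₃ y₄ →
      (q * (x₀ * y₀)) * ((q * (x₁ * y₁)) * ((q * (x₂ * y₂)) * ((q * (x₃ * y₃)) * (q * (x₄ * y₄))))) ≈
      q X2.^ 5 * ((x₀ * (x₁ * (x₂ * (x₃ * x₄)))) * (y₀ * (y₁ * (y₂ * (y₃ * y₄)))))
    regroup5 q x₀ x₁ x₂ x₃ x₄ y₀ y₁ y₂ y₃ y₄ =
      trans (*-congˡ (trans (*-congˡ (trans (*-congˡ (pair q q x₃ y₃ x₄ y₄)) (pair q _ x₂ y₂ _ _))) (pair q _ x₁ y₁ _ _)))
        (trans (pair q _ x₀ y₀ _ _) (*-congʳ (solve 1 (λ q → q :* (q :* (q :* (q :* q))) := q :^ 5) refl q)))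
      where
      pair : ∀ q r x y x′ y′ → (q * (x * y)) * (r * (x′ * y′)) ≈ (q * r) * ((x * x′) * (y * y′))
      pair = solve 6 (λ q r x y x′ y′ → (q :* (x :* y)) :* (r :* (x′ :* y′)) := (q :* r) :* ((x :* x′) :* (y :* y′))) refl

  ℤ⁵-≟ : DecidableEquality ℤ⁵
  ℤ⁵-≟ = ×P.≡-dec ℤ._≟_ (×P.≡-dec ℤ._≟_ (×P.≡-dec ℤ._≟_ (×P.≡-dec ℤ._≟_ ℤ._≟_)))

  theta5 : ∀ {e₀ e₁ e₂ e₃ e₄ k₀ k₁ k₂ k₃ k₄ l₀ l₁ l₂ l₃ l₄ : ℤ → ℕ} {s₀ s₁ s₂ s₃ s₄} →
    S2.HasSum (λ z → M (ζ UX.^ e₀ z) (k₀ z) (l₀ z)) s₀ → S2.HasSum (λ z → M (ζ UX.^ e₁ z) (k₁ z) (l₁ z)) s₁ →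
    S2.HasSum (λ z → M (ζ UX.^ e₂ z) (k₂ z) (l₂ z)) s₂ → S2.HasSum (λ z → M (ζ UX.^ e₃ z) (k₃ z) (l₃ z)) s₃ →
    S2.HasSum (λ z → M (ζ UX.^ e₄ z) (k₄ z) (l₄ z)) s₄ →
    S2.HasSum (λ ((a , b , c , d , e) : ℤ⁵) → M (ζ UX.^ (e₀ a ℕ.+ (e₁ b ℕ.+ (e₂ c ℕ.+ (e₃ d ℕ.+ e₄ e)))))
        (k₀ a ℕ.+ (k₁ b ℕ.+ (k₂ c ℕ.+ (k₃ d ℕ.+ k₄ e)))) (l₀ a ℕ.+ (l₁ b ℕ.+ (l₂ c ℕ.+ (l₃ d ℕ.+ l₄ e)))))
      (s₀ C2.* (s₁ C2.* (s₂ C2.* (s₃ C2.* s₄))))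
  theta5 {e₀} {e₁} {e₂} {e₃} {e₄} {k₀} {k₁} {k₂} {k₃} {k₄} {l₀} {l₁} {l₂} {l₃} {l₄} p₀ p₁ p₂ p₃ p₄ =
    S2.HasSum-cong
      (λ (a , b , c , d , e) → C2.trans (C2.*-congˡ (C2.trans (C2.*-congˡ (C2.trans (C2.*-congˡ
          (mul (e₃ d) (k₃ d) (l₃ d) (e₄ e) (k₄ e) (l₄ e))) (mul (e₂ c) (k₂ c) (l₂ c) _ _ _))) (mul (e₁ b) (k₁ b) (l₁ b) _ _ _))) (mul (e₀ a) (k₀ a) (l₀ a) _ _ _))
      C2.refl
      (S2.HasSum-* ℤ._≟_ p₀ (S2.HasSum-* ℤ._≟_ p₁ (S2.HasSum-* ℤ._≟_ p₂ (S2.HasSum-* ℤ._≟_ p₃ p₄))))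
    where
    mul : ∀ e k l e′ k′ l′ → M (ζ UX.^ e) k l C2.* M (ζ UX.^ e′) k′ l′ C2.≈ M (ζ UX.^ (e ℕ.+ e′)) (k ℕ.+ k′) (l ℕ.+ l′)
    mul e k l e′ k′ l′ = C2.trans (M-* _ k l _ k′ l′) (M-cong (k ℕ.+ k′) (l ℕ.+ l′) (UR.sym (UX.^-homo-* ζ e e′)))

  unit-0 : UR.1# UR.* UR.1# UR.≈ UR.1#
  unit-0 = UR.*-identityʳ _

  module T1 where
    X Y : P2.Series
    X = productX 0 0 1 0 0 1 0 unit-0 ≡.refl ≡.refl
    Y = productY 0 0 1 0 0 1 0 unit-0 ≡.refl ≡.refl
    sum₁ : S2.HasSum (λ z → M (ζ UX.^ wt 0 0 z) (wt 1 0 z) (wt 0 1 z)) (ι.ev (Q 1) C2.* (X C2.* Y))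
    sum₁ = theta-sum 0 0 1 0 0 1 0 unit-0 ≡.refl ≡.refl

  module T5 where
    X Y : P2.Series
    X = productX 0 0 5 0 0 5 4 unit-0 ≡.refl ≡.refl
    Y = productY 0 0 5 0 0 5 4 unit-0 ≡.refl ≡.refl
    sum₅ : S2.HasSum (λ z → M (ζ UX.^ wt 0 0 z) (wt 5 0 z) (wt 0 5 z)) (ι.ev (Q 5) C2.* (X C2.* Y))
    sum₅ = theta-sum 0 0 5 0 0 5 4 unit-0 ≡.refl ≡.refl

  wt00 : ∀ z → wt 0 0 z ≡ 0
  wt00 z = ≡.cong₂ ℕ._+_ (ℕP.*-zeroʳ (triℤ z)) (ℕP.*-zeroʳ (triℤ (ℤ.- z)))

  -- As T(z) - T(-z) = z, the two exponents agree for z = 0 alone. Once five products are regrouped,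
  -- it is such a theta series that remains under the diagonal, and it disappears.
  diag-theta : ∀ m {s} → S2.HasSum (λ z → M (ζ UX.^ wt 0 0 z) (wt (suc m) 0 z) (wt 0 (suc m) z)) s → diag s C1.≈ C1.1#
  diag-theta m h = S1.HasSum-unique ℤ._≟_ (diag-HasSum h)
    (S1.HasSum-cong (λ _ → C1.refl) (diag-M-≡ UR.1# 0) (S1.HasSum-point (+ 0) (λ z z≢0 → diag-M-≢ _ _ _ (λ e → z≢0 (only-zero z e)))))
    where
    only-zero : ∀ z → wt (suc m) 0 z ≡ wt 0 (suc m) z → z ≡ + 0
    only-zero z e = ≡.trans (shape (+ triℤ (ℤ.- z)) z) (≡.trans (≡.cong (ℤ._- + triℤ (ℤ.- z)) (≡.trans (≡.sym (tri-diff z)) (≡.cong +_ tri-eq))) (ℤP.+-inverseʳ (+ triℤ (ℤ.- z))))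
      where
      shape : ∀ t z → z ≡ (t ℤ.+ z) ℤ.- t
      shape = ℤS.solve-∀
      tri-eq : triℤ z ≡ triℤ (ℤ.- z)
      tri-eq = ℕP.*-cancelʳ-≡ (triℤ z) (triℤ (ℤ.- z)) (suc m)
        (≡.trans (≡.sym (ℕP.+-identityʳ _)) (≡.trans (≡.cong (triℤ z ℕ.* suc m ℕ.+_) (≡.sym (ℕP.*-zeroʳ (triℤ (ℤ.- z)))))
          (≡.trans e (≡.cong (ℕ._+ triℤ (ℤ.- z) ℕ.* suc m) (ℕP.*-zeroʳ (triℤ z))))))

  unit-ζ : ∀ i → ζ UX.^ i UR.* ζ UX.^ (4 ℕ.* i) UR.≈ UR.1#
  unit-ζ i = UR.trans (UR.sym (UX.^-homo-* ζ i (4 ℕ.* i))) (ζ^5* i)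

  ẑ : P2.Series
  ẑ = M ζ 0 0

  ẑ-Φ₅ : C2.1# C2.+ ẑ C2.+ ẑ X2.^ 2 C2.+ ẑ X2.^ 3 C2.+ ẑ X2.^ 4 C2.≈ C2.0#
  ẑ-Φ₅ = C2.trans (C2.sym (C2.trans (h.hom-+ (UR.1# UR.+ ζ UR.+ ζ UX.^ 2 UR.+ ζ UX.^ 3) (ζ UX.^ 4))
      (C2.+-cong (C2.trans (h.hom-+ (UR.1# UR.+ ζ UR.+ ζ UX.^ 2) (ζ UX.^ 3))
        (C2.+-cong (C2.trans (h.hom-+ (UR.1# UR.+ ζ) (ζ UX.^ 2)) (C2.+-cong (h.hom-+ UR.1# ζ) (hX.hom-^ ζ 2))) (hX.hom-^ ζ 3))) (hX.hom-^ ζ 4))))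
    (C2.trans (h.cong Φ₅) h.hom-0)
    where
    module h = RingHom const₂
    module hX = HomX const₂

  as-ẑ : ∀ r n {e k l k′ l′} → e ≡ r ℕ.+ 5 ℕ.* n → k ≡ k′ → l ≡ l′ → M (ζ UX.^ e) k l C2.≈ ẑ X2.^ r C2.* M UR.1# k′ l′
  as-ẑ r n {e} {k} {l} ≡.refl ≡.refl ≡.refl = C2.sym (C2.trans (C2.*-congʳ (M-^ ζ 0 0 r)) (C2.trans (M-* (ζ UX.^ r) (r ℕ.* 0) (r ℕ.* 0) UR.1# k l)
    (C2.trans (M-cong (r ℕ.* 0 ℕ.+ k) (r ℕ.* 0 ℕ.+ l) (UR.trans (UR.*-identityʳ _) (UR.sym (ζ^+5* r n))))
      (M-≡ _ (≡.cong (ℕ._+ k) (ℕP.*-zeroʳ r)) (≡.cong (ℕ._+ l) (ℕP.*-zeroʳ r))))))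

  wt10 : ∀ z → wt 1 0 z ≡ triℤ z
  wt10 z = ≡.trans (≡.cong₂ ℕ._+_ (ℕP.*-identityʳ (triℤ z)) (ℕP.*-zeroʳ (triℤ (ℤ.- z)))) (ℕP.+-identityʳ (triℤ z))

  wt01 : ∀ z → wt 0 1 z ≡ triℤ (ℤ.- z)
  wt01 z = ≡.cong₂ ℕ._+_ (ℕP.*-zeroʳ (triℤ z)) (ℕP.*-identityʳ (triℤ (ℤ.- z)))

  tri⁻ : ℤ → ℕ
  tri⁻ z = triℤ (ℤ.- z)

  module TH (i : ℕ) where
    X Y : P2.Series
    X = productX i (4 ℕ.* i) 1 0 0 1 0 (unit-ζ i) ≡.refl ≡.refl
    Y = productY i (4 ℕ.* i) 1 0 0 1 0 (unit-ζ i) ≡.refl ≡.refl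
    sumᵢ : S2.HasSum (λ z → M (ζ UX.^ wt i (4 ℕ.* i) z) (triℤ z) (triℤ (ℤ.- z))) (ι.ev (Q 1) C2.* (X C2.* Y))
    sumᵢ = S2.HasSum-cong (λ z → M-≡ (ζ UX.^ wt i (4 ℕ.* i) z) (wt10 z) (wt01 z)) C2.refl (theta-sum i (4 ℕ.* i) 1 0 0 1 0 (unit-ζ i) ≡.refl ≡.refl)

    Xfactor : ∀ j → C2.1# C2.+ thetaX i (4 ℕ.* i) 1 0 0 1 0 (unit-ζ i) ≡.refl ≡.refl j C2.≈ C2.1# C2.+ ẑ X2.^ i C2.* M UR.1# (suc j) j
    Xfactor j = C2.+-congˡ (as-ẑ i (i ℕ.* j) (e i j) (k j) (l j))
      where
      e : ∀ i j → suc j ℕ.* i ℕ.+ j ℕ.* (4 ℕ.* i) ≡ i ℕ.+ 5 ℕ.* (i ℕ.* j)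
      e = ℕS.solve-∀
      k : ∀ j → suc j ℕ.* 1 ℕ.+ j ℕ.* 0 ≡ suc j
      k = ℕS.solve-∀
      l : ∀ j → suc j ℕ.* 0 ℕ.+ j ℕ.* 1 ≡ j
      l = ℕS.solve-∀

    -- r is the exponent 4 i reduced modulo 5 and n the quotient.
    Yfactor : ∀ r n → 4 ℕ.* i ≡ r ℕ.+ 5 ℕ.* n → ∀ j →
      C2.1# C2.+ thetaY i (4 ℕ.* i) 1 0 0 1 0 (unit-ζ i) ≡.refl ≡.refl j C2.≈ C2.1# C2.+ ẑ X2.^ r C2.* M UR.1# j (suc j)
    Yfactor r n 4i j = C2.+-congˡ (as-ẑ r (n ℕ.+ i ℕ.* j) (≡.trans (e i j) (≡.trans (≡.cong (ℕ._+ 5 ℕ.* (i ℕ.* j)) 4i) (e′ r n (i ℕ.* j)))) (k j) (l j))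
      where
      e : ∀ i j → j ℕ.* i ℕ.+ suc j ℕ.* (4 ℕ.* i) ≡ 4 ℕ.* i ℕ.+ 5 ℕ.* (i ℕ.* j)
      e = ℕS.solve-∀
      e′ : ∀ r n m → (r ℕ.+ 5 ℕ.* n) ℕ.+ 5 ℕ.* m ≡ r ℕ.+ 5 ℕ.* (n ℕ.+ m)
      e′ = ℕS.solve-∀
      k : ∀ j → j ℕ.* 1 ℕ.+ suc j ℕ.* 0 ≡ j
      k = ℕS.solve-∀
      l : ∀ j → j ℕ.* 0 ℕ.+ suc j ℕ.* 1 ≡ suc j
      l = ℕS.solve-∀

  private
    Lim-Xᵢ : ∀ i → P2.Lim (λ N → X2.Π< N (λ j → C2.1# C2.+ ẑ X2.^ i C2.* M UR.1# (suc j) j)) (TH.X i)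
    Lim-Xᵢ i = P2.Lim-cong (λ N → X2.Π<-cong N (TH.Xfactor i)) (Lim-productX i (4 ℕ.* i) 1 0 0 1 0 (unit-ζ i) ≡.refl ≡.refl)

    Lim-Yᵢ : ∀ i r n → 4 ℕ.* i ≡ r ℕ.+ 5 ℕ.* n → P2.Lim (λ N → X2.Π< N (λ j → C2.1# C2.+ ẑ X2.^ r C2.* M UR.1# j (suc j))) (TH.Y i)
    Lim-Yᵢ i r n e = P2.Lim-cong (λ N → X2.Π<-cong N (TH.Yfactor i r n e)) (Lim-productY i (4 ℕ.* i) 1 0 0 1 0 (unit-ζ i) ≡.refl ≡.refl)

    fifth : ∀ k l → M UR.1# k l X2.^ 5 C2.≈ M (ζ UX.^ 0) (5 ℕ.* k) (5 ℕ.* l)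
    fifth k l = C2.trans (M-^ UR.1# k l 5) (M-cong (5 ℕ.* k) (5 ℕ.* l) (UX.solve 0 (UX.con (+ 1) UX.:^ 5 UX.:= UX.con (+ 1)) UR.refl))

    five : ∀ k l → let t = M UR.1# k l in
      (C2.1# C2.+ ẑ X2.^ 0 C2.* t) C2.* ((C2.1# C2.+ ẑ X2.^ 1 C2.* t) C2.* ((C2.1# C2.+ ẑ X2.^ 2 C2.* t) C2.* ((C2.1# C2.+ ẑ X2.^ 3 C2.* t) C2.* (C2.1# C2.+ ẑ X2.^ 4 C2.* t))))
      C2.≈ C2.1# C2.+ M (ζ UX.^ 0) (5 ℕ.* k) (5 ℕ.* l)
    five k l = C2.trans
      (X2.solve 2 (λ z t → (one X2.:+ z X2.:^ 0 X2.:* t) X2.:* ((one X2.:+ z X2.:^ 1 X2.:* t) X2.:* ((one X2.:+ z X2.:^ 2 X2.:* t) X2.:* ((one X2.:+ z X2.:^ 3 X2.:* t) X2.:* (one X2.:+ z X2.:^ 4 X2.:* t))))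
        X2.:= (one X2.:+ t) X2.:* ((one X2.:+ z X2.:* t) X2.:* ((one X2.:+ z X2.:^ 2 X2.:* t) X2.:* ((one X2.:+ z X2.:^ 3 X2.:* t) X2.:* (one X2.:+ z X2.:^ 4 X2.:* t))))) C2.refl ẑ t)
      (C2.trans (Q2.quintic ẑ t ẑ-Φ₅) (C2.+-congˡ (fifth k l)))
      where
      t = M UR.1# k l
      one : ∀ {n} → X2.Polynomial n
      one = X2.con (+ 1)

    shift5 : ∀ e k l → e ≡ 0 → ∀ {k′ l′} → k ≡ k′ → l ≡ l′ → C2.1# C2.+ M (ζ UX.^ e) k l C2.≈ C2.1# C2.+ M (ζ UX.^ 0) k′ l′
    shift5 .0 k l ≡.refl ≡.refl ≡.refl = C2.refl

    zero-sum : ∀ m n → m ℕ.* 0 ℕ.+ n ℕ.* 0 ≡ 0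
    zero-sum m n = ≡.cong₂ ℕ._+_ (ℕP.*-zeroʳ m) (ℕP.*-zeroʳ n)

    ΠXᵢ : TH.X 0 C2.* (TH.X 1 C2.* (TH.X 2 C2.* (TH.X 3 C2.* TH.X 4))) C2.≈ T5.X
    ΠXᵢ = P2.Lim-Π5 (Lim-Xᵢ 0) (Lim-Xᵢ 1) (Lim-Xᵢ 2) (Lim-Xᵢ 3) (Lim-Xᵢ 4) (λ j → five (suc j) j)
      (P2.Lim-cong (λ N → X2.Π<-cong N (λ j → shift5 _ _ _ (zero-sum (suc j) j) (k j) (l j))) (Lim-productX 0 0 5 0 0 5 4 unit-0 ≡.refl ≡.refl))
      where
      k : ∀ j → suc j ℕ.* 5 ℕ.+ j ℕ.* 0 ≡ 5 ℕ.* suc j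
      k = ℕS.solve-∀
      l : ∀ j → suc j ℕ.* 0 ℕ.+ j ℕ.* 5 ≡ 5 ℕ.* j
      l = ℕS.solve-∀

    ΠYᵢ : TH.Y 0 C2.* (TH.Y 1 C2.* (TH.Y 2 C2.* (TH.Y 3 C2.* TH.Y 4))) C2.≈ T5.Y
    ΠYᵢ = P2.Lim-Π5 (Lim-Yᵢ 0 0 0 ≡.refl) (Lim-Yᵢ 1 4 0 ≡.refl) (Lim-Yᵢ 2 3 1 ≡.refl) (Lim-Yᵢ 3 2 2 ≡.refl) (Lim-Yᵢ 4 1 3 ≡.refl)
      -- For i = 0, ..., 4 the exponents 4 i reduce to 0, 4, 3, 2, 1, hence the reversal.
      (λ j → C2.trans (reverse _ _ _ _ _) (five j (suc j)))
      (P2.Lim-cong (λ N → X2.Π<-cong N (λ j → shift5 _ _ _ (zero-sum j (suc j)) (k j) (l j))) (Lim-productY 0 0 5 0 0 5 4 unit-0 ≡.refl ≡.refl))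
      where
      k : ∀ j → j ℕ.* 5 ℕ.+ suc j ℕ.* 0 ≡ 5 ℕ.* j
      k = ℕS.solve-∀
      l : ∀ j → j ℕ.* 0 ℕ.+ suc j ℕ.* 5 ≡ 5 ℕ.* suc j
      l = ℕS.solve-∀
      reverse : ∀ a b c d e → a C2.* (b C2.* (c C2.* (d C2.* e))) C2.≈ a C2.* (e C2.* (d C2.* (c C2.* b)))
      reverse = X2.solve 5 (λ a b c d e → a X2.:* (b X2.:* (c X2.:* (d X2.:* e))) X2.:= a X2.:* (e X2.:* (d X2.:* (c X2.:* b)))) C2.refl

    q₁ q₅ : P2.Series
    q₁ = ι.ev (Q 1)
    q₅ = ι.ev (Q 5)

  -- Σ ζ^(Σ i wᵢ) over A₄
  module Twisted where
    total : P2.Series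
    total = (q₁ C2.* (TH.X 0 C2.* TH.Y 0)) C2.* ((q₁ C2.* (TH.X 1 C2.* TH.Y 1)) C2.* ((q₁ C2.* (TH.X 2 C2.* TH.Y 2)) C2.*
      ((q₁ C2.* (TH.X 3 C2.* TH.Y 3)) C2.* (q₁ C2.* (TH.X 4 C2.* TH.Y 4)))))

    H : P1.Series
    H = diag total

    H-sum : S1.HasSum (λ w → diag (M (ζ UX.^ eζ w) (kC w) (lC w))) H
    H-sum = diag-HasSum (theta5 {wt 0 0} {wt 1 4} {wt 2 8} {wt 3 12} {wt 4 16}
      {triℤ} {triℤ} {triℤ} {triℤ} {triℤ} {tri⁻} {tri⁻} {tri⁻} {tri⁻} {tri⁻}
      (TH.sumᵢ 0) (TH.sumᵢ 1) (TH.sumᵢ 2) (TH.sumᵢ 3) (TH.sumᵢ 4))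

    -- `Q 5` enters the diagonal as a series in xy. By the quintic factorisation the ten twisted
    -- products become those of x⁵ and y⁵; together with `Q 5` they form a single theta series of
    -- diagonal 1, and only the five factors (q; q) remain.
    H-product : H C1.* Q 5 C1.≈ Q 1 X1.^ 5
    H-product = C1.trans (C1.sym (Δdiag.Δ-* total (Q 5)))
      (C1.trans (diag-cong (C2.trans (C2.*-congʳ (C2.trans (regroup5 q₁ _ _ _ _ _ _ _ _ _ _) (C2.*-congˡ (C2.*-cong ΠXᵢ ΠYᵢ))))
          (C2.trans (X2.solve 3 (λ a b c → (a X2.:* b) X2.:* c X2.:= (c X2.:* b) X2.:* a) C2.refl (q₁ X2.^ 5) (T5.X C2.* T5.Y) q₅)
            (C2.*-congˡ (C2.sym (ιX.hom-^ (Q 1) 5))))))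
        (C1.trans (Δdiag.Δ-* (q₅ C2.* (T5.X C2.* T5.Y)) (Q 1 X1.^ 5)) (C1.trans (C1.*-congʳ (diag-theta 4 T5.sum₅)) (C1.*-identityˡ _))))

-- The theta series of A₄, decomposed by residue classes.

module LatticeSum (U : CommutativeRing 0ℓ 0ℓ) (root : Cyclo.FifthRoot U) where
  open Cyclo.FifthRoot root using (ζ; Φ₅)
  open Jacobi
  open LatticeZ
  open Theta U root public
  open ThetaSeries ζ

  factorX factorY : ℕ → P2.Series
  factorX j = C2.1# C2.+ M UR.1# (suc j) j
  factorY j = C2.1# C2.+ M UR.1# j (suc j)

  as-1 : ∀ {e k k′ l l′} → e ≡ 0 → k ≡ k′ → l ≡ l′ → C2.1# C2.+ M (ζ UX.^ e) k l C2.≈ C2.1# C2.+ M UR.1# k′ l′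
  as-1 ≡.refl ≡.refl ≡.refl = C2.refl

  zero-sum : ∀ m n → m ℕ.* 0 ℕ.+ n ℕ.* 0 ≡ 0
  zero-sum m n = ≡.cong₂ ℕ._+_ (ℕP.*-zeroʳ m) (ℕP.*-zeroʳ n)

  lim₁X : P2.Lim (λ N → X2.Π< N factorX) T1.X
  lim₁X = P2.Lim-cong (λ N → X2.Π<-cong N (λ j → as-1 (zero-sum (suc j) j) (k j) (l j))) (Lim-productX 0 0 1 0 0 1 0 unit-0 ≡.refl ≡.refl)
    where
    k : ∀ j → suc j ℕ.* 1 ℕ.+ j ℕ.* 0 ≡ suc j
    k = ℕS.solve-∀
    l : ∀ j → suc j ℕ.* 0 ℕ.+ j ℕ.* 1 ≡ j
    l = ℕS.solve-∀

  lim₁Y : P2.Lim (λ N → X2.Π< N factorY) T1.Y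
  lim₁Y = P2.Lim-cong (λ N → X2.Π<-cong N (λ j → as-1 (zero-sum j (suc j)) (k j) (l j))) (Lim-productY 0 0 1 0 0 1 0 unit-0 ≡.refl ≡.refl)
    where
    k : ∀ j → j ℕ.* 1 ℕ.+ suc j ℕ.* 0 ≡ j
    k = ℕS.solve-∀
    l : ∀ j → j ℕ.* 0 ℕ.+ suc j ℕ.* 1 ≡ suc j
    l = ℕS.solve-∀

  -- x (xy)ᵇ and y (xy)ᶜ with b + c = 4: one residue class modulo 5 of the factors of the product over x and y.
  module TG (b c : ℕ) (bc : suc b ℕ.+ c ≡ 5) (bc′ : b ℕ.+ suc c ≡ 5) where
    X Y : P2.Series
    X = productX 0 0 (suc b) b c (suc c) 4 unit-0 bc bc′
    Y = productY 0 0 (suc b) b c (suc c) 4 unit-0 bc bc′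

    sum-G : S2.HasSum (λ z → M (ζ UX.^ wt 0 0 z) (wt (suc b) c z) (wt b (suc c) z)) (ι.ev (Q 5) C2.* (X C2.* Y))
    sum-G = theta-sum 0 0 (suc b) b c (suc c) 4 unit-0 bc bc′

    private
      sum4 : b ℕ.+ c ≡ 4
      sum4 = ℕP.suc-injective bc

    lim-X : P2.Lim (λ N → X2.Π< N (λ j → factorX (b ℕ.+ j ℕ.* 5))) X
    lim-X = P2.Lim-cong (λ N → X2.Π<-cong N (λ j → as-1 (zero-sum (suc j) j)
        (≡.trans (k b c j) (≡.cong (λ t → suc (b ℕ.+ j ℕ.* suc t)) sum4)) (≡.trans (l b c j) (≡.cong (λ t → b ℕ.+ j ℕ.* suc t) sum4))))
      (Lim-productX 0 0 (suc b) b c (suc c) 4 unit-0 bc bc′)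
      where
      k : ∀ b c j → suc j ℕ.* suc b ℕ.+ j ℕ.* c ≡ suc (b ℕ.+ j ℕ.* suc (b ℕ.+ c))
      k = ℕS.solve-∀
      l : ∀ b c j → suc j ℕ.* b ℕ.+ j ℕ.* suc c ≡ b ℕ.+ j ℕ.* suc (b ℕ.+ c)
      l = ℕS.solve-∀

    lim-Y : P2.Lim (λ N → X2.Π< N (λ j → factorY (c ℕ.+ j ℕ.* 5))) Y
    lim-Y = P2.Lim-cong (λ N → X2.Π<-cong N (λ j → as-1 (zero-sum j (suc j))
        (≡.trans (k b c j) (≡.cong (λ t → c ℕ.+ j ℕ.* suc t) sum4)) (≡.trans (l b c j) (≡.cong (λ t → suc (c ℕ.+ j ℕ.* suc t)) sum4))))
      (Lim-productY 0 0 (suc b) b c (suc c) 4 unit-0 bc bc′)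
      where
      k : ∀ b c j → j ℕ.* suc b ℕ.+ suc j ℕ.* c ≡ c ℕ.+ j ℕ.* suc (b ℕ.+ c)
      k = ℕS.solve-∀
      l : ∀ b c j → j ℕ.* b ℕ.+ suc j ℕ.* suc c ≡ suc (c ℕ.+ j ℕ.* suc (b ℕ.+ c))
      l = ℕS.solve-∀

  module G₀ = TG 4 0 ≡.refl ≡.refl
  module G₁ = TG 3 1 ≡.refl ≡.refl
  module G₂ = TG 2 2 ≡.refl ≡.refl
  module G₃ = TG 1 3 ≡.refl ≡.refl
  module G₄ = TG 0 4 ≡.refl ≡.refl

  private
    by-residue : ∀ {f L} → P2.Lim (λ N → X2.Π< N f) L →
      P2.Lim (λ N → X2.Π< N (λ i → f (i ℕ.* 5) C2.* f (1 ℕ.+ i ℕ.* 5) C2.* f (2 ℕ.+ i ℕ.* 5) C2.* f (3 ℕ.+ i ℕ.* 5) C2.* f (4 ℕ.+ i ℕ.* 5))) L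
    by-residue {f} h = P2.Lim-cong (λ N → X2.Π<-5 N f) (P2.Lim-sub (ℕ._* 5) (λ N → ℕP.m≤m*n N 5) h)

    ΠX-G : G₀.X C2.* (G₁.X C2.* (G₂.X C2.* (G₃.X C2.* G₄.X))) C2.≈ T1.X
    -- `TG b c` collects the factors in x of index b and those in y of index c = 4 - b modulo 5. As
    -- b descends from 4, the factors in x come in reverse order and those in y do not.
    ΠX-G = P2.Lim-Π5 G₀.lim-X G₁.lim-X G₂.lim-X G₃.lim-X G₄.lim-X (λ _ → reverse _ _ _ _ _) (by-residue lim₁X)
      where
      reverse : ∀ a b c d e → a C2.* (b C2.* (c C2.* (d C2.* e))) C2.≈ e C2.* d C2.* c C2.* b C2.* a
      reverse = X2.solve 5 (λ a b c d e → a X2.:* (b X2.:* (c X2.:* (d X2.:* e))) X2.:= e X2.:* d X2.:* c X2.:* b X2.:* a) C2.refl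

    ΠY-G : G₀.Y C2.* (G₁.Y C2.* (G₂.Y C2.* (G₃.Y C2.* G₄.Y))) C2.≈ T1.Y
    ΠY-G = P2.Lim-Π5 G₀.lim-Y G₁.lim-Y G₂.lim-Y G₃.lim-Y G₄.lim-Y (λ _ → reassoc _ _ _ _ _) (by-residue lim₁Y)
      where
      reassoc : ∀ a b c d e → a C2.* (b C2.* (c C2.* (d C2.* e))) C2.≈ a C2.* b C2.* c C2.* d C2.* e
      reassoc = X2.solve 5 (λ a b c d e → a X2.:* (b X2.:* (c X2.:* (d X2.:* e))) X2.:= a X2.:* b X2.:* c X2.:* d X2.:* e) C2.refl

    q₁ q₅ : P2.Series
    q₁ = ι.ev (Q 1)
    q₅ = ι.ev (Q 5)

    zeros : ∀ (w : ℤ⁵) → let (a , b , c , d , e) = w in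
      wt 0 0 a ℕ.+ (wt 0 0 b ℕ.+ (wt 0 0 c ℕ.+ (wt 0 0 d ℕ.+ wt 0 0 e))) ≡ 0
    zeros (a , b , c , d , e) = ≡.cong₂ ℕ._+_ (wt00 a) (≡.cong₂ ℕ._+_ (wt00 b) (≡.cong₂ ℕ._+_ (wt00 c) (≡.cong₂ ℕ._+_ (wt00 d) (wt00 e))))

  module Cores where
    total : P2.Series
    total = (q₅ C2.* (G₀.X C2.* G₀.Y)) C2.* ((q₅ C2.* (G₁.X C2.* G₁.Y)) C2.* ((q₅ C2.* (G₂.X C2.* G₂.Y)) C2.*
      ((q₅ C2.* (G₃.X C2.* G₃.Y)) C2.* (q₅ C2.* (G₄.X C2.* G₄.Y)))))

    G : P1.Series
    G = diag total

    G-sum : S1.HasSum (λ w → diag (M UR.1# (kG w) (lG w))) G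
    G-sum = S1.HasSum-cong (λ w → diag-cong (M-cong (kG w) (lG w) (UR.reflexive (≡.cong (ζ UX.^_) (zeros w))))) C1.refl
      (diag-HasSum (theta5 {wt 0 0} {wt 0 0} {wt 0 0} {wt 0 0} {wt 0 0}
        {wt 5 0} {wt 4 1} {wt 3 2} {wt 2 3} {wt 1 4} {wt 4 1} {wt 3 2} {wt 2 3} {wt 1 4} {wt 0 5}
        G₀.sum-G G₁.sum-G G₂.sum-G G₃.sum-G G₄.sum-G))

    -- `H-product` with the roles of 1 and 5 exchanged: the five residue classes make up the full
    -- products in x and y, and `Q 1` completes them to a theta series of diagonal 1.
    G-product : G C1.* Q 1 C1.≈ Q 5 X1.^ 5
    G-product = C1.trans (C1.sym (Δdiag.Δ-* total (Q 1)))
      (C1.trans (diag-cong (C2.trans (C2.*-congʳ (C2.trans (regroup5 q₅ _ _ _ _ _ _ _ _ _ _) (C2.*-congˡ (C2.*-cong ΠX-G ΠY-G))))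
          (C2.trans (X2.solve 3 (λ a b c → (a X2.:* b) X2.:* c X2.:= (c X2.:* b) X2.:* a) C2.refl (q₅ X2.^ 5) (T1.X C2.* T1.Y) q₁)
            (C2.*-congˡ (C2.sym (ιX.hom-^ (Q 5) 5))))))
        (C1.trans (Δdiag.Δ-* (q₁ C2.* (T1.X C2.* T1.Y)) (Q 5 X1.^ 5)) (C1.trans (C1.*-congʳ (diag-theta 0 T1.sum₁)) (C1.*-identityˡ _))))

  module Frobenius where
    total : P2.Series
    total = let s = q₁ C2.* (T1.X C2.* T1.Y) in s C2.* (s C2.* (s C2.* (s C2.* s)))

    Θ : P1.Series
    Θ = diag total

    private
      sum₁ : S2.HasSum (λ z → M (ζ UX.^ wt 0 0 z) (triℤ z) (tri⁻ z)) (q₁ C2.* (T1.X C2.* T1.Y))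
      sum₁ = S2.HasSum-cong (λ z → M-≡ (ζ UX.^ wt 0 0 z) (wt10 z) (wt01 z)) C2.refl T1.sum₁

    Θ-sum : S1.HasSum (λ w → diag (M UR.1# (kC w) (lC w))) Θ
    Θ-sum = S1.HasSum-cong (λ w → diag-cong (M-cong (kC w) (lC w) (UR.reflexive (≡.cong (ζ UX.^_) (zeros w))))) C1.refl
      (diag-HasSum (theta5 {wt 0 0} {wt 0 0} {wt 0 0} {wt 0 0} {wt 0 0}
        {triℤ} {triℤ} {triℤ} {triℤ} {triℤ} {tri⁻} {tri⁻} {tri⁻} {tri⁻} {tri⁻} sum₁ sum₁ sum₁ sum₁ sum₁))

    -- The symbols are counted by the bare products. Moved inside the diagonal, (q; q)⁵ completes
    -- each of the five pairs of products to a theta series.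
    Θ-product : diag ((T1.X C2.* T1.Y) X2.^ 5) C1.* Q 1 X1.^ 5 C1.≈ Θ
    Θ-product = C1.trans (C1.sym (Δdiag.Δ-* ((T1.X C2.* T1.Y) X2.^ 5) (Q 1 X1.^ 5)))
      (diag-cong (C2.trans (C2.*-congˡ (ιX.hom-^ (Q 1) 5))
        (X2.solve 2 (λ q t → t X2.:^ 5 X2.:* q X2.:^ 5 X2.:= (q X2.:* t) X2.:* ((q X2.:* t) X2.:* ((q X2.:* t) X2.:* ((q X2.:* t) X2.:* (q X2.:* t)))))
          C2.refl q₁ (T1.X C2.* T1.Y))))

  open Cores using (G; G-sum; G-product) public
  open Twisted using (H; H-sum; H-product) public
  open Frobenius using (Θ; Θ-sum; Θ-product) public

  κ-≟ : DecidableEquality (ℕ × ℕ)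
  κ-≟ = ×P.≡-dec ℕ._≟_ ℕ._≟_

  -- The part of the theta series of A₄ on which (c₁ , c₂) takes the value κ modulo 5.
  ind : ℕ × ℕ → ℤ⁵ → P1.Series
  ind κ w with (S w ℤ.≟ + 0) ×-dec (κ-≟ (key w) κ)
  ... | yes _ = P1.mon UR.1# (kC w)
  ... | no _ = C1.0#

  ind-in : ∀ {κ} w → S w ≡ + 0 → key w ≡ κ → ind κ w C1.≈ P1.mon UR.1# (kC w)
  ind-in {κ} w s k with (S w ℤ.≟ + 0) ×-dec (κ-≟ (key w) κ)
  ... | yes _ = C1.refl
  ... | no ¬p = contradiction (s , k) ¬p

  ind-out : ∀ {κ} w → ¬ (S w ≡ + 0 × key w ≡ κ) → ind κ w C1.≈ C1.0#
  ind-out {κ} w ¬p with (S w ℤ.≟ + 0) ×-dec (κ-≟ (key w) κ)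
  ... | yes p = contradiction p ¬p
  ... | no _ = C1.refl

  diag-C-0 : ∀ c w → S w ≡ + 0 → diag (M c (kC w) (lC w)) C1.≈ P1.mon c (kC w)
  diag-C-0 c w s = diag-M-balanced c (kC w) (lC w) (S≡0⇒balanced (kC-lC w) s)

  diag-C-≢ : ∀ c w → S w ≢ + 0 → diag (M c (kC w) (lC w)) C1.≈ C1.0#
  diag-C-≢ c w s = diag-M-≢ c (kC w) (lC w) (λ e → s (balanced⇒S≡0 (kC-lC w) e))

  q : P1.Series
  q = P1.mon UR.1# 1

  -- `φ` carries A₄ bijectively onto this class, and by `kC-φ` it raises the exponent by one, whence
  -- the factor q. Off A₄ and off the class all terms vanish.
  ind-32 : S1.HasSum (ind (3 , 2)) (q C1.* G)
  ind-32 = S1.HasSum-transport ℤ⁵-≟ {f = f} {ind (3 , 2)} φ ψ fwd bwd (S1.HasSum-scale q G-sum)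
    where
    f : ℤ⁵ → P1.Series
    f n = q C1.* diag (M UR.1# (kG n) (lG n))

    key-φ : ∀ n → S n ≡ + 0 → key (φ n) ≡ (3 , 2)
    key-φ n@(_ , b , c , d , e) s = ≡.cong₂ _,_
      (res5-unique (c₁ (φ n)) 3 (d ℤ.- b ℤ.- + 1) (c₁-φ n) (ℕ.s≤s (ℕ.s≤s (ℕ.s≤s (ℕ.s≤s ℕ.z≤n)))))
      (res5-unique (c₂ (φ n)) 2 (c ℤ.+ d ℤ.+ e ℤ.- + 1) (c₂-φ n s) (ℕ.s≤s (ℕ.s≤s (ℕ.s≤s ℕ.z≤n))))

    value : ∀ n → S n ≡ + 0 → ind (3 , 2) (φ n) C1.≈ f n
    value n s = C1.trans (ind-in (φ n) (S-φ n) (key-φ n s)) (C1.trans (P1.mon-≡ UR.1# (kC-φ n s))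
      (C1.sym (C1.trans (C1.*-congˡ (diag-M-balanced UR.1# (kG n) (lG n) (S≡0⇒balanced (kG-lG n) s)))
        (C1.trans (P1.mon-* UR.1# 1 UR.1# (kG n)) (P1.mon-cong (suc (kG n)) unit-0)))))

    fwd : ∀ n → f n C1.≈ C1.0# ⊎ (ψ (φ n) ≡ n × ind (3 , 2) (φ n) C1.≈ f n)
    fwd n with S n ℤ.≟ + 0
    ... | yes s = inj₂ (ψ-φ n s , value n s)
    ... | no s = inj₁ (C1.trans (C1.*-congˡ (diag-M-≢ UR.1# (kG n) (lG n) (λ e → s (balanced⇒S≡0 (kG-lG n) e)))) (C1.zeroʳ q))

    split : ∀ z r → res5 z ≡ r → z ≡ + r ℤ.+ quot5 z ℤ.* + 5
    split z r ≡.refl = split5 z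

    bwd : ∀ w → ind (3 , 2) w C1.≈ C1.0# ⊎ (φ (ψ w) ≡ w × ind (3 , 2) w C1.≈ f (ψ w))
    bwd w with (S w ℤ.≟ + 0) ×-dec (κ-≟ (key w) (3 , 2))
    ... | no _ = inj₁ C1.refl
    ... | yes (s , k) = inj₂ (back , ≡.subst (λ v → P1.mon UR.1# (kC v) C1.≈ f (ψ w)) back
        (C1.trans (C1.sym (ind-in {3 , 2} (φ (ψ w)) (S-φ (ψ w)) (key-φ (ψ w) sψ))) (value (ψ w) sψ)))
      where
      p₁ = split (c₁ w) 3 (≡.cong proj₁ k)
      p₂ = split (c₂ w) 2 (≡.cong proj₂ k)
      back : φ (ψ w) ≡ w
      back = φ-ψ′ w (quot5 (c₁ w)) (quot5 (c₂ w)) s p₁ p₂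
      sψ : S (ψ w) ≡ + 0
      sψ = S-ψ′ w (quot5 (c₁ w)) (quot5 (c₂ w)) p₂

  -- Permuting coordinates keeps `kC` and moves the class by `step`. Invertibility is demanded for
  -- the one κ in question, because `step` reduces modulo 5 and `step⁻¹` undoes it on reduced pairs
  -- only.
  ind-act : (σ : Symmetry) → let open Symmetry σ in ∀ κ {s} → step⁻¹ (step κ) ≡ κ → S1.HasSum (ind κ) s → S1.HasSum (ind (step κ)) s
  ind-act σ κ inverse h = S1.HasSum-transport ℤ⁵-≟ {f = ind κ} {ind (step κ)} act act⁻¹ fwd bwd h
    where
    open Symmetry σ
    fwd : ∀ w → ind κ w C1.≈ C1.0# ⊎ (act⁻¹ (act w) ≡ w × ind (step κ) (act w) C1.≈ ind κ w)
    fwd w with (S w ℤ.≟ + 0) ×-dec (κ-≟ (key w) κ)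
    ... | no _ = inj₁ C1.refl
    ... | yes (s , k) = inj₂ (act⁻¹-act w , C1.trans (ind-in (act w) (≡.trans (S-act w) s) (≡.trans (key-act w s) (≡.cong step k))) (P1.mon-≡ UR.1# (kC-act w)))
    bwd : ∀ w → ind (step κ) w C1.≈ C1.0# ⊎ (act (act⁻¹ w) ≡ w × ind (step κ) w C1.≈ ind κ (act⁻¹ w))
    bwd w with (S w ℤ.≟ + 0) ×-dec (κ-≟ (key w) (step κ))
    ... | no _ = inj₁ C1.refl
    ... | yes (s , k) = inj₂ (act-act⁻¹ w , C1.sym (C1.trans
        (ind-in (act⁻¹ w) (≡.trans (S-act⁻¹ w) s) (≡.trans (key-act⁻¹ w s) (≡.trans (≡.cong step⁻¹ k) inverse)))
        (P1.mon-≡ UR.1# (≡.trans (≡.sym (kC-act (act⁻¹ w))) (≡.cong kC (act-act⁻¹ w))))))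

  keys₀ keys₁ : List (ℕ × ℕ)
  keys₀ = map (0 ,_) (upTo 5)
  keys₁ = cartesianProduct (1 ∷ 2 ∷ 3 ∷ 4 ∷ []) (upTo 5)

  ind-keys₁ : All (λ κ → S1.HasSum (ind κ) (q C1.* G)) keys₁
  ind-keys₁ =
    h₁₀ ∷ h₁₁ ∷ h₁₂ ∷ h₁₃ ∷ h₁₄ ∷ h₂₀ ∷ h₂₁ ∷ h₂₂ ∷ h₂₃ ∷ h₂₄ ∷ h₃₀ ∷ h₃₁ ∷ h₃₂ ∷ h₃₃ ∷ h₃₄ ∷ h₄₀ ∷ h₄₁ ∷ h₄₂ ∷ h₄₃ ∷ h₄₄ ∷ []
    where
    -- Doubling carries c₁ through 3, 1, 2, 4. For fixed c₁ a rotation adds c₁ to c₂, so four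
    -- rotations reach the remaining values of c₂.
    h₃₂ = ind-32
    h₁₁ = ind-act doubling (3 , 2) ≡.refl h₃₂
    h₂₀ = ind-act doubling (1 , 1) ≡.refl h₁₁
    h₄₂ = ind-act doubling (2 , 0) ≡.refl h₂₀
    h₁₂ = ind-act rotation (1 , 1) ≡.refl h₁₁
    h₁₃ = ind-act rotation (1 , 2) ≡.refl h₁₂
    h₁₄ = ind-act rotation (1 , 3) ≡.refl h₁₃
    h₁₀ = ind-act rotation (1 , 4) ≡.refl h₁₄
    h₂₂ = ind-act rotation (2 , 0) ≡.refl h₂₀
    h₂₄ = ind-act rotation (2 , 2) ≡.refl h₂₂
    h₂₁ = ind-act rotation (2 , 4) ≡.refl h₂₄
    h₂₃ = ind-act rotation (2 , 1) ≡.refl h₂₁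
    h₃₀ = ind-act rotation (3 , 2) ≡.refl h₃₂
    h₃₃ = ind-act rotation (3 , 0) ≡.refl h₃₀
    h₃₁ = ind-act rotation (3 , 3) ≡.refl h₃₃
    h₃₄ = ind-act rotation (3 , 1) ≡.refl h₃₁
    h₄₁ = ind-act rotation (4 , 2) ≡.refl h₄₂
    h₄₀ = ind-act rotation (4 , 1) ≡.refl h₄₁
    h₄₄ = ind-act rotation (4 , 0) ≡.refl h₄₀
    h₄₃ = ind-act rotation (4 , 4) ≡.refl h₄₄

  decompose : ∀ (c : ℕ × ℕ → P1.Series) w →
    X1.sumL (λ κ → c κ C1.* ind κ w) (keys₀ ++ keys₁) C1.≈ c (key w) C1.* ind (key w) w
  decompose c w = S1.sumL-point (λ κ → c κ C1.* ind κ w) (key w)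
    (λ κ κ≢ → C1.trans (C1.*-congˡ (ind-out w (λ (_ , k) → κ≢ (≡.sym k)))) (C1.zeroʳ (c κ)))
    (UP.cartesianProduct⁺ (UP.upTo⁺ 5) (UP.upTo⁺ 5))
    (∈P.∈-cartesianProduct⁺ (∈P.∈-upTo⁺ (res5<5 (c₁ w))) (∈P.∈-upTo⁺ (res5<5 (c₂ w))))

  ζκ : ℕ × ℕ → P1.Series
  ζκ (a , _) = P1.C (ζ UX.^ a)

  twisted-terms : ∀ w → diag (M (ζ UX.^ eζ w) (kC w) (lC w)) C1.≈ X1.sumL (λ κ → ζκ κ C1.* ind κ w) (keys₀ ++ keys₁)
  twisted-terms w = by-sum (S w ℤ.≟ + 0)
    where
    by-sum : Dec (S w ≡ + 0) → diag (M (ζ UX.^ eζ w) (kC w) (lC w)) C1.≈ X1.sumL (λ κ → ζκ κ C1.* ind κ w) (keys₀ ++ keys₁)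
    by-sum (yes s) = C1.sym (C1.trans (decompose ζκ w) (C1.trans (C1.*-congˡ (ind-in w s ≡.refl))
      (C1.trans (P1.mon-* (ζ UX.^ res5 (c₁ w)) 0 UR.1# (kC w)) (C1.trans
      (P1.mon-cong (kC w) (UR.trans (UR.*-identityʳ _) (UR.sym (UR.trans (ζ^% (eζ w)) (UR.reflexive (≡.cong (ζ UX.^_) (eζ-res w)))))))
      (C1.sym (diag-C-0 (ζ UX.^ eζ w) w s))))))
    by-sum (no s) = C1.trans (diag-C-≢ (ζ UX.^ eζ w) w s)
      (C1.sym (C1.trans (decompose ζκ w) (C1.trans (C1.*-congˡ (ind-out w (λ (s′ , _) → s s′))) (C1.zeroʳ _))))

  plain-terms : ∀ w → diag (M UR.1# (kC w) (lC w)) C1.≈ X1.sumL (λ κ → C1.1# C1.* ind κ w) (keys₀ ++ keys₁)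
  plain-terms w = by-sum (S w ℤ.≟ + 0)
    where
    by-sum : Dec (S w ≡ + 0) → diag (M UR.1# (kC w) (lC w)) C1.≈ X1.sumL (λ κ → C1.1# C1.* ind κ w) (keys₀ ++ keys₁)
    by-sum (yes s) = C1.sym (C1.trans (decompose (λ _ → C1.1#) w) (C1.trans (C1.*-identityˡ _) (C1.trans (ind-in w s ≡.refl) (C1.sym (diag-C-0 UR.1# w s)))))
    by-sum (no s) = C1.trans (diag-C-≢ UR.1# w s)
      (C1.sym (C1.trans (decompose (λ _ → C1.1#) w) (C1.trans (C1.*-congˡ (ind-out w (λ (s′ , _) → s s′))) (C1.zeroʳ _))))

  private
    weighted : ∀ (c : ℕ × ℕ → P1.Series) → S1.HasSum (λ w → X1.sumL (λ κ → c κ C1.* ind κ w) keys₁) (X1.sumL (λ κ → c κ C1.* (q C1.* G)) keys₁)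
    weighted c = S1.HasSum-sumL ℤ⁵-≟ {λ κ w → c κ C1.* ind κ w} {λ κ → c κ C1.* (q C1.* G)} keys₁
      (All.map {P = λ κ → S1.HasSum (ind κ) (q C1.* G)} {Q = λ κ → S1.HasSum (λ w → c κ C1.* ind κ w) (c κ C1.* (q C1.* G))}
        (λ {κ} h → S1.HasSum-scale {f = ind κ} {s = q C1.* G} (c κ) h) ind-keys₁)

    -- Where c₁ ≡ 0 the twist is 1. Removing the twisted classes with c₁ ≢ 0 from H therefore leaves
    -- an untwisted sum.
    keys₀-sum : S1.HasSum (λ w → X1.sumL (λ κ → C1.1# C1.* ind κ w) keys₀) (H C1.+ (C1.- C1.1#) C1.* X1.sumL (λ κ → ζκ κ C1.* (q C1.* G)) keys₁)
    keys₀-sum = S1.HasSum-cong cancel C1.refl (S1.HasSum-+ ℤ⁵-≟ H-sum (S1.HasSum-scale (C1.- C1.1#) (weighted ζκ)))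
      where
      cancel : ∀ w → diag (M (ζ UX.^ eζ w) (kC w) (lC w)) C1.+ (C1.- C1.1#) C1.* X1.sumL (λ κ → ζκ κ C1.* ind κ w) keys₁
        C1.≈ X1.sumL (λ κ → C1.1# C1.* ind κ w) keys₀
      cancel w = C1.trans (C1.+-congʳ (C1.trans (twisted-terms w) (X1.sumL-++ (λ κ → ζκ κ C1.* ind κ w) keys₀ keys₁)))
        (X1.solve 2 (λ a b → (a X1.:+ b) X1.:+ (X1.:- X1.con (+ 1)) X1.:* b X1.:= a) C1.refl _ _)

  -- The classes with c₁ ≢ 0 enter the twisted sum with total coefficient 5 (ζ + ζ² + ζ³ + ζ⁴) = −5.
  theta-A₄ : Θ C1.≈ H C1.+ X1.intR (+ 25) C1.* (q C1.* G)
  theta-A₄ = C1.trans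
    (S1.HasSum-unique ℤ⁵-≟ Θ-sum (S1.HasSum-cong (λ w → C1.sym (C1.trans (plain-terms w) (X1.sumL-++ (λ κ → C1.1# C1.* ind κ w) keys₀ keys₁))) C1.refl
      (S1.HasSum-+ ℤ⁵-≟ keys₀-sum (weighted (λ _ → C1.1#)))))
    (C1.trans (X1.solve 6 (λ h g z₁ z₂ z₃ z₄ → (h X1.:+ (X1.:- one) X1.:* (row z₁ g (row z₂ g (row z₃ g (row z₄ g (X1.con (+ 0)))))))
        X1.:+ row one g (row one g (row one g (row one g (X1.con (+ 0)))))
        X1.:= (h X1.:+ X1.con (+ 25) X1.:* g) X1.:+ (one X1.:+ z₁ X1.:+ z₂ X1.:+ z₃ X1.:+ z₄) X1.:* (X1.:- X1.con (+ 5) X1.:* g))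
        C1.refl H (q C1.* G) (P1.C (ζ UX.^ 1)) (P1.C (ζ UX.^ 2)) (P1.C (ζ UX.^ 3)) (P1.C (ζ UX.^ 4)))
      (C1.trans (C1.+-congˡ (C1.trans (C1.*-congʳ sum-zero) (C1.zeroˡ _))) (C1.+-identityʳ _)))
    where
    one : ∀ {n} → X1.Polynomial n
    one = X1.con (+ 1)
    row : ∀ {n} → X1.Polynomial n → X1.Polynomial n → X1.Polynomial n → X1.Polynomial n
    row z g r = z X1.:* g X1.:+ (z X1.:* g X1.:+ (z X1.:* g X1.:+ (z X1.:* g X1.:+ (z X1.:* g X1.:+ r))))
    C-+ : ∀ a b → P1.C a C1.+ P1.C b C1.≈ P1.C (a UR.+ b)
    C-+ a b = P1.mon-+ a b 0
    sum-zero : C1.1# C1.+ P1.C (ζ UX.^ 1) C1.+ P1.C (ζ UX.^ 2) C1.+ P1.C (ζ UX.^ 3) C1.+ P1.C (ζ UX.^ 4) C1.≈ C1.0#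
    sum-zero = C1.trans (C1.+-congʳ (C1.trans (C1.+-congʳ (C1.trans (C1.+-congʳ (C-+ UR.1# (ζ UX.^ 1))) (C-+ _ (ζ UX.^ 2)))) (C-+ _ (ζ UX.^ 3))))
      (C1.trans (C-+ _ (ζ UX.^ 4)) (C1.trans (P1.C-cong (UR.trans (UR.+-congʳ (UR.+-congʳ (UR.+-congʳ (UR.+-congˡ (UR.*-identityʳ ζ))))) Φ₅)) (P1.mon-zero 0)))

-- Frobenius symbols as pairs of subsets, partitions by largest part.

module Comb where
  open import Data.Nat using (_+_; _≤_; _<_; s≤s; z≤n; _∸_)
  open import Data.Nat.ListAction using (sum)
  open import Data.Fin as Fin using (Fin; toℕ)
  open import Data.List using (concatMap; allFin; filter; length)
  open import Data.List.Properties using (length-++; length-map)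
  open import Data.List.Membership.Propositional using (lose)
  open import Data.List.Relation.Unary.Any using (Any)
  open AllPairs using (AllPairs)
  open import Data.List.Relation.Unary.Linked as Linked using (Linked; []; [-]; _∷_; linked?)
  open ≡ using (refl; sym; trans; cong; subst)

  module _ {A : Set} where
    remove : ∀ {x : A} {ys} → x ∈ ys → ∃ λ zs → length ys ≡ suc (length zs) × (∀ {z} → z ∈ ys → z ≢ x → z ∈ zs)
    remove {ys = y ∷ ys} (here refl) = ys , refl , λ { (here e) z≢ → ⊥-elim (z≢ e) ; (there z∈) _ → z∈ }
    remove {ys = y ∷ ys} (there x∈) = let (zs , e , h) = remove x∈ in
      y ∷ zs , cong suc e , λ { (here e′) _ → here e′ ; (there z∈) z≢ → there (h z∈ z≢) }

    length-⊆ : ∀ {xs ys : List A} → Unique xs → (∀ {x} → x ∈ xs → x ∈ ys) → length xs ≤ length ys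
    length-⊆ [] _ = z≤n
    length-⊆ {x ∷ xs} (x∉ ∷ u) h = let (zs , e , k) = remove (h (here refl)) in
      ℕP.≤-trans (s≤s (length-⊆ u (λ z∈ → k (h (there z∈)) (λ z≡x → All.lookup x∉ z∈ (sym z≡x))))) (ℕP.≤-reflexive (sym e))

    length-≡ : ∀ {xs ys : List A} → Unique xs → Unique ys → (∀ {x} → x ∈ xs → x ∈ ys) → (∀ {x} → x ∈ ys → x ∈ xs) → length xs ≡ length ys
    length-≡ u v h k = ℕP.≤-antisym (length-⊆ u h) (length-⊆ v k)

  module _ {A B : Set} (f : A → List B) where
    ∈-concatMap : ∀ {x xs y} → x ∈ xs → y ∈ f x → y ∈ concatMap f xs
    ∈-concatMap x∈ y∈ = ∈P.∈-concatMap⁺ f (lose x∈ y∈)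

    concatMap-! : ∀ {xs} → Unique xs → (∀ x → Unique (f x)) → (∀ {x y z} → z ∈ f x → z ∈ f y → x ≡ y) → Unique (concatMap f xs)
    concatMap-! [] _ _ = []
    concatMap-! {x ∷ xs} (x∉ ∷ u) v h = UP.++⁺ (v x) (concatMap-! u v h)
      (λ (z∈ , z∈′) → let (y , y∈ , z∈y) = find (∈P.∈-concatMap⁻ f z∈′) in All.lookup x∉ y∈ (h z∈ z∈y))
      where
      find : ∀ {P : A → Set} {xs} → Any P xs → ∃ λ y → y ∈ xs × P y
      find (here p) = _ , here refl , p
      find (there a) = let (y , y∈ , p) = find a in y , there y∈ , p

  module _ {A : Set} where
    ∈-listsOfLength : ∀ (L xs : List A) → All (_∈ L) xs → xs ∈ listsOfLength (length xs) L
    ∈-listsOfLength L [] [] = here refl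
    ∈-listsOfLength L (x ∷ xs) (x∈ ∷ h) = ∈-concatMap (λ x → map (x ∷_) (listsOfLength (length xs) L)) x∈
      (∈P.∈-map⁺ (x ∷_) (∈-listsOfLength L xs h))

    length-listsOfLength : ∀ d (L : List A) {xs} → xs ∈ listsOfLength d L → length xs ≡ d × All (_∈ L) xs
    length-listsOfLength zero L (here refl) = refl , []
    length-listsOfLength (suc d) L xs∈ = go L (λ z → z) xs∈
      where
      go : ∀ L′ → (∀ {x} → x ∈ L′ → x ∈ L) → ∀ {xs} → xs ∈ concatMap (λ x → map (x ∷_) (listsOfLength d L)) L′ → length xs ≡ suc d × All (_∈ L) xs
      go (x ∷ L′) sub xs∈ with ∈P.∈-++⁻ (map (x ∷_) (listsOfLength d L)) xs∈
      ... | inj₂ r = go L′ (sub ∘ there) r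
      ... | inj₁ l with ∈P.∈-map⁻ (x ∷_) l
      ...   | ys , ys∈ , refl = let (e , h) = length-listsOfLength d L ys∈ in cong suc e , sub (here refl) ∷ h

    listsOfLength-! : ∀ d {L : List A} → Unique L → Unique (listsOfLength d L)
    listsOfLength-! zero u = [] ∷ []
    listsOfLength-! (suc d) {L} u = concatMap-! (λ x → map (x ∷_) (listsOfLength d L)) u (λ x → UP.map⁺ (λ { refl → refl }) (listsOfLength-! d u)) same-head
      where
      same-head : ∀ {x y zs} → zs ∈ map (x ∷_) (listsOfLength d L) → zs ∈ map (y ∷_) (listsOfLength d L) → x ≡ y
      same-head p q with ∈P.∈-map⁻ _ p | ∈P.∈-map⁻ _ q
      ... | _ , _ , refl | _ , _ , refl = refl

    -- The sublists, in the form in which a product over the list expands. Over a strictly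
    -- decreasing list they are all the strictly decreasing lists with entries from it.
    subs : List A → List (List A)
    subs [] = [] ∷ []
    subs (e ∷ E) = map (e ∷_) (subs E) ++ subs E

    subs-⊆ : ∀ E {xs} → xs ∈ subs E → All (_∈ E) xs
    subs-⊆ [] (here refl) = []
    subs-⊆ (e ∷ E) xs∈ with ∈P.∈-++⁻ (map (e ∷_) (subs E)) xs∈
    ... | inj₂ r = All.map there (subs-⊆ E r)
    ... | inj₁ l with ∈P.∈-map⁻ (e ∷_) l
    ...   | ys , ys∈ , refl = here refl ∷ All.map there (subs-⊆ E ys∈)

    subs-! : ∀ {E} → Unique E → Unique (subs E)
    subs-! [] = [] ∷ []
    subs-! {e ∷ E} (e∉ ∷ u) = UP.++⁺ (UP.map⁺ (λ { refl → refl }) (subs-! u)) (subs-! u) disjoint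
      where
      disjoint : ∀ {zs} → zs ∈ map (e ∷_) (subs E) × zs ∈ subs E → _
      disjoint (p , q) with ∈P.∈-map⁻ (e ∷_) p
      ... | ys , _ , refl = All.lookup e∉ (All.lookup (subs-⊆ E q) (here refl)) refl

    module _ {_▷_ : A → A → Set} where
      subs-sorted : ∀ {E xs} → AllPairs _▷_ E → xs ∈ subs E → AllPairs _▷_ xs
      subs-sorted {[]} _ (here refl) = []
      subs-sorted {e ∷ E} (h ∷ s) xs∈ with ∈P.∈-++⁻ (map (e ∷_) (subs E)) xs∈
      ... | inj₂ r = subs-sorted s r
      ... | inj₁ l with ∈P.∈-map⁻ (e ∷_) l
      ...   | ys , ys∈ , refl = All.map (All.lookup h) (subs-⊆ E ys∈) ∷ subs-sorted s ys∈

      module _ (irr : ∀ {x y : A} → x ▷ y → x ≢ y) (asym : ∀ {x y : A} → x ▷ y → ¬ (y ▷ x)) where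
        tail∈ : ∀ {e : A} {E} xs → All (_∈ (e ∷ E)) xs → All (_≢ e) xs → All (_∈ E) xs
        tail∈ [] [] [] = []
        tail∈ (x ∷ xs) (here x≡e ∷ h) (x≢e ∷ k) = ⊥-elim (x≢e x≡e)
        tail∈ (x ∷ xs) (there x∈ ∷ h) (_ ∷ k) = x∈ ∷ tail∈ xs h k

        -- The head e of E can occur in xs only in front: irreflexivity forbids a second copy behind
        -- it, asymmetry forbids it behind an entry that follows e in E.
        ∈-subs : ∀ {E xs} → AllPairs _▷_ E → AllPairs _▷_ xs → All (_∈ E) xs → xs ∈ subs E
        ∈-subs {[]} _ [] [] = here refl
        ∈-subs {[]} _ (_ ∷ _) (() ∷ _)
        ∈-subs {e ∷ E} (h ∷ s) [] [] = ∈P.∈-++⁺ʳ (map (e ∷_) (subs E)) (∈-subs s [] [])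
        ∈-subs {e ∷ E} (h ∷ s) (p ∷ ps) (here refl ∷ k) =
          ∈P.∈-++⁺ˡ (∈P.∈-map⁺ (e ∷_) (∈-subs s ps (tail∈ _ k (All.map (λ e▷x x≡e → irr e▷x (sym x≡e)) p))))
        ∈-subs {e ∷ E} {x ∷ xs} (h ∷ s) (p ∷ ps) (there x∈ ∷ k) =
          ∈P.∈-++⁺ʳ (map (e ∷_) (subs E)) (∈-subs s (p ∷ ps)
            (x∈ ∷ tail∈ xs k (All.map (λ x▷y → λ { refl → asym x▷y (All.lookup h x∈) }) p)))

  module _ {k : ℕ} where
    ≻-trans : ∀ {x y z : Entry k} → x ≻ y → y ≻ z → x ≻ z
    ≻-trans (inj₁ p) (inj₁ q) = inj₁ (ℕP.<-trans q p)
    ≻-trans (inj₁ p) (inj₂ (refl , q)) = inj₁ p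
    ≻-trans (inj₂ (refl , p)) (inj₁ q) = inj₁ q
    ≻-trans (inj₂ (refl , p)) (inj₂ (refl , q)) = inj₂ (refl , ℕP.<-trans q p)

    ≻-irr : ∀ {x y : Entry k} → x ≻ y → x ≢ y
    ≻-irr (inj₁ p) refl = ℕP.<-irrefl refl p
    ≻-irr (inj₂ (_ , p)) refl = ℕP.<-irrefl refl p

    ≻-asym : ∀ {x y : Entry k} → x ≻ y → ¬ (y ≻ x)
    ≻-asym p q = ≻-irr (≻-trans p q) refl

  -- From the largest colour down, which makes `entries` strictly decreasing.
  colors : (k : ℕ) → List (Fin k)
  colors zero = []
  colors (suc k) = map Fin.suc (colors k) ++ Fin.zero ∷ []

  colors-sorted : ∀ k → AllPairs (λ c d → toℕ d < toℕ c) (colors k)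
  colors-sorted zero = []
  colors-sorted (suc k) = APP.++⁺ (APP.map⁺ (AllPairs.map s≤s (colors-sorted k))) ([] ∷ [])
    (AllP.map⁺ (All.universal (λ c → s≤s z≤n ∷ []) (colors k)))

  ∈-colors : ∀ {k} (c : Fin k) → c ∈ colors k
  ∈-colors {suc k} Fin.zero = ∈P.∈-++⁺ʳ (map Fin.suc (colors k)) (here refl)
  ∈-colors {suc k} (Fin.suc c) = ∈P.∈-++⁺ˡ (∈P.∈-map⁺ Fin.suc (∈-colors c))

  length-colors : ∀ k → length (colors k) ≡ k
  length-colors zero = refl
  length-colors (suc k) = trans (length-++ (map Fin.suc (colors k))) (trans (cong (_+ 1) (trans (length-map Fin.suc (colors k)) (length-colors k))) (ℕP.+-comm k 1))

  entries : (k N : ℕ) → List (Entry k)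
  entries k zero = []
  entries k (suc N) = map (N ,_) (colors k) ++ entries k N

  ∈-entries⁻ : ∀ k N {e} → e ∈ entries k N → proj₁ e < N
  ∈-entries⁻ k (suc N) e∈ with ∈P.∈-++⁻ (map (N ,_) (colors k)) e∈
  ... | inj₂ r = ℕP.m<n⇒m<1+n (∈-entries⁻ k N r)
  ... | inj₁ l with ∈P.∈-map⁻ (N ,_) l
  ...   | _ , _ , refl = ℕP.n<1+n N

  ∈-entries : ∀ k N {e : Entry k} → proj₁ e < N → e ∈ entries k N
  ∈-entries k (suc N) {ℓ , c} (s≤s ℓ≤N) with ℕP.m≤n⇒m<n∨m≡n ℓ≤N
  ... | inj₁ ℓ<N = ∈P.∈-++⁺ʳ (map (N ,_) (colors k)) (∈-entries k N ℓ<N)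
  ... | inj₂ refl = ∈P.∈-++⁺ˡ (∈P.∈-map⁺ (N ,_) (∈-colors c))

  entries-sorted : ∀ k N → AllPairs _≻_ (entries k N)
  entries-sorted k zero = []
  entries-sorted k (suc N) = APP.++⁺ (APP.map⁺ (AllPairs.map (λ d<c → inj₂ (refl , d<c)) (colors-sorted k))) (entries-sorted k N)
    (AllP.map⁺ (All.universal (λ c → All.tabulate (λ e∈ → inj₁ (∈-entries⁻ k N e∈))) (colors k)))

  entries-! : ∀ k N → Unique (entries k N)
  entries-! k N = AllPairs.map ≻-irr (entries-sorted k N)

  ∈-entriesUpTo : ∀ k N {e : Entry k} → proj₁ e ≤ N → e ∈ entriesUpTo k N
  ∈-entriesUpTo k N {ℓ , c} ℓ≤N = ∈-concatMap (λ ℓ → map (ℓ ,_) (allFin k)) (∈P.∈-upTo⁺ (s≤s ℓ≤N)) (∈P.∈-map⁺ (ℓ ,_) (∈P.∈-allFin c))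

  entriesUpTo-! : ∀ k N → Unique (entriesUpTo k N)
  entriesUpTo-! k N = concatMap-! (λ ℓ → map (ℓ ,_) (allFin k)) (UP.upTo⁺ (suc N)) (λ ℓ → UP.map⁺ (λ { refl → refl }) (UP.allFin⁺ k)) same
    where
    same : ∀ {ℓ ℓ′ : ℕ} {e : Entry k} → e ∈ map (ℓ ,_) (allFin k) → e ∈ map (ℓ′ ,_) (allFin k) → ℓ ≡ ℓ′
    same p q with ∈P.∈-map⁻ _ p | ∈P.∈-map⁻ _ q
    ... | _ , _ , refl | _ , _ , refl = refl

  layer : ∀ k n → ℕ → List (Symbol k)
  layer k n d = cartesianProduct (listsOfLength d (entriesUpTo k n)) (listsOfLength d (entriesUpTo k n))

  candidates-! : ∀ k n → Unique (candidates k n)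
  candidates-! k n = concatMap-! (layer k n) (UP.upTo⁺ (suc n))
    (λ d → UP.cartesianProduct⁺ (listsOfLength-! d (entriesUpTo-! k n)) (listsOfLength-! d (entriesUpTo-! k n))) same
    where
    E = entriesUpTo k n
    same : ∀ {d d′ s} → s ∈ cartesianProduct (listsOfLength d E) (listsOfLength d E) → s ∈ cartesianProduct (listsOfLength d′ E) (listsOfLength d′ E) → d ≡ d′
    same {d} {d′} p q = trans (sym (proj₁ (length-listsOfLength d E (proj₁ (∈P.∈-cartesianProduct⁻ (listsOfLength d E) (listsOfLength d E) p)))))
      (proj₁ (length-listsOfLength d′ E (proj₁ (∈P.∈-cartesianProduct⁻ (listsOfLength d′ E) (listsOfLength d′ E) q))))

  ∈⇒≤sum : ∀ {A : Set} (f : A → ℕ) xs → All (λ x → f x ≤ sum (map f xs)) xs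
  ∈⇒≤sum f [] = []
  ∈⇒≤sum f (x ∷ xs) = ℕP.m≤m+n (f x) _ ∷ All.map (λ le → ℕP.≤-trans le (ℕP.m≤n+m _ (f x))) (∈⇒≤sum f xs)

  xDegree yDegree : ∀ {k} → Symbol k → ℕ
  xDegree (t , b) = (length t + sum (map proj₁ t)) + sum (map proj₁ b)
  yDegree (t , b) = sum (map proj₁ t) + (length b + sum (map proj₁ b))

  balanced? : ∀ {k} n (s : Symbol k) → Dec (xDegree s ≡ n × yDegree s ≡ n)
  balanced? n s = (xDegree s ℕ.≟ n) ×-dec (yDegree s ℕ.≟ n)

  -- The weight conditions turn into xDegree = yDegree = n.
  cφ-subs : ∀ k n → cφ k n ≡ length (filter (balanced? n) (cartesianProduct (subs (entries k (suc n))) (subs (entries k (suc n)))))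
  cφ-subs k n = length-≡ (UP.filter⁺ frob? (candidates-! k n)) (UP.filter⁺ (balanced? n) (UP.cartesianProduct⁺ E! E!)) fwd bwd
    where
    E = entries k (suc n)
    E! = subs-! (entries-! k (suc n))
    frob? : ∀ s → Dec (IsFrobenius s × weight s ≡ n)
    frob? s = isFrobenius? s ×-dec (weight s ℕ.≟ n)

    small : ∀ {s : Symbol k} → weight s ≡ n → All (λ e → proj₁ e ≤ n) (proj₁ s) × All (λ e → proj₁ e ≤ n) (proj₂ s) × length (proj₁ s) ≤ n
    small {t , b} refl =
      All.map (λ le → ℕP.≤-trans le (ℕP.≤-trans (ℕP.m≤n+m _ (length t)) (ℕP.m≤m+n _ _))) (∈⇒≤sum proj₁ t) ,
      All.map (λ le → ℕP.≤-trans le (ℕP.m≤n+m _ _)) (∈⇒≤sum proj₁ b) ,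
      ℕP.≤-trans (ℕP.m≤m+n (length t) _) (ℕP.m≤m+n _ _)

    member : ∀ {xs : List (Entry k)} → StrictlyDecreasing xs → All (λ e → proj₁ e ≤ n) xs → xs ∈ subs E
    member sd sm = ∈-subs ≻-irr ≻-asym (entries-sorted k (suc n)) (LinkedP.Linked⇒AllPairs (λ {x} {y} {z} → ≻-trans {k} {x} {y} {z}) sd)
      (All.map (λ le → ∈-entries k (suc n) (s≤s le)) sm)

    swap : ∀ t s s′ → t + s + s′ ≡ s + (t + s′)
    swap t s s′ = trans (cong (_+ s′) (ℕP.+-comm t s)) (ℕP.+-assoc s t s′)

    fwd : ∀ {s} → s ∈ filter frob? (candidates k n) → s ∈ filter (balanced? n) (cartesianProduct (subs E) (subs E))
    fwd {s@(t , b)} s∈ with ∈P.∈-filter⁻ frob? {xs = candidates k n} s∈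
    ... | _ , ((st , sb , le) , w) with small {s} w
    ...   | smt , smb , _ = ∈P.∈-filter⁺ (balanced? n) (∈P.∈-cartesianProduct⁺ (member st smt) (member sb smb))
      (w , trans (sym (trans (swap (length t) (sum (map proj₁ t)) (sum (map proj₁ b))) (cong (λ l → sum (map proj₁ t) + (l + sum (map proj₁ b))) le))) w)

    bwd : ∀ {s} → s ∈ filter (balanced? n) (cartesianProduct (subs E) (subs E)) → s ∈ filter frob? (candidates k n)
    bwd {s@(t , b)} s∈ with ∈P.∈-filter⁻ (balanced? n) {xs = cartesianProduct (subs E) (subs E)} s∈
    ... | s∈′ , (px , py) with ∈P.∈-cartesianProduct⁻ (subs E) (subs E) s∈′ | small {s} px
    ...   | t∈ , b∈ | smt , smb , lt = ∈P.∈-filter⁺ frob?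
      (∈-concatMap (layer k n) (∈P.∈-upTo⁺ (s≤s lt)) (∈P.∈-cartesianProduct⁺ (∈-listsOfLength _ t (All.map (∈-entriesUpTo k n) smt))
        (subst (λ l → b ∈ listsOfLength l (entriesUpTo k n)) (sym le) (∈-listsOfLength _ b (All.map (∈-entriesUpTo k n) smb)))))
      ((LinkedP.AllPairs⇒Linked (subs-sorted (entries-sorted k (suc n)) t∈) , LinkedP.AllPairs⇒Linked (subs-sorted (entries-sorted k (suc n)) b∈) , le) , px)
      where
      -- The difference of the two degrees is the difference of the row lengths.
      le : length t ≡ length b
      le = ℕP.+-cancelʳ-≡ (sum (map proj₁ b)) (length t) (length b)
        (ℕP.+-cancelˡ-≡ (sum (map proj₁ t)) _ _ (trans (sym (swap (length t) (sum (map proj₁ t)) (sum (map proj₁ b)))) (trans px (sym py))))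

  -- The first argument bounds the number of parts.
  parts : ℕ → ℕ → ℕ → List (List ℕ)
  withPart : ∀ f m n → Dec (suc m ≤ n) → List (List ℕ)
  parts f zero zero = [] ∷ []
  parts f zero (suc n) = []
  parts zero (suc m) n = parts zero m n
  parts (suc f) (suc m) n = parts (suc f) m n ++ withPart f m n (suc m ℕ.≤? n)
  withPart f m n (yes _) = map (suc m ∷_) (parts f (suc m) (n ∸ suc m))
  withPart f m n (no _) = []

  Parts : ℕ → ℕ → List ℕ → Set
  Parts m n xs = AllPairs (λ x y → y ≤ x) xs × All (λ x → 1 ≤ x × x ≤ m) xs × sum xs ≡ n

  ∈-parts⁻ : ∀ f m n {xs} → xs ∈ parts f m n → Parts m n xs
  ∈-withPart⁻ : ∀ f m n d {xs} → xs ∈ withPart f m n d → ∃ λ ys → xs ≡ suc m ∷ ys × suc m ≤ n × Parts (suc m) (n ∸ suc m) ys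
  ∈-parts⁻ f zero zero (here refl) = [] , [] , refl
  ∈-parts⁻ zero (suc m) n xs∈ = let (a , b , c) = ∈-parts⁻ zero m n xs∈ in a , All.map (λ (p , q) → p , ℕP.m≤n⇒m≤1+n q) b , c
  ∈-parts⁻ (suc f) (suc m) n xs∈ with ∈P.∈-++⁻ (parts (suc f) m n) xs∈
  ... | inj₁ l = let (a , b , c) = ∈-parts⁻ (suc f) m n l in a , All.map (λ (p , q) → p , ℕP.m≤n⇒m≤1+n q) b , c
  ... | inj₂ r with ∈-withPart⁻ f m n (suc m ℕ.≤? n) r
  ...   | ys , refl , le , (a , b , c) = All.map proj₂ b ∷ a , (s≤s z≤n , ℕP.≤-refl) ∷ b , trans (cong (_+_ (suc m)) c) (ℕP.m+[n∸m]≡n le)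
  ∈-withPart⁻ f m n (yes le) xs∈ with ∈P.∈-map⁻ (suc m ∷_) xs∈
  ... | ys , ys∈ , refl = ys , refl , le , ∈-parts⁻ f (suc m) (n ∸ suc m) ys∈
  ∈-withPart⁻ f m n (no _) ()

  ∈-parts⁺ : ∀ f m n {xs} → n ≤ f → Parts m n xs → xs ∈ parts f m n
  ∈-parts⁺ f zero n {[]} _ (_ , _ , refl) = here refl
  ∈-parts⁺ f zero n {x ∷ xs} _ (_ , (p , q) ∷ _ , _) = contradiction (ℕP.≤-trans p q) λ ()
  ∈-parts⁺ zero (suc m) n {[]} _ (_ , _ , refl) = ∈-parts⁺ zero m 0 z≤n ([] , [] , refl)
  ∈-parts⁺ zero (suc m) n {x ∷ xs} n≤0 (_ , (p , _) ∷ _ , refl) = contradiction (ℕP.≤-trans p (ℕP.≤-trans (ℕP.m≤m+n x _) n≤0)) λ ()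
  ∈-parts⁺ (suc f) (suc m) n {[]} n≤ (_ , _ , refl) = ∈P.∈-++⁺ˡ (∈-parts⁺ (suc f) m 0 n≤ ([] , [] , refl))
  ∈-parts⁺ (suc f) (suc m) n {x ∷ xs} n≤ (h ∷ a , (p , q) ∷ b , refl) with ℕP.m≤n⇒m<n∨m≡n q
  ... | inj₁ (s≤s x≤m) = ∈P.∈-++⁺ˡ (∈-parts⁺ (suc f) m n n≤
    (h ∷ a , (p , x≤m) ∷ All.zipWith (λ (y≤x , (1≤y , _)) → 1≤y , ℕP.≤-trans y≤x x≤m) (h , b) , refl))
  ... | inj₂ refl = ∈P.∈-++⁺ʳ (parts (suc f) m n) (go (suc m ℕ.≤? n))
    where
    rest : n ∸ suc m ≡ sum xs
    rest = ℕP.m+n∸m≡n (suc m) (sum xs)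
    go : ∀ d → suc m ∷ xs ∈ withPart f m n d
    go (yes _) = ∈P.∈-map⁺ (suc m ∷_) (∈-parts⁺ f (suc m) (n ∸ suc m)
      (ℕP.≤-trans (ℕP.≤-reflexive rest) (ℕP.≤-trans (ℕP.m≤n+m (sum xs) m) (ℕP.≤-pred n≤))) (a , b , sym rest))
    go (no ¬le) = ⊥-elim (¬le (ℕP.m≤m+n (suc m) (sum xs)))

  parts-! : ∀ f m n → Unique (parts f m n)
  withPart-! : ∀ f m n d → Unique (withPart f m n d)
  parts-! f zero zero = [] ∷ []
  parts-! f zero (suc n) = []
  parts-! zero (suc m) n = parts-! zero m n
  parts-! (suc f) (suc m) n = UP.++⁺ (parts-! (suc f) m n) (withPart-! f m n (suc m ℕ.≤? n)) disjoint
    where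
    disjoint : ∀ {xs} → xs ∈ parts (suc f) m n × xs ∈ withPart f m n (suc m ℕ.≤? n) → _
    disjoint (p , q) with ∈-withPart⁻ f m n (suc m ℕ.≤? n) q
    ... | ys , refl , _ with ∈-parts⁻ (suc f) m n p
    ...   | _ , (_ , le) ∷ _ , _ = ℕP.<-irrefl refl le
  withPart-! f m n (yes _) = UP.map⁺ (λ { refl → refl }) (parts-! f (suc m) (n ∸ suc m))
  withPart-! f m n (no _) = []

  #parts : ℕ → ℕ → ℕ
  #parts m n = length (parts n m n)

  #parts-bound : ∀ f m n → n ≤ f → length (parts f m n) ≡ #parts m n
  #parts-bound f m n n≤f = length-≡ (parts-! f m n) (parts-! n m n)
    (λ xs∈ → ∈-parts⁺ n m n ℕP.≤-refl (∈-parts⁻ f m n xs∈)) (λ xs∈ → ∈-parts⁺ f m n n≤f (∈-parts⁻ n m n xs∈))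

  #parts-< : ∀ m n → n < suc m → #parts (suc m) n ≡ #parts m n
  #parts-< m zero _ = refl
  #parts-< m (suc n) n< = trans (length-++ (parts (suc n) m (suc n))) (trans (cong (_+_ (#parts m (suc n))) (none (suc m ℕ.≤? suc n))) (ℕP.+-identityʳ _))
    where
    none : ∀ d → length (withPart n m (suc n) d) ≡ 0
    none (yes le) = contradiction le (ℕP.<⇒≱ n<)
    none (no _) = refl

  -- Either no part equals m + 1 or one such part is removed. On generating functions this is A(m +
  -- 1) = A(m) + q^(m + 1) A(m + 1).
  #parts-≥ : ∀ m n → #parts (suc m) (suc m + n) ≡ #parts m (suc m + n) + #parts (suc m) n
  #parts-≥ m n = trans (length-++ (parts (suc m + n) m (suc m + n))) (cong (_+_ (#parts m (suc m + n))) (some (suc m ℕ.≤? suc m + n)))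
    where
    rest : suc m + n ∸ suc m ≡ n
    rest = ℕP.m+n∸m≡n (suc m) n
    some : ∀ d → length (withPart (m + n) m (suc m + n) d) ≡ #parts (suc m) n
    some (yes _) = trans (length-map (suc m ∷_) (parts (m + n) (suc m) (suc m + n ∸ suc m)))
      (trans (cong (λ r → length (parts (m + n) (suc m) r)) rest) (#parts-bound (m + n) (suc m) n (ℕP.m≤n+m n m)))
    some (no ¬le) = ⊥-elim (¬le (ℕP.m≤m+n (suc m) n))

  p-#parts : ∀ m n → n ≤ m → p n ≡ #parts m n
  p-#parts m n n≤m = length-≡ (UP.filter⁺ part? partitionCandidates-!) (parts-! n m n) fwd bwd
    where
    L = map suc (upTo n)
    part? : ∀ xs → Dec (Linked (λ x y → y ≤ x) xs × sum xs ≡ n)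
    part? xs = linked? (λ x y → y ℕ.≤? x) xs ×-dec (sum xs ℕ.≟ n)

    partitionCandidates-! : Unique (partitionCandidates n)
    partitionCandidates-! = concatMap-! (λ d → listsOfLength d L) (UP.upTo⁺ (suc n))
      (λ d → listsOfLength-! d (UP.map⁺ ℕP.suc-injective (UP.upTo⁺ n)))
      (λ {d} {d′} a b → trans (sym (proj₁ (length-listsOfLength d L a))) (proj₁ (length-listsOfLength d′ L b)))

    in-L⁻ : ∀ {x} → x ∈ L → 1 ≤ x × x ≤ m
    in-L⁻ x∈ with ∈P.∈-map⁻ suc x∈
    ... | y , y∈ , refl = s≤s z≤n , ℕP.≤-trans (∈P.∈-upTo⁻ y∈) n≤m

    fwd : ∀ {xs} → xs ∈ filter part? (partitionCandidates n) → xs ∈ parts n m n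
    fwd {xs} xs∈ with ∈P.∈-filter⁻ part? {xs = partitionCandidates n} xs∈
    ... | c , (l , s) = ∈-parts⁺ n m n ℕP.≤-refl
      (LinkedP.Linked⇒AllPairs (λ y≤x z≤y → ℕP.≤-trans z≤y y≤x) l , All.map in-L⁻ (in-candidate c) , s)
      where
      in-candidate : ∀ {xs} → xs ∈ partitionCandidates n → All (_∈ L) xs
      in-candidate c = go (upTo (suc n)) c
        where
        go : ∀ ds {xs} → xs ∈ concatMap (λ d → listsOfLength d L) ds → All (_∈ L) xs
        go (d ∷ ds) c with ∈P.∈-++⁻ (listsOfLength d L) c
        ... | inj₁ l = proj₂ (length-listsOfLength d L l)
        ... | inj₂ r = go ds r

    bwd : ∀ {xs} → xs ∈ parts n m n → xs ∈ filter part? (partitionCandidates n)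
    bwd {xs} xs∈ with ∈-parts⁻ n m n xs∈
    ... | a , b , s = ∈P.∈-filter⁺ part?
      (∈-concatMap (λ d → listsOfLength d L) (∈P.∈-upTo⁺ (s≤s (ℕP.≤-trans (length≤sum xs b) (ℕP.≤-reflexive s)))) (∈-listsOfLength L xs (in-L xs b s)))
      (LinkedP.AllPairs⇒Linked a , s)
      where
      length≤sum : ∀ xs → All (λ x → 1 ≤ x × x ≤ m) xs → length xs ≤ sum xs
      length≤sum [] [] = z≤n
      length≤sum (x ∷ xs) ((1≤x , _) ∷ b) = ℕP.+-mono-≤ 1≤x (length≤sum xs b)
      ∈L : ∀ {x} → 1 ≤ x → x ≤ n → x ∈ L
      ∈L {suc x} _ x≤n = ∈P.∈-map⁺ suc (∈P.∈-upTo⁺ x≤n)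
      in-L : ∀ xs → All (λ x → 1 ≤ x × x ≤ m) xs → sum xs ≡ n → All (_∈ L) xs
      in-L [] [] _ = []
      in-L (x ∷ xs) b s = All.tabulate (λ {y} y∈ → ∈L (proj₁ (All.lookup b y∈))
        (ℕP.≤-trans (bound (x ∷ xs) y∈) (ℕP.≤-reflexive s)))
        where
        bound : ∀ xs {y} → y ∈ xs → y ≤ sum xs
        bound (x ∷ xs) (here refl) = ℕP.m≤m+n x _
        bound (x ∷ xs) (there y∈) = ℕP.≤-trans (bound xs y∈) (ℕP.m≤n+m _ x)

-- Generating functions of Frobenius partitions and of partitions.

module Frob (U : CommutativeRing 0ℓ 0ℓ) (root : Cyclo.FifthRoot U) where
  open import Data.Nat.ListAction using (sum)
  open import Data.List using (filter; length)
  open import Data.List.Properties using (filter-accept; filter-reject)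
  open Comb
  open LatticeSum U root public

  module _ where
    open C2
    open X2 using (sumL; Π<; _^_)

    prodL : {A : Set} → (A → P2.Series) → List A → P2.Series
    prodL f [] = 1#
    prodL f (x ∷ xs) = f x * prodL f xs

    prodL-++ : ∀ {A : Set} (f : A → P2.Series) xs ys → prodL f (xs ++ ys) ≈ prodL f xs * prodL f ys
    prodL-++ f [] ys = sym (*-identityˡ _)
    prodL-++ f (x ∷ xs) ys = trans (*-congˡ (prodL-++ f xs ys)) (sym (*-assoc _ _ _))

    prodL-subs : ∀ {A : Set} (t : A → P2.Series) E → prodL (λ e → 1# + t e) E ≈ sumL (prodL t) (subs E)
    prodL-subs t [] = sym (+-identityʳ 1#)
    prodL-subs t (e ∷ E) = trans (*-congˡ (prodL-subs t E)) (trans (distribʳ _ _ _) (trans (+-comm _ _)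
      (trans (+-cong
        (trans (sym (X2.sumL-*ˡ (t e) (prodL t) (subs E))) (sym (X2.sumL-map (prodL t) (e ∷_) (subs E)))) (*-identityˡ _))
        (sym (X2.sumL-++ (prodL t) (map (e ∷_) (subs E)) (subs E))))))

    prodL-M : ∀ {A : Set} (a b : A → ℕ) S → prodL (λ e → M UR.1# (a e) (b e)) S ≈ M UR.1# (sum (map a S)) (sum (map b S))
    prodL-M a b [] = refl
    prodL-M a b (e ∷ S) = trans (*-congˡ (prodL-M a b S)) (trans (M-* UR.1# (a e) (b e) UR.1# (sum (map a S)) (sum (map b S)))
      (M-cong (a e ℕ.+ sum (map a S)) (b e ℕ.+ sum (map b S)) unit-0))

    prodL-entries : ∀ k (t : ℕ → P2.Series) N → prodL (t ∘ proj₁) (entries k N) ≈ Π< N t ^ k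
    prodL-entries k t zero = sym (one^ k)
      where
      one^ : ∀ k → 1# ^ k ≈ 1#
      one^ zero = refl
      one^ (suc k) = trans (*-identityˡ _) (one^ k)
    prodL-entries k t (suc N) = trans (prodL-++ (t ∘ proj₁) (map (N ,_) (colors k)) (entries k N))
      (trans (*-cong (trans (level (colors k)) (reflexive (≡.cong (t N ^_) (length-colors k)))) (prodL-entries k t N))
        (trans (*-comm _ _) (sym (X2.^-distrib-* (Π< N t) (t N) k))))
      where
      level : ∀ {B : Set} (cs : List B) → prodL (t ∘ proj₁) (map (N ,_) cs) ≈ t N ^ length cs
      level [] = refl
      level (c ∷ cs) = *-congˡ (level cs)

  sum-map-suc : ∀ {k} (S : List (Entry k)) → sum (map (suc ∘ proj₁) S) ≡ length S ℕ.+ sum (map proj₁ S)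
  sum-map-suc [] = ≡.refl
  sum-map-suc (e ∷ S) = ≡.cong suc (≡.trans (≡.cong (proj₁ e ℕ.+_) (sum-map-suc S))
    (≡.trans (≡.sym (ℕP.+-assoc (proj₁ e) (length S) _)) (≡.trans (≡.cong (ℕ._+ sum (map proj₁ S)) (ℕP.+-comm (proj₁ e) (length S))) (ℕP.+-assoc (length S) (proj₁ e) _))))

  symbols : ∀ k N → List (Symbol k)
  symbols k N = cartesianProduct (subs (entries k N)) (subs (entries k N))

  -- An entry ℓ is marked by x^(ℓ + 1) y^ℓ in the top row and by x^ℓ y^(ℓ + 1) in the bottom row.
  -- Rows of equal length give a power of xy, with the weight as its exponent.
  product-symbols : ∀ k N → X2.Π< N factorX X2.^ k C2.* X2.Π< N factorY X2.^ k C2.≈ X2.sumL (λ s → M UR.1# (xDegree s) (yDegree s)) (symbols k N)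
  product-symbols k N = C2.trans (C2.*-cong (expand factorX tX (prodL-entries k factorX N)) (expand factorY tY (prodL-entries k factorY N)))
    (C2.sym (C2.trans (X2.sumL-product (λ s → M UR.1# (xDegree s) (yDegree s)) E E)
      (C2.trans (X2.sumL-cong (λ S → C2.trans (X2.sumL-cong (λ T → C2.sym (pair S T)) E) (X2.sumL-*ˡ (prodL (tX ∘ proj₁) S) (prodL (tY ∘ proj₁)) E)) E)
        (X2.sumL-*ʳ (X2.sumL (prodL (tY ∘ proj₁)) E) (prodL (tX ∘ proj₁)) E))))
    where
    E = subs (entries k N)
    tX tY : ℕ → P2.Series
    tX ℓ = M UR.1# (suc ℓ) ℓ
    tY ℓ = M UR.1# ℓ (suc ℓ)
    expand : ∀ (f t : ℕ → P2.Series) → prodL (λ e → C2.1# C2.+ t (proj₁ e)) (entries k N) C2.≈ X2.Π< N f X2.^ k →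
      X2.Π< N f X2.^ k C2.≈ X2.sumL (prodL (t ∘ proj₁)) E
    expand f t e = C2.trans (C2.sym e) (prodL-subs (t ∘ proj₁) (entries k N))
    pair : ∀ S T → prodL (tX ∘ proj₁) S C2.* prodL (tY ∘ proj₁) T C2.≈ M UR.1# (xDegree (S , T)) (yDegree (S , T))
    pair S T = C2.trans (C2.*-cong (prodL-M (suc ∘ proj₁) proj₁ S) (prodL-M proj₁ (suc ∘ proj₁) T))
      (C2.trans (M-* UR.1# (sum (map (suc ∘ proj₁) S)) (sum (map proj₁ S)) UR.1# (sum (map proj₁ T)) (sum (map (suc ∘ proj₁) T)))
        (C2.trans (M-cong (sum (map (suc ∘ proj₁) S) ℕ.+ sum (map proj₁ T)) (sum (map proj₁ S) ℕ.+ sum (map (suc ∘ proj₁) T)) unit-0)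
          (M-≡ UR.1# (≡.cong (ℕ._+ sum (map proj₁ T)) (sum-map-suc S)) (≡.cong (sum (map proj₁ S) ℕ.+_) (sum-map-suc T)))))

  intR-suc : ∀ m → UX.intR (+ suc m) UR.≈ UR.1# UR.+ UX.intR (+ m)
  intR-suc m = UX.intR-+ (+ 1) (+ m)

  diag-count : ∀ {k} n (L : List (Symbol k)) → X1.sumL (λ s → diag (M UR.1# (xDegree s) (yDegree s))) L n UR.≈ UX.intR (+ length (filter (balanced? n) L))
  diag-count n [] = UR.refl
  diag-count n (s ∷ L) = by-degree (balanced? n s)
    where
    by-degree : Dec (xDegree s ≡ n × yDegree s ≡ n) → diag (M UR.1# (xDegree s) (yDegree s)) n UR.+ X1.sumL (λ s → diag (M UR.1# (xDegree s) (yDegree s))) L n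
      UR.≈ UX.intR (+ length (filter (balanced? n) (s ∷ L)))
    by-degree (yes b@(x , y)) = UR.trans (UR.+-cong (UR.trans (diag-M-balanced UR.1# (xDegree s) (yDegree s) (≡.trans x (≡.sym y)) n)
        (UR.trans (P1.mon-≡ UR.1# x n) (P1.mon-same UR.1# n))) (diag-count n L))
      (UR.sym (UR.trans (UR.reflexive (≡.cong (λ l → UX.intR (+ length l)) (filter-accept (balanced? n) {s} {L} b))) (intR-suc (length (filter (balanced? n) L)))))
    by-degree (no ¬b) = UR.trans (UR.+-cong (vanish ¬b (xDegree s ℕ.≟ n)) (diag-count n L)) (UR.trans (UR.+-identityˡ _)
      (UR.reflexive (≡.cong (λ l → UX.intR (+ length l)) (≡.sym (filter-reject (balanced? n) {s} {L} ¬b)))))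
      where
      vanish : ¬ (xDegree s ≡ n × yDegree s ≡ n) → Dec (xDegree s ≡ n) → diag (M UR.1# (xDegree s) (yDegree s)) n UR.≈ UR.0#
      vanish _ (no x≢) = P2.mon-diff (P1.mon UR.1# (yDegree s)) (xDegree s) n (x≢ ∘ ≡.sym) n
      vanish ¬b (yes x) = UR.trans (UR.reflexive (≡.cong (λ m → M UR.1# (xDegree s) (yDegree s) m m) (≡.sym x)))
        (UR.trans (P2.mon-same (P1.mon UR.1# (yDegree s)) (xDegree s) (xDegree s))
          (P1.mon-diff UR.1# (yDegree s) (xDegree s) (λ e → ¬b (x , ≡.trans (≡.sym e) x))))

  truncate : ∀ {t : ℕ → P2.Series} {l} n → (∀ j → suc n ℕ.≤ j → P2.O (suc n) (t j)) → P2.Lim (λ N → X2.Π< N (λ j → C2.1# C2.+ t j)) l →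
    l P2.≈[ suc n ] X2.Π< (suc n) (λ j → C2.1# C2.+ t j)
  truncate {t} n small lim = let (M₀ , h) = lim (suc n) in
    P2.tr (P2.sy (h (M₀ ℕ.+ suc n) (ℕP.m≤m+n M₀ (suc n)))) (J2.Π<-stable {t} {suc n} small M₀)

  ^-≈[] : ∀ {N f g} k → f P2.≈[ N ] g → f X2.^ k P2.≈[ N ] g X2.^ k
  ^-≈[] zero e = P2.≈⇒ C2.refl
  ^-≈[] (suc k) e = P2.*-≈⟨⟩ e (^-≈[] k e)

  -- In a symbol of weight n all entries are at most n, so n + 1 factors of each product decide the
  -- coefficient.
  cφ-diag : ∀ k n → diag ((T1.X C2.* T1.Y) X2.^ k) n UR.≈ UX.intR (+ cφ k n)
  cφ-diag k n = UR.trans (approx n (ℕP.n<1+n n) n)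
    (UR.trans (diag-sumL (λ s → M UR.1# (xDegree s) (yDegree s)) (symbols k (suc n)) n)
      (UR.trans (diag-count n (symbols k (suc n))) (UR.reflexive (≡.cong (λ m → UX.intR (+ m)) (≡.sym (cφ-subs k n))))))
    where
    approx : (T1.X C2.* T1.Y) X2.^ k P2.≈[ suc n ] X2.sumL (λ s → M UR.1# (xDegree s) (yDegree s)) (symbols k (suc n))
    approx = P2.tr (^-≈[] k (P2.*-≈⟨⟩
        (truncate {λ j → M UR.1# (suc j) j} n (λ j le → P2.O-weaken {f = M UR.1# (suc j) j} (ℕP.m≤n⇒m≤1+n le) (P2.O-mon _ (suc j))) lim₁X)
        (truncate {λ j → M UR.1# j (suc j)} n (λ j le → P2.O-weaken {f = M UR.1# j (suc j)} le (P2.O-mon _ j)) lim₁Y)))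
      (P2.≈⇒ (C2.trans (X2.^-distrib-* _ _ k) (product-symbols k (suc n))))

  pSeries₁ : P1.Series
  pSeries₁ n = UX.intR (+ p n)

  -- By `step` the generating function of partitions into parts at most m is inverse to the first m
  -- factors of (q; q). For m beyond the required precision both agree with their limits.
  partitions-product : pSeries₁ C1.* Q 1 C1.≈ C1.1#
  partitions-product = P1.⇒≈ λ N → let (M₀ , h) = Lim-Q 0 N ; m = M₀ ℕ.+ N in
    P1.tr (P1.*-≈⟨⟩ (λ n n<N → UR.reflexive (≡.cong (λ c → UX.intR (+ c)) (p-#parts m n (ℕP.≤-trans (ℕP.<⇒≤ n<N) (ℕP.m≤n+m N M₀)))))
        (P1.sy (h m (ℕP.m≤m+n M₀ N))))
      (P1.≈⇒ (product m))
    where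
    A : ℕ → P1.Series
    A m n = UX.intR (+ #parts m n)

    step : ∀ m → A (suc m) C1.≈ A m C1.+ P1.mon UR.1# (suc m) C1.* A (suc m)
    step m n with n ℕP.<? suc m
    ... | yes n< = UR.trans (UR.reflexive (≡.cong (λ c → UX.intR (+ c)) (#parts-< m n n<)))
      (UR.sym (UR.trans (UR.+-congˡ (P1.mon-below UR.1# (suc m) (A (suc m)) n n<)) (UR.+-identityʳ _)))
    ... | no n≮ = ≡.subst (λ n → A (suc m) n UR.≈ A m n UR.+ (P1.mon UR.1# (suc m) C1.* A (suc m)) n) (ℕP.m+[n∸m]≡n (ℕP.≮⇒≥ n≮))
      (UR.trans (UR.trans (UR.reflexive (≡.cong (λ c → UX.intR (+ c)) (#parts-≥ m d))) (UX.intR-+ (+ #parts m (suc m ℕ.+ d)) (+ #parts (suc m) d)))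
        (UR.+-congˡ (UR.sym (UR.trans (P1.mon-shift UR.1# (suc m) (A (suc m)) d) (UR.*-identityˡ _)))))
      where d = n ℕ.∸ suc m

    product : ∀ m → A m C1.* X1.Π< m (qFactor 1) C1.≈ C1.1#
    product zero = C1.trans (C1.*-identityʳ (A 0)) (λ { zero → UR.refl ; (suc n) → UR.refl })
    product (suc m) = C1.trans (X1.solve 3 (λ a b t → a X1.:* (b X1.:* (X1.con (+ 1) X1.:- t)) X1.:= (a X1.:- t X1.:* a) X1.:* b) C1.refl (A (suc m)) _ (P1.mon UR.1# (1 ℕ.* suc m)))
      (C1.trans (C1.*-congʳ (C1.trans (C1.+-cong (step m) (C1.-‿cong (C1.*-congʳ (P1.mon-≡ UR.1# (ℕP.*-identityˡ (suc m))))))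
          (X1.solve 2 (λ a b → (a X1.:+ b) X1.:- b X1.:= a) C1.refl (A m) _)))
        (product m))

-- Products of two theta functions as determinants.

module Weier (V : CommutativeRing 0ℓ 0ℓ) where
  open import Algebra.Properties.AbelianGroup ℤP.+-0-abelianGroup using (∙-cancelʳ)
  open Jacobi
  open LatticeZ using (wt; wt2; halve)
  open Base V using (module UR; module UX; module P1; module C1; module X1; module S1; Q; Lim-Q; qFactor; O-neg1)
  private module J1 = JTP V

  -- Characters of ℤ, standing for monomials α ↦ αⁱ in a unit α.
  record Char : Set where
    field
      χ : ℤ → UR.Carrier
      χ-0 : χ (+ 0) UR.≈ UR.1#
      χ-+ : ∀ i j → χ (i ℤ.+ j) UR.≈ χ i UR.* χ j

    χ-⊖ : ∀ m n → χ (m ℤ.⊖ n) UR.≈ χ (+ 1) UX.^ m UR.* χ (ℤ.- + 1) UX.^ n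
    χ-⊖ zero zero = UR.trans χ-0 (UR.sym (UR.*-identityʳ _))
    χ-⊖ (suc m) zero = UR.trans (χ-+ (+ 1) (+ m)) (UR.trans (UR.*-congˡ (χ-⊖ m zero)) (UR.sym (UR.*-assoc _ _ _)))
    χ-⊖ zero (suc zero) = UR.sym (UR.trans (UR.*-identityˡ _) (UR.*-identityʳ _))
    χ-⊖ zero (suc (suc n)) = UR.trans (χ-+ (ℤ.- + 1) (0 ℤ.⊖ suc n)) (UR.trans (UR.*-congˡ (χ-⊖ zero (suc n)))
      (UX.solve 2 (λ a b → a UX.:* (UX.con (+ 1) UX.:* b) UX.:= UX.con (+ 1) UX.:* (a UX.:* b)) UR.refl _ _))
    χ-⊖ (suc m) (suc n) = UR.trans (UR.reflexive (≡.cong χ (ℤP.[1+m]⊖[1+n]≡m⊖n m n))) (UR.trans (χ-⊖ m n)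
      (UR.trans (UR.sym (UR.*-identityˡ _)) (UR.trans (UR.*-congʳ (UR.trans (UR.sym χ-0) (χ-+ (+ 1) (ℤ.- + 1))))
        (UX.solve 4 (λ a b c d → (a UX.:* b) UX.:* (c UX.:* d) UX.:= (a UX.:* c) UX.:* (b UX.:* d)) UR.refl _ _ _ _))))

  open Char

  unit-char : ∀ u v → u UR.* v UR.≈ UR.1# → Char
  unit-char u v uv = record { χ = pow ; χ-0 = UR.refl ; χ-+ = pow-+ }
    where
    pow : ℤ → UR.Carrier
    pow (+ n) = u UX.^ n
    pow -[1+ n ] = v UX.^ suc n
    pow-⊖ : ∀ m n → pow (m ℤ.⊖ n) UR.≈ u UX.^ m UR.* v UX.^ n
    pow-⊖ m zero = UR.sym (UR.*-identityʳ _)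
    pow-⊖ zero (suc n) = UR.sym (UR.*-identityˡ _)
    pow-⊖ (suc m) (suc n) = UR.trans (UR.reflexive (≡.cong pow (ℤP.[1+m]⊖[1+n]≡m⊖n m n))) (UR.trans (pow-⊖ m n)
      (UR.trans (UR.sym (UR.*-identityˡ _)) (UR.trans (UR.*-congʳ (UR.sym uv))
        (UX.solve 4 (λ a b c d → (a UX.:* b) UX.:* (c UX.:* d) UX.:= (a UX.:* c) UX.:* (b UX.:* d)) UR.refl _ _ _ _))))
    pow-+ : ∀ i j → pow (i ℤ.+ j) UR.≈ pow i UR.* pow j
    pow-+ (+ m) (+ n) = UX.^-homo-* u m n
    pow-+ (+ m) -[1+ n ] = pow-⊖ m (suc n)
    pow-+ -[1+ m ] (+ n) = UR.trans (pow-⊖ n (suc m)) (UR.*-comm _ _)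
    pow-+ -[1+ m ] -[1+ n ] = UR.trans (UR.reflexive (≡.cong (λ k → v UX.^ suc k) (≡.sym (ℕP.+-suc m n)))) (UX.^-homo-* v (suc m) (suc n))

  infixl 7 _⊗_
  _⊗_ : Char → Char → Char
  a ⊗ b = record
    { χ = λ i → χ a i UR.* χ b i
    ; χ-0 = UR.trans (UR.*-cong (χ-0 a) (χ-0 b)) (UR.*-identityʳ _)
    ; χ-+ = λ i j → UR.trans (UR.*-cong (χ-+ a i j) (χ-+ b i j))
        (UX.solve 4 (λ a b c d → (a UX.:* b) UX.:* (c UX.:* d) UX.:= (a UX.:* c) UX.:* (b UX.:* d)) UR.refl _ _ _ _) }

  _⁻¹ : Char → Char
  a ⁻¹ = record
    { χ = λ i → χ a (ℤ.- i)
    ; χ-0 = χ-0 a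
    ; χ-+ = λ i j → UR.trans (UR.reflexive (≡.cong (χ a) (ℤP.neg-distrib-+ i j))) (χ-+ a (ℤ.- i) (ℤ.- j)) }

  𝟙 : Char
  𝟙 = record { χ = λ _ → UR.1# ; χ-0 = UR.refl ; χ-+ = λ _ _ → UR.sym (UR.*-identityʳ _) }

  sgn : Char
  sgn = unit-char (UR.- UR.1#) (UR.- UR.1#) (UX.solve 0 ((UX.:- UX.con (+ 1)) UX.:* (UX.:- UX.con (+ 1)) UX.:= UX.con (+ 1)) UR.refl)

  sgn-double : ∀ i → χ sgn (i ℤ.+ i) UR.≈ UR.1#
  sgn-double i = UR.trans (χ-+ sgn i i) (square i)
    where
    pow² : ∀ n → (UR.- UR.1#) UX.^ n UR.* (UR.- UR.1#) UX.^ n UR.≈ UR.1#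
    pow² zero = UR.*-identityʳ _
    pow² (suc n) = UR.trans (UX.solve 1 (λ a → (UX.:- UX.con (+ 1) UX.:* a) UX.:* (UX.:- UX.con (+ 1) UX.:* a) UX.:= a UX.:* a) UR.refl _) (pow² n)
    square : ∀ i → χ sgn i UR.* χ sgn i UR.≈ UR.1#
    square (+ n) = pow² n
    square -[1+ n ] = pow² (suc n)

  -- F c e = ∏_j (1 − c q^(e + j w)), with w = 1 + m.
  module Modulus (m : ℕ) where
    w = suc m

    tF : UR.Carrier → ℕ → ℕ → P1.Series
    tF c e j = P1.mon c (e ℕ.+ j ℕ.* w)

    O-tF : ∀ c e j → P1.O j (tF c e j)
    O-tF c e j = P1.O-weaken {f = tF c e j} (ℕP.≤-trans (ℕP.m≤m*n j w) (ℕP.m≤n+m (j ℕ.* w) e)) (P1.O-mon c (e ℕ.+ j ℕ.* w))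

    F : UR.Carrier → ℕ → P1.Series
    F c e = P1.limit (λ N → X1.Π< N (λ j → C1.1# C1.- tF c e j))

    Lim-F : ∀ c e → P1.Lim (λ N → X1.Π< N (λ j → C1.1# C1.- tF c e j)) (F c e)
    Lim-F c e = P1.Lim-Π {λ j → C1.- tF c e j} (λ j → O-neg1 (tF c e j) (O-tF c e j))

    F-cong : ∀ {c d} e → c UR.≈ d → F c e C1.≈ F d e
    F-cong {c} {d} e p = P1.Lim-unique (P1.Lim-cong (λ N → X1.Π<-cong N (λ j → C1.+-congˡ (C1.-‿cong (P1.mon-cong (e ℕ.+ j ℕ.* w) p)))) (Lim-F c e)) (Lim-F d e)

    F-shift : ∀ c e → F c e C1.≈ (C1.1# C1.- P1.mon c e) C1.* F c (e ℕ.+ w)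
    F-shift c e = P1.Lim-unique (P1.Lim-sub suc (ℕP.n≤1+n) (Lim-F c e))
      (P1.Lim-cong (λ N → C1.sym (C1.trans (X1.Π<-front N _) (C1.*-cong
          (C1.+-congˡ (C1.-‿cong (P1.mon-≡ c (ℕP.+-identityʳ e))))
          (X1.Π<-cong N (λ j → C1.+-congˡ (C1.-‿cong (P1.mon-≡ c (≡.sym (ℕP.+-assoc e w (j ℕ.* w))))))))))
        (P1.Lim-* (P1.Lim-const _) (Lim-F c (e ℕ.+ w))))

    F-Q : F UR.1# w C1.≈ Q w
    F-Q = P1.Lim-unique (P1.Lim-cong (λ N → X1.Π<-cong N (λ j → C1.+-congˡ (C1.-‿cong (P1.mon-≡ UR.1# (ℕP.*-comm (suc j) w))))) (Lim-F UR.1# w)) (Lim-Q m)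

    -- The theta function of base q^w at α q^e, with ē standing for w - e.
    θ : Char → ℕ → ℕ → P1.Series
    θ a e ē = Q w C1.* (F (χ a (+ 1)) e C1.* F (χ a (ℤ.- + 1)) ē)

    -- Jacobi's identity at -α q^e and -α⁻¹ q^ē; the character `sgn` carries the sign (-1)ᶻ.
    θ-sum : ∀ a e ē → e ℕ.+ ē ≡ w → S1.HasSum (λ z → P1.mon (χ (sgn ⊗ a) z) (wt e ē z)) (θ a e ē)
    θ-sum a e ē eē = S1.HasSum-cong term (C1.*-congˡ (C1.*-cong
        (P1.Lim-unique (J1.Lim-xProduct ox oy pos) (P1.Lim-cong (λ N → X1.Π<-cong N (λ j → C1.+-congˡ (C1.sym (xfactor j)))) (Lim-F (χ a (+ 1)) e)))
        (P1.Lim-unique (J1.Lim-yProduct ox oy pos) (P1.Lim-cong (λ N → X1.Π<-cong N (λ j → C1.+-congˡ (C1.sym (yfactor j)))) (Lim-F (χ a (ℤ.- + 1)) ē)))))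
      (J1.jacobi ox oy pos (P1.Lim-cong (λ N → X1.Π<-cong N qfactor) (Lim-Q m)))
      where
      σ = sgn ⊗ a
      x y : P1.Series
      x = P1.mon (χ σ (+ 1)) e
      y = P1.mon (χ σ (ℤ.- + 1)) ē
      ox : P1.O e x
      ox = P1.O-mon _ e
      oy : P1.O ē y
      oy = P1.O-mon _ ē
      pos : 1 ℕ.≤ e ℕ.+ ē
      pos = ≡.subst (1 ℕ.≤_) (≡.sym eē) (ℕ.s≤s ℕ.z≤n)
      power : ∀ k l → x X1.^ k C1.* y X1.^ l C1.≈ P1.mon (χ σ (k ℤ.⊖ l)) (k ℕ.* e ℕ.+ l ℕ.* ē)
      power k l = C1.trans (C1.*-cong (P1.mon-^ _ e k) (P1.mon-^ _ ē l)) (C1.trans (P1.mon-* _ (k ℕ.* e) _ (l ℕ.* ē))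
        (P1.mon-cong (k ℕ.* e ℕ.+ l ℕ.* ē) (UR.sym (χ-⊖ σ k l))))
      term : ∀ z → x X1.^ triℤ z C1.* y X1.^ triℤ (ℤ.- z) C1.≈ P1.mon (χ σ z) (wt e ē z)
      term z = C1.trans (power (triℤ z) (triℤ (ℤ.- z))) (P1.mon-cong (wt e ē z) (UR.reflexive (≡.cong (χ σ) diff)))
        where
        shape : ∀ t z → (t ℤ.+ z) ℤ.- t ≡ z
        shape = ℤS.solve-∀
        diff : triℤ z ℤ.⊖ triℤ (ℤ.- z) ≡ z
        diff = ≡.trans (≡.sym (ℤP.m-n≡m⊖n (triℤ z) (triℤ (ℤ.- z)))) (≡.trans (≡.cong (ℤ._- + triℤ (ℤ.- z)) (LatticeZ.tri-diff z)) (shape (+ triℤ (ℤ.- z)) z))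
      suc⊖ : ∀ j → suc j ℤ.⊖ j ≡ + 1
      suc⊖ zero = ≡.refl
      suc⊖ (suc j) = ≡.trans (ℤP.[1+m]⊖[1+n]≡m⊖n (suc j) j) (suc⊖ j)
      ⊖suc : ∀ j → j ℤ.⊖ suc j ≡ ℤ.- + 1
      ⊖suc j = ≡.trans (ℤP.⊖-swap j (suc j)) (≡.cong ℤ.-_ (suc⊖ j))
      minus : ∀ c k {c′ k′} → c UR.≈ UR.- c′ → k ≡ k′ → P1.mon c k C1.≈ C1.- P1.mon c′ k′
      minus c k {c′} e ≡.refl = C1.trans (P1.mon-cong k e) (C1.sym (P1.mon-neg c′ k))
      neg : ∀ c → (UR.- UR.1# UR.* UR.1#) UR.* c UR.≈ UR.- c
      neg = UX.solve 1 (λ c → (UX.:- UX.con (+ 1) UX.:* UX.con (+ 1)) UX.:* c UX.:= UX.:- c) UR.refl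
      xfactor : ∀ j → x X1.^ suc j C1.* y X1.^ j C1.≈ C1.- tF (χ a (+ 1)) e j
      xfactor j = C1.trans (power (suc j) j) (minus _ _ (UR.trans (UR.reflexive (≡.cong (χ σ) (suc⊖ j))) (neg _))
        (≡.trans (ℕP.+-assoc e (j ℕ.* e) (j ℕ.* ē)) (≡.cong (e ℕ.+_) (≡.trans (≡.sym (ℕP.*-distribˡ-+ j e ē)) (≡.cong (j ℕ.*_) eē)))))
      yfactor : ∀ j → x X1.^ j C1.* y X1.^ suc j C1.≈ C1.- tF (χ a (ℤ.- + 1)) ē j
      yfactor j = C1.trans (power j (suc j)) (minus _ _ (UR.trans (UR.reflexive (≡.cong (χ σ) (⊖suc j))) (neg _))
        (≡.trans (rotate (j ℕ.* e) ē (j ℕ.* ē)) (≡.cong (ē ℕ.+_) (≡.trans (≡.sym (ℕP.*-distribˡ-+ j e ē)) (≡.cong (j ℕ.*_) eē)))))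
        where
        rotate : ∀ a b c → a ℕ.+ (b ℕ.+ c) ≡ b ℕ.+ (a ℕ.+ c)
        rotate = ℕS.solve-∀
      xy-eq : x C1.* y C1.≈ P1.mon UR.1# w
      xy-eq = C1.trans (P1.mon-* _ e _ ē) (C1.trans (P1.mon-cong (e ℕ.+ ē) (UR.trans (UR.sym (χ-+ σ (+ 1) (ℤ.- + 1))) (χ-0 σ))) (P1.mon-≡ UR.1# eē))
      one^ : ∀ k → UR.1# UX.^ k UR.≈ UR.1#
      one^ zero = UR.refl
      one^ (suc k) = UR.trans (UR.*-identityˡ _) (one^ k)
      qfactor : ∀ j → qFactor w j C1.≈ C1.1# C1.- (x C1.* y) X1.^ suc j
      qfactor j = C1.+-congˡ (C1.-‿cong (C1.sym (C1.trans (X1.^-congˡ (suc j) xy-eq) (C1.trans (P1.mon-^ UR.1# w (suc j))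
        (C1.trans (P1.mon-cong (suc j ℕ.* w) (one^ (suc j))) (P1.mon-≡ UR.1# (ℕP.*-comm (suc j) w)))))))

  sq : ℤ → ℕ
  sq i = ℤ.∣ i ∣ ℕ.* ℤ.∣ i ∣

  sq-ℤ : ∀ i → + sq i ≡ i ℤ.* i
  sq-ℤ (+ n) = ℤP.pos-* n n
  sq-ℤ -[1+ n ] = ≡.refl

  sq-≥ : ∀ n → n ℕ.≤ n ℕ.* n
  sq-≥ zero = ℕ.z≤n
  sq-≥ (suc n) = ℕP.m≤m*n (suc n) (suc n)

  sq-suc-≥ : ∀ i → ℤ.∣ i ∣ ℕ.∸ 1 ℕ.≤ sq (i ℤ.+ + 1)
  sq-suc-≥ (+ n) = ℕP.≤-trans (ℕP.m∸n≤m n 1) (ℕP.≤-trans (ℕP.m≤m+n n 1) (sq-≥ (n ℕ.+ 1)))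
  sq-suc-≥ -[1+ zero ] = ℕ.z≤n
  sq-suc-≥ -[1+ suc n ] = sq-≥ (suc n)

  -- Separation of θ(ab) θ(a/b) by the parity of the sum of the two summation indices.
  evenTerm oddTerm : Char → ℕ → ℕ → ℤ → P1.Series
  evenTerm a e ē i = P1.mon (χ a (i ℤ.+ i)) (wt (e ℕ.+ e) (ē ℕ.+ ē) i)
  oddTerm a e ē i = P1.mon (χ a (i ℤ.+ i ℤ.+ + 1)) (sq (i ℤ.+ + 1) ℕ.* e ℕ.+ sq i ℕ.* ē)

  module _ (a : Char) (e ē : ℕ) (pos : 1 ℕ.≤ e ℕ.+ ē) where
    O-evenTerm : ∀ i → P1.O (ℤ.∣ i ∣ ℕ.∸ 1) (evenTerm a e ē i)
    O-evenTerm i = P1.O-weaken {f = evenTerm a e ē i} (J1.weighted-≥ (e ℕ.+ e) (ē ℕ.+ ē) _ {triℤ i} {triℤ (ℤ.- i)}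
        (ℕP.≤-trans pos (ℕP.+-mono-≤ (ℕP.m≤m+n e e) (ℕP.m≤m+n ē ē))) (J1.triℤ-≥ i) (J1.triℤ-neg-≥ i)) (P1.O-mon _ _)

    O-oddTerm : ∀ i → P1.O (ℤ.∣ i ∣ ℕ.∸ 1) (oddTerm a e ē i)
    O-oddTerm i = P1.O-weaken {f = oddTerm a e ē i} (J1.weighted-≥ e ē _ {sq (i ℤ.+ + 1)} {sq i} pos (sq-suc-≥ i)
        (ℕP.≤-trans (ℕP.m∸n≤m _ 1) (sq-≥ ℤ.∣ i ∣))) (P1.O-mon _ _)

    evenSum oddSum : P1.Series
    evenSum = S1.sumℤ (evenTerm a e ē) O-evenTerm
    oddSum = S1.sumℤ (oddTerm a e ē) O-oddTerm

  data Parity (z : ℤ) : Set where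
    even : ∀ k → z ≡ k ℤ.+ k → Parity z
    odd : ∀ k → z ≡ k ℤ.+ k ℤ.+ + 1 → Parity z

  parity : ∀ z → Parity z
  parity z = by-remainder (z %ℕ 2) (n%ℕd<d z 2) (a≡a%ℕn+[a/ℕn]*n z 2)
    where
    double : ∀ k → + 0 ℤ.+ k ℤ.* + 2 ≡ k ℤ.+ k
    double = ℤS.solve-∀
    double+1 : ∀ k → + 1 ℤ.+ k ℤ.* + 2 ≡ k ℤ.+ k ℤ.+ + 1
    double+1 = ℤS.solve-∀
    by-remainder : ∀ r → r ℕ.< 2 → z ≡ + r ℤ.+ z /ℕ 2 ℤ.* + 2 → Parity z
    by-remainder 0 _ e = even (z /ℕ 2) (≡.trans e (double (z /ℕ 2)))
    by-remainder 1 _ e = odd (z /ℕ 2) (≡.trans e (double+1 (z /ℕ 2)))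
    by-remainder (suc (suc r)) (ℕ.s≤s (ℕ.s≤s ())) e

  double-injective : ∀ {i j} → i ℤ.+ i ≡ j ℤ.+ j → i ≡ j
  double-injective {i} {j} e = halve i j (≡.trans (shape i) (≡.trans e (≡.sym (shape j))))
    where
    shape : ∀ i → i ℤ.* + 2 ≡ i ℤ.+ i
    shape = ℤS.solve-∀

  even≢odd : ∀ {i j} → i ℤ.+ i ≢ j ℤ.+ j ℤ.+ + 1
  even≢odd {i} {j} e = no-half (i ℤ.- j) (≡.trans (shape i j) (≡.trans (≡.cong (ℤ._- (j ℤ.+ j)) e) (shape′ j)))
    where
    shape : ∀ i j → (i ℤ.- j) ℤ.+ (i ℤ.- j) ≡ (i ℤ.+ i) ℤ.- (j ℤ.+ j)
    shape = ℤS.solve-∀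
    shape′ : ∀ j → (j ℤ.+ j ℤ.+ + 1) ℤ.- (j ℤ.+ j) ≡ + 1
    shape′ = ℤS.solve-∀
    no-half : ∀ d → d ℤ.+ d ≢ + 1
    no-half (+ zero) ()
    no-half (+ suc n) e = ℕP.m+1+n≢0 n (ℕP.suc-injective (ℤP.+-injective e))
    no-half -[1+ n ] ()

  Index : Set
  Index = (ℤ × ℤ) ⊎ (ℤ × ℤ)

  toPair : Index → ℤ × ℤ
  toPair (inj₁ (i , j)) = i ℤ.+ j , i ℤ.- j
  toPair (inj₂ (i , j)) = i ℤ.+ j , i ℤ.- j ℤ.+ + 1

  fromPair : ℤ × ℤ → Index
  fromPair (m , n) with parity (m ℤ.+ n)
  ... | even k _ = inj₁ (k , m ℤ.- k)
  ... | odd k _ = inj₂ (k , m ℤ.- k)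

  from-to : ∀ x → fromPair (toPair x) ≡ x
  from-to (inj₁ (i , j)) with parity ((i ℤ.+ j) ℤ.+ (i ℤ.- j))
  ... | odd k e = ⊥-elim (even≢odd {i} {k} (≡.trans (shape i j) e))
    where
    shape : ∀ i j → i ℤ.+ i ≡ (i ℤ.+ j) ℤ.+ (i ℤ.- j)
    shape = ℤS.solve-∀
  ... | even k e with double-injective {i} {k} (≡.trans (shape i j) e)
    where
    shape : ∀ i j → i ℤ.+ i ≡ (i ℤ.+ j) ℤ.+ (i ℤ.- j)
    shape = ℤS.solve-∀
  ...   | ≡.refl = ≡.cong (λ t → inj₁ (i , t)) (shape′ i j)
    where
    shape′ : ∀ i j → (i ℤ.+ j) ℤ.- i ≡ j
    shape′ = ℤS.solve-∀
  from-to (inj₂ (i , j)) with parity ((i ℤ.+ j) ℤ.+ (i ℤ.- j ℤ.+ + 1))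
  ... | even k e = ⊥-elim (even≢odd {k} {i} (≡.trans (≡.sym e) (shape i j)))
    where
    shape : ∀ i j → (i ℤ.+ j) ℤ.+ (i ℤ.- j ℤ.+ + 1) ≡ i ℤ.+ i ℤ.+ + 1
    shape = ℤS.solve-∀
  ... | odd k e with double-injective {i} {k} (∙-cancelʳ (+ 1) (i ℤ.+ i) (k ℤ.+ k) (≡.trans (shape i j) e))
    where
    shape : ∀ i j → i ℤ.+ i ℤ.+ + 1 ≡ (i ℤ.+ j) ℤ.+ (i ℤ.- j ℤ.+ + 1)
    shape = ℤS.solve-∀
  ...   | ≡.refl = ≡.cong (λ t → inj₂ (i , t)) (shape′ i j)
    where
    shape′ : ∀ i j → (i ℤ.+ j) ℤ.- i ≡ j
    shape′ = ℤS.solve-∀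

  to-from : ∀ y → toPair (fromPair y) ≡ y
  to-from (m , n) with parity (m ℤ.+ n)
  ... | even k e = ≡.cong₂ _,_ (first m k) (≡.trans (second m k) (≡.trans (≡.cong (ℤ._- m) (≡.sym e)) (third m n)))
    where
    first : ∀ m k → k ℤ.+ (m ℤ.- k) ≡ m
    first = ℤS.solve-∀
    second : ∀ m k → k ℤ.- (m ℤ.- k) ≡ (k ℤ.+ k) ℤ.- m
    second = ℤS.solve-∀
    third : ∀ m n → (m ℤ.+ n) ℤ.- m ≡ n
    third = ℤS.solve-∀
  ... | odd k e = ≡.cong₂ _,_ (first m k) (≡.trans (second m k) (≡.trans (≡.cong (ℤ._- m) (≡.sym e)) (third m n)))
    where
    first : ∀ m k → k ℤ.+ (m ℤ.- k) ≡ m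
    first = ℤS.solve-∀
    second : ∀ m k → k ℤ.- (m ℤ.- k) ℤ.+ + 1 ≡ (k ℤ.+ k ℤ.+ + 1) ℤ.- m
    second = ℤS.solve-∀
    third : ∀ m n → (m ℤ.+ n) ℤ.- m ≡ n
    third = ℤS.solve-∀

  -- Exponents of q, with e = h + f, ē = f + ḡ, f̄ = h + f + ḡ.
  private
    2wt2 : ∀ m n i → (+ wt (m ℕ.+ m) (n ℕ.+ n) i) ℤ.* + 2 ≡ ((i ℤ.* i ℤ.+ i) ℤ.* + m ℤ.+ (i ℤ.* i ℤ.- i) ℤ.* + n) ℤ.* + 2
    2wt2 m n i = ≡.trans (wt2 (m ℕ.+ m) (n ℕ.+ n) i) (shape (i ℤ.* i ℤ.+ i) (i ℤ.* i ℤ.- i) (+ m) (+ n))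
      where
      shape : ∀ a b m n → a ℤ.* (m ℤ.+ m) ℤ.+ b ℤ.* (n ℤ.+ n) ≡ (a ℤ.* m ℤ.+ b ℤ.* n) ℤ.* + 2
      shape = ℤS.solve-∀

    sqs-ℤ : ∀ i f f̄ → + (sq (i ℤ.+ + 1) ℕ.* f ℕ.+ sq i ℕ.* f̄) ≡ (i ℤ.+ + 1) ℤ.* (i ℤ.+ + 1) ℤ.* + f ℤ.+ i ℤ.* i ℤ.* + f̄
    sqs-ℤ i f f̄ = ≡.cong₂ ℤ._+_ (≡.trans (ℤP.pos-* (sq (i ℤ.+ + 1)) f) (≡.cong (ℤ._* + f) (sq-ℤ (i ℤ.+ + 1))))
      (≡.trans (ℤP.pos-* (sq i) f̄) (≡.cong (ℤ._* + f̄) (sq-ℤ i)))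

    ℕ-from-double : ∀ {a b : ℕ} → + a ℤ.* + 2 ≡ + b ℤ.* + 2 → a ≡ b
    ℕ-from-double {a} {b} e = ℤP.+-injective (halve (+ a) (+ b) e)

    distrib3 : ∀ a b c → (a ℤ.+ (b ℤ.+ c)) ℤ.* + 2 ≡ a ℤ.* + 2 ℤ.+ (b ℤ.* + 2 ℤ.+ c ℤ.* + 2)
    distrib3 = ℤS.solve-∀

  exponent-even : ∀ h f ḡ i j → f ℕ.+ (wt (h ℕ.+ f ℕ.+ f) ḡ (i ℤ.+ j) ℕ.+ wt h (f ℕ.+ ḡ ℕ.+ f) (i ℤ.- j)) ≡
    wt ((h ℕ.+ f) ℕ.+ (h ℕ.+ f)) ((f ℕ.+ ḡ) ℕ.+ (f ℕ.+ ḡ)) i ℕ.+ (sq (j ℤ.+ + 1) ℕ.* f ℕ.+ sq j ℕ.* (h ℕ.+ f ℕ.+ ḡ))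
  exponent-even h f ḡ i j = ℕ-from-double (≡.trans (distrib3 (+ f) (+ wt (h ℕ.+ f ℕ.+ f) ḡ (i ℤ.+ j)) (+ wt h (f ℕ.+ ḡ ℕ.+ f) (i ℤ.- j)))
    (≡.trans (≡.cong₂ (λ s t → + f ℤ.* + 2 ℤ.+ (s ℤ.+ t)) (wt2 (h ℕ.+ f ℕ.+ f) ḡ (i ℤ.+ j)) (wt2 h (f ℕ.+ ḡ ℕ.+ f) (i ℤ.- j)))
      (≡.trans (shape (+ h) (+ f) (+ ḡ) i j)
        (≡.sym (≡.trans (ℤP.*-distribʳ-+ (+ 2) (+ wt ((h ℕ.+ f) ℕ.+ (h ℕ.+ f)) ((f ℕ.+ ḡ) ℕ.+ (f ℕ.+ ḡ)) i) (+ (sq (j ℤ.+ + 1) ℕ.* f ℕ.+ sq j ℕ.* (h ℕ.+ f ℕ.+ ḡ))))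
          (≡.cong₂ ℤ._+_ (2wt2 (h ℕ.+ f) (f ℕ.+ ḡ) i) (≡.cong (ℤ._* + 2) (sqs-ℤ j f (h ℕ.+ f ℕ.+ ḡ)))))))))
    where
    shape : ∀ h f g i j → f ℤ.* + 2 ℤ.+ ((((i ℤ.+ j) ℤ.* (i ℤ.+ j) ℤ.+ (i ℤ.+ j)) ℤ.* (h ℤ.+ f ℤ.+ f) ℤ.+ ((i ℤ.+ j) ℤ.* (i ℤ.+ j) ℤ.- (i ℤ.+ j)) ℤ.* g)
        ℤ.+ (((i ℤ.- j) ℤ.* (i ℤ.- j) ℤ.+ (i ℤ.- j)) ℤ.* h ℤ.+ ((i ℤ.- j) ℤ.* (i ℤ.- j) ℤ.- (i ℤ.- j)) ℤ.* (f ℤ.+ g ℤ.+ f)))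
      ≡ ((i ℤ.* i ℤ.+ i) ℤ.* (h ℤ.+ f) ℤ.+ (i ℤ.* i ℤ.- i) ℤ.* (f ℤ.+ g)) ℤ.* + 2 ℤ.+ ((j ℤ.+ + 1) ℤ.* (j ℤ.+ + 1) ℤ.* f ℤ.+ j ℤ.* j ℤ.* (h ℤ.+ f ℤ.+ g)) ℤ.* + 2
    shape = ℤS.solve-∀

  exponent-odd : ∀ h f ḡ i j → f ℕ.+ (wt (h ℕ.+ f ℕ.+ f) ḡ (i ℤ.+ j) ℕ.+ wt h (f ℕ.+ ḡ ℕ.+ f) (i ℤ.- j ℤ.+ + 1)) ≡
    (sq (i ℤ.+ + 1) ℕ.* (h ℕ.+ f) ℕ.+ sq i ℕ.* (f ℕ.+ ḡ)) ℕ.+ wt (f ℕ.+ f) ((h ℕ.+ f ℕ.+ ḡ) ℕ.+ (h ℕ.+ f ℕ.+ ḡ)) j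
  exponent-odd h f ḡ i j = ℕ-from-double (≡.trans (distrib3 (+ f) (+ wt (h ℕ.+ f ℕ.+ f) ḡ (i ℤ.+ j)) (+ wt h (f ℕ.+ ḡ ℕ.+ f) (i ℤ.- j ℤ.+ + 1)))
    (≡.trans (≡.cong₂ (λ s t → + f ℤ.* + 2 ℤ.+ (s ℤ.+ t)) (wt2 (h ℕ.+ f ℕ.+ f) ḡ (i ℤ.+ j)) (wt2 h (f ℕ.+ ḡ ℕ.+ f) (i ℤ.- j ℤ.+ + 1)))
      (≡.trans (shape (+ h) (+ f) (+ ḡ) i j)
        (≡.sym (≡.trans (ℤP.*-distribʳ-+ (+ 2) (+ (sq (i ℤ.+ + 1) ℕ.* (h ℕ.+ f) ℕ.+ sq i ℕ.* (f ℕ.+ ḡ))) (+ wt (f ℕ.+ f) ((h ℕ.+ f ℕ.+ ḡ) ℕ.+ (h ℕ.+ f ℕ.+ ḡ)) j))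
          (≡.cong₂ ℤ._+_ (≡.cong (ℤ._* + 2) (sqs-ℤ i (h ℕ.+ f) (f ℕ.+ ḡ))) (2wt2 f (h ℕ.+ f ℕ.+ ḡ) j)))))))
    where
    shape : ∀ h f g i j → f ℤ.* + 2 ℤ.+ ((((i ℤ.+ j) ℤ.* (i ℤ.+ j) ℤ.+ (i ℤ.+ j)) ℤ.* (h ℤ.+ f ℤ.+ f) ℤ.+ ((i ℤ.+ j) ℤ.* (i ℤ.+ j) ℤ.- (i ℤ.+ j)) ℤ.* g)
        ℤ.+ (((i ℤ.- j ℤ.+ + 1) ℤ.* (i ℤ.- j ℤ.+ + 1) ℤ.+ (i ℤ.- j ℤ.+ + 1)) ℤ.* h ℤ.+ ((i ℤ.- j ℤ.+ + 1) ℤ.* (i ℤ.- j ℤ.+ + 1) ℤ.- (i ℤ.- j ℤ.+ + 1)) ℤ.* (f ℤ.+ g ℤ.+ f)))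
      ≡ ((i ℤ.+ + 1) ℤ.* (i ℤ.+ + 1) ℤ.* (h ℤ.+ f) ℤ.+ i ℤ.* i ℤ.* (f ℤ.+ g)) ℤ.* + 2 ℤ.+ ((j ℤ.* j ℤ.+ j) ℤ.* f ℤ.+ (j ℤ.* j ℤ.- j) ℤ.* (h ℤ.+ f ℤ.+ g)) ℤ.* + 2
    shape = ℤS.solve-∀

  -- e and f are the powers of q that accompany a and b; g = e + f and h = e - f accompany ab and
  -- a/b, and a bar denotes the complement to w. Expressing all of them by h, f and ḡ avoids
  -- subtraction.
  module Bracket (m : ℕ) (a b : Char) (e ē f f̄ g ḡ h h̄ : ℕ)
    (e-eq : e ≡ h ℕ.+ f) (ē-eq : ē ≡ f ℕ.+ ḡ) (f̄-eq : f̄ ≡ h ℕ.+ f ℕ.+ ḡ) (g-eq : g ≡ h ℕ.+ f ℕ.+ f) (h̄-eq : h̄ ≡ f ℕ.+ ḡ ℕ.+ f)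
    (total : h ℕ.+ f ℕ.+ f ℕ.+ ḡ ≡ suc m) (eē : 1 ℕ.≤ e ℕ.+ ē) (ff̄ : 1 ℕ.≤ f ℕ.+ f̄) where
    open Modulus m

    private
      T : ℤ × ℤ → P1.Series
      T (r , s) = P1.mon (χ b (+ 1)) f C1.* (P1.mon (χ (sgn ⊗ (a ⊗ b)) r) (wt g ḡ r) C1.* P1.mon (χ (sgn ⊗ (a ⊗ b ⁻¹)) s) (wt h h̄ s))

      evens odds : ℤ × ℤ → P1.Series
      evens (i , j) = evenTerm a e ē i C1.* oddTerm b f f̄ j
      odds (i , j) = (C1.- C1.1#) C1.* (oddTerm a e ē i C1.* evenTerm b f f̄ j)

      T-mon : ∀ r s → T (r , s) C1.≈ P1.mon (χ b (+ 1) UR.* (χ (sgn ⊗ (a ⊗ b)) r UR.* χ (sgn ⊗ (a ⊗ b ⁻¹)) s)) (f ℕ.+ (wt g ḡ r ℕ.+ wt h h̄ s))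
      T-mon r s = C1.trans (C1.*-congˡ (P1.mon-* _ (wt g ḡ r) _ (wt h h̄ s))) (P1.mon-* _ f _ (wt g ḡ r ℕ.+ wt h h̄ s))

      collect : ∀ r s → χ b (+ 1) UR.* (χ (sgn ⊗ (a ⊗ b)) r UR.* χ (sgn ⊗ (a ⊗ b ⁻¹)) s) UR.≈ χ sgn (r ℤ.+ s) UR.* (χ a (r ℤ.+ s) UR.* χ b (r ℤ.- s ℤ.+ + 1))
      collect r s = UR.trans (UX.solve 7 (λ o s₁ a₁ b₁ s₂ a₂ b₂ → o UX.:* ((s₁ UX.:* (a₁ UX.:* b₁)) UX.:* (s₂ UX.:* (a₂ UX.:* b₂)))
          UX.:= (s₁ UX.:* s₂) UX.:* ((a₁ UX.:* a₂) UX.:* ((b₁ UX.:* b₂) UX.:* o))) UR.refl _ _ _ _ _ _ _)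
        (UR.sym (UR.*-cong (χ-+ sgn r s) (UR.*-cong (χ-+ a r s) (UR.trans (χ-+ b (r ℤ.- s) (+ 1)) (UR.*-congʳ (χ-+ b r (ℤ.- s)))))))

      by-exponent : ∀ {c c′ k k′} → c UR.≈ c′ → k ≡ k′ → P1.mon c k C1.≈ P1.mon c′ k′
      by-exponent {k = k} p ≡.refl = P1.mon-cong k p

      even-case : ∀ i j → T (i ℤ.+ j , i ℤ.- j) C1.≈ evens (i , j)
      even-case i j = C1.trans (T-mon (i ℤ.+ j) (i ℤ.- j)) (C1.trans
        (by-exponent {k = f ℕ.+ (wt g ḡ (i ℤ.+ j) ℕ.+ wt h h̄ (i ℤ.- j))} coefficient exponent)
        (C1.sym (P1.mon-* _ (wt (e ℕ.+ e) (ē ℕ.+ ē) i) _ (sq (j ℤ.+ + 1) ℕ.* f ℕ.+ sq j ℕ.* f̄))))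
        where
        s₁ : ∀ i j → (i ℤ.+ j) ℤ.+ (i ℤ.- j) ≡ i ℤ.+ i
        s₁ = ℤS.solve-∀
        s₂ : ∀ i j → (i ℤ.+ j) ℤ.- (i ℤ.- j) ℤ.+ + 1 ≡ j ℤ.+ j ℤ.+ + 1
        s₂ = ℤS.solve-∀
        coefficient : χ b (+ 1) UR.* (χ (sgn ⊗ (a ⊗ b)) (i ℤ.+ j) UR.* χ (sgn ⊗ (a ⊗ b ⁻¹)) (i ℤ.- j)) UR.≈ χ a (i ℤ.+ i) UR.* χ b (j ℤ.+ j ℤ.+ + 1)
        coefficient = UR.trans (collect (i ℤ.+ j) (i ℤ.- j)) (UR.trans (UR.*-cong
          (UR.trans (UR.reflexive (≡.cong (χ sgn) (s₁ i j))) (sgn-double i))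
          (UR.*-cong (UR.reflexive (≡.cong (χ a) (s₁ i j))) (UR.reflexive (≡.cong (χ b) (s₂ i j))))) (UR.*-identityˡ _))
        exponent : f ℕ.+ (wt g ḡ (i ℤ.+ j) ℕ.+ wt h h̄ (i ℤ.- j)) ≡ wt (e ℕ.+ e) (ē ℕ.+ ē) i ℕ.+ (sq (j ℤ.+ + 1) ℕ.* f ℕ.+ sq j ℕ.* f̄)
        exponent rewrite e-eq | ē-eq | f̄-eq | g-eq | h̄-eq = exponent-even h f ḡ i j

      odd-case : ∀ i j → T (i ℤ.+ j , i ℤ.- j ℤ.+ + 1) C1.≈ odds (i , j)
      odd-case i j = C1.trans (T-mon (i ℤ.+ j) (i ℤ.- j ℤ.+ + 1)) (C1.trans
        (by-exponent {k = f ℕ.+ (wt g ḡ (i ℤ.+ j) ℕ.+ wt h h̄ (i ℤ.- j ℤ.+ + 1))} coefficient exponent)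
        (C1.trans (C1.sym (P1.mon-neg (χ a (i ℤ.+ i ℤ.+ + 1) UR.* χ b (j ℤ.+ j)) ((sq (i ℤ.+ + 1) ℕ.* e ℕ.+ sq i ℕ.* ē) ℕ.+ wt (f ℕ.+ f) (f̄ ℕ.+ f̄) j))) (C1.trans (C1.-‿cong (C1.sym (P1.mon-* _ (sq (i ℤ.+ + 1) ℕ.* e ℕ.+ sq i ℕ.* ē) _ (wt (f ℕ.+ f) (f̄ ℕ.+ f̄) j))))
          (X1.solve 1 (λ a → X1.:- a X1.:= (X1.:- X1.con (+ 1)) X1.:* a) C1.refl _))))
        where
        s₁ : ∀ i j → (i ℤ.+ j) ℤ.+ (i ℤ.- j ℤ.+ + 1) ≡ i ℤ.+ i ℤ.+ + 1
        s₁ = ℤS.solve-∀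
        s₂ : ∀ i j → (i ℤ.+ j) ℤ.- (i ℤ.- j ℤ.+ + 1) ℤ.+ + 1 ≡ j ℤ.+ j
        s₂ = ℤS.solve-∀
        coefficient : χ b (+ 1) UR.* (χ (sgn ⊗ (a ⊗ b)) (i ℤ.+ j) UR.* χ (sgn ⊗ (a ⊗ b ⁻¹)) (i ℤ.- j ℤ.+ + 1)) UR.≈ UR.- (χ a (i ℤ.+ i ℤ.+ + 1) UR.* χ b (j ℤ.+ j))
        coefficient = UR.trans (collect (i ℤ.+ j) (i ℤ.- j ℤ.+ + 1)) (UR.trans (UR.*-cong
          (UR.trans (UR.reflexive (≡.cong (χ sgn) (s₁ i j))) (UR.trans (χ-+ sgn (i ℤ.+ i) (+ 1)) (UR.*-congʳ (sgn-double i))))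
          (UR.*-cong (UR.reflexive (≡.cong (χ a) (s₁ i j))) (UR.reflexive (≡.cong (χ b) (s₂ i j)))))
          (UX.solve 1 (λ c → (UX.con (+ 1) UX.:* (UX.:- UX.con (+ 1) UX.:* UX.con (+ 1))) UX.:* c UX.:= UX.:- c) UR.refl _))
        exponent : f ℕ.+ (wt g ḡ (i ℤ.+ j) ℕ.+ wt h h̄ (i ℤ.- j ℤ.+ + 1)) ≡ (sq (i ℤ.+ + 1) ℕ.* e ℕ.+ sq i ℕ.* ē) ℕ.+ wt (f ℕ.+ f) (f̄ ℕ.+ f̄) j
        exponent rewrite e-eq | ē-eq | f̄-eq | g-eq | h̄-eq = exponent-odd h f ḡ i j

      case : ∀ x → T (toPair x) C1.≈ [ evens , odds ]′ x
      case (inj₁ (i , j)) = even-case i j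
      case (inj₂ (i , j)) = odd-case i j

      pair-≟ = ×P.≡-dec ℤ._≟_ ℤ._≟_

      separated : S1.HasSum T (evenSum a e ē eē C1.* oddSum b f f̄ ff̄ C1.+ (C1.- C1.1#) C1.* (oddSum a e ē eē C1.* evenSum b f f̄ ff̄))
      separated = S1.HasSum-transport (⊎P.≡-dec pair-≟ pair-≟) {f = [ evens , odds ]′} {T} toPair fromPair
        (λ x → inj₂ (from-to x , case x))
        (λ y → inj₂ (to-from y , C1.trans (C1.reflexive (≡.cong T (≡.sym (to-from y)))) (case (fromPair y))))
        (S1.HasSum-⊎
          (S1.HasSum-* ℤ._≟_ (S1.HasSum-sumℤ (evenTerm a e ē) (O-evenTerm a e ē eē)) (S1.HasSum-sumℤ (oddTerm b f f̄) (O-oddTerm b f f̄ ff̄)))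
          (S1.HasSum-scale {f = λ (i , j) → oddTerm a e ē i C1.* evenTerm b f f̄ j} (C1.- C1.1#)
            (S1.HasSum-* ℤ._≟_ (S1.HasSum-sumℤ (oddTerm a e ē) (O-oddTerm a e ē eē)) (S1.HasSum-sumℤ (evenTerm b f f̄) (O-evenTerm b f f̄ ff̄)))))

    -- The substitution r = i + j, s = i - j or i - j + 1, according to the parity of r + s,
    -- separates a from b. The result is the determinant of the vectors (even sum, odd sum)
    -- belonging to a and to b.
    bracket : P1.mon (χ b (+ 1)) f C1.* (θ (a ⊗ b) g ḡ C1.* θ (a ⊗ b ⁻¹) h h̄)
      C1.≈ evenSum a e ē eē C1.* oddSum b f f̄ ff̄ C1.+ (C1.- C1.1#) C1.* (oddSum a e ē eē C1.* evenSum b f f̄ ff̄)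
    bracket = S1.HasSum-unique pair-≟ (S1.HasSum-scale (P1.mon (χ b (+ 1)) f)
        (S1.HasSum-* ℤ._≟_ (θ-sum (a ⊗ b) g ḡ (≡.trans (≡.cong (ℕ._+ ḡ) g-eq) total))
          (θ-sum (a ⊗ b ⁻¹) h h̄ (≡.trans (≡.cong (h ℕ.+_) h̄-eq) (≡.trans (shape h f ḡ) total))))) separated
      where
      shape : ∀ h f g → h ℕ.+ (f ℕ.+ g ℕ.+ f) ≡ h ℕ.+ f ℕ.+ f ℕ.+ g
      shape = ℕS.solve-∀

-- Lambert series.

module Lambert (V : CommutativeRing 0ℓ 0ℓ) where
  open Base V using (module UR; module UX; module P1; module C1; module X1; O-neg1)

  private
    one : ∀ {n} → X1.Polynomial n
    one = X1.con (+ 1)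

  C-+ : ∀ a b → P1.C a C1.+ P1.C b C1.≈ P1.C (a UR.+ b)
  C-+ a b = P1.mon-+ a b 0

  -- Λ c k = c qᵏ / (1 − c qᵏ)²
  ΛTerm : UR.Carrier → ℕ → ℕ → P1.Series
  ΛTerm c k r = P1.mon (UX.intR (+ suc r) UR.* c UX.^ suc r) (suc r ℕ.* k)

  Λ : UR.Carrier → ℕ → P1.Series
  Λ c k = P1.limit (λ M → X1.Σ< M (ΛTerm c k))

  O-ΛTerm : ∀ c k r → P1.O r (ΛTerm c (suc k) r)
  O-ΛTerm c k r = P1.O-weaken {f = ΛTerm c (suc k) r} (ℕP.≤-trans (ℕP.n≤1+n r) (ℕP.m≤m*n (suc r) (suc k))) (P1.O-mon _ (suc r ℕ.* suc k))

  Lim-Λ : ∀ c k → P1.Lim (λ M → X1.Σ< M (ΛTerm c (suc k))) (Λ c (suc k))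
  Lim-Λ c k = P1.Lim-limit λ M → P1.tr (P1.+-≈⟨⟩ {f = X1.Σ< M (ΛTerm c (suc k))} (P1.≈⇒ C1.refl) (O-ΛTerm c k M)) (P1.≈⇒ (C1.+-identityʳ _))

  O-Λ : ∀ c k → P1.O (suc k) (Λ c (suc k))
  O-Λ c k i i≤k = sum-zero (suc i)
    where
    sum-zero : ∀ M → X1.Σ< M (ΛTerm c (suc k)) i UR.≈ UR.0#
    sum-zero zero = UR.refl
    sum-zero (suc M) = UR.trans (UR.+-cong (sum-zero M) (P1.mon-diff _ (suc M ℕ.* suc k) i
      (ℕP.<⇒≢ (ℕP.<-≤-trans i≤k (ℕP.m≤n*m (suc k) (suc M)))))) (UR.+-identityˡ _)

  Λ-eq : ∀ c k → let t = P1.mon c (suc k) in Λ c (suc k) C1.* ((C1.1# C1.- t) C1.* (C1.1# C1.- t)) C1.≈ t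
  Λ-eq c k = P1.Lim-unique (P1.Lim-cong (λ M → finite M) (P1.Lim-* (Lim-Λ c k) (P1.Lim-const _))) tail-vanishes
    where
    t = P1.mon c (suc k)
    N : ℕ → P1.Series
    N M = P1.C (UX.intR (+ M))
    N-suc : ∀ M → N (suc M) C1.≈ C1.1# C1.+ N M
    N-suc M = C1.trans (P1.C-cong (UX.intR-+ (+ 1) (+ M))) (C1.sym (C-+ UR.1# (UX.intR (+ M))))
    -- From (1 - t)² times the sum of r tʳ over r ≤ M, which is t - (M + 1) t^(M + 1) + M t^(M + 2).
    rest : ℕ → P1.Series
    rest M = t X1.^ suc M C1.* (C1.- N (suc M) C1.+ N M C1.* t)
    term : ∀ r → ΛTerm c (suc k) r C1.≈ N (suc r) C1.* t X1.^ suc r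
    term r = C1.sym (C1.trans (C1.*-congˡ (P1.mon-^ c (suc k) (suc r))) (P1.mon-* (UX.intR (+ suc r)) 0 (c UX.^ suc r) (suc r ℕ.* suc k)))
    finite : ∀ M → X1.Σ< M (ΛTerm c (suc k)) C1.* ((C1.1# C1.- t) C1.* (C1.1# C1.- t)) C1.≈ t C1.+ rest M
    finite zero = C1.trans (C1.zeroˡ _) (C1.sym (C1.trans (C1.+-congˡ (C1.*-congˡ (C1.+-congˡ (C1.trans (C1.*-congʳ (P1.mon-zero 0)) (C1.zeroˡ t)))))
      (X1.solve 1 (λ t → t X1.:+ (t X1.:* one) X1.:* (X1.:- one X1.:+ X1.con (+ 0)) X1.:= X1.con (+ 0)) C1.refl t)))
    finite (suc M) = C1.trans (C1.distribʳ _ _ _) (C1.trans (C1.+-cong (finite M) (C1.*-congʳ (term M)))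
      (C1.trans (C1.+-cong (C1.+-congˡ (C1.*-congˡ (C1.+-congʳ (C1.-‿cong (N-suc M))))) (C1.*-congʳ (C1.*-congʳ (N-suc M))))
        (C1.trans (X1.solve 3 (λ t p n → (t X1.:+ p X1.:* (X1.:- (one X1.:+ n) X1.:+ n X1.:* t)) X1.:+ ((one X1.:+ n) X1.:* p) X1.:* ((one X1.:- t) X1.:* (one X1.:- t))
            X1.:= t X1.:+ (t X1.:* p) X1.:* (X1.:- (one X1.:+ (one X1.:+ n)) X1.:+ (one X1.:+ n) X1.:* t)) C1.refl t (t X1.^ suc M) (N M))
          (C1.sym (C1.+-congˡ (C1.*-congˡ (C1.+-cong (C1.-‿cong (C1.trans (N-suc (suc M)) (C1.+-congˡ (N-suc M)))) (C1.*-congʳ (N-suc M)))))))))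
    tail-vanishes : P1.Lim (λ M → t C1.+ rest M) t
    tail-vanishes n = n , λ M n≤M → P1.tr (P1.+-≈⟨⟩ {f = t} (P1.≈⇒ C1.refl)
      (P1.O-weaken {f = rest M} n≤M (P1.O-≈ (C1.*-comm (C1.- N (suc M) C1.+ N M C1.* t) (t X1.^ suc M)) (P1.O-*ˡ (C1.- N (suc M) C1.+ N M C1.* t) {t X1.^ suc M}
        (P1.O-weaken {f = t X1.^ suc M} (ℕP.≤-trans (ℕP.n≤1+n M) (ℕP.m≤m*n (suc M) (suc k))) (P1.O-^ (suc M) (P1.O-mon c (suc k)))))))) (P1.≈⇒ (C1.+-identityʳ t))

  -- Γ k = qᵏ / (1 − qᵏ)
  ΓTerm : ℕ → ℕ → P1.Series
  ΓTerm k r = P1.mon UR.1# (suc r ℕ.* k)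

  Γ : ℕ → P1.Series
  Γ k = P1.limit (λ M → X1.Σ< M (ΓTerm k))

  O-ΓTerm : ∀ k r → P1.O r (ΓTerm (suc k) r)
  O-ΓTerm k r = P1.O-weaken {f = ΓTerm (suc k) r} (ℕP.≤-trans (ℕP.n≤1+n r) (ℕP.m≤m*n (suc r) (suc k))) (P1.O-mon _ (suc r ℕ.* suc k))

  O-Γ : ∀ k → P1.O (suc k) (Γ (suc k))
  O-Γ k i i≤k = sum-zero (suc i)
    where
    sum-zero : ∀ M → X1.Σ< M (ΓTerm (suc k)) i UR.≈ UR.0#
    sum-zero zero = UR.refl
    sum-zero (suc M) = UR.trans (UR.+-cong (sum-zero M) (P1.mon-diff UR.1# (suc M ℕ.* suc k) i
      (ℕP.<⇒≢ (ℕP.<-≤-trans i≤k (ℕP.m≤n*m (suc k) (suc M)))))) (UR.+-identityˡ _)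

  Lim-Σ : ∀ {t : ℕ → P1.Series} → (∀ M → P1.O M (t M)) → P1.Lim (λ M → X1.Σ< M t) (P1.limit (λ M → X1.Σ< M t))
  Lim-Σ {t} h = P1.Lim-limit λ M → P1.tr (P1.+-≈⟨⟩ {f = X1.Σ< M t} (P1.≈⇒ C1.refl) (h M)) (P1.≈⇒ (C1.+-identityʳ _))

  Lim-Γ : ∀ k → P1.Lim (λ M → X1.Σ< M (ΓTerm (suc k))) (Γ (suc k))
  Lim-Γ k = Lim-Σ {ΓTerm (suc k)} (O-ΓTerm k)

  Γ-eq : ∀ k → let t = P1.mon UR.1# (suc k) in Γ (suc k) C1.* (C1.1# C1.- t) C1.≈ t
  Γ-eq k = P1.Lim-unique (P1.Lim-cong finite (P1.Lim-* (Lim-Γ k) (P1.Lim-const _))) tail-vanishes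
    where
    t = P1.mon UR.1# (suc k)
    one^ : ∀ k → UR.1# UX.^ k UR.≈ UR.1#
    one^ zero = UR.refl
    one^ (suc k) = UR.trans (UR.*-identityˡ _) (one^ k)
    term : ∀ r → ΓTerm (suc k) r C1.≈ t X1.^ suc r
    term r = C1.sym (C1.trans (P1.mon-^ UR.1# (suc k) (suc r)) (P1.mon-cong (suc r ℕ.* suc k) (one^ (suc r))))
    finite : ∀ M → X1.Σ< M (ΓTerm (suc k)) C1.* (C1.1# C1.- t) C1.≈ t C1.- t X1.^ suc M
    finite zero = X1.solve 1 (λ t → X1.con (+ 0) X1.:* (one X1.:- t) X1.:= t X1.:- t X1.:* one) C1.refl t
    finite (suc M) = C1.trans (C1.distribʳ _ _ _) (C1.trans (C1.+-cong (finite M) (C1.*-congʳ (term M)))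
      (X1.solve 2 (λ t p → (t X1.:- p) X1.:+ p X1.:* (one X1.:- t) X1.:= t X1.:- t X1.:* p) C1.refl t (t X1.^ suc M)))
    tail-vanishes : P1.Lim (λ M → t C1.- t X1.^ suc M) t
    tail-vanishes n = n , λ M n≤M → P1.tr (P1.+-≈⟨⟩ {f = t} (P1.≈⇒ C1.refl) (O-neg1 (t X1.^ suc M)
        (P1.O-weaken {f = t X1.^ suc M} (ℕP.≤-trans n≤M (ℕP.≤-trans (ℕP.n≤1+n M) (ℕP.m≤m*n (suc M) (suc k)))) (P1.O-^ (suc M) (P1.O-mon UR.1# (suc k))))))
      (P1.≈⇒ (C1.+-identityʳ t))

  limit-at : ∀ {s : ℕ → P1.Series} → (∀ M → s (suc M) P1.≈[ M ] s M) → ∀ {i M} → i ℕ.< M → P1.limit s i UR.≈ s M i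
  limit-at {s} h {i} {M} i<M = UR.trans (UR.sym (P1.lim-stable h {suc i} (M ℕ.∸ suc i) i (ℕP.n<1+n i))) (UR.reflexive (≡.cong (λ k → s k i) (ℕP.m∸n+n≡m i<M)))

  -- Lambert's double series Σ_{r, j} a(r) q^(r j), summed in either order.
  module Double (a : ℕ → UR.Carrier) where
    cell : ℕ → ℕ → P1.Series
    cell r j = P1.mon (a (suc r)) (suc r ℕ.* suc j)

    square : ℕ → P1.Series
    square N = X1.Σ< N (λ j → X1.Σ< N (λ r → cell r j))

    row : ℕ → P1.Series
    row r = P1.C (a (suc r)) C1.* Γ (suc r)

    O-row : ∀ r → P1.O r (row r)
    O-row r = P1.O-weaken {f = row r} (ℕP.n≤1+n r) (P1.O-*ˡ (P1.C (a (suc r))) {Γ (suc r)} (O-Γ r))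

    rows : P1.Series
    rows = P1.limit (λ N → X1.Σ< N row)

    Lim-rows : P1.Lim (λ N → X1.Σ< N row) rows
    Lim-rows = Lim-Σ {row} O-row

    Lim-square : P1.Lim square rows
    Lim-square n = let (M₀ , h) = Lim-rows n in M₀ ℕ.⊔ n , λ M le → P1.tr
      (P1.tr (P1.≈⇒ (X1.Σ<-swap M M (λ j r → cell r j)))
        (P1.Σ<-≈⟨⟩ M (λ r _ → P1.tr (P1.≈⇒ (cells r M))
          (P1.*-≈⟨⟩ {f = P1.C (a (suc r))} (P1.≈⇒ C1.refl) (P1.sy (λ i i<n → limit-at {λ N → X1.Σ< N (ΓTerm (suc r))}
            (λ N → P1.tr (P1.+-≈⟨⟩ {f = X1.Σ< N (ΓTerm (suc r))} (P1.≈⇒ C1.refl) (O-ΓTerm r N)) (P1.≈⇒ (C1.+-identityʳ _))) {i} {M} (ℕP.<-≤-trans i<n (ℕP.m⊔n≤o⇒n≤o M₀ n le))))))))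
      (h M (ℕP.m⊔n≤o⇒m≤o M₀ n le))
      where
      cells : ∀ r M → X1.Σ< M (cell r) C1.≈ P1.C (a (suc r)) C1.* X1.Σ< M (ΓTerm (suc r))
      cells r M = C1.trans (X1.Σ<-cong M (λ j _ → C1.sym (C1.trans (P1.mon-* (a (suc r)) 0 UR.1# (suc j ℕ.* suc r))
        (C1.trans (P1.mon-cong (suc j ℕ.* suc r) (UR.*-identityʳ _)) (P1.mon-≡ (a (suc r)) (ℕP.*-comm (suc j) (suc r))))))) (X1.Σ<-*ˡ M (P1.C (a (suc r))) (ΓTerm (suc r)))

  -- For a(m) = m cᵐ the columns of the square are partial sums of the series `Λ c (suc j)`, so the
  -- iterated sum of the Λ is also the limit of squares, whose order of summation can be exchanged.
  Lim-ΣΛ : ∀ c {S} → P1.Lim (λ N → X1.Σ< N (λ j → Λ c (suc j))) S → P1.Lim (Double.square (λ m → UX.intR (+ m) UR.* c UX.^ m)) S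
  Lim-ΣΛ c h n = let (M₀ , k) = h n in M₀ ℕ.⊔ n , λ M le → P1.tr
    (P1.Σ<-≈⟨⟩ M (λ j _ → P1.sy (λ i i<n → limit-at {λ N → X1.Σ< N (ΛTerm c (suc j))}
      (λ N → P1.tr (P1.+-≈⟨⟩ {f = X1.Σ< N (ΛTerm c (suc j))} (P1.≈⇒ C1.refl) (O-ΛTerm c j N)) (P1.≈⇒ (C1.+-identityʳ _))) {i} {M} (ℕP.<-≤-trans i<n (ℕP.m⊔n≤o⇒n≤o M₀ n le)))))
    (k M (ℕP.m⊔n≤o⇒m≤o M₀ n le))

-- The coefficient of δ in Weierstrass' relation.

module Eis (V : CommutativeRing 0ℓ 0ℓ) (root : Cyclo.FifthRoot V) (dual : Cyclo.DualUnit V) where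
  open Cyclo.FifthRoot root using (ζ; Φ₅)
  open Cyclo.DualUnit dual using (u; v; δ; uv; u+v; δδ)
  open Base V using (module UR; module UX; module P1; module C1; module X1; R1; Q; Lim-Q; qFactor)
  open Weier V
  open Lambert V using (Λ; Λ-eq; C-+)
  open Char

  private
    one : ∀ {n} → X1.Polynomial n
    one = X1.con (+ 1)

  û v̂ δ̂ : P1.Series
  û = P1.C u
  v̂ = P1.C v
  δ̂ = P1.C δ

  C-* : ∀ a b → P1.C a C1.* P1.C b C1.≈ P1.C (a UR.* b)
  C-* a b = P1.mon-* a 0 b 0

  ûv̂ : û C1.* v̂ C1.≈ C1.1#
  ûv̂ = C1.trans (C-* u v) (P1.C-cong uv)

  û+v̂ : û C1.+ v̂ C1.≈ C1.1# C1.+ C1.1# C1.+ δ̂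
  û+v̂ = C1.trans (C-+ u v) (C1.trans (P1.C-cong u+v) (C1.sym (C1.trans (C1.+-congʳ (C-+ UR.1# UR.1#)) (C-+ _ δ))))

  δ̂δ̂ : δ̂ C1.* δ̂ C1.≈ C1.0#
  δ̂δ̂ = C1.trans (C-* δ δ) (C1.trans (P1.C-cong δδ) (P1.mon-zero 0))

  U : Char
  U = unit-char u v uv

  -- F(c u) F(c u⁻¹) = F(c)² (1 − δ Σ t/(1 − t)²) over the factors 1 − t of F(c).
  module Deformed (m : ℕ) where
    open Modulus m public

    D : UR.Carrier → ℕ → P1.Series
    D c e = F (c UR.* u) e C1.* F (c UR.* v) e

    private
      twist : ∀ c k s → P1.mon (c UR.* s) k C1.≈ P1.mon c k C1.* P1.C s
      twist c k s = C1.sym (C1.trans (P1.mon-* c k s 0) (P1.mon-≡ (c UR.* s) (ℕP.+-identityʳ k)))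

    deformed-factor : ∀ c k → let t = P1.mon c k in
      (C1.1# C1.- P1.mon (c UR.* u) k) C1.* (C1.1# C1.- P1.mon (c UR.* v) k) C1.≈ (C1.1# C1.- t) C1.* (C1.1# C1.- t) C1.- δ̂ C1.* t
    deformed-factor c k = C1.trans (C1.*-cong (C1.+-congˡ (C1.-‿cong (twist c k u))) (C1.+-congˡ (C1.-‿cong (twist c k v))))
      (C1.trans (X1.solve 3 (λ t a b → (one X1.:- t X1.:* a) X1.:* (one X1.:- t X1.:* b) X1.:= one X1.:- t X1.:* (a X1.:+ b) X1.:+ t X1.:* t X1.:* (a X1.:* b)) C1.refl _ û v̂)
        (C1.trans (C1.+-cong (C1.+-congˡ (C1.-‿cong (C1.*-congˡ û+v̂))) (C1.*-congˡ ûv̂))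
          (X1.solve 2 (λ t d → one X1.:- t X1.:* (one X1.:+ one X1.:+ d) X1.:+ t X1.:* t X1.:* one X1.:= (one X1.:- t) X1.:* (one X1.:- t) X1.:- d X1.:* t) C1.refl _ δ̂)))

    private
      dF : UR.Carrier → ℕ → ℕ → P1.Series
      dF c e j = (C1.1# C1.- tF c e j) C1.* (C1.1# C1.- tF c e j) C1.- δ̂ C1.* tF c e j

      sF : UR.Carrier → ℕ → ℕ → P1.Series
      sF c e j = (C1.1# C1.- tF c e j) C1.* (C1.1# C1.- tF c e j)

    Lim-D : ∀ c e → P1.Lim (λ N → X1.Π< N (dF c e)) (D c e)
    Lim-D c e = P1.Lim-cong (λ N → C1.trans (C1.sym (X1.Π<-* N _ _)) (X1.Π<-cong N (λ j → deformed-factor c (e ℕ.+ j ℕ.* w))))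
      (P1.Lim-* (Lim-F (c UR.* u) e) (Lim-F (c UR.* v) e))

    Lim-F² : ∀ c e → P1.Lim (λ N → X1.Π< N (sF c e)) (F c e C1.* F c e)
    Lim-F² c e = P1.Lim-cong (λ N → C1.sym (X1.Π<-* N _ _)) (P1.Lim-* (Lim-F c e) (Lim-F c e))

    -- Every correction in the deformed product carries a second factor δ.
    δ̂D : ∀ c e → δ̂ C1.* D c e C1.≈ δ̂ C1.* (F c e C1.* F c e)
    δ̂D c e = P1.Lim-unique (P1.Lim-* (P1.Lim-const δ̂) (Lim-D c e)) (P1.Lim-cong (λ N → C1.sym (finite N)) (P1.Lim-* (P1.Lim-const δ̂) (Lim-F² c e)))
      where
      finite : ∀ N → δ̂ C1.* X1.Π< N (dF c e) C1.≈ δ̂ C1.* X1.Π< N (sF c e)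
      finite zero = C1.refl
      finite (suc N) = C1.trans (X1.solve 4 (λ d P s t → d X1.:* (P X1.:* (s X1.:- d X1.:* t)) X1.:= (d X1.:* P) X1.:* s X1.:- (d X1.:* d) X1.:* (P X1.:* t)) C1.refl δ̂ _ (sF c e N) (tF c e N))
        (C1.trans (C1.+-cong (C1.*-congʳ (finite N)) (C1.-‿cong (C1.trans (C1.*-congʳ δ̂δ̂) (C1.zeroˡ _))))
          (X1.solve 3 (λ d P s → (d X1.:* P) X1.:* s X1.:- X1.con (+ 0) X1.:= d X1.:* (P X1.:* s)) C1.refl δ̂ _ (sF c e N)))

    module _ (c : UR.Carrier) (e : ℕ) (L : ℕ → P1.Series) (L-eq : ∀ j → L j C1.* sF c e j C1.≈ tF c e j)
             {Σ : P1.Series} (lim-Σ : P1.Lim (λ N → X1.Σ< N L) Σ) where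
      -- The hypothesis on L rewrites (1 - t)² - δ t as (1 - t)² (1 - δ L j), and since δ² = 0 the
      -- factors 1 - δ L j multiply by adding the L j.
      D-log : D c e C1.≈ (F c e C1.* F c e) C1.* (C1.1# C1.- δ̂ C1.* Σ)
      D-log = P1.Lim-unique (Lim-D c e) (P1.Lim-cong (λ N → C1.sym (finite N))
        (P1.Lim-* (Lim-F² c e) (limit-1-δ lim-Σ)))
        where
        limit-1-δ : ∀ {s l} → P1.Lim s l → P1.Lim (λ N → C1.1# C1.- δ̂ C1.* s N) (C1.1# C1.- δ̂ C1.* l)
        limit-1-δ {s} {l} h = P1.Lim-cong (λ N → rewrite-neg (s N)) (P1.Lim-≈ (rewrite-neg l)
          (P1.Lim-+ (P1.Lim-const C1.1#) (P1.Lim-* (P1.Lim-const (C1.- δ̂)) h)))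
          where
          rewrite-neg : ∀ s → C1.1# C1.+ (C1.- δ̂) C1.* s C1.≈ C1.1# C1.- δ̂ C1.* s
          rewrite-neg = X1.solve 2 (λ d s → one X1.:+ (X1.:- d) X1.:* s X1.:= one X1.:- d X1.:* s) C1.refl δ̂
        finite : ∀ N → X1.Π< N (dF c e) C1.≈ X1.Π< N (sF c e) C1.* (C1.1# C1.- δ̂ C1.* X1.Σ< N L)
        finite zero = X1.solve 1 (λ d → one X1.:= one X1.:* (one X1.:- d X1.:* X1.con (+ 0))) C1.refl δ̂
        finite (suc N) = C1.trans (C1.*-cong (finite N) (C1.+-congˡ (C1.-‿cong (C1.*-congˡ (C1.sym (L-eq N))))))
          (C1.trans (X1.solve 5 (λ P d S s l → (P X1.:* (one X1.:- d X1.:* S)) X1.:* (s X1.:- d X1.:* (l X1.:* s)) X1.:=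
              (P X1.:* s) X1.:* (one X1.:- d X1.:* (S X1.:+ l)) X1.:+ (d X1.:* d) X1.:* (P X1.:* S X1.:* l X1.:* s)) C1.refl _ δ̂ _ (sF c e N) (L N))
            (C1.trans (C1.+-congˡ (C1.trans (C1.*-congʳ δ̂δ̂) (C1.zeroˡ _))) (C1.+-identityʳ _)))

    -- At exponent 0 the first t is the constant c, where t / (1 - t)² need not exist. This factor
    -- is split off before the Lambert expansion; for c = 1 it is -δ.
    D-first : ∀ c → D c 0 C1.≈ ((C1.1# C1.- P1.C c) C1.* (C1.1# C1.- P1.C c) C1.- δ̂ C1.* P1.C c) C1.* D c w
    D-first c = C1.trans (C1.*-cong (F-shift (c UR.* u) 0) (F-shift (c UR.* v) 0))
      (C1.trans (X1.solve 4 (λ a x b y → (a X1.:* x) X1.:* (b X1.:* y) X1.:= (a X1.:* b) X1.:* (x X1.:* y)) C1.refl _ _ _ _)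
        (C1.*-congʳ (deformed-factor c 0)))

    F₂ D₂ : Char → ℕ → ℕ → P1.Series
    F₂ a e ē = F (χ a (+ 1)) e C1.* F (χ a (ℤ.- + 1)) ē
    D₂ a e ē = D (χ a (+ 1)) e C1.* D (χ a (ℤ.- + 1)) ē

    θ-U : ∀ a e ē → θ (a ⊗ U) e ē C1.* θ (a ⊗ U ⁻¹) e ē C1.≈ (Q w C1.* Q w) C1.* D₂ a e ē
    θ-U a e ē = C1.trans (C1.*-cong (C1.*-congˡ (C1.*-cong (F-cong e (UR.*-congˡ (UR.*-identityʳ u))) (F-cong ē (UR.*-congˡ (UR.*-identityʳ v)))))
        (C1.*-congˡ (C1.*-cong (F-cong e (UR.*-congˡ (UR.*-identityʳ v))) (F-cong ē (UR.*-congˡ (UR.*-identityʳ u))))))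
      (X1.solve 5 (λ q a b c d → (q X1.:* (a X1.:* b)) X1.:* (q X1.:* (c X1.:* d)) X1.:= (q X1.:* q) X1.:* ((a X1.:* c) X1.:* (d X1.:* b))) C1.refl (Q w) _ _ _ _)

    θ-𝟙 : ∀ a e ē → θ (a ⊗ 𝟙) e ē C1.* θ (a ⊗ 𝟙 ⁻¹) e ē C1.≈ (Q w C1.* Q w) C1.* (F₂ a e ē C1.* F₂ a e ē)
    θ-𝟙 a e ē = C1.trans (C1.*-cong (C1.*-congˡ (C1.*-cong (F-cong e (UR.*-identityʳ _)) (F-cong ē (UR.*-identityʳ _))))
        (C1.*-congˡ (C1.*-cong (F-cong e (UR.*-identityʳ _)) (F-cong ē (UR.*-identityʳ _)))))
      (X1.solve 3 (λ q a b → (q X1.:* (a X1.:* b)) X1.:* (q X1.:* (a X1.:* b)) X1.:= (q X1.:* q) X1.:* ((a X1.:* b) X1.:* (a X1.:* b))) C1.refl (Q w) _ _)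

    -- The bracket with f = 0, where ac and a/c share the exponent e; it is applied with c equal to
    -- 1 or u.
    module Zero (a c : Char) (e ē : ℕ) (eē : e ℕ.+ ē ≡ w) where
      pos : 1 ℕ.≤ e ℕ.+ ē
      pos = ≡.subst (1 ℕ.≤_) (≡.sym eē) (ℕ.s≤s ℕ.z≤n)

      zero-bracket = Bracket.bracket m a c e ē 0 w e ē e ē
        (≡.sym (ℕP.+-identityʳ e)) ≡.refl (≡.trans (≡.sym eē) (≡.cong (ℕ._+ ē) (≡.sym (ℕP.+-identityʳ e))))
        (≡.sym (≡.trans (ℕP.+-identityʳ _) (ℕP.+-identityʳ e))) (≡.sym (ℕP.+-identityʳ ē))
        (≡.trans (≡.cong (ℕ._+ ē) (≡.trans (ℕP.+-identityʳ _) (ℕP.+-identityʳ e))) eē) pos (ℕ.s≤s ℕ.z≤n)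

    module Weierstrass (z b : Char) (e ē f f̄ g ḡ h h̄ : ℕ)
      (e-eq : e ≡ h ℕ.+ f) (ē-eq : ē ≡ f ℕ.+ ḡ) (f̄-eq : f̄ ≡ h ℕ.+ f ℕ.+ ḡ) (g-eq : g ≡ h ℕ.+ f ℕ.+ f) (h̄-eq : h̄ ≡ f ℕ.+ ḡ ℕ.+ f)
      (total : h ℕ.+ f ℕ.+ f ℕ.+ ḡ ≡ w) (eē : e ℕ.+ ē ≡ w) (ff̄ : f ℕ.+ f̄ ≡ w) where
      B : P1.Series
      B = P1.mon (χ b (+ 1)) f C1.* (θ (z ⊗ b) g ḡ C1.* θ (z ⊗ b ⁻¹) h h̄)

      private
        q = Q w
        Dz = D₂ z e ē
        Db = D₂ b f f̄
        Fz = F₂ z e ē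
        Fb = F₂ b f f̄

        module z1 = Zero z 𝟙 e ē eē
        module zU = Zero z U e ē eē
        module b1 = Zero b 𝟙 f f̄ ff̄
        module bU = Zero b U f f̄ ff̄
        module 1U = Zero 𝟙 U 0 w ≡.refl

        -- One factor of D₂ 𝟙 is 1 − u times 1 − u⁻¹, that is −δ.
        D𝟙 : D₂ 𝟙 0 w C1.≈ C1.- (δ̂ C1.* ((q C1.* q) C1.* (q C1.* q)))
        D𝟙 = C1.trans (C1.*-congʳ (D-first UR.1#))
          (C1.trans (X1.solve 2 (λ d x → (((one X1.:- one) X1.:* (one X1.:- one) X1.:- d X1.:* one) X1.:* x) X1.:* x X1.:= X1.:- ((d X1.:* x) X1.:* x)) C1.refl δ̂ (D UR.1# w))
            (C1.-‿cong (C1.trans (C1.*-congʳ (δ̂D UR.1# w)) (C1.trans (X1.solve 3 (λ d f x → (d X1.:* f) X1.:* x X1.:= (d X1.:* x) X1.:* f) C1.refl δ̂ _ _)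
              (C1.trans (C1.*-congʳ (δ̂D UR.1# w)) (C1.trans (C1.*-assoc _ _ _) (C1.*-congˡ (C1.*-cong (C1.*-cong F-Q F-Q) (C1.*-cong F-Q F-Q)))))))))

        ûmon : P1.mon (χ U (+ 1)) 0 C1.≈ û
        ûmon = P1.C-cong (UR.*-identityʳ u)

        -- With square brackets for the determinants this is [z b] [1 u] + [z u] [b 1] = [z 1]
        -- [b u]. As [1 u] contains the factor δ, the first term is already of first order;
        -- comparing the other two yields the Lambert series.
        plücker : B C1.* (û C1.* ((q C1.* q) C1.* C1.- (δ̂ C1.* ((q C1.* q) C1.* (q C1.* q)))))
            C1.+ (û C1.* ((q C1.* q) C1.* Dz)) C1.* (C1.1# C1.* ((q C1.* q) C1.* (Fb C1.* Fb)))
          C1.≈ (C1.1# C1.* ((q C1.* q) C1.* (Fz C1.* Fz))) C1.* (û C1.* ((q C1.* q) C1.* Db))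
        plücker = C1.trans
          (C1.+-cong
            (C1.*-cong (Bracket.bracket m z b e ē f f̄ g ḡ h h̄ e-eq ē-eq f̄-eq g-eq h̄-eq total z1.pos b1.pos)
              (C1.trans (C1.sym (C1.*-cong ûmon (C1.trans (θ-U 𝟙 0 w) (C1.*-congˡ D𝟙)))) 1U.zero-bracket))
            (C1.*-cong (C1.trans (C1.sym (C1.*-cong ûmon (θ-U z e ē))) zU.zero-bracket)
              (C1.trans (C1.sym (C1.*-congˡ (θ-𝟙 b f f̄))) b1.zero-bracket)))
          -- Here the determinants are expanded: the Plücker relation for four vectors in the plane.
          (C1.trans (X1.solve 8 (λ ez oz eb ob e1 o1 eU oU →
              (ez X1.:* ob X1.:+ X1.:- one X1.:* (oz X1.:* eb)) X1.:* (e1 X1.:* oU X1.:+ X1.:- one X1.:* (o1 X1.:* eU))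
                X1.:+ (ez X1.:* oU X1.:+ X1.:- one X1.:* (oz X1.:* eU)) X1.:* (eb X1.:* o1 X1.:+ X1.:- one X1.:* (ob X1.:* e1))
              X1.:= (ez X1.:* o1 X1.:+ X1.:- one X1.:* (oz X1.:* e1)) X1.:* (eb X1.:* oU X1.:+ X1.:- one X1.:* (ob X1.:* eU)))
              C1.refl _ _ _ _ _ _ _ _)
            (C1.*-cong (C1.trans (C1.sym z1.zero-bracket) (C1.*-congˡ (θ-𝟙 z e ē)))
              (C1.trans (C1.sym bU.zero-bracket) (C1.*-cong ûmon (θ-U b f f̄)))))

      weierstrass : B C1.* (δ̂ C1.* q X1.^ 6) C1.+ q X1.^ 4 C1.* ((Fz C1.* Fz) C1.* Db) C1.≈ q X1.^ 4 C1.* ((Fb C1.* Fb) C1.* Dz)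
      weierstrass = C1.trans (C1.sym (strip (B C1.* (δ̂ C1.* q X1.^ 6) C1.+ q X1.^ 4 C1.* ((Fz C1.* Fz) C1.* Db))))
        (C1.trans (C1.*-congˡ numerator) (strip (q X1.^ 4 C1.* ((Fb C1.* Fb) C1.* Dz))))
        where
        strip : ∀ s → v̂ C1.* (û C1.* s) C1.≈ s
        strip s = C1.trans (X1.solve 3 (λ v u s → v X1.:* (u X1.:* s) X1.:= (u X1.:* v) X1.:* s) C1.refl v̂ û s) (C1.trans (C1.*-congʳ ûv̂) (C1.*-identityˡ s))
        numerator : û C1.* (B C1.* (δ̂ C1.* q X1.^ 6) C1.+ q X1.^ 4 C1.* ((Fz C1.* Fz) C1.* Db)) C1.≈ û C1.* (q X1.^ 4 C1.* ((Fb C1.* Fb) C1.* Dz))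
        numerator = C1.trans (X1.solve 6 (λ u B d q Fz Db → u X1.:* (B X1.:* (d X1.:* q X1.:^ 6) X1.:+ q X1.:^ 4 X1.:* ((Fz X1.:* Fz) X1.:* Db)) X1.:=
              (one X1.:* ((q X1.:* q) X1.:* (Fz X1.:* Fz))) X1.:* (u X1.:* ((q X1.:* q) X1.:* Db)) X1.:- B X1.:* (u X1.:* ((q X1.:* q) X1.:* X1.:- (d X1.:* ((q X1.:* q) X1.:* (q X1.:* q))))))
              C1.refl û B δ̂ q Fz Db)
          (C1.trans (C1.+-congʳ (C1.sym plücker))
            (X1.solve 6 (λ u B d q Fb Dz → (B X1.:* (u X1.:* ((q X1.:* q) X1.:* X1.:- (d X1.:* ((q X1.:* q) X1.:* (q X1.:* q)))))
                X1.:+ (u X1.:* ((q X1.:* q) X1.:* Dz)) X1.:* (one X1.:* ((q X1.:* q) X1.:* (Fb X1.:* Fb))))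
                X1.:- B X1.:* (u X1.:* ((q X1.:* q) X1.:* X1.:- (d X1.:* ((q X1.:* q) X1.:* (q X1.:* q))))) X1.:=
              u X1.:* (q X1.:^ 4 X1.:* ((Fb X1.:* Fb) X1.:* Dz))) C1.refl û B δ̂ q Fb Dz))

  -- All cancellations below reduce to `Q 1` and `Q 5`, whose inverses are images of integral series
  -- and are therefore passed in.
  module _ {I₁ I₅ : P1.Series} (inv₁ : Q 1 C1.* I₁ C1.≈ C1.1#) (inv₅ : Q 5 C1.* I₅ C1.≈ C1.1#) where
    cancel : ∀ {X Y K K′} → K C1.* K′ C1.≈ C1.1# → X C1.* K C1.≈ Y C1.* K → X C1.≈ Y
    cancel {X} {Y} {K} {K′} inv e = C1.trans (C1.sym (C1.*-identityʳ X)) (C1.trans (C1.*-congˡ (C1.sym inv)) (C1.trans (C1.sym (C1.*-assoc X K K′))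
      (C1.trans (C1.*-congʳ e) (C1.trans (C1.*-assoc Y K K′) (C1.trans (C1.*-congˡ inv) (C1.*-identityʳ Y))))))

    log-pair : ∀ {D D′ F F′ Σ Σ′} → D C1.≈ (F C1.* F) C1.* (C1.1# C1.- δ̂ C1.* Σ) → D′ C1.≈ (F′ C1.* F′) C1.* (C1.1# C1.- δ̂ C1.* Σ′) →
      D C1.* D′ C1.≈ ((F C1.* F′) C1.* (F C1.* F′)) C1.* (C1.1# C1.- δ̂ C1.* (Σ C1.+ Σ′))
    log-pair {F = F} {F′} {Σ} {Σ′} p p′ = C1.trans (C1.*-cong p p′) (C1.trans
      (X1.solve 5 (λ f f′ d s s′ → ((f X1.:* f) X1.:* (one X1.:- d X1.:* s)) X1.:* ((f′ X1.:* f′) X1.:* (one X1.:- d X1.:* s′)) X1.:=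
        ((f X1.:* f′) X1.:* (f X1.:* f′)) X1.:* (one X1.:- d X1.:* (s X1.:+ s′)) X1.:+ (d X1.:* d) X1.:* ((f X1.:* f′) X1.:* (f X1.:* f′) X1.:* s X1.:* s′)) C1.refl F F′ δ̂ Σ Σ′)
      (C1.trans (C1.+-congˡ (C1.trans (C1.*-congʳ δ̂δ̂) (C1.zeroˡ _))) (C1.+-identityʳ _)))

    module Level5 (S : ℕ → P1.Series) (lim-S : ∀ r → P1.Lim (λ N → X1.Σ< N (λ j → Λ UR.1# (suc r ℕ.+ j ℕ.* 5))) (S (suc r))) where
      open Deformed 4

      private
        f : ℕ → P1.Series
        f = F UR.1#
        A B′ T K : P1.Series
        A = f 2 C1.* f 3
        B′ = f 1 C1.* f 4
        T = (S 1 C1.+ S 4) C1.- (S 2 C1.+ S 3)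
        K = Q 5 X1.^ 4 C1.* (A C1.* B′)
        q = P1.mon UR.1# 1

        log : ∀ r → D UR.1# (suc r) C1.≈ (f (suc r) C1.* f (suc r)) C1.* (C1.1# C1.- δ̂ C1.* S (suc r))
        log r = D-log UR.1# (suc r) (λ j → Λ UR.1# (suc r ℕ.+ j ℕ.* 5)) (λ j → Λ-eq UR.1# (r ℕ.+ j ℕ.* 5)) (lim-S r)

        residues : f 1 C1.* (f 2 C1.* (f 3 C1.* (f 4 C1.* f 5))) C1.≈ Q 1
        residues = P1.Lim-Π5 (Lim-F UR.1# 1) (Lim-F UR.1# 2) (Lim-F UR.1# 3) (Lim-F UR.1# 4) (Lim-F UR.1# 5)
          (λ j → X1.solve 5 (λ a b c d e → a X1.:* (b X1.:* (c X1.:* (d X1.:* e))) X1.:= a X1.:* b X1.:* c X1.:* d X1.:* e) C1.refl _ _ _ _ _)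
          (P1.Lim-cong (λ N → C1.trans (X1.Π<-5 N (qFactor 1)) (X1.Π<-cong N (λ j → C1.*-cong (C1.*-cong (C1.*-cong (C1.*-cong (ex 0 j) (ex 1 j)) (ex 2 j)) (ex 3 j)) (ex 4 j))))
            (P1.Lim-sub (ℕ._* 5) (λ N → ℕP.m≤m*n N 5) (Lim-Q 0)))
          where
          ex : ∀ r j → qFactor 1 (r ℕ.+ j ℕ.* 5) C1.≈ C1.1# C1.- P1.mon UR.1# (suc r ℕ.+ j ℕ.* 5)
          ex r j = C1.+-congˡ (C1.-‿cong (P1.mon-≡ UR.1# (ℕP.*-identityˡ (suc r ℕ.+ j ℕ.* 5))))

        -- Four residue classes modulo 5 make up A and B′, and the multiples of 5 supply `Q 5`.
        AB : (A C1.* B′) C1.* Q 5 C1.≈ Q 1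
        AB = C1.trans (C1.*-congˡ (C1.sym F-Q)) (C1.trans
          (X1.solve 5 (λ a b c d e → ((b X1.:* c) X1.:* (a X1.:* d)) X1.:* e X1.:= a X1.:* (b X1.:* (c X1.:* (d X1.:* e)))) C1.refl (f 1) (f 2) (f 3) (f 4) (f 5)) residues)

        -- z = q² and b = q in base q⁵, so zb = q³ and z/b = q; each exponent is followed by its
        -- complement to 5. Only the residue pairs 1, 4 and 2, 3 occur.
        open Weierstrass 𝟙 𝟙 2 3 1 4 3 2 1 4 ≡.refl ≡.refl ≡.refl ≡.refl ≡.refl ≡.refl ≡.refl ≡.refl

        B-eq : B C1.≈ q C1.* ((Q 5 C1.* Q 5) C1.* (A C1.* B′))
        B-eq = C1.*-congˡ (C1.trans (C1.*-cong (C1.*-congˡ (C1.*-cong (F-cong 3 (UR.*-identityʳ _)) (F-cong 2 (UR.*-identityʳ _))))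
            (C1.*-congˡ (C1.*-cong (F-cong 1 (UR.*-identityʳ _)) (F-cong 4 (UR.*-identityʳ _)))))
          (X1.solve 5 (λ q a b c d → (q X1.:* (c X1.:* b)) X1.:* (q X1.:* (a X1.:* d)) X1.:= (q X1.:* q) X1.:* ((b X1.:* c) X1.:* (a X1.:* d))) C1.refl (Q 5) (f 1) (f 2) (f 3) (f 4)))

        W : q C1.* ((Q 5 C1.* Q 5) C1.* (A C1.* B′)) C1.* (δ̂ C1.* Q 5 X1.^ 6) C1.+ Q 5 X1.^ 4 C1.* ((A C1.* A) C1.* ((B′ C1.* B′) C1.* (C1.1# C1.- δ̂ C1.* (S 1 C1.+ S 4))))
          C1.≈ Q 5 X1.^ 4 C1.* ((B′ C1.* B′) C1.* ((A C1.* A) C1.* (C1.1# C1.- δ̂ C1.* (S 2 C1.+ S 3))))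
        W = C1.trans (C1.sym (C1.+-cong (C1.*-congʳ B-eq) (C1.*-congˡ (C1.*-congˡ (log-pair (log 0) (log 3))))))
          (C1.trans weierstrass (C1.*-congˡ (C1.*-congˡ (log-pair (log 1) (log 2)))))

        scaled : (δ̂ C1.* (q C1.* Q 5 X1.^ 4)) C1.* K C1.≈ (δ̂ C1.* ((A C1.* B′) C1.* T)) C1.* K
        scaled = C1.trans (X1.solve 6 (λ d q Q A B s → (d X1.:* (q X1.:* Q X1.:^ 4)) X1.:* (Q X1.:^ 4 X1.:* (A X1.:* B)) X1.:=
            (q X1.:* ((Q X1.:* Q) X1.:* (A X1.:* B)) X1.:* (d X1.:* Q X1.:^ 6) X1.:+ Q X1.:^ 4 X1.:* ((A X1.:* A) X1.:* ((B X1.:* B) X1.:* (one X1.:- d X1.:* s))))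
            X1.:- Q X1.:^ 4 X1.:* ((A X1.:* A) X1.:* ((B X1.:* B) X1.:* (one X1.:- d X1.:* s)))) C1.refl δ̂ q (Q 5) A B′ (S 1 C1.+ S 4))
          (C1.trans (C1.+-congʳ W)
            (X1.solve 6 (λ d Q A B s s′ → Q X1.:^ 4 X1.:* ((B X1.:* B) X1.:* ((A X1.:* A) X1.:* (one X1.:- d X1.:* s′))) X1.:- Q X1.:^ 4 X1.:* ((A X1.:* A) X1.:* ((B X1.:* B) X1.:* (one X1.:- d X1.:* s)))
              X1.:= (d X1.:* ((A X1.:* B) X1.:* (s X1.:- s′))) X1.:* (Q X1.:^ 4 X1.:* (A X1.:* B))) C1.refl δ̂ (Q 5) A B′ (S 1 C1.+ S 4) (S 2 C1.+ S 3)))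

        K-inv : K C1.* (I₅ X1.^ 4 C1.* (Q 5 C1.* I₁)) C1.≈ C1.1#
        K-inv = C1.trans (X1.solve 4 (λ Q ab i₅ i₁ → (Q X1.:^ 4 X1.:* ab) X1.:* (i₅ X1.:^ 4 X1.:* (Q X1.:* i₁)) X1.:= (Q X1.:* i₅) X1.:^ 4 X1.:* ((ab X1.:* Q) X1.:* i₁)) C1.refl (Q 5) (A C1.* B′) I₅ I₁)
          (C1.trans (C1.*-cong (X1.^-congˡ 4 inv₅) (C1.trans (C1.*-congʳ AB) inv₁)) (X1.solve 0 (one X1.:^ 4 X1.:* one X1.:= one) C1.refl))

      eisenstein : δ̂ C1.* (q C1.* Q 5 X1.^ 5) C1.≈ δ̂ C1.* (T C1.* Q 1)
      eisenstein = C1.trans (X1.solve 3 (λ d q Q → d X1.:* (q X1.:* Q X1.:^ 5) X1.:= (d X1.:* (q X1.:* Q X1.:^ 4)) X1.:* Q) C1.refl δ̂ q (Q 5))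
        (C1.trans (C1.*-congʳ (cancel K-inv scaled))
          (C1.trans (X1.solve 4 (λ d ab t Q → (d X1.:* (ab X1.:* t)) X1.:* Q X1.:= d X1.:* (t X1.:* (ab X1.:* Q))) C1.refl δ̂ (A C1.* B′) T (Q 5)) (C1.*-congˡ (C1.*-congˡ AB))))

    module Level1 (S : ℕ → P1.Series) (lim-S : ∀ i → P1.Lim (λ N → X1.Σ< N (λ j → Λ (ζ UX.^ i) (suc j))) (S i)) where
      open Deformed 0

      private
        ζ⁵ : ζ UX.^ 5 UR.≈ UR.1#
        ζ⁵ = UR.trans (UX.solve 1 (λ z → z UX.:^ 5 UX.:= UX.con (+ 1) UX.:+ (z UX.:- UX.con (+ 1)) UX.:* (UX.con (+ 1) UX.:+ z UX.:+ z UX.:^ 2 UX.:+ z UX.:^ 3 UX.:+ z UX.:^ 4)) UR.refl ζ)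
          (UR.trans (UR.+-congˡ (UR.trans (UR.*-congˡ Φ₅) (UR.zeroʳ _))) (UR.+-identityʳ _))

        reduce : ∀ n → ζ UX.^ (5 ℕ.+ n) UR.≈ ζ UX.^ n
        reduce n = UR.trans (UX.^-homo-* ζ 5 n) (UR.trans (UR.*-congʳ ζ⁵) (UR.*-identityˡ _))

        Z₁ Z₂ : Char
        Z₁ = unit-char (ζ UX.^ 1) (ζ UX.^ 4) (UR.trans (UR.sym (UX.^-homo-* ζ 1 4)) ζ⁵)
        Z₂ = unit-char (ζ UX.^ 2) (ζ UX.^ 3) (UR.trans (UR.sym (UX.^-homo-* ζ 2 3)) ζ⁵)

        f : ℕ → P1.Series
        f i = F (ζ UX.^ i) 1
        c : ℕ → P1.Series
        c i = P1.C (ζ UX.^ i)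
        x : ℕ → P1.Series
        x i = C1.1# C1.- c i

        val : ∀ {a} → a UX.^ 1 UR.≈ a
        val = UR.*-identityʳ _

        F₀ : ∀ {a} i → a UR.≈ ζ UX.^ i → F a 0 C1.≈ x i C1.* f i
        F₀ i e = C1.trans (F-cong 0 e) (F-shift (ζ UX.^ i) 0)

        D₀ : ∀ i → D (ζ UX.^ i) 0 C1.≈ (x i C1.* x i C1.- δ̂ C1.* c i) C1.* D (ζ UX.^ i) 1
        D₀ i = D-first (ζ UX.^ i)

        D-cong : ∀ {a b} e → a UR.≈ b → D a e C1.≈ D b e
        D-cong e p = C1.*-cong (F-cong e (UR.*-congʳ p)) (F-cong e (UR.*-congʳ p))

        log : ∀ i → D (ζ UX.^ i) 1 C1.≈ (f i C1.* f i) C1.* (C1.1# C1.- δ̂ C1.* S i)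
        log i = D-log (ζ UX.^ i) 1 (λ j → Λ (ζ UX.^ i) (suc j))
          (λ j → C1.trans (C1.*-congˡ (C1.*-cong (at j) (at j))) (C1.trans (Λ-eq (ζ UX.^ i) j) (P1.mon-≡ _ (≡.cong suc (≡.sym (ℕP.*-identityʳ j))))))
          (lim-S i)
          where
          at : ∀ j → C1.1# C1.- tF (ζ UX.^ i) 1 j C1.≈ C1.1# C1.- P1.mon (ζ UX.^ i) (suc j)
          at j = C1.+-congˡ (C1.-‿cong (P1.mon-≡ (ζ UX.^ i) (≡.cong suc (ℕP.*-identityʳ j))))

        -- z = ζ² and b = ζ in base q, with all exponents 0; then zb = ζ³ and z/b = ζ.
        open Weierstrass Z₂ Z₁ 0 1 0 1 0 1 0 1 ≡.refl ≡.refl ≡.refl ≡.refl ≡.refl ≡.refl ≡.refl ≡.refl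

        A B′ T K : P1.Series
        A = f 2 C1.* f 3
        B′ = f 1 C1.* f 4
        T = (S 1 C1.+ S 4) C1.- (S 2 C1.+ S 3)
        K = Q 1 X1.^ 4 C1.* (A C1.* B′)

        B-eq : B C1.≈ c 1 C1.* ((Q 1 C1.* ((x 3 C1.* f 3) C1.* f 2)) C1.* (Q 1 C1.* ((x 1 C1.* f 1) C1.* f 4)))
        B-eq = C1.*-cong (P1.C-cong val) (C1.*-cong
          (C1.*-congˡ (C1.*-cong (F₀ 3 (UR.trans (UR.*-cong val val) (UR.sym (UX.^-homo-* ζ 2 1)))) (F-cong 1 (UR.trans (UR.*-cong val val) (UR.trans (UR.sym (UX.^-homo-* ζ 3 4)) (reduce 2))))))
          (C1.*-congˡ (C1.*-cong (F₀ 1 (UR.trans (UR.*-cong val val) (UR.trans (UR.sym (UX.^-homo-* ζ 2 4)) (reduce 1)))) (F-cong 1 (UR.trans (UR.*-cong val val) (UR.sym (UX.^-homo-* ζ 3 1)))))))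

        Fz : F₂ Z₂ 0 1 C1.≈ x 2 C1.* A
        Fz = C1.trans (C1.*-cong (F₀ 2 val) (F-cong 1 val)) (C1.*-assoc _ _ _)
        Fb : F₂ Z₁ 0 1 C1.≈ x 1 C1.* B′
        Fb = C1.trans (C1.*-cong (F₀ 1 val) (F-cong 1 val)) (C1.*-assoc _ _ _)
        Dz : D₂ Z₂ 0 1 C1.≈ (x 2 C1.* x 2 C1.- δ̂ C1.* c 2) C1.* ((A C1.* A) C1.* (C1.1# C1.- δ̂ C1.* (S 2 C1.+ S 3)))
        Dz = C1.trans (C1.*-cong (C1.trans (D-cong 0 val) (D₀ 2)) (D-cong 1 val)) (C1.trans (C1.*-assoc _ _ _) (C1.*-congˡ (log-pair (log 2) (log 3))))
        Db : D₂ Z₁ 0 1 C1.≈ (x 1 C1.* x 1 C1.- δ̂ C1.* c 1) C1.* ((B′ C1.* B′) C1.* (C1.1# C1.- δ̂ C1.* (S 1 C1.+ S 4)))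
        Db = C1.trans (C1.*-cong (C1.trans (D-cong 0 val) (D₀ 1)) (D-cong 1 val)) (C1.trans (C1.*-assoc _ _ _) (C1.*-congˡ (log-pair (log 1) (log 4))))

        -- Constants of ℤ[ζ] left by the factors at exponent 0: `κ₃` from the bracket of z and b,
        -- `κ₁` from the δ-terms of the split-off factors, `κ₂` as the multiplier of the Lambert
        -- series.
        κ₃ κ₁ κ₂ : P1.Series
        κ₃ = c 1 C1.* (x 3 C1.* x 1)
        κ₁ = c 1 C1.* (x 2 C1.* x 2) C1.- c 2 C1.* (x 1 C1.* x 1)
        κ₂ = (x 1 C1.* x 1) C1.* (x 2 C1.* x 2)

        lhs rhs : P1.Series
        lhs = Q 1 X1.^ 4 C1.* (((x 2 C1.* A) C1.* (x 2 C1.* A)) C1.* ((x 1 C1.* x 1 C1.- δ̂ C1.* c 1) C1.* ((B′ C1.* B′) C1.* (C1.1# C1.- δ̂ C1.* (S 1 C1.+ S 4)))))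
        rhs = Q 1 X1.^ 4 C1.* (((x 1 C1.* B′) C1.* (x 1 C1.* B′)) C1.* ((x 2 C1.* x 2 C1.- δ̂ C1.* c 2) C1.* ((A C1.* A) C1.* (C1.1# C1.- δ̂ C1.* (S 2 C1.+ S 3)))))

        W : (δ̂ C1.* (κ₃ C1.* Q 1 X1.^ 4)) C1.* K C1.+ lhs C1.≈ rhs
        W = C1.trans (C1.+-cong (C1.trans (X1.solve 9 (λ d c x₃ x₁ q f₁ f₂ f₃ f₄ → (d X1.:* ((c X1.:* (x₃ X1.:* x₁)) X1.:* q X1.:^ 4)) X1.:* (q X1.:^ 4 X1.:* ((f₂ X1.:* f₃) X1.:* (f₁ X1.:* f₄)))
                X1.:= (c X1.:* ((q X1.:* ((x₃ X1.:* f₃) X1.:* f₂)) X1.:* (q X1.:* ((x₁ X1.:* f₁) X1.:* f₄)))) X1.:* (d X1.:* q X1.:^ 6)) C1.refl δ̂ (c 1) (x 3) (x 1) (Q 1) (f 1) (f 2) (f 3) (f 4))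
              (C1.*-congʳ (C1.sym B-eq)))
            (C1.*-congˡ (C1.*-cong (C1.*-cong (C1.sym Fz) (C1.sym Fz)) (C1.sym Db))))
          (C1.trans weierstrass (C1.*-congˡ (C1.*-cong (C1.*-cong Fb Fb) Dz)))

        difference : rhs C1.- lhs C1.≈ (δ̂ C1.* ((A C1.* B′) C1.* (κ₁ C1.+ κ₂ C1.* T))) C1.* K
        difference = C1.trans (X1.solve 10 (λ d q A B c₁ c₂ x₁ x₂ s s′ →
              q X1.:^ 4 X1.:* (((x₁ X1.:* B) X1.:* (x₁ X1.:* B)) X1.:* ((x₂ X1.:* x₂ X1.:- d X1.:* c₂) X1.:* ((A X1.:* A) X1.:* (one X1.:- d X1.:* s′))))
              X1.:- q X1.:^ 4 X1.:* (((x₂ X1.:* A) X1.:* (x₂ X1.:* A)) X1.:* ((x₁ X1.:* x₁ X1.:- d X1.:* c₁) X1.:* ((B X1.:* B) X1.:* (one X1.:- d X1.:* s))))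
              X1.:= (d X1.:* ((A X1.:* B) X1.:* ((c₁ X1.:* (x₂ X1.:* x₂) X1.:- c₂ X1.:* (x₁ X1.:* x₁)) X1.:+ ((x₁ X1.:* x₁) X1.:* (x₂ X1.:* x₂)) X1.:* (s X1.:- s′)))) X1.:* (q X1.:^ 4 X1.:* (A X1.:* B))
                X1.:+ (d X1.:* d) X1.:* (q X1.:^ 4 X1.:* (A X1.:* A) X1.:* (B X1.:* B) X1.:* ((x₁ X1.:* x₁) X1.:* c₂ X1.:* s′ X1.:- (x₂ X1.:* x₂) X1.:* c₁ X1.:* s)))
              C1.refl δ̂ (Q 1) A B′ (c 1) (c 2) (x 1) (x 2) (S 1 C1.+ S 4) (S 2 C1.+ S 3))
          (C1.trans (C1.+-congˡ (C1.trans (C1.*-congʳ δ̂δ̂) (C1.zeroˡ _))) (C1.+-identityʳ _))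

        scaled : (δ̂ C1.* (κ₃ C1.* Q 1 X1.^ 4)) C1.* K C1.≈ (δ̂ C1.* ((A C1.* B′) C1.* (κ₁ C1.+ κ₂ C1.* T))) C1.* K
        scaled = C1.trans (X1.solve 2 (λ a b → a X1.:= (a X1.:+ b) X1.:- b) C1.refl _ lhs) (C1.trans (C1.+-congʳ W) difference)

        module Quint = Cyclo.Quintic R1

        z-Φ₅ : C1.1# C1.+ P1.C ζ C1.+ P1.C ζ X1.^ 2 C1.+ P1.C ζ X1.^ 3 C1.+ P1.C ζ X1.^ 4 C1.≈ C1.0#
        z-Φ₅ = C1.trans (C1.+-cong (C1.+-cong (C1.+-cong (C-+ UR.1# ζ) (pw 2)) (pw 3)) (pw 4))
          (C1.trans (C1.+-congʳ (C1.trans (C1.+-congʳ (C-+ _ (ζ UX.^ 2))) (C-+ _ (ζ UX.^ 3)))) (C1.trans (C-+ _ (ζ UX.^ 4)) (C1.trans (P1.C-cong Φ₅) (P1.mon-zero 0))))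
          where
          pw : ∀ n → P1.C ζ X1.^ n C1.≈ P1.C (ζ UX.^ n)
          pw n = C1.trans (P1.mon-^ ζ 0 n) (P1.mon-≡ (ζ UX.^ n) (ℕP.*-zeroʳ n))

        -- The quintic factorisation at -q^(j + 1) multiplies the five conjugate factors to 1 - q^(5
        -- (j + 1)).
        conjugates : F UR.1# 1 C1.* (f 1 C1.* (f 2 C1.* (f 3 C1.* f 4))) C1.≈ Q 5
        conjugates = P1.Lim-Π5 (Lim-F UR.1# 1) (Lim-F (ζ UX.^ 1) 1) (Lim-F (ζ UX.^ 2) 1) (Lim-F (ζ UX.^ 3) 1) (Lim-F (ζ UX.^ 4) 1) factor (Lim-Q 4)
          where
          split : ∀ i k → C1.1# C1.- P1.mon (ζ UX.^ i) k C1.≈ C1.1# C1.+ P1.C ζ X1.^ i C1.* (C1.- P1.mon UR.1# k)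
          split i k = C1.trans (C1.+-congˡ (C1.-‿cong (C1.sym (C1.trans (C1.*-congʳ (C1.trans (P1.mon-^ ζ 0 i) (P1.mon-≡ (ζ UX.^ i) (ℕP.*-zeroʳ i))))
              (C1.trans (P1.mon-* (ζ UX.^ i) 0 UR.1# k) (P1.mon-cong k (UR.*-identityʳ _)))))))
            (X1.solve 2 (λ z t → one X1.:- z X1.:* t X1.:= one X1.:+ z X1.:* (X1.:- t)) C1.refl _ _)
          one^ : ∀ k → UR.1# UX.^ k UR.≈ UR.1#
          one^ zero = UR.refl
          one^ (suc k) = UR.trans (UR.*-identityˡ _) (one^ k)
          factor : ∀ j → (C1.1# C1.- tF UR.1# 1 j) C1.* ((C1.1# C1.- tF (ζ UX.^ 1) 1 j) C1.* ((C1.1# C1.- tF (ζ UX.^ 2) 1 j) C1.* ((C1.1# C1.- tF (ζ UX.^ 3) 1 j) C1.* (C1.1# C1.- tF (ζ UX.^ 4) 1 j))))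
            C1.≈ qFactor 5 j
          factor j = C1.trans (C1.*-congˡ (C1.*-cong (C1.trans (split 1 k) (C1.+-congˡ (C1.*-congʳ (C1.*-identityʳ _)))) (C1.*-cong (split 2 k) (C1.*-cong (split 3 k) (split 4 k)))))
            (C1.trans (Quint.quintic (P1.C ζ) (C1.- P1.mon UR.1# k) z-Φ₅)
              (C1.+-congˡ (C1.trans (X1.solve 1 (λ t → (X1.:- t) X1.:^ 5 X1.:= X1.:- (t X1.:^ 5)) C1.refl (P1.mon UR.1# k))
                (C1.-‿cong (C1.trans (P1.mon-^ UR.1# k 5) (C1.trans (P1.mon-cong (5 ℕ.* k) (one^ 5)) (P1.mon-≡ UR.1# (≡.cong (λ t → 5 ℕ.* suc t) (ℕP.*-identityʳ j)))))))))
            where k = 1 ℕ.+ j ℕ.* 1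

        AB : (A C1.* B′) C1.* Q 1 C1.≈ Q 5
        AB = C1.trans (C1.*-congˡ (C1.sym F-Q)) (C1.trans
          (X1.solve 5 (λ a b c d e → ((b X1.:* c) X1.:* (a X1.:* d)) X1.:* e X1.:= e X1.:* (a X1.:* (b X1.:* (c X1.:* d)))) C1.refl (f 1) (f 2) (f 3) (f 4) (F UR.1# 1)) conjugates)

        K-inv : K C1.* (I₁ X1.^ 4 C1.* (Q 1 C1.* I₅)) C1.≈ C1.1#
        K-inv = C1.trans (X1.solve 4 (λ Q ab i₁ i₅ → (Q X1.:^ 4 X1.:* ab) X1.:* (i₁ X1.:^ 4 X1.:* (Q X1.:* i₅)) X1.:= (Q X1.:* i₁) X1.:^ 4 X1.:* ((ab X1.:* Q) X1.:* i₅)) C1.refl (Q 1) (A C1.* B′) I₁ I₅)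
          (C1.trans (C1.*-cong (X1.^-congˡ 4 inv₁) (C1.trans (C1.*-congʳ AB) inv₅)) (X1.solve 0 (one X1.:^ 4 X1.:* one X1.:= one) C1.refl))

      eisenstein : δ̂ C1.* (κ₃ C1.* Q 1 X1.^ 5) C1.≈ δ̂ C1.* ((κ₁ C1.+ κ₂ C1.* T) C1.* Q 5)
      eisenstein = C1.trans (X1.solve 3 (λ d q Q → d X1.:* (q X1.:* Q X1.:^ 5) X1.:= (d X1.:* (q X1.:* Q X1.:^ 4)) X1.:* Q) C1.refl δ̂ κ₃ (Q 1))
        (C1.trans (C1.*-congʳ (cancel K-inv scaled))
          (C1.trans (X1.solve 4 (λ d ab t Q → (d X1.:* (ab X1.:* t)) X1.:* Q X1.:= d X1.:* (t X1.:* (ab X1.:* Q))) C1.refl δ̂ (A C1.* B′) (κ₁ C1.+ κ₂ C1.* T) (Q 1)) (C1.*-congˡ (C1.*-congˡ AB))))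

-- A free extension of ℤ that contains ζ, δ and u.

module Tower where
  open ≡ using (refl)

  -- The free quadratic extension K[x] / (x² − a x − b); (c , d) is c + d x.
  module Quadratic (K : CommutativeRing 0ℓ 0ℓ) (a b : CommutativeRing.Carrier K) where
    private module K = CommutativeRing K
    open RingX K

    quadratic : CommutativeRing 0ℓ 0ℓ
    quadratic = record
      { Carrier = K.Carrier × K.Carrier
      ; _≈_ = λ (c , d) (c′ , d′) → c K.≈ c′ × d K.≈ d′
      ; _+_ = λ (c , d) (c′ , d′) → c K.+ c′ , d K.+ d′
      ; _*_ = λ (c , d) (c′ , d′) → c K.* c′ K.+ b K.* (d K.* d′) , c K.* d′ K.+ d K.* c′ K.+ a K.* (d K.* d′)
      ; -_ = λ (c , d) → K.- c , K.- d
      ; 0# = K.0# , K.0#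
      ; 1# = K.1# , K.0#
      ; isCommutativeRing = record
        { isRing = record
          { +-isAbelianGroup = record
            { isGroup = record
              { isMonoid = record
                { isSemigroup = record
                  { isMagma = record
                    { isEquivalence = record
                      { refl = K.refl , K.refl ; sym = λ (p , q) → K.sym p , K.sym q ; trans = λ (p , q) (p′ , q′) → K.trans p p′ , K.trans q q′ }
                    ; ∙-cong = λ (p , q) (p′ , q′) → K.+-cong p p′ , K.+-cong q q′ }
                  ; assoc = λ _ _ _ → K.+-assoc _ _ _ , K.+-assoc _ _ _ }
                ; identity = (λ _ → K.+-identityˡ _ , K.+-identityˡ _) , (λ _ → K.+-identityʳ _ , K.+-identityʳ _) }
              ; inverse = (λ _ → K.-‿inverseˡ _ , K.-‿inverseˡ _) , (λ _ → K.-‿inverseʳ _ , K.-‿inverseʳ _)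
              ; ⁻¹-cong = λ (p , q) → K.-‿cong p , K.-‿cong q }
            ; comm = λ _ _ → K.+-comm _ _ , K.+-comm _ _ }
          ; *-cong = λ (p , q) (p′ , q′) → K.+-cong (K.*-cong p p′) (K.*-congˡ (K.*-cong q q′)) ,
              K.+-cong (K.+-cong (K.*-cong p q′) (K.*-cong q p′)) (K.*-congˡ (K.*-cong q q′))
          ; *-assoc = λ (c , d) (c′ , d′) (c″ , d″) → assoc₁ a b c d c′ d′ c″ d″ , assoc₂ a b c d c′ d′ c″ d″
          ; *-identity = (λ (c , d) → idˡ₁ b c d , idˡ₂ a c d) , (λ (c , d) → idʳ₁ b c d , idʳ₂ a c d)
          ; distrib = (λ (c , d) (c′ , d′) (c″ , d″) → dˡ₁ b c d c′ d′ c″ d″ , dˡ₂ a c d c′ d′ c″ d″)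
                    , (λ (c , d) (c′ , d′) (c″ , d″) → dʳ₁ b c d c′ d′ c″ d″ , dʳ₂ a c d c′ d′ c″ d″) }
        ; *-comm = λ (c , d) (c′ , d′) → comm₁ b c d c′ d′ , comm₂ a c d c′ d′ } }
      where
      assoc₁ = solve 8 (λ a b c d c′ d′ c″ d″ →
        (c :* c′ :+ b :* (d :* d′)) :* c″ :+ b :* ((c :* d′ :+ d :* c′ :+ a :* (d :* d′)) :* d″) :=
        c :* (c′ :* c″ :+ b :* (d′ :* d″)) :+ b :* (d :* (c′ :* d″ :+ d′ :* c″ :+ a :* (d′ :* d″)))) K.refl
      assoc₂ = solve 8 (λ a b c d c′ d′ c″ d″ →
        (c :* c′ :+ b :* (d :* d′)) :* d″ :+ (c :* d′ :+ d :* c′ :+ a :* (d :* d′)) :* c″ :+ a :* ((c :* d′ :+ d :* c′ :+ a :* (d :* d′)) :* d″) :=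
        c :* (c′ :* d″ :+ d′ :* c″ :+ a :* (d′ :* d″)) :+ d :* (c′ :* c″ :+ b :* (d′ :* d″)) :+ a :* (d :* (c′ :* d″ :+ d′ :* c″ :+ a :* (d′ :* d″)))) K.refl
      idˡ₁ = solve 3 (λ b c d → con (+ 1) :* c :+ b :* (con (+ 0) :* d) := c) K.refl
      idˡ₂ = solve 3 (λ a c d → con (+ 1) :* d :+ con (+ 0) :* c :+ a :* (con (+ 0) :* d) := d) K.refl
      idʳ₁ = solve 3 (λ b c d → c :* con (+ 1) :+ b :* (d :* con (+ 0)) := c) K.refl
      idʳ₂ = solve 3 (λ a c d → c :* con (+ 0) :+ d :* con (+ 1) :+ a :* (d :* con (+ 0)) := d) K.refl
      dˡ₁ = solve 7 (λ b c d c′ d′ c″ d″ → c :* (c′ :+ c″) :+ b :* (d :* (d′ :+ d″)) := (c :* c′ :+ b :* (d :* d′)) :+ (c :* c″ :+ b :* (d :* d″))) K.refl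
      dˡ₂ = solve 7 (λ a c d c′ d′ c″ d″ → c :* (d′ :+ d″) :+ d :* (c′ :+ c″) :+ a :* (d :* (d′ :+ d″)) :=
        (c :* d′ :+ d :* c′ :+ a :* (d :* d′)) :+ (c :* d″ :+ d :* c″ :+ a :* (d :* d″))) K.refl
      dʳ₁ = solve 7 (λ b c d c′ d′ c″ d″ → (c′ :+ c″) :* c :+ b :* ((d′ :+ d″) :* d) := (c′ :* c :+ b :* (d′ :* d)) :+ (c″ :* c :+ b :* (d″ :* d))) K.refl
      dʳ₂ = solve 7 (λ a c d c′ d′ c″ d″ → (c′ :+ c″) :* d :+ (d′ :+ d″) :* c :+ a :* ((d′ :+ d″) :* d) :=
        (c′ :* d :+ d′ :* c :+ a :* (d′ :* d)) :+ (c″ :* d :+ d″ :* c :+ a :* (d″ :* d))) K.refl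
      comm₁ = solve 5 (λ b c d c′ d′ → c :* c′ :+ b :* (d :* d′) := c′ :* c :+ b :* (d′ :* d)) K.refl
      comm₂ = solve 5 (λ a c d c′ d′ → c :* d′ :+ d :* c′ :+ a :* (d :* d′) := c′ :* d :+ d′ :* c :+ a :* (d′ :* d)) K.refl

  open Quadratic using (quadratic)

  -- ℤ[γ] with γ = ζ + ζ⁻¹, then ℤ[ζ], then δ with δ² = 0, then u with u² = (2 + δ) u − 1.
  ℤ[γ] ℤ[ζ] ℤ[ζ,δ] 𝕌 : CommutativeRing 0ℓ 0ℓ
  ℤ[γ] = quadratic ℤP.+-*-commutativeRing -[1+ 0 ] (+ 1)
  ℤ[ζ] = quadratic ℤ[γ] (+ 0 , + 1) (-[1+ 0 ] , + 0)
  ℤ[ζ,δ] = quadratic ℤ[ζ] 0# 0#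
    where
    open CommutativeRing ℤ[ζ]
  𝕌 = quadratic ℤ[ζ,δ] (((+ 2 , + 0) , (+ 0 , + 0)) , ((+ 1 , + 0) , (+ 0 , + 0))) (- 1#)
    where
    open CommutativeRing ℤ[ζ,δ]

  private module 𝕌 = CommutativeRing 𝕌

  O₂ I₂ : ℤ × ℤ
  O₂ = + 0 , + 0
  I₂ = + 1 , + 0

  -- An equation in `𝕌` is sixteen equations between closed integers, each settled by evaluation.
  fifthRoot : Cyclo.FifthRoot 𝕌
  fifthRoot = record { ζ = (((O₂ , I₂) , (O₂ , O₂)) , ((O₂ , O₂) , (O₂ , O₂)))
    ; Φ₅ = (((refl , refl) , (refl , refl)) , ((refl , refl) , (refl , refl))) , (((refl , refl) , (refl , refl)) , ((refl , refl) , (refl , refl))) }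

  dualUnit : Cyclo.DualUnit 𝕌
  dualUnit = record
    { u = ((O₂ , O₂) , (O₂ , O₂)) , ((I₂ , O₂) , (O₂ , O₂))
    -- v = 2 + δ - u, the conjugate of u.
    ; v = (((+ 2 , + 0) , O₂) , (I₂ , O₂)) , (((-[1+ 0 ] , + 0) , O₂) , (O₂ , O₂))
    ; δ = ((O₂ , O₂) , (I₂ , O₂)) , ((O₂ , O₂) , (O₂ , O₂))
    ; uv = (((refl , refl) , (refl , refl)) , ((refl , refl) , (refl , refl))) , (((refl , refl) , (refl , refl)) , ((refl , refl) , (refl , refl)))
    ; u+v = (((refl , refl) , (refl , refl)) , ((refl , refl) , (refl , refl))) , (((refl , refl) , (refl , refl)) , ((refl , refl) , (refl , refl)))
    ; δδ = (((refl , refl) , (refl , refl)) , ((refl , refl) , (refl , refl))) , (((refl , refl) , (refl , refl)) , ((refl , refl) , (refl , refl))) }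

  -- The coefficient of δ.
  κ : 𝕌.Carrier → ℤ
  κ ((_ , ((n , _) , _)) , _) = n

  κ-cong : ∀ {x y} → x 𝕌.≈ y → κ x ≡ κ y
  κ-cong ((_ , ((e , _) , _)) , _) = e

  κ-+ : ∀ x y → κ (x 𝕌.+ y) ≡ κ x ℤ.+ κ y
  κ-+ _ _ = refl

-- The series of the statement over ℤ, and the extraction of every fifth coefficient.

module DefsZ where
  open import Data.Nat.Divisibility as ℕV using (_∣_; divides)
  open import Data.Nat.Coprimality using (Coprime; coprime-divisor)
  open import Data.Nat.Primality using (Prime; prime?; prime⇒irreducible)
  open import Data.List using (applyUpTo; zipWith)
  open import Function using (id)
  open import Relation.Nullary.Decidable using (from-yes)
  open ≡ using (refl; sym; trans; cong; cong₂)
  open Ev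

  ℤring : CommutativeRing 0ℓ 0ℓ
  ℤring = ℤP.+-*-commutativeRing

  module PZ = PS ℤring
  module CZ = CommutativeRing PZ.psRing
  module XZ = RingX PZ.psRing
  module NZ = RingX ℤring
  module LZ = Lambert ℤring
  open Base ℤring public using () renaming (Q to QZ; qFactor to qFactorZ; Lim-Q to Lim-QZ)
  open PZ using (_≋_)

  sumZ-map : ∀ {A : Set} (h : A → ℤ) xs → sumZ (map h xs) ≡ NZ.sumL h xs
  sumZ-map h [] = refl
  sumZ-map h (x ∷ xs) = cong (λ z → h x ℤ.+ z) (sumZ-map h xs)

  sumZ-upTo : ∀ (h : ℕ → ℤ) n → sumZ (map h (upTo n)) ≡ NZ.Σ< n h
  sumZ-upTo h n = trans (sumZ-map h (upTo n)) (NZ.sumL-upTo h n)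

  ⊛-conv : ∀ f g → f ⊛ g ≋ PZ.conv f g
  ⊛-conv f g n = trans (sumZ-upTo (λ i → f i ℤ.* g (n ℕ.∸ i)) (suc n)) (go f n)
    where
    go : ∀ f n → NZ.Σ< (suc n) (λ i → f i ℤ.* g (n ℕ.∸ i)) ≡ PZ.conv f g n
    go f zero = ℤP.+-identityˡ _
    go f (suc n) = trans (NZ.Σ<-front (suc n) (λ i → f i ℤ.* g (suc n ℕ.∸ i))) (cong (λ z → f 0 ℤ.* g (suc n) ℤ.+ z) (go (PZ.tail f) n))

  ⊛-cong : ∀ {f f′ g g′} → f ≋ f′ → g ≋ g′ → f ⊛ g ≋ f′ CZ.* g′
  ⊛-cong {f} {g = g} p q n = trans (⊛-conv f g n) (CZ.*-cong p q n)

  oneP-C : oneP ≋ CZ.1#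
  oneP-C zero = refl
  oneP-C (suc n) = refl

  mono-mon : ∀ j → mono j ≋ PZ.mon (+ 1) j
  mono-mon j n with n ℕ.≟ j
  ... | yes refl = sym (PZ.mon-same (+ 1) n)
  ... | no n≢j = sym (PZ.mon-diff (+ 1) j n n≢j)

  ^P-^ : ∀ {f f′} m → f ≋ f′ → f ^P m ≋ f′ XZ.^ m
  ^P-^ zero p = oneP-C
  ^P-^ (suc m) p = ⊛-cong p (^P-^ m p)

  one-mono : ∀ j → oneP ⊖ mono j ≋ CZ.1# CZ.- PZ.mon (+ 1) j
  one-mono j n = cong₂ ℤ._-_ (oneP-C n) (mono-mon j n)

  intR-id : ∀ a → NZ.intR a ≡ a
  intR-id (+ n) = nat n
    where
    nat : ∀ n → NZ.intR (+ n) ≡ + n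
    nat zero = refl
    nat (suc n) = trans (NZ.intR-+ (+ 1) (+ n)) (cong (λ z → + 1 ℤ.+ z) (nat n))
  intR-id -[1+ n ] = trans (NZ.intR-neg (+ suc n)) (cong ℤ.-_ (intR-id (+ suc n)))

  constHom : RingHom ℤring PZ.psRing
  constHom = record { ⟦_⟧ = PZ.C ; cong = PZ.C-cong ; hom-0 = PZ.mon-zero 0 ; hom-1 = CZ.refl
    ; hom-+ = λ a b → CZ.sym (PZ.mon-+ a b 0) ; hom-* = λ a b → CZ.sym (PZ.mon-* a 0 b 0) }

  ·-C : ∀ a f → a · f ≋ XZ.intR a CZ.* f
  ·-C a f n = sym (trans (CZ.*-cong {y = PZ.C a} (CZ.trans (CZ.sym (HomX.hom-intR (constHom) a)) (λ m → PZ.C-cong (intR-id a) m)) CZ.refl n) (PZ.C-conv a f n))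

  qPoch-Q : ∀ m → qPoch (suc m) ≋ QZ (suc m)
  qPoch-Q m n = trans (finite n n) (sym (last n (ℕP.n<1+n n)))
    where
    finite : ∀ N → finProd (suc m) N ≋ XZ.Π< N (qFactorZ (suc m))
    finite zero = oneP-C
    finite (suc N) = ⊛-cong (finite N) (one-mono (suc m ℕ.* suc N))
    -- `qPoch` reads coefficient n off n factors, the limit off n + 1; the additional factor is 1
    -- modulo X^(n + 1).
    last : XZ.Π< (suc n) (qFactorZ (suc m)) PZ.≈[ suc n ] XZ.Π< n (qFactorZ (suc m))
    last = PZ.tr (PZ.*-≈⟨⟩ {f = XZ.Π< n (qFactorZ (suc m))} (PZ.≈⇒ CZ.refl)
        (PZ.+-≈⟨⟩ {f = CZ.1#} (PZ.≈⇒ CZ.refl) (Base.O-neg1 ℤring (PZ.mon (+ 1) (suc m ℕ.* suc n))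
          (PZ.O-weaken {f = PZ.mon (+ 1) (suc m ℕ.* suc n)} (ℕP.m≤n*m (suc n) (suc m)) (PZ.O-mon (+ 1) (suc m ℕ.* suc n))))))
      (PZ.≈⇒ (CZ.trans (CZ.*-congˡ (CZ.+-identityʳ CZ.1#)) (CZ.*-identityʳ _)))

  inv-inverse : ∀ f → f 0 ≡ + 1 → f CZ.* inv f ≋ CZ.1#
  inv-inverse f f₀ zero = cong (ℤ._* + 1) f₀
  inv-inverse f f₀ (suc n) = trans (cong₂ (λ a s → a ℤ.* inv f (suc n) ℤ.+ s) f₀ (sym (tail-sum (PZ.tail f) n)))
    (cancel (sumZ (zipWith ℤ._*_ (map (λ i → f (suc i)) (upTo (suc n))) (invL f n))))
    where
    cancel : ∀ s → + 1 ℤ.* (ℤ.- s) ℤ.+ s ≡ + 0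
    cancel = ℤS.solve-∀
    shifted : ∀ (g : ℕ → ℤ) (xs : ℕ → ℕ) n → map g (applyUpTo (suc ∘ xs) n) ≡ map (g ∘ suc) (applyUpTo xs n)
    shifted g xs zero = refl
    shifted g xs (suc n) = cong (g (suc (xs 0)) ∷_) (shifted g (xs ∘ suc) n)
    tail-sum : ∀ g n → sumZ (zipWith ℤ._*_ (map g (upTo (suc n))) (invL f n)) ≡ PZ.conv g (inv f) n
    tail-sum g zero = ℤP.+-identityʳ _
    tail-sum g (suc n) = cong (λ z → g 0 ℤ.* inv f (suc n) ℤ.+ z)
      (trans (cong (λ l → sumZ (zipWith ℤ._*_ l (invL f n))) (shifted g id (suc n))) (tail-sum (PZ.tail g) n))

  quotient : ∀ {a f g s} → f 0 ≡ + 1 → f ≋ g → s CZ.* g ≋ a → a CZ.* inv f ≋ s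
  quotient {a} {f} {g} {s} f₀ fg sg = CZ.trans (CZ.*-congʳ (CZ.sym sg)) (CZ.trans (CZ.*-assoc s g (inv f))
    (CZ.trans (CZ.*-congˡ (CZ.trans (CZ.*-congʳ (CZ.sym fg)) (inv-inverse f f₀))) (CZ.*-identityʳ s)))

  lambert-Λ : ∀ j → mono (suc j) ⊛ inv ((oneP ⊖ mono (suc j)) ^P 2) ≋ LZ.Λ (+ 1) (suc j)
  lambert-Λ j = CZ.trans (⊛-cong (mono-mon (suc j)) CZ.refl)
    (quotient refl (CZ.trans (^P-^ 2 (one-mono (suc j))) (CZ.*-congˡ (CZ.*-identityʳ _))) (LZ.Λ-eq (+ 1) j))

  lambert-Γ : ∀ j → mono (suc j) ⊛ inv (oneP ⊖ mono (suc j)) ≋ LZ.Γ (suc j)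
  lambert-Γ j = CZ.trans (⊛-cong (mono-mon (suc j)) CZ.refl) (quotient refl (one-mono (suc j)) (LZ.Γ-eq j))

  -- At coefficient n the two sides differ by the term of index n in t, which is divisible by X^(n +
  -- 1).
  sumInf-limit : ∀ (g : ℕ → PS) (t : ℕ → PZ.Series) → (∀ j → g (suc j) ≋ t j) → (∀ j → PZ.O (suc j) (t j)) →
    sumInf g ≋ PZ.limit (λ N → XZ.Σ< N t)
  sumInf-limit g t e small n = trans (sumZ-upTo (λ j → g (suc j) n) n) (trans (NZ.Σ<-cong n (λ j _ → e j n))
    (trans (pointwise n) (sym (trans (cong (λ z → XZ.Σ< n t n ℤ.+ z) (small n n (ℕP.n<1+n n))) (ℤP.+-identityʳ _)))))
    where
    pointwise : ∀ N → NZ.Σ< N (λ j → t j n) ≡ XZ.Σ< N t n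
    pointwise zero = refl
    pointwise (suc N) = cong (ℤ._+ t N n) (pointwise N)

  Lam₃ Lam₄ : PZ.Series
  Lam₃ = PZ.limit (λ N → XZ.Σ< N (λ j → PZ.C (leg5 (suc j)) CZ.* LZ.Λ (+ 1) (suc j)))
  Lam₄ = LZ.Double.rows (λ m → leg5 m ℤ.* + m)

  O-Lam₃ : ∀ j → PZ.O (suc j) (PZ.C (leg5 (suc j)) CZ.* LZ.Λ (+ 1) (suc j))
  O-Lam₃ j = PZ.O-*ˡ (PZ.C (leg5 (suc j))) {LZ.Λ (+ 1) (suc j)} (LZ.O-Λ (+ 1) j)

  Lam₃-Defs : sumInf (λ j → leg5 j · (mono j ⊛ inv ((oneP ⊖ mono j) ^P 2))) ≋ Lam₃
  Lam₃-Defs = sumInf-limit (λ j → leg5 j · (mono j ⊛ inv ((oneP ⊖ mono j) ^P 2))) (λ j → PZ.C (leg5 (suc j)) CZ.* LZ.Λ (+ 1) (suc j))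
    (λ j n → trans (cong (leg5 (suc j) ℤ.*_) (lambert-Λ j n)) (sym (PZ.C-conv (leg5 (suc j)) (LZ.Λ (+ 1) (suc j)) n))) O-Lam₃

  Lam₄-Defs : sumInf (λ j → (leg5 j ℤ.* + j) · (mono j ⊛ inv (oneP ⊖ mono j))) ≋ Lam₄
  Lam₄-Defs = sumInf-limit (λ j → (leg5 j ℤ.* + j) · (mono j ⊛ inv (oneP ⊖ mono j))) (LZ.Double.row (λ m → leg5 m ℤ.* + m))
    (λ j n → trans (cong ((leg5 (suc j) ℤ.* + suc j) ℤ.*_) (lambert-Γ j n)) (sym (PZ.C-conv (leg5 (suc j) ℤ.* + suc j) (LZ.Γ (suc j)) n)))
    (λ j → PZ.O-*ˡ (PZ.C (leg5 (suc j) ℤ.* + suc j)) {LZ.Γ (suc j)} (LZ.O-Γ j))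

  Lim-Lam₃ : PZ.Lim (λ N → XZ.Σ< N (λ j → PZ.C (leg5 (suc j)) CZ.* LZ.Λ (+ 1) (suc j))) Lam₃
  Lim-Lam₃ = LZ.Lim-Σ {λ j → PZ.C (leg5 (suc j)) CZ.* LZ.Λ (+ 1) (suc j)} (λ j → PZ.O-weaken {f = PZ.C (leg5 (suc j)) CZ.* LZ.Λ (+ 1) (suc j)} (ℕP.n≤1+n j) (O-Lam₃ j))

  residueSum : ℕ → PZ.Series
  residueSum r = PZ.limit (λ N → XZ.Σ< N (λ j → LZ.Λ (+ 1) (r ℕ.+ j ℕ.* 5)))

  Lim-residueSum : ∀ r → PZ.Lim (λ N → XZ.Σ< N (λ j → LZ.Λ (+ 1) (suc r ℕ.+ j ℕ.* 5))) (residueSum (suc r))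
  Lim-residueSum r = LZ.Lim-Σ {λ j → LZ.Λ (+ 1) (suc r ℕ.+ j ℕ.* 5)} (λ j → PZ.O-weaken {f = LZ.Λ (+ 1) (suc r ℕ.+ j ℕ.* 5)}
    (ℕP.≤-trans (ℕP.m≤m*n j 5) (ℕP.m≤n+m (j ℕ.* 5) (suc r))) (LZ.O-Λ (+ 1) (r ℕ.+ j ℕ.* 5)))

  leg5-residue : ∀ r j → leg5 (j ℕ.* 5 ℕ.+ r) ≡ leg5 r
  leg5-residue r zero = refl
  leg5-residue r (suc j) = leg5-residue r j

  Lam₃-residues : Lam₃ ≋ (residueSum 1 CZ.+ residueSum 4) CZ.- (residueSum 2 CZ.+ residueSum 3)
  Lam₃-residues = PZ.Lim-unique (PZ.Lim-cong (λ N → XZ.Σ<-5 N _) (PZ.Lim-sub (ℕ._* 5) (λ N → ℕP.m≤m*n N 5) Lim-Lam₃))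
    (PZ.Lim-cong collect (PZ.Lim-≈ (XZ.solve 4 (λ a b c d → (a XZ.:+ d) XZ.:+ (XZ.:- XZ.con (+ 1)) XZ.:* (b XZ.:+ c) XZ.:= (a XZ.:+ d) XZ.:- (b XZ.:+ c)) CZ.refl (residueSum 1) (residueSum 2) (residueSum 3) (residueSum 4))
      (PZ.Lim-+ (PZ.Lim-+ (Lim-residueSum 0) (Lim-residueSum 3)) (PZ.Lim-* (PZ.Lim-const (CZ.- CZ.1#)) (PZ.Lim-+ (Lim-residueSum 1) (Lim-residueSum 2))))))
    where
    Λ₁ : ℕ → ℕ → PZ.Series
    Λ₁ r j = LZ.Λ (+ 1) (suc r ℕ.+ j ℕ.* 5)
    term : ℕ → ℕ → PZ.Series
    term r j = PZ.C (leg5 (suc r ℕ.+ j ℕ.* 5)) CZ.* Λ₁ r j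
    value : ∀ r j c → leg5 (suc r) ≡ c → term r j ≋ PZ.C c CZ.* Λ₁ r j
    value r j c e = CZ.*-congʳ (PZ.C-cong (trans (cong leg5 (ℕP.+-comm (suc r) (j ℕ.* 5))) (trans (leg5-residue (suc r) j) e)))
    minus-one : PZ.C -[1+ 0 ] ≋ CZ.- CZ.1#
    minus-one = CZ.sym (PZ.mon-neg (+ 1) 0)
    one-step : ∀ j → term 0 j CZ.+ term 1 j CZ.+ term 2 j CZ.+ term 3 j CZ.+ term 4 j ≋ (Λ₁ 0 j CZ.+ Λ₁ 3 j) CZ.+ (CZ.- CZ.1#) CZ.* (Λ₁ 1 j CZ.+ Λ₁ 2 j)
    one-step j = CZ.trans (CZ.+-cong (CZ.+-cong (CZ.+-cong (CZ.+-cong (value 0 j (+ 1) refl) (CZ.trans (value 1 j -[1+ 0 ] refl) (CZ.*-congʳ minus-one)))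
        (CZ.trans (value 2 j -[1+ 0 ] refl) (CZ.*-congʳ minus-one))) (value 3 j (+ 1) refl)) (CZ.trans (value 4 j (+ 0) refl) (CZ.*-congʳ (PZ.mon-zero 0))))
      (XZ.solve 5 (λ a b c d e → XZ.con (+ 1) XZ.:* a XZ.:+ (XZ.:- XZ.con (+ 1)) XZ.:* b XZ.:+ (XZ.:- XZ.con (+ 1)) XZ.:* c XZ.:+ XZ.con (+ 1) XZ.:* d XZ.:+ XZ.con (+ 0) XZ.:* e
        XZ.:= (a XZ.:+ d) XZ.:+ (XZ.:- XZ.con (+ 1)) XZ.:* (b XZ.:+ c)) CZ.refl (Λ₁ 0 j) (Λ₁ 1 j) (Λ₁ 2 j) (Λ₁ 3 j) (Λ₁ 4 j))
    collect : ∀ N → (XZ.Σ< N (Λ₁ 0) CZ.+ XZ.Σ< N (Λ₁ 3)) CZ.+ (CZ.- CZ.1#) CZ.* (XZ.Σ< N (Λ₁ 1) CZ.+ XZ.Σ< N (Λ₁ 2))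
      ≋ XZ.Σ< N (λ j → term 0 j CZ.+ term 1 j CZ.+ term 2 j CZ.+ term 3 j CZ.+ term 4 j)
    collect N = CZ.trans (CZ.+-cong (CZ.sym (XZ.Σ<-+ N (Λ₁ 0) (Λ₁ 3))) (CZ.trans (CZ.*-congˡ (CZ.sym (XZ.Σ<-+ N (Λ₁ 1) (Λ₁ 2)))) (CZ.sym (XZ.Σ<-*ˡ N (CZ.- CZ.1#) (λ j → Λ₁ 1 j CZ.+ Λ₁ 2 j)))))
      (CZ.trans (CZ.sym (XZ.Σ<-+ N (λ j → Λ₁ 0 j CZ.+ Λ₁ 3 j) (λ j → (CZ.- CZ.1#) CZ.* (Λ₁ 1 j CZ.+ Λ₁ 2 j)))) (XZ.Σ<-cong N (λ j _ → CZ.sym (one-step j))))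

  Λ-coeff : ∀ a N → LZ.Λ (+ 1) (suc a) N ≡ NZ.Σ< (suc N) (λ r → LZ.ΛTerm (+ 1) (suc a) r N)
  Λ-coeff a N = go (suc N)
    where
    go : ∀ M → XZ.Σ< M (LZ.ΛTerm (+ 1) (suc a)) N ≡ NZ.Σ< M (λ r → LZ.ΛTerm (+ 1) (suc a) r N)
    go zero = refl
    go (suc M) = cong (ℤ._+ LZ.ΛTerm (+ 1) (suc a) M N) (go M)

  Λ-multiple : ∀ a k → LZ.Λ (+ 1) (suc a) (suc k ℕ.* suc a) ≡ + suc k
  Λ-multiple a k = trans (Λ-coeff a (suc k ℕ.* suc a)) (trans
    (NZ.Σ<-point (suc (suc k ℕ.* suc a)) k (ℕ.s≤s (ℕP.≤-trans (ℕP.n≤1+n k) (ℕP.m≤m*n (suc k) (suc a))))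
      (λ r r≢k → PZ.mon-diff _ (suc r ℕ.* suc a) (suc k ℕ.* suc a) (λ e → r≢k (ℕP.suc-injective (sym (ℕP.*-cancelʳ-≡ (suc k) (suc r) (suc a) e))))))
    (trans (PZ.mon-same _ (suc k ℕ.* suc a)) (trans (cong₂ ℤ._*_ (intR-id (+ suc k)) (one^ (suc k))) (ℤP.*-identityʳ (+ suc k)))))
    where
    one^ : ∀ n → (+ 1) NZ.^ n ≡ + 1
    one^ zero = refl
    one^ (suc n) = trans (ℤP.*-identityˡ _) (one^ n)

  Λ-nonmultiple : ∀ a N → (∀ r → N ≢ suc r ℕ.* suc a) → LZ.Λ (+ 1) (suc a) N ≡ + 0
  Λ-nonmultiple a N h = trans (Λ-coeff a N) (NZ.Σ<-zero (suc N) (λ r _ → PZ.mon-diff _ (suc r ℕ.* suc a) N (h r)))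

  5-prime : Prime 5
  5-prime = from-yes (prime? 5)

  coprime-5 : ∀ a → ¬ (5 ∣ a) → Coprime a 5
  coprime-5 a ¬5 {d} (d∣a , d∣5) with prime⇒irreducible 5-prime d∣5
  ... | inj₁ d≡1 = d≡1
  ... | inj₂ d≡5 = contradiction (≡.subst (_∣ a) d≡5 d∣a) ¬5

  -- The coefficient at a multiple of suc a is the quotient, at any other index it is 0. A number
  -- prime to 5 divides 5 n exactly when it divides n, and then the quotient grows by the factor 5.
  Λ-5 : ∀ a n → ¬ (5 ∣ suc a) → LZ.Λ (+ 1) (suc a) (n ℕ.* 5) ≡ + 5 ℤ.* LZ.Λ (+ 1) (suc a) n
  Λ-5 a n ¬5 with suc a ℕV.∣? n
  ... | yes (divides zero refl) = trans (Λ-nonmultiple a 0 (λ r ())) (cong (λ z → + 5 ℤ.* z) (sym (Λ-nonmultiple a 0 (λ r ()))))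
  ... | yes (divides (suc k) refl) = trans (cong (LZ.Λ (+ 1) (suc a)) rearrange)
      (trans (Λ-multiple a (4 ℕ.+ k ℕ.* 5)) (trans (cong +_ (ℕP.*-comm (suc k) 5)) (trans (ℤP.pos-* 5 (suc k)) (cong (λ z → + 5 ℤ.* z) (sym (Λ-multiple a k))))))
    where
    rearrange : (suc k ℕ.* suc a) ℕ.* 5 ≡ (suc k ℕ.* 5) ℕ.* suc a
    rearrange = trans (ℕP.*-assoc (suc k) (suc a) 5) (trans (cong (suc k ℕ.*_) (ℕP.*-comm (suc a) 5)) (sym (ℕP.*-assoc (suc k) 5 (suc a))))
  ... | no ∤n = trans (Λ-nonmultiple a (n ℕ.* 5) (λ r e → ∤n (coprime-divisor (coprime-5 (suc a) ¬5) (divides (suc r) (trans (ℕP.*-comm 5 n) e)))))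
      (cong (λ z → + 5 ℤ.* z) (sym (Λ-nonmultiple a n (λ r e → ∤n (divides (suc r) e)))))

  every5 : PZ.Series → PZ.Series
  every5 f n = f (n ℕ.* 5)

  leg5-multiple : ∀ a → 5 ∣ a → leg5 a ≡ + 0
  leg5-multiple a (divides k refl) = trans (cong leg5 (sym (ℕP.+-identityʳ (k ℕ.* 5)))) (leg5-residue 0 k)

  -- An eigenvalue of the Hecke type: indices divisible by 5 have Legendre symbol 0, and all others
  -- scale by `Λ-5`.
  every5-Lam₃ : every5 Lam₃ ≋ XZ.intR (+ 5) CZ.* Lam₃
  every5-Lam₃ n = trans (at (n ℕ.* 5) ℕP.≤-refl) (trans (go (suc (n ℕ.* 5)))
    (trans (sym (cong (λ z → + 5 ℤ.* z) (at n (ℕP.m≤m*n n 5)))) (·-C (+ 5) Lam₃ n)))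
    where
    t : ℕ → PZ.Series
    t j = PZ.C (leg5 (suc j)) CZ.* LZ.Λ (+ 1) (suc j)
    at : ∀ i → i ℕ.≤ n ℕ.* 5 → Lam₃ i ≡ XZ.Σ< (suc (n ℕ.* 5)) t i
    at i i≤ = LZ.limit-at {λ N → XZ.Σ< N t} (λ N → PZ.tr (PZ.+-≈⟨⟩ {f = XZ.Σ< N t} (PZ.≈⇒ CZ.refl)
      (PZ.O-weaken {f = t N} (ℕP.n≤1+n N) (O-Lam₃ N))) (PZ.≈⇒ (CZ.+-identityʳ _))) (ℕ.s≤s i≤)
    term : ∀ j → t j (n ℕ.* 5) ≡ + 5 ℤ.* t j n
    term j = trans (PZ.C-conv (leg5 (suc j)) (LZ.Λ (+ 1) (suc j)) (n ℕ.* 5)) (trans (by-divisor (5 ℕV.∣? suc j))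
      (trans (swap (leg5 (suc j)) (LZ.Λ (+ 1) (suc j) n)) (cong (λ z → + 5 ℤ.* z) (sym (PZ.C-conv (leg5 (suc j)) (LZ.Λ (+ 1) (suc j)) n)))))
      where
      swap : ∀ a b → a ℤ.* (+ 5 ℤ.* b) ≡ + 5 ℤ.* (a ℤ.* b)
      swap = ℤS.solve-∀
      by-divisor : Dec (5 ∣ suc j) → leg5 (suc j) ℤ.* LZ.Λ (+ 1) (suc j) (n ℕ.* 5) ≡ leg5 (suc j) ℤ.* (+ 5 ℤ.* LZ.Λ (+ 1) (suc j) n)
      by-divisor (no ¬5) = cong (leg5 (suc j) ℤ.*_) (Λ-5 j n ¬5)
      by-divisor (yes 5∣) = trans (cong (ℤ._* LZ.Λ (+ 1) (suc j) (n ℕ.* 5)) (leg5-multiple (suc j) 5∣))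
        (sym (cong (ℤ._* (+ 5 ℤ.* LZ.Λ (+ 1) (suc j) n)) (leg5-multiple (suc j) 5∣)))
    go : ∀ M → XZ.Σ< M t (n ℕ.* 5) ≡ + 5 ℤ.* XZ.Σ< M t n
    go zero = refl
    go (suc M) = trans (cong₂ ℤ._+_ (go M) (term M)) (sym (ℤP.*-distribˡ-+ (+ 5) (XZ.Σ< M t n) (t M n)))

  -- The substitution q ↦ q⁵, over whose image `every5` is linear.
  module E = Substitution ℤring ℤring constHom (PZ.mon (+ 1) 5) (PZ.O-weaken {f = PZ.mon (+ 1) 5} (ℕ.s≤s ℕ.z≤n) (PZ.O-mon (+ 1) 5))
  module EX = HomX E.evHom

  module Δ5 = E.Extraction every5 (λ p n → p (n ℕ.* 5)) (λ _ _ _ → refl) (λ c f n → PZ.C-conv c f (n ℕ.* 5))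
    (λ f → PZ.mon-below (+ 1) 5 f 0 (ℕ.s≤s ℕ.z≤n)) (λ f n → trans (PZ.mon-shift (+ 1) 5 f (n ℕ.* 5)) (ℤP.*-identityˡ _))

  ev-Q : E.ev (QZ 1) ≋ QZ 5
  ev-Q = PZ.Lim-unique (E.ev-Lim (Lim-QZ 0)) (PZ.Lim-cong (λ N → CZ.sym (CZ.trans (EX.hom-Π N (qFactorZ 1)) (XZ.Π<-cong N factor))) (Lim-QZ 4))
    where
    one^ : ∀ n → (+ 1) NZ.^ n ≡ + 1
    one^ zero = refl
    one^ (suc n) = trans (ℤP.*-identityˡ _) (one^ n)
    factor : ∀ j → E.ev (qFactorZ 1 j) ≋ qFactorZ 5 j
    factor j = CZ.trans (EX.hom-sub CZ.1# (PZ.mon (+ 1) (1 ℕ.* suc j))) (CZ.+-cong (RingHom.hom-1 E.evHom) (CZ.-‿cong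
      (CZ.trans (E.ev-mon (+ 1) (1 ℕ.* suc j)) (CZ.trans (CZ.*-identityˡ _) (CZ.trans (PZ.mon-^ (+ 1) 5 (1 ℕ.* suc j))
        (CZ.trans (PZ.mon-cong ((1 ℕ.* suc j) ℕ.* 5) (one^ (1 ℕ.* suc j))) (PZ.mon-≡ (+ 1) (trans (cong (ℕ._* 5) (ℕP.*-identityˡ (suc j))) (ℕP.*-comm (suc j) 5)))))))))

  partitionSeries : PZ.Series
  partitionSeries n = + p n

  every5-partitions : every5 (PZ.mon (+ 1) 1 CZ.* partitionSeries) ≋ pSeries
  every5-partitions zero = refl
  every5-partitions (suc j) = trans (PZ.mon-shift (+ 1) 1 partitionSeries (4 ℕ.+ j ℕ.* 5)) (trans (ℤP.*-identityˡ _)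
    (cong (λ m → + p (m ℕ.∸ 1)) (ℕP.*-comm (suc j) 5)))

-- Descent to ℤ and the three evaluations.

module Final (U : CommutativeRing 0ℓ 0ℓ) (root : Cyclo.FifthRoot U) (dual : Cyclo.DualUnit U)
  (κ : CommutativeRing.Carrier U → ℤ)
  (κ-cong : ∀ {x y} → CommutativeRing._≈_ U x y → κ x ≡ κ y)
  (κ-+ : ∀ x y → κ (CommutativeRing._+_ U x y) ≡ κ x ℤ.+ κ y)
  (κ-δ : κ (Cyclo.DualUnit.δ dual) ≡ + 1) where
  open import Algebra.Properties.AbelianGroup ℤP.+-0-abelianGroup using (∙-cancelʳ)
  open Ev
  open DefsZ
  open Cyclo.FifthRoot root using (ζ; Φ₅)
  open Cyclo.DualUnit dual using (δ)
  open Frob U root using (module UR; module UX; module P1; module C1; module X1; module T1; module C2; module X2; Q; q; G; G-product; H; H-product; Θ-product; theta-A₄; cφ-diag; partitions-product; diag; ζ⁵)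
  open Eis U root dual using (δ̂; module Level5; module Level1)
  open PZ using (_≋_)
  private module LU = Lambert U

  î : RingHom PZ.psRing P1.psRing
  î = Coefficientwise.mapHom (intHom U)

  module î = RingHom î
  module îX = HomX î
  module îC = Coefficientwise (intHom U)

  κ-0 : κ UR.0# ≡ + 0
  κ-0 = ∙-cancelʳ (κ UR.0#) (κ UR.0#) (+ 0) (≡.trans (≡.sym (κ-+ UR.0# UR.0#)) (≡.trans (κ-cong (UR.+-identityˡ _)) (≡.sym (ℤP.+-identityˡ _))))

  κ-neg : ∀ x → κ (UR.- x) ≡ ℤ.- κ x
  κ-neg x = ∙-cancelʳ (κ x) (κ (UR.- x)) (ℤ.- κ x) (≡.trans (≡.sym (κ-+ (UR.- x) x)) (≡.trans (κ-cong (UR.-‿inverseˡ x)) (≡.trans κ-0 (≡.sym (ℤP.+-inverseˡ (κ x))))))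

  κ-δ* : ∀ i → κ (δ UR.* UX.intR i) ≡ i
  κ-δ* (+ n) = nat n
    where
    nat : ∀ n → κ (δ UR.* UX.intR (+ n)) ≡ + n
    nat zero = ≡.trans (κ-cong (UR.zeroʳ δ)) κ-0
    nat (suc n) = ≡.trans (κ-cong (UR.trans (UR.*-congˡ (UX.intR-+ (+ 1) (+ n))) (UR.trans (UR.distribˡ _ _ _) (UR.+-congʳ (UR.*-identityʳ δ)))))
      (≡.trans (κ-+ δ _) (≡.cong₂ ℤ._+_ κ-δ (nat n)))
  κ-δ* -[1+ n ] = ≡.trans (κ-cong (UR.trans (UR.*-congˡ (UX.intR-neg (+ suc n))) (UX.solve 2 (λ d x → d UX.:* (UX.:- x) UX.:= UX.:- (d UX.:* x)) UR.refl δ _)))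
    (≡.trans (κ-neg _) (≡.cong ℤ.-_ (κ-δ* (+ suc n))))

  -- Identities between integral series may be checked after multiplication by δ in U.
  descend : ∀ {f g} → δ̂ C1.* î.⟦ f ⟧ C1.≈ δ̂ C1.* î.⟦ g ⟧ → f ≋ g
  descend {f} {g} e n = ≡.trans (≡.sym (κ-δ* (f n))) (≡.trans (κ-cong (UR.trans (UR.sym (P1.C-conv δ î.⟦ f ⟧ n)) (UR.trans (e n) (P1.C-conv δ î.⟦ g ⟧ n)))) (κ-δ* (g n)))

  descend₁ : ∀ {f g} → î.⟦ f ⟧ C1.≈ î.⟦ g ⟧ → f ≋ g
  descend₁ e = descend (C1.*-congˡ e)

  î-mon : ∀ k → î.⟦ PZ.mon (+ 1) k ⟧ C1.≈ P1.mon UR.1# k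
  î-mon = îC.mapPS-mon (+ 1)

  î-Q : ∀ m → î.⟦ QZ m ⟧ C1.≈ Q m
  î-Q m n = C1.trans (îX.hom-Π (suc n) (qFactorZ m)) (X1.Π<-cong (suc n) (λ j → C1.trans (îX.hom-sub CZ.1# (PZ.mon (+ 1) (m ℕ.* suc j)))
    (C1.+-cong î.hom-1 (C1.-‿cong (î-mon (m ℕ.* suc j)))))) n

  î-* : ∀ f g {a b} → î.⟦ f ⟧ C1.≈ a → î.⟦ g ⟧ C1.≈ b → î.⟦ f CZ.* g ⟧ C1.≈ a C1.* b
  î-* f g p r = C1.trans (î.hom-* f g) (C1.*-cong p r)

  î-+ : ∀ f g {a b} → î.⟦ f ⟧ C1.≈ a → î.⟦ g ⟧ C1.≈ b → î.⟦ f CZ.+ g ⟧ C1.≈ a C1.+ b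
  î-+ f g p r = C1.trans (î.hom-+ f g) (C1.+-cong p r)

  î-^ : ∀ f k {a} → î.⟦ f ⟧ C1.≈ a → î.⟦ f XZ.^ k ⟧ C1.≈ a X1.^ k
  î-^ f k p = C1.trans (îX.hom-^ f k) (X1.^-congˡ k p)

  partitionsZ : partitionSeries CZ.* QZ 1 ≋ CZ.1#
  partitionsZ = descend₁ (C1.trans (î-* partitionSeries (QZ 1) C1.refl (î-Q 1)) (C1.trans partitions-product (C1.sym î.hom-1)))

  qZ : PZ.Series
  qZ = PZ.mon (+ 1) 1

  -- All denominators are cleared: (q; q)⁵ turns the generating function into the theta series of
  -- A₄, then (q⁵; q⁵) disposes of H and the remaining (q; q) of G.
  frobeniusZ : CΦ 5 CZ.* (QZ 1 XZ.^ 6 CZ.* QZ 5) ≋ QZ 1 XZ.^ 6 CZ.+ XZ.intR (+ 25) CZ.* (qZ CZ.* QZ 5 XZ.^ 6)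
  frobeniusZ = descend₁ (C1.trans lhs (C1.trans middle (C1.sym rhs)))
    where
    c : P1.Series
    c = diag ((T1.X C2.* T1.Y) X2.^ 5)
    lhs : î.⟦ CΦ 5 CZ.* (QZ 1 XZ.^ 6 CZ.* QZ 5) ⟧ C1.≈ c C1.* (Q 1 X1.^ 6 C1.* Q 5)
    lhs = î-* (CΦ 5) _ (λ n → UR.sym (cφ-diag 5 n)) (î-* (QZ 1 XZ.^ 6) (QZ 5) (î-^ (QZ 1) 6 (î-Q 1)) (î-Q 5))
    rhs : î.⟦ QZ 1 XZ.^ 6 CZ.+ XZ.intR (+ 25) CZ.* (qZ CZ.* QZ 5 XZ.^ 6) ⟧ C1.≈ Q 1 X1.^ 6 C1.+ X1.intR (+ 25) C1.* (q C1.* Q 5 X1.^ 6)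
    rhs = î-+ (QZ 1 XZ.^ 6) _ (î-^ (QZ 1) 6 (î-Q 1)) (î-* (XZ.intR (+ 25)) (qZ CZ.* QZ 5 XZ.^ 6) (îX.hom-intR (+ 25)) (î-* qZ (QZ 5 XZ.^ 6) (î-mon 1) (î-^ (QZ 5) 6 (î-Q 5))))
    middle : c C1.* (Q 1 X1.^ 6 C1.* Q 5) C1.≈ Q 1 X1.^ 6 C1.+ X1.intR (+ 25) C1.* (q C1.* Q 5 X1.^ 6)
    middle = C1.trans (X1.solve 3 (λ c a b → c X1.:* (a X1.:^ 6 X1.:* b) X1.:= (c X1.:* a X1.:^ 5) X1.:* (a X1.:* b)) C1.refl c (Q 1) (Q 5))
      (C1.trans (C1.*-congʳ (C1.trans Θ-product theta-A₄))
        (C1.trans (X1.solve 5 (λ h g q a b → (h X1.:+ X1.con (+ 25) X1.:* (q X1.:* g)) X1.:* (a X1.:* b) X1.:= (h X1.:* b) X1.:* a X1.:+ X1.con (+ 25) X1.:* (q X1.:* ((g X1.:* a) X1.:* b))) C1.refl H G q (Q 1) (Q 5))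
          (C1.trans (C1.+-cong (C1.*-congʳ H-product) (C1.*-congˡ (C1.*-congˡ (C1.*-congʳ G-product))))
            (X1.solve 3 (λ q a b → a X1.:^ 5 X1.:* a X1.:+ X1.con (+ 25) X1.:* (q X1.:* (b X1.:^ 5 X1.:* b)) X1.:= a X1.:^ 6 X1.:+ X1.con (+ 25) X1.:* (q X1.:* b X1.:^ 6)) C1.refl q (Q 1) (Q 5)))))

  inv-î : ∀ m → QZ m 0 ≡ + 1 → Q m C1.* î.⟦ inv (QZ m) ⟧ C1.≈ C1.1#
  inv-î m e = C1.trans (C1.*-congʳ (C1.sym (î-Q m))) (C1.trans (C1.sym (î.hom-* (QZ m) (inv (QZ m)))) (C1.trans (î.cong (inv-inverse (QZ m) e)) î.hom-1))

  inv₁ : Q 1 C1.* î.⟦ inv (QZ 1) ⟧ C1.≈ C1.1#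
  inv₁ = inv-î 1 ≡.refl

  inv₅ : Q 5 C1.* î.⟦ inv (QZ 5) ⟧ C1.≈ C1.1#
  inv₅ = inv-î 5 ≡.refl

  one^ : ∀ n → (+ 1) NZ.^ n ≡ + 1
  one^ zero = ≡.refl
  one^ (suc n) = ≡.trans (ℤP.*-identityˡ _) (one^ n)

  one^U : ∀ n → UR.1# UX.^ n UR.≈ UR.1#
  one^U zero = UR.refl
  one^U (suc n) = UR.trans (UR.*-identityˡ _) (one^U n)

  î-Λ : ∀ k → î.⟦ LZ.Λ (+ 1) k ⟧ C1.≈ LU.Λ UR.1# k
  î-Λ k n = C1.trans (îX.hom-Σ (suc n) (LZ.ΛTerm (+ 1) k)) (X1.Σ<-cong (suc n) (λ r _ → C1.trans (îC.mapPS-mon _ (suc r ℕ.* k))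
    (P1.mon-cong (suc r ℕ.* k) (UR.trans (UX.intR-* (NZ.intR (+ suc r)) ((+ 1) NZ.^ suc r))
      (UR.*-cong (UR.reflexive (≡.cong UX.intR (intR-id (+ suc r)))) (UR.trans (UR.reflexive (≡.cong UX.intR (one^ (suc r)))) (UR.sym (one^U (suc r))))))))) n

  eisenstein₅ : Lam₃ CZ.* QZ 1 ≋ qZ CZ.* QZ 5 XZ.^ 5
  eisenstein₅ = CZ.trans (CZ.*-congʳ Lam₃-residues) (descend (C1.sym (C1.trans (C1.*-congˡ (î-* qZ (QZ 5 XZ.^ 5) (î-mon 1) (î-^ (QZ 5) 5 (î-Q 5))))
    (C1.trans (L5.eisenstein) (C1.*-congˡ (C1.sym (î-* T (QZ 1) T-eq (î-Q 1))))))))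
    where
    S : ℕ → P1.Series
    S r = î.⟦ residueSum r ⟧
    lim-S : ∀ r → P1.Lim (λ N → X1.Σ< N (λ j → LU.Λ UR.1# (suc r ℕ.+ j ℕ.* 5))) (S (suc r))
    lim-S r = P1.Lim-cong (λ N → C1.trans (îX.hom-Σ N (λ j → LZ.Λ (+ 1) (suc r ℕ.+ j ℕ.* 5))) (X1.Σ<-cong N (λ j _ → î-Λ (suc r ℕ.+ j ℕ.* 5)))) (îC.mapPS-Lim (Lim-residueSum r))
    module L5 = Level5 inv₁ inv₅ S lim-S
    T : PZ.Series
    T = (residueSum 1 CZ.+ residueSum 4) CZ.- (residueSum 2 CZ.+ residueSum 3)
    T-eq : î.⟦ T ⟧ C1.≈ (S 1 C1.+ S 4) C1.- (S 2 C1.+ S 3)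
    T-eq = C1.trans (îX.hom-sub (residueSum 1 CZ.+ residueSum 4) (residueSum 2 CZ.+ residueSum 3))
      (C1.+-cong (î.hom-+ (residueSum 1) (residueSum 4)) (C1.-‿cong (î.hom-+ (residueSum 2) (residueSum 3))))

  -- The Gauss sum ζᵐ + ζ⁴ᵐ − ζ²ᵐ − ζ³ᵐ = (m/5) √5
  √5 : UR.Carrier
  √5 = (ζ UX.^ 1 UR.+ ζ UX.^ 4) UR.- (ζ UX.^ 2 UR.+ ζ UX.^ 3)

  private
    vanish : ∀ a b → a UR.+ (ζ UX.^ 5 UR.- UR.1#) UR.* b UR.≈ a
    vanish a b = UR.trans (UR.+-congˡ (UR.trans (UR.*-congʳ (UR.trans (UR.+-congʳ ζ⁵) (UR.-‿inverseʳ UR.1#))) (UR.zeroˡ b))) (UR.+-identityʳ a)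

  gauss-sum : ∀ m → ((ζ UX.^ 1) UX.^ m UR.+ (ζ UX.^ 4) UX.^ m) UR.- ((ζ UX.^ 2) UX.^ m UR.+ (ζ UX.^ 3) UX.^ m) UR.≈ √5 UR.* UX.intR (leg5 m)
  gauss-sum 0 = UX.solve 1 (λ z → ((z UX.:^ 1) UX.:^ 0 UX.:+ (z UX.:^ 4) UX.:^ 0) UX.:- ((z UX.:^ 2) UX.:^ 0 UX.:+ (z UX.:^ 3) UX.:^ 0)
    UX.:= ((z UX.:^ 1 UX.:+ z UX.:^ 4) UX.:- (z UX.:^ 2 UX.:+ z UX.:^ 3)) UX.:* UX.con (+ 0)) UR.refl ζ
  gauss-sum 1 = UX.solve 1 (λ z → ((z UX.:^ 1) UX.:^ 1 UX.:+ (z UX.:^ 4) UX.:^ 1) UX.:- ((z UX.:^ 2) UX.:^ 1 UX.:+ (z UX.:^ 3) UX.:^ 1)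
    UX.:= ((z UX.:^ 1 UX.:+ z UX.:^ 4) UX.:- (z UX.:^ 2 UX.:+ z UX.:^ 3)) UX.:* UX.con (+ 1)) UR.refl ζ
  -- The cofactor of z⁵ - 1, here and in the next two cases, records the reduction of exponents
  -- modulo 5.
  gauss-sum 2 = UR.trans (UX.solve 1 (λ z → ((z UX.:^ 1) UX.:^ 2 UX.:+ (z UX.:^ 4) UX.:^ 2) UX.:- ((z UX.:^ 2) UX.:^ 2 UX.:+ (z UX.:^ 3) UX.:^ 2)
      UX.:= ((z UX.:^ 1 UX.:+ z UX.:^ 4) UX.:- (z UX.:^ 2 UX.:+ z UX.:^ 3)) UX.:* UX.con -[1+ 0 ] UX.:+ (z UX.:^ 5 UX.:- UX.con (+ 1)) UX.:* (z UX.:^ 3 UX.:- z)) UR.refl ζ)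
    (vanish _ _)
  gauss-sum 3 = UR.trans (UX.solve 1 (λ z → ((z UX.:^ 1) UX.:^ 3 UX.:+ (z UX.:^ 4) UX.:^ 3) UX.:- ((z UX.:^ 2) UX.:^ 3 UX.:+ (z UX.:^ 3) UX.:^ 3)
      UX.:= ((z UX.:^ 1 UX.:+ z UX.:^ 4) UX.:- (z UX.:^ 2 UX.:+ z UX.:^ 3)) UX.:* UX.con -[1+ 0 ] UX.:+ (z UX.:^ 5 UX.:- UX.con (+ 1)) UX.:* (z UX.:^ 7 UX.:+ z UX.:^ 2 UX.:- z UX.:- z UX.:^ 4)) UR.refl ζ)
    (vanish _ _)
  gauss-sum 4 = UR.trans (UX.solve 1 (λ z → ((z UX.:^ 1) UX.:^ 4 UX.:+ (z UX.:^ 4) UX.:^ 4) UX.:- ((z UX.:^ 2) UX.:^ 4 UX.:+ (z UX.:^ 3) UX.:^ 4)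
      UX.:= ((z UX.:^ 1 UX.:+ z UX.:^ 4) UX.:- (z UX.:^ 2 UX.:+ z UX.:^ 3)) UX.:* UX.con (+ 1) UX.:+ (z UX.:^ 5 UX.:- UX.con (+ 1)) UX.:* (z UX.:^ 11 UX.:+ z UX.:^ 6 UX.:+ z UX.:- z UX.:^ 3 UX.:- z UX.:^ 7 UX.:- z UX.:^ 2)) UR.refl ζ)
    (vanish _ _)
  gauss-sum (suc (suc (suc (suc (suc m))))) = UR.trans (UR.+-cong (UR.+-cong (reduce 1) (reduce 4)) (UR.-‿cong (UR.+-cong (reduce 2) (reduce 3)))) (gauss-sum m)
    where
    reduce : ∀ i → (ζ UX.^ i) UX.^ (5 ℕ.+ m) UR.≈ (ζ UX.^ i) UX.^ m
    reduce i = UR.trans (UX.^-homo-* (ζ UX.^ i) 5 m) (UR.trans (UR.*-congʳ (UR.trans (UX.^-assocʳ ζ i 5)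
      (UR.trans (UR.reflexive (≡.cong (ζ UX.^_) (ℕP.*-comm i 5))) (UR.trans (UR.sym (UX.^-assocʳ ζ 5 i)) (UR.trans (UX.^-congˡ i ζ⁵) (one^U i)))))) (UR.*-identityˡ _))

  private
    C₁ : UR.Carrier → P1.Series
    C₁ = P1.C
    C-* : ∀ a b → C₁ a C1.* C₁ b C1.≈ C₁ (a UR.* b)
    C-* a b = P1.mon-* a 0 b 0
    C-sub : ∀ a b → C₁ a C1.- C₁ b C1.≈ C₁ (a UR.- b)
    C-sub a b = C1.trans (C1.+-congˡ (P1.mon-neg b 0)) (LU.C-+ a (UR.- b))

  module Weighted where
    S : ℕ → P1.Series
    S i = P1.limit (λ N → X1.Σ< N (λ j → LU.Λ (ζ UX.^ i) (suc j)))

    lim-S : ∀ i → P1.Lim (λ N → X1.Σ< N (λ j → LU.Λ (ζ UX.^ i) (suc j))) (S i)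
    lim-S i = LU.Lim-Σ {λ j → LU.Λ (ζ UX.^ i) (suc j)} (λ j → P1.O-weaken {f = LU.Λ (ζ UX.^ i) (suc j)} (ℕP.n≤1+n j) (LU.O-Λ (ζ UX.^ i) j))

    a : ℕ → ℕ → UR.Carrier
    a i m = UX.intR (+ m) UR.* (ζ UX.^ i) UX.^ m

    b : ℕ → UR.Carrier
    b m = UX.intR (leg5 m ℤ.* + m)

    private
      combine : ∀ N c {f₁ f₄ f₂ f₃ h : ℕ → P1.Series} →
        (∀ j → (f₁ j C1.+ f₄ j) C1.+ (C1.- C1.1#) C1.* (f₂ j C1.+ f₃ j) C1.≈ c C1.* h j) →
        (X1.Σ< N f₁ C1.+ X1.Σ< N f₄) C1.+ (C1.- C1.1#) C1.* (X1.Σ< N f₂ C1.+ X1.Σ< N f₃) C1.≈ c C1.* X1.Σ< N h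
      combine zero c e = X1.solve 1 (λ c → (X1.con (+ 0) X1.:+ X1.con (+ 0)) X1.:+ (X1.:- X1.con (+ 1)) X1.:* (X1.con (+ 0) X1.:+ X1.con (+ 0)) X1.:= c X1.:* X1.con (+ 0)) C1.refl c
      combine (suc N) c e = C1.trans (X1.solve 8 (λ a b c d a′ b′ c′ d′ → ((a X1.:+ a′) X1.:+ (b X1.:+ b′)) X1.:+ (X1.:- X1.con (+ 1)) X1.:* ((c X1.:+ c′) X1.:+ (d X1.:+ d′))
          X1.:= ((a X1.:+ b) X1.:+ (X1.:- X1.con (+ 1)) X1.:* (c X1.:+ d)) X1.:+ ((a′ X1.:+ b′) X1.:+ (X1.:- X1.con (+ 1)) X1.:* (c′ X1.:+ d′))) C1.refl _ _ _ _ _ _ _ _)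
        (C1.trans (C1.+-cong (combine N c e) (e N)) (C1.sym (C1.distribˡ _ _ _)))

      coefficient : ∀ m → (a 1 m UR.+ a 4 m) UR.+ UR.- UR.1# UR.* (a 2 m UR.+ a 3 m) UR.≈ √5 UR.* b m
      coefficient m = UR.trans (UX.solve 5 (λ n p q r s → (n UX.:* p UX.:+ n UX.:* q) UX.:+ UX.:- UX.con (+ 1) UX.:* (n UX.:* r UX.:+ n UX.:* s)
          UX.:= n UX.:* ((p UX.:+ q) UX.:- (r UX.:+ s))) UR.refl (UX.intR (+ m)) _ _ _ _)
        (UR.trans (UR.*-congˡ (gauss-sum m)) (UR.trans (UX.solve 3 (λ n s l → n UX.:* (s UX.:* l) UX.:= s UX.:* (l UX.:* n)) UR.refl (UX.intR (+ m)) √5 (UX.intR (leg5 m)))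
          (UR.*-congˡ (UR.sym (UX.intR-* (leg5 m) (+ m))))))

      cells : ∀ r j → (LU.Double.cell (a 1) r j C1.+ LU.Double.cell (a 4) r j) C1.+ (C1.- C1.1#) C1.* (LU.Double.cell (a 2) r j C1.+ LU.Double.cell (a 3) r j)
        C1.≈ C₁ √5 C1.* LU.Double.cell b r j
      cells r j = C1.trans (C1.+-cong (P1.mon-+ (a 1 m) (a 4 m) k) (C1.trans (C1.*-cong (P1.mon-neg UR.1# 0) (P1.mon-+ (a 2 m) (a 3 m) k)) (P1.mon-* (UR.- UR.1#) 0 _ k)))
        (C1.trans (P1.mon-+ _ _ k) (C1.trans (P1.mon-cong k (coefficient m)) (C1.sym (P1.mon-* √5 0 (b m) k))))
        where
        m = suc r
        k = suc r ℕ.* suc j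

    T : P1.Series
    T = (S 1 C1.+ S 4) C1.- (S 2 C1.+ S 3)

    -- Each S i is the double series of m ζ^(i m) q^(m j). In the combination T the Gauss sum turns
    -- the coefficient into √5 (m/5) m, and summing over j first gives the second Lambert series.
    T-rows : T C1.≈ C₁ √5 C1.* LU.Double.rows b
    T-rows = P1.Lim-unique
      (P1.Lim-≈ (X1.solve 4 (λ a b c d → (a X1.:+ d) X1.:+ (X1.:- X1.con (+ 1)) X1.:* (b X1.:+ c) X1.:= (a X1.:+ d) X1.:- (b X1.:+ c)) C1.refl (S 1) (S 2) (S 3) (S 4))
        (P1.Lim-+ (P1.Lim-+ (lim 1) (lim 4)) (P1.Lim-* (P1.Lim-const (C1.- C1.1#)) (P1.Lim-+ (lim 2) (lim 3)))))
      (P1.Lim-cong (λ N → C1.sym (combine N (C₁ √5) (λ j → combine N (C₁ √5) (λ r → cells r j)))) (P1.Lim-* (P1.Lim-const (C₁ √5)) (LU.Double.Lim-square b)))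
      where
      lim : ∀ i → P1.Lim (LU.Double.square (a i)) (S i)
      lim i = LU.Lim-ΣΛ (ζ UX.^ i) (lim-S i)

    î-Lam₄ : î.⟦ Lam₄ ⟧ C1.≈ LU.Double.rows b
    î-Lam₄ n = C1.trans (îX.hom-Σ (suc n) (LZ.Double.row (λ m → leg5 m ℤ.* + m))) (X1.Σ<-cong (suc n) (λ r _ →
      î-* (PZ.C (leg5 (suc r) ℤ.* + suc r)) (LZ.Γ (suc r)) (îC.mapPS-mon (leg5 (suc r) ℤ.* + suc r) 0) (î-Γ (suc r)))) n
      where
      î-Γ : ∀ k → î.⟦ LZ.Γ k ⟧ C1.≈ LU.Γ k
      î-Γ k n = C1.trans (îX.hom-Σ (suc n) (LZ.ΓTerm k)) (X1.Σ<-cong (suc n) (λ r _ → î-mon (suc r ℕ.* k))) n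

    private
      module L1 = Level1 inv₁ inv₅ S lim-S
      c x : ℕ → P1.Series
      c i = C₁ (ζ UX.^ i)
      x i = C1.1# C1.- c i
      z = C₁ ζ

      pw : ∀ i → c i C1.≈ z X1.^ i
      pw i = C1.sym (C1.trans (P1.mon-^ ζ 0 i) (P1.mon-≡ (ζ UX.^ i) (ℕP.*-zeroʳ i)))

      xpw : ∀ i → x i C1.≈ C1.1# C1.- z X1.^ i
      xpw i = C1.+-congˡ (C1.-‿cong (pw i))

      √5-z : C₁ √5 C1.≈ (z X1.^ 1 C1.+ z X1.^ 4) C1.- (z X1.^ 2 C1.+ z X1.^ 3)
      √5-z = C1.trans (C1.sym (C-sub _ _)) (C1.+-cong (C1.trans (C1.sym (LU.C-+ _ _)) (C1.+-cong (pw 1) (pw 4))) (C1.-‿cong (C1.trans (C1.sym (LU.C-+ _ _)) (C1.+-cong (pw 2) (pw 3)))))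

      z-Φ₅ : C1.1# C1.+ z C1.+ z X1.^ 2 C1.+ z X1.^ 3 C1.+ z X1.^ 4 C1.≈ C1.0#
      z-Φ₅ = C1.trans (C1.sym (C1.+-cong (C1.+-cong (C1.+-congˡ (pw 2)) (pw 3)) (pw 4)))
        (C1.trans (C1.+-congʳ (C1.trans (C1.+-congʳ (C1.trans (C1.+-congʳ (LU.C-+ UR.1# ζ)) (LU.C-+ _ _))) (LU.C-+ _ _))) (C1.trans (LU.C-+ _ _) (C1.trans (P1.C-cong Φ₅) (P1.mon-zero 0))))

      drop-Φ : ∀ s t → s C1.+ (C1.1# C1.+ z C1.+ z X1.^ 2 C1.+ z X1.^ 3 C1.+ z X1.^ 4) C1.* t C1.≈ s
      drop-Φ s t = C1.trans (C1.+-congˡ (C1.trans (C1.*-congʳ z-Φ₅) (C1.zeroˡ t))) (C1.+-identityʳ s)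

      L : P1.Series
      L = î.⟦ Lam₄ ⟧

      κ₃ κ₁₂ κ′ : P1.Series
      κ₃ = z X1.^ 1 C1.* ((C1.1# C1.- z X1.^ 3) C1.* (C1.1# C1.- z X1.^ 1))
      κ₁₂ = (z X1.^ 1 C1.* ((C1.1# C1.- z X1.^ 2) C1.* (C1.1# C1.- z X1.^ 2)) C1.- z X1.^ 2 C1.* ((C1.1# C1.- z X1.^ 1) C1.* (C1.1# C1.- z X1.^ 1)))
        C1.+ (((C1.1# C1.- z X1.^ 1) C1.* (C1.1# C1.- z X1.^ 1)) C1.* ((C1.1# C1.- z X1.^ 2) C1.* (C1.1# C1.- z X1.^ 2))) C1.* (((z X1.^ 1 C1.+ z X1.^ 4) C1.- (z X1.^ 2 C1.+ z X1.^ 3)) C1.* L)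
      -- κ′ κ₃ = 5
      κ′ = C1.- (X1.intR (+ 2) C1.* z C1.+ z X1.^ 2 C1.+ X1.intR (+ 2) C1.* z X1.^ 3)

      e : δ̂ C1.* (κ₃ C1.* Q 1 X1.^ 5) C1.≈ δ̂ C1.* (κ₁₂ C1.* Q 5)
      e = C1.trans (C1.*-congˡ (C1.*-congʳ (C1.sym (C1.*-cong (pw 1) (C1.*-cong (xpw 3) (xpw 1))))))
        (C1.trans L1.eisenstein (C1.*-congˡ (C1.*-congʳ (C1.+-cong
          (C1.+-cong (C1.*-cong (pw 1) (C1.*-cong (xpw 2) (xpw 2))) (C1.-‿cong (C1.*-cong (pw 2) (C1.*-cong (xpw 1) (xpw 1)))))
          (C1.*-cong (C1.*-cong (C1.*-cong (xpw 1) (xpw 1)) (C1.*-cong (xpw 2) (xpw 2)))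
            (C1.trans T-rows (C1.*-cong √5-z (C1.sym î-Lam₄))))))))

      one : ∀ {n} → X1.Polynomial n
      one = X1.con (+ 1)

      -- As polynomials in z, `κ₁` coincides with `κ₃`, and `κ₂` times the Gauss sum is -5 `κ₃` + Φ₅
      -- `Bₚ`; `Aₚ` is the cofactor in κ′ κ₃ = 5 + Φ₅ Aₚ. Hence the constant `κ₃` is common to both
      -- sides and leaves 1 - 5 L.
      Φₚ Aₚ Bₚ κ′ₚ : ∀ {n} → X1.Polynomial n → X1.Polynomial n
      Φₚ z = one X1.:+ z X1.:+ z X1.:^ 2 X1.:+ z X1.:^ 3 X1.:+ z X1.:^ 4
      Aₚ z = X1.con -[1+ 4 ] X1.:+ X1.con (+ 5) X1.:* z X1.:- X1.con (+ 2) X1.:* z X1.:^ 2 X1.:+ X1.con (+ 3) X1.:* z X1.:^ 3 X1.:- X1.con (+ 2) X1.:* z X1.:^ 4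
      Bₚ z = X1.con (+ 6) X1.:* z X1.:- X1.con (+ 14) X1.:* z X1.:^ 2 X1.:+ X1.con (+ 8) X1.:* z X1.:^ 3 X1.:+ X1.con (+ 3) X1.:* z X1.:^ 4 X1.:- X1.con (+ 4) X1.:* z X1.:^ 5 X1.:+ z X1.:^ 6
      κ′ₚ z = X1.:- (X1.con (+ 2) X1.:* z X1.:+ z X1.:^ 2 X1.:+ X1.con (+ 2) X1.:* z X1.:^ 3)

      κ′κ₃ : κ′ C1.* κ₃ C1.≈ X1.intR (+ 5)
      κ′κ₃ = C1.trans (X1.solve 1 (λ z → κ′ₚ z X1.:* (z X1.:^ 1 X1.:* ((one X1.:- z X1.:^ 3) X1.:* (one X1.:- z X1.:^ 1))) X1.:= X1.con (+ 5) X1.:+ Φₚ z X1.:* Aₚ z) C1.refl z) (drop-Φ _ _)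

      κ′κ₁₂ : κ′ C1.* κ₁₂ C1.≈ X1.intR (+ 5) C1.* (C1.1# C1.- X1.intR (+ 5) C1.* L)
      κ′κ₁₂ = C1.trans (X1.solve 2 (λ z l → κ′ₚ z X1.:* ((z X1.:^ 1 X1.:* ((one X1.:- z X1.:^ 2) X1.:* (one X1.:- z X1.:^ 2)) X1.:- z X1.:^ 2 X1.:* ((one X1.:- z X1.:^ 1) X1.:* (one X1.:- z X1.:^ 1)))
          X1.:+ (((one X1.:- z X1.:^ 1) X1.:* (one X1.:- z X1.:^ 1)) X1.:* ((one X1.:- z X1.:^ 2) X1.:* (one X1.:- z X1.:^ 2))) X1.:* (((z X1.:^ 1 X1.:+ z X1.:^ 4) X1.:- (z X1.:^ 2 X1.:+ z X1.:^ 3)) X1.:* l))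
        X1.:= X1.con (+ 5) X1.:* (one X1.:- X1.con (+ 5) X1.:* l) X1.:+ Φₚ z X1.:* (Aₚ z X1.:* (one X1.:- X1.con (+ 5) X1.:* l) X1.:+ κ′ₚ z X1.:* Bₚ z X1.:* l)) C1.refl z L) (drop-Φ _ _)

      scaled : δ̂ C1.* (X1.intR (+ 5) C1.* Q 1 X1.^ 5) C1.≈ δ̂ C1.* ((X1.intR (+ 5) C1.* (C1.1# C1.- X1.intR (+ 5) C1.* L)) C1.* Q 5)
      scaled = C1.trans (C1.*-congˡ (C1.*-congʳ (C1.sym κ′κ₃))) (C1.trans (X1.solve 4 (λ d k l s → d X1.:* ((k X1.:* l) X1.:* s) X1.:= k X1.:* (d X1.:* (l X1.:* s))) C1.refl δ̂ κ′ κ₃ (Q 1 X1.^ 5))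
        (C1.trans (C1.*-congˡ e) (C1.trans (X1.solve 4 (λ d k l s → k X1.:* (d X1.:* (l X1.:* s)) X1.:= d X1.:* ((k X1.:* l) X1.:* s)) C1.refl δ̂ κ′ κ₁₂ (Q 5))
          (C1.*-congˡ (C1.*-congʳ κ′κ₁₂)))))

    times5 : XZ.intR (+ 5) CZ.* QZ 1 XZ.^ 5 ≋ XZ.intR (+ 5) CZ.* ((CZ.1# CZ.- XZ.intR (+ 5) CZ.* Lam₄) CZ.* QZ 5)
    times5 = descend (C1.trans (C1.*-congˡ (î-* (XZ.intR (+ 5)) (QZ 1 XZ.^ 5) (îX.hom-intR (+ 5)) (î-^ (QZ 1) 5 (î-Q 1))))
      (C1.trans scaled (C1.*-congˡ (C1.trans (C1.*-assoc _ _ _) (C1.sym (î-* (XZ.intR (+ 5)) _ (îX.hom-intR (+ 5)) (î-* (CZ.1# CZ.- XZ.intR (+ 5) CZ.* Lam₄) (QZ 5)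
        (C1.trans (îX.hom-sub CZ.1# (XZ.intR (+ 5) CZ.* Lam₄)) (C1.+-cong î.hom-1 (C1.-‿cong (î-* (XZ.intR (+ 5)) Lam₄ (îX.hom-intR (+ 5)) C1.refl)))) (î-Q 5))))))))

  -- The common constant `κ₃` is not a unit of ℤ[ζ]. Multiplied up to 5 it survives the descent as a
  -- positive integer and is cancelled coefficient by coefficient.
  eisenstein₁ : (CZ.1# CZ.- XZ.intR (+ 5) CZ.* Lam₄) CZ.* QZ 5 ≋ QZ 1 XZ.^ 5
  eisenstein₁ n = ≡.sym (ℤP.*-cancelˡ-≡ (+ 5) _ _ (≡.trans (·-C (+ 5) (QZ 1 XZ.^ 5) n) (≡.trans (Weighted.times5 n) (≡.sym (·-C (+ 5) ((CZ.1# CZ.- XZ.intR (+ 5) CZ.* Lam₄) CZ.* QZ 5) n)))))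

  -- Ramanujan's Σ p(5n − 1) qⁿ, by extracting every fifth coefficient of Lam₃ = q P (q⁵; q⁵)⁵.
  ramanujan : pSeries CZ.* QZ 1 XZ.^ 5 ≋ XZ.intR (+ 5) CZ.* Lam₃
  ramanujan = CZ.trans (CZ.*-congʳ (CZ.sym every5-partitions)) (CZ.trans (CZ.sym (Δ5.Δ-* (qZ CZ.* partitionSeries) (QZ 1 XZ.^ 5)))
    (CZ.trans (λ n → quotient₃ (n ℕ.* 5)) every5-Lam₃))
    where
    quotient₃ : (qZ CZ.* partitionSeries) CZ.* E.ev (QZ 1 XZ.^ 5) ≋ Lam₃
    quotient₃ = CZ.trans (CZ.*-congˡ (CZ.trans (EX.hom-^ (QZ 1) 5) (XZ.^-congˡ 5 ev-Q)))
      (CZ.trans (XZ.solve 3 (λ q p a → (q XZ.:* p) XZ.:* a XZ.:= (q XZ.:* a) XZ.:* p) CZ.refl qZ partitionSeries (QZ 5 XZ.^ 5))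
        (CZ.trans (CZ.*-congʳ (CZ.sym eisenstein₅)) (CZ.trans (XZ.solve 3 (λ l a p → (l XZ.:* a) XZ.:* p XZ.:= l XZ.:* (p XZ.:* a)) CZ.refl Lam₃ (QZ 1) partitionSeries)
          (CZ.trans (CZ.*-congˡ partitionsZ) (CZ.*-identityʳ Lam₃)))))

  module Conclusion where
    -- `K` is a common denominator of the three right-hand sides and `N` their common numerator. As
    -- `K` is invertible, four evaluations of a product with `K` suffice.
    I₅ J₅ J₆ K N : PZ.Series
    I₅ = inv (qPoch 5)
    J₅ = inv (qPoch 1 Defs.^P 5)
    J₆ = inv (qPoch 1 Defs.^P 6)
    K = QZ 1 XZ.^ 6 CZ.* QZ 5
    N = QZ 1 XZ.^ 6 CZ.+ XZ.intR (+ 25) CZ.* (qZ CZ.* QZ 5 XZ.^ 6)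

    I₅-inv : QZ 5 CZ.* I₅ ≋ CZ.1#
    I₅-inv = CZ.trans (CZ.*-congʳ (CZ.sym (qPoch-Q 4))) (inv-inverse (qPoch 5) ≡.refl)

    J-inv : ∀ k → (qPoch 1 Defs.^P k) 0 ≡ + 1 → QZ 1 XZ.^ k CZ.* inv (qPoch 1 Defs.^P k) ≋ CZ.1#
    J-inv k e = CZ.trans (CZ.*-congʳ (CZ.sym (^P-^ k (qPoch-Q 0)))) (inv-inverse (qPoch 1 Defs.^P k) e)

    cancel-K : ∀ {s t} → s CZ.* K ≋ N → t CZ.* K ≋ N → s ≋ t
    cancel-K {s} {t} p r = CZ.trans (expand s) (CZ.trans (CZ.*-congʳ (CZ.trans p (CZ.sym r))) (CZ.sym (expand t)))
      where
      expand : ∀ s → s ≋ (s CZ.* K) CZ.* (J₆ CZ.* I₅)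
      expand s = CZ.sym (CZ.trans (XZ.solve 5 (λ s a j b i → (s XZ.:* (a XZ.:* b)) XZ.:* (j XZ.:* i) XZ.:= s XZ.:* ((a XZ.:* j) XZ.:* (b XZ.:* i))) CZ.refl s (QZ 1 XZ.^ 6) J₆ (QZ 5) I₅)
        (CZ.trans (CZ.*-congˡ (CZ.*-cong (J-inv 6 ≡.refl) I₅-inv)) (XZ.solve 1 (λ s → s XZ.:* (XZ.con (+ 1) XZ.:* XZ.con (+ 1)) XZ.:= s) CZ.refl s)))

    first : rhs1 CZ.* K ≋ N
    first = CZ.trans (CZ.*-congʳ (⊛-cong {J₅} CZ.refl (λ n → ≡.cong₂ ℤ._-_ (≡.cong₂ ℤ._+_ (oneP-C n)
          (≡.trans (≡.cong (+ 25 ℤ.*_) (Lam₃-Defs n)) (·-C (+ 25) Lam₃ n))) (≡.trans (≡.cong (+ 5 ℤ.*_) (Lam₄-Defs n)) (·-C (+ 5) Lam₄ n)))))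
      (CZ.trans (XZ.solve 5 (λ j a l₃ l₄ b → (j XZ.:* ((XZ.con (+ 1) XZ.:+ XZ.con (+ 25) XZ.:* l₃) XZ.:- XZ.con (+ 5) XZ.:* l₄)) XZ.:* (a XZ.:^ 6 XZ.:* b)
          XZ.:= (a XZ.:^ 5 XZ.:* j) XZ.:* (((XZ.con (+ 1) XZ.:- XZ.con (+ 5) XZ.:* l₄) XZ.:* b) XZ.:* a XZ.:+ XZ.con (+ 25) XZ.:* ((l₃ XZ.:* a) XZ.:* b))) CZ.refl J₅ (QZ 1) Lam₃ Lam₄ (QZ 5))
        (CZ.trans (CZ.*-cong (J-inv 5 ≡.refl) (CZ.+-cong (CZ.*-congʳ eisenstein₁) (CZ.*-congˡ (CZ.*-congʳ eisenstein₅))))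
          (XZ.solve 3 (λ a b q → XZ.con (+ 1) XZ.:* (a XZ.:^ 5 XZ.:* a XZ.:+ XZ.con (+ 25) XZ.:* ((q XZ.:* b XZ.:^ 5) XZ.:* b)) XZ.:= a XZ.:^ 6 XZ.:+ XZ.con (+ 25) XZ.:* (q XZ.:* b XZ.:^ 6)) CZ.refl (QZ 1) (QZ 5) qZ)))

    second : rhs2 CZ.* K ≋ N
    second = CZ.trans (CZ.*-congʳ (CZ.+-congˡ {I₅} (λ n → ≡.trans (≡.cong (+ 25 ℤ.*_) (⊛-cong (mono-mon 1) (⊛-cong (^P-^ 5 (qPoch-Q 4)) (CZ.refl {J₆})) n))
          (·-C (+ 25) (qZ CZ.* (QZ 5 XZ.^ 5 CZ.* J₆)) n))))
      (CZ.trans (XZ.solve 5 (λ i q b j a → (i XZ.:+ XZ.con (+ 25) XZ.:* (q XZ.:* (b XZ.:^ 5 XZ.:* j))) XZ.:* (a XZ.:^ 6 XZ.:* b)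
          XZ.:= (b XZ.:* i) XZ.:* a XZ.:^ 6 XZ.:+ (a XZ.:^ 6 XZ.:* j) XZ.:* (XZ.con (+ 25) XZ.:* (q XZ.:* b XZ.:^ 6))) CZ.refl I₅ qZ (QZ 5) J₆ (QZ 1))
        (CZ.+-cong (CZ.trans (CZ.*-congʳ I₅-inv) (CZ.*-identityˡ _)) (CZ.trans (CZ.*-congʳ (J-inv 6 ≡.refl)) (CZ.*-identityˡ _))))

    third : rhs3 CZ.* K ≋ N
    third = CZ.trans (CZ.*-congʳ (CZ.+-congˡ {I₅} (·-C (+ 5) pSeries)))
      (CZ.trans (XZ.solve 4 (λ i p a b → (i XZ.:+ XZ.con (+ 5) XZ.:* p) XZ.:* (a XZ.:^ 6 XZ.:* b)
          XZ.:= (b XZ.:* i) XZ.:* a XZ.:^ 6 XZ.:+ XZ.con (+ 5) XZ.:* ((p XZ.:* a XZ.:^ 5) XZ.:* (a XZ.:* b))) CZ.refl I₅ pSeries (QZ 1) (QZ 5))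
        (CZ.+-cong (CZ.trans (CZ.*-congʳ I₅-inv) (CZ.*-identityˡ _))
          (CZ.trans (CZ.*-congˡ (CZ.*-congʳ ramanujan)) (CZ.trans
            (XZ.solve 3 (λ l a b → XZ.con (+ 5) XZ.:* ((XZ.con (+ 5) XZ.:* l) XZ.:* (a XZ.:* b)) XZ.:= XZ.con (+ 25) XZ.:* ((l XZ.:* a) XZ.:* b)) CZ.refl Lam₃ (QZ 1) (QZ 5))
            (CZ.trans (CZ.*-congˡ (CZ.*-congʳ eisenstein₅)) (XZ.solve 2 (λ q b → XZ.con (+ 25) XZ.:* ((q XZ.:* b XZ.:^ 5) XZ.:* b) XZ.:= XZ.con (+ 25) XZ.:* (q XZ.:* b XZ.:^ 6)) CZ.refl qZ (QZ 5)))))))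

    conclusion : (n : ℕ) → (CΦ 5 n ≡ rhs1 n) × (CΦ 5 n ≡ rhs2 n) × (CΦ 5 n ≡ rhs3 n)
    conclusion n = cancel-K frobeniusZ first n , cancel-K frobeniusZ second n , cancel-K frobeniusZ third n

theorem3p1 : (n : ℕ) → (CΦ 5 n ≡ rhs1 n) × (CΦ 5 n ≡ rhs2 n) × (CΦ 5 n ≡ rhs3 n)
theorem3p1 = Final.Conclusion.conclusion Tower.𝕌 Tower.fifthRoot Tower.dualUnit Tower.κ (λ {x} {y} → Tower.κ-cong {x} {y}) Tower.κ-+ _≡_.refl
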